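{- Let $n\geq 1$ and let $\mu$ be a partition of $n$. Suppose that either (i) $n\ge 3$ and $\mu\leq (3,1^{n-3})$, or (ii) $n\ge 5$ and $\mu\geq (n-4,1^4)$, where $\leq$ denotes reverse lexicographic order on partitions of $n$. Then the symmetric function $$\psi_\mu=\sum_{\lambda\vdash n,\ (1^n)\leq \lambda\leq \mu} p_\lambda$$ is Schur-positive.
   Context: Reverse lexicographic order on partitions of $n$: $\lambda$ is preceded by $\mu$ (i.e. $\lambda>\mu$) if $\lambda_1>\mu_1$, or there is $j\geq 2$ with $\lambda_i=\mu_i$ for $i<j$ and $\lambda_j>\mu_j$; this is a total order with minimum $(1^n)$ and maximum $(n)$. $p_\lambda=\prod_i p_{\lambda_i}$ is the power sum symmetric function. A symmetric function is Schur-positive if its expansion in the Schur functions $s_\lambda$ has all coefficients nonnegative. Exponents in partitions denote multiplicities of parts, e.g. $(3,1^{n-3})$. -}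

module Defs where

open import Data.Nat using (ℕ; zero; suc; _+_; _*_; _∸_; _≤_; _<_; _≤ᵇ_; _<ᵇ_; _≡ᵇ_)
open import Data.Bool using (Bool; true; false; _∧_; _∨_; T; if_then_else_)
open import Data.Nat.ListAction using (sum)
open import Data.List using (List; []; _∷_; _++_; map; concatMap; filterᵇ; upTo; reverse; replicate)
open import Data.List.Relation.Unary.All using (All)
open import Data.List.Relation.Unary.Linked using (Linked)
open import Data.Vec using (Vec; toList)
open import Data.Product using (Σ; _×_)
open import Relation.Binary.PropositionalEquality using (_≡_)

IsPartition : ℕ → List ℕ → Set
IsPartition n μ = Linked (λ a b → b ≤ a) μ × All (λ k → 1 ≤ k) μ × sum μ ≡ n

range : ℕ → ℕ → List ℕ
range a b = map (a +_) (upTo (suc (b ∸ a)))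

-- partsF fuel n m : all partitions of n with all parts ≤ m (fuel ≥ n)
partsF : ℕ → ℕ → ℕ → List (List ℕ)
partsF zero zero m = [] ∷ []
partsF zero (suc n) m = []
partsF (suc f) zero m = [] ∷ []
partsF (suc f) (suc n) m =
  concatMap (λ k → map (k ∷_) (partsF f (suc n ∸ k) k))
            (filterᵇ (λ k → k ≤ᵇ m) (range 1 (suc n)))

partitions : ℕ → List (List ℕ)
partitions n = partsF n n n

leB : List ℕ → List ℕ → Bool
leB [] _ = true
leB (_ ∷ _) [] = false
leB (x ∷ xs) (y ∷ ys) = (x <ᵇ y) ∨ ((x ≡ᵇ y) ∧ leB xs ys)

_≤ʳ_ : List ℕ → List ℕ → Set
μ ≤ʳ λ' = T (leB μ λ')

-- Polynomials in N variables x_1..x_N with ℕ coefficients are represented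
-- by their coefficient functions on exponent vectors α.

subtractOne : ℕ → List ℕ → List (List ℕ)
subtractOne k [] = []
subtractOne k (a ∷ as) =
  (if k ≤ᵇ a then ((a ∸ k) ∷ as) ∷ [] else []) ++ map (a ∷_) (subtractOne k as)

allZero : List ℕ → Bool
allZero [] = true
allZero (a ∷ as) = (a ≡ᵇ 0) ∧ allZero as

-- coefficient of x^α in p_λ = ∏_i (x_1^{λ_i} + ... + x_N^{λ_i})
pCoeff : List ℕ → List ℕ → ℕ
pCoeff [] α = if allZero α then 1 else 0
pCoeff (k ∷ λ') α = sum (map (pCoeff λ') (subtractOne k α))

ψ : (n : ℕ) → List ℕ → Vec ℕ n → ℕ
ψ n μ α = sum (map (λ λ' → pCoeff λ' (toList α)) (filterᵇ (λ λ' → leB λ' μ) (partitions n)))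

-- Schur functions via semistandard tableaux (Macdonald I.1): a tableau of
-- shape ν with entries in [N] is a chain ∅ = ν⁰ ⊆ ν¹ ⊆ … ⊆ νᴺ = ν of
-- partitions with each νⁱ/νⁱ⁻¹ a horizontal strip; entry i fills νⁱ/νⁱ⁻¹.

dropZeros : List ℕ → List ℕ
dropZeros [] = []
dropZeros (zero ∷ as) = dropZeros as
dropZeros (suc a ∷ as) = suc a ∷ dropZeros as

interlace : List ℕ → List (List ℕ)
interlace [] = [] ∷ []
interlace (x ∷ []) = map (λ z → z ∷ []) (range 0 x)
interlace (x ∷ y ∷ r) = concatMap (λ z → map (z ∷_) (interlace (y ∷ r))) (range y x)

hstrips : List ℕ → List (List ℕ)
hstrips ν = map dropZeros (interlace ν)

-- number of tableaux of shape ν whose content, read from the largest entry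
-- downwards, is the list given
kostkaRev : List ℕ → List ℕ → ℕ
kostkaRev ν [] = if allZero ν then 1 else 0
kostkaRev ν (a ∷ as) =
  sum (map (λ ν' → kostkaRev ν' as)
           (filterᵇ (λ ν' → (sum ν ∸ sum ν') ≡ᵇ a) (hstrips ν)))

-- Kostka number K_{ν,α}: the coefficient of x^α in the Schur function s_ν
kostka : List ℕ → List ℕ → ℕ
kostka ν α = kostkaRev ν (reverse α)

-- A homogeneous symmetric function of degree n (given by its coefficient
-- function in n variables, which determines it) is Schur-positive if it is
-- a nonnegative integer combination of the s_ν, ν ⊢ n.
SchurPositive : (n : ℕ) → (Vec ℕ n → ℕ) → Set
SchurPositive n f =
  Σ (List ℕ → ℕ) λ c → ∀ (α : Vec ℕ n) →
    f α ≡ sum (map (λ ν → c ν * kostka ν (toList α)) (partitions n))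

{-# OPTIONS --safe #-}
-- Write χ^ν(λ) for the coefficient of x^{ν+δ} in a_δ p_λ (a_δ the Vandermonde product), so that
-- p_λ = Σ_ν χ^ν(λ) s_ν by Gessel–Viennot; then ψ_μ is Schur-positive iff Σ_{λ ≤ μ} χ^ν(λ) ≥ 0 for all ν.
-- The characters χ^ν are positive definite class functions on S_n: one adds boxes one at a time and separates
-- the results by the eigenvalues of the class sum of transpositions.  This gives closure of Schur positivity
-- under products and the nonnegativity of averages over centralisers.
--
-- μ ≥ (n-4,1⁴): by the class equation Σ_{λ ⊢ n} p_λ = Σ_λ H_λ, where H_λ is the average of p_{type g} over the
-- centraliser of a permutation of type λ; the λ with a part i > n/2 contribute L_i · Σ_{κ ⊢ n-i} p_κ, L_i being
-- the average over the cyclic group.  Now L_i - p_i and p_{i+1} + p_1 L_i are Schur-positive (compare hooks with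
-- the dihedral group), and these absorb the few p_λ with λ > μ.  Small n are computed.
--
-- μ ≤ (3,1^{n-3}): with p_1² = h_2 + e_2 and p_2 = h_2 - e_2, the sums Σ_i p_1^{2(k-i)} p_2^i are polynomials in
-- h_2 and e_2² with nonnegative coefficients, large enough to absorb the negative part of p_3 p_1^{n-3}.
module Submission where

open import Defs
open import Data.Nat using (ℕ; _≤_; _∸_; zero; suc; z≤n; s≤s; _!)
open import Data.List using (List; _∷_; replicate)
open import Data.Product using (_×_)
open import Data.Sum using (_⊎_)

-- No representation is constructed. Everything is an integer function of an exponent vector, and a
-- character counts as positive when a positive multiple of `Φ (σ ⨾ flip τ)` has an integer Gram
-- factorisation. This survives induction and the operators (T - e)², T being the class sum; the
-- boxes that can be added to one diagram have different contents, so such squares isolate a single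
-- constituent. The same device gives, for each shape, a group algebra element whose quadratic form
-- vanishes at all other shapes, and this carries positivity of characters over to products. The
-- class equation is usable because a permutation with a cycle longer than all others together has a
-- product centraliser. The obstacle near (n) is the block of partitions with the same first part as
-- μ. Only some of them exceed μ, so the sum of their p_κ can have negative Schur coefficients;
-- these are paid for by the next block, whose first part is one smaller. With 4 boxes below the
-- first row, the first part n - 5 of that next block exceeds n/2 exactly when n ≥ 11, which fixes
-- the range left to computation.

module N where
  open import Data.Nat public
  open import Data.Nat.Properties public

module Z where
  open import Data.Integer public
  open import Data.Integer.Properties public

-- Alternating polynomials and division by the Vandermonde product.

module Alternants where
  open import Data.Integer using (ℤ; -[1+_]; _+_; _*_; _-_; -_; 0ℤ; 1ℤ) renaming (+_ to pos)
  open import Data.Integer.Properties using (+-identityˡ; +-identityʳ; +-comm; +-assoc; neg-distrib-+; *-zeroʳ; *-distribˡ-+; +-inverseʳ)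
  open import Data.Integer.Tactic.RingSolver using (solve-∀)
  open import Data.Vec using (Vec; []; _∷_; map)
  open import Data.List using (foldr) renaming ([] to []ᴸ; _∷_ to _∷ᴸ_)
  open import Data.Product using (_,_) renaming (proj₁ to fst; proj₂ to snd)
  open import Data.Unit using (⊤; tt)
  open import Relation.Binary.PropositionalEquality using (_≡_; _≢_; refl; sym; trans; cong; cong₂; subst; module ≡-Reasoning)
  open ≡-Reasoning
  open import Data.Sum using (inj₁; inj₂)
  open import Data.Empty using (⊥; ⊥-elim)
  open import Relation.Binary.Definitions using (tri<; tri≈; tri>)
  open import Relation.Nullary using (yes; no; ¬_)

  infix 4 _≗ᵥ_

  V : ℕ -> Set
  V N = Vec ℕ N -> ℤ

  _≗ᵥ_ : ∀ {N} -> V N -> V N -> Set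
  A ≗ᵥ B = ∀ β -> A β ≡ B β

  -- Multiplication by xᵏ on the coefficient sequence of a power series.
  sh : ℕ -> (ℕ -> ℤ) -> ℕ -> ℤ
  sh zero g b = g b
  sh (suc k) g zero = 0ℤ
  sh (suc k) g (suc b) = sh k g b

  sh-cong : ∀ k {g h : ℕ -> ℤ} -> (∀ x -> g x ≡ h x) -> ∀ b -> sh k g b ≡ sh k h b
  sh-cong zero e b = e b
  sh-cong (suc k) e zero = refl
  sh-cong (suc k) e (suc b) = sh-cong k e b

  sh-0 : ∀ k b -> sh k (\ _ -> 0ℤ) b ≡ 0ℤ
  sh-0 zero b = refl
  sh-0 (suc k) zero = refl
  sh-0 (suc k) (suc b) = sh-0 k b

  sh-+ : ∀ k (g h : ℕ -> ℤ) b -> sh k (\ x -> g x + h x) b ≡ sh k g b + sh k h b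
  sh-+ zero g h b = refl
  sh-+ (suc k) g h zero = refl
  sh-+ (suc k) g h (suc b) = sh-+ k g h b

  sh-* : ∀ k c (g : ℕ -> ℤ) b -> sh k (\ x -> c * g x) b ≡ c * sh k g b
  sh-* zero c g b = refl
  sh-* (suc k) c g zero = sym (*-zeroʳ c)
  sh-* (suc k) c g (suc b) = sh-* k c g b

  sh-neg : ∀ k (g : ℕ -> ℤ) b -> sh k (\ x -> - g x) b ≡ - sh k g b
  sh-neg zero g b = refl
  sh-neg (suc k) g zero = refl
  sh-neg (suc k) g (suc b) = sh-neg k g b

  sh-sh : ∀ j k (g : ℕ -> ℤ) b -> sh j (sh k g) b ≡ sh (j N.+ k) g b
  sh-sh zero k g b = refl
  sh-sh (suc j) k g zero = refl
  sh-sh (suc j) k g (suc b) = sh-sh j k g b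

  sh-≡ : ∀ {j k} -> j ≡ k -> ∀ (g : ℕ -> ℤ) b -> sh j g b ≡ sh k g b
  sh-≡ refl g b = refl

  sh-comm : ∀ j k (g : ℕ -> ℤ) b -> sh j (sh k g) b ≡ sh k (sh j g) b
  sh-comm j k g b = trans (sh-sh j k g b) (trans (sh-≡ (N.+-comm j k) g b) (sym (sh-sh k j g b)))

  sh-comm₂ : ∀ j k (g : ℕ -> ℕ -> ℤ) b c -> sh j (\ x -> sh k (g x) c) b ≡ sh k (\ y -> sh j (\ x -> g x y) b) c
  sh-comm₂ zero k g b c = refl
  sh-comm₂ (suc j) k g zero c = sym (sh-0 k c)
  sh-comm₂ (suc j) k g (suc b) c = sh-comm₂ j k g b c

  sh-θ : ∀ k (g : ℕ -> ℤ) b -> (pos b) * sh k g b ≡ sh k (\ x -> (pos x) * g x) b + (pos k) * sh k g b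
  sh-θ zero g b = (\ x y -> solveθ x y) (pos b) (g b)
    where solveθ : ∀ x y -> x * y ≡ x * y + 0ℤ * y
          solveθ = solve-∀
  sh-θ (suc k) g zero = l (pos (suc k))
    where l : ∀ x -> 0ℤ ≡ 0ℤ + x * 0ℤ
          l = solve-∀
  sh-θ (suc k) g (suc b) = trans (l₁ (pos b) (sh k g b)) (trans (cong (sh k g b +_) (sh-θ k g b)) (l₂ (pos k) (sh k g b) (sh k (\ x -> pos x * g x) b)))
    where l₁ : ∀ x y -> (1ℤ + x) * y ≡ y + x * y
          l₁ = solve-∀
          l₂ : ∀ x y z -> y + (z + x * y) ≡ z + (1ℤ + x) * y
          l₂ = solve-∀

  -- ad F b c = Σ_{m ≤ b} F (b − m) (c + m)
  ad : (ℕ -> ℕ -> ℤ) -> ℕ -> ℕ -> ℤ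
  ad F zero c = F zero c
  ad F (suc b) c = F (suc b) c + ad F b (suc c)

  ad-cong : ∀ {F G : ℕ -> ℕ -> ℤ} -> (∀ u v -> F u v ≡ G u v) -> ∀ b c -> ad F b c ≡ ad G b c
  ad-cong e zero c = e zero c
  ad-cong e (suc b) c = cong₂ _+_ (e (suc b) c) (ad-cong e b (suc c))

  ad-unf : ∀ F b c -> ad F b c ≡ F b c + sh 1 (\ x -> ad F x (suc c)) b
  ad-unf F zero c = sym (+-identityʳ _)
  ad-unf F (suc b) c = refl

  +-swap : ∀ a b c d -> (a + b) + (c + d) ≡ (a + c) + (b + d)
  +-swap = solve-∀

  ad-+ : ∀ F G b c -> ad (\ u v -> F u v + G u v) b c ≡ ad F b c + ad G b c
  ad-+ F G zero c = refl
  ad-+ F G (suc b) c = trans (cong (F (suc b) c + G (suc b) c +_) (ad-+ F G b (suc c))) (+-swap (F (suc b) c) (G (suc b) c) _ _)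

  ad-0 : ∀ b c -> ad (\ _ _ -> 0ℤ) b c ≡ 0ℤ
  ad-0 zero c = refl
  ad-0 (suc b) c = trans (+-identityˡ _) (ad-0 b (suc c))

  ad-* : ∀ k F b c -> ad (\ u v -> k * F u v) b c ≡ k * ad F b c
  ad-* k F zero c = refl
  ad-* k F (suc b) c = trans (cong (k * F (suc b) c +_) (ad-* k F b (suc c))) (sym (*-distribˡ-+ k _ _))

  ad-neg : ∀ F b c -> ad (\ u v -> - F u v) b c ≡ - ad F b c
  ad-neg F zero c = refl
  ad-neg F (suc b) c = trans (cong (- F (suc b) c +_) (ad-neg F b (suc c))) (sym (neg-distrib-+ (F (suc b) c) _))

  ad-shiftʳ : ∀ F b c -> ad F b (suc c) ≡ ad (\ u v -> F u (suc v)) b c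
  ad-shiftʳ F zero c = refl
  ad-shiftʳ F (suc b) c = cong (F (suc b) (suc c) +_) (ad-shiftʳ F b (suc c))

  ad-last : ∀ F b c -> ad F (suc b) c ≡ ad (\ u v -> F (suc u) v) b c + F 0 (c N.+ suc b)
  ad-last F zero c = cong (\ t -> F 1 c + F 0 t) (N.+-comm 1 c)
  ad-last F (suc b) c = trans (cong (F (suc (suc b)) c +_) (ad-last F b (suc c)))
    (trans (sym (+-assoc (F (suc (suc b)) c) _ _)) (cong (\ t -> F (suc (suc b)) c + ad (\ u v -> F (suc u) v) b (suc c) + F 0 t) (sym (N.+-suc c (suc b)))))

  ad-flip : ∀ F b -> ad F b 0 ≡ ad (\ u v -> F v u) b 0
  ad-flip F zero = refl
  ad-flip F (suc b) = trans (ad-last F b 0) (trans (+-comm _ (F 0 (suc b)))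
    (cong (F 0 (suc b) +_) (trans (ad-flip (\ u v -> F (suc u) v) b) (sym (ad-shiftʳ (\ u v -> F v u) b 0)))))

  x≡-x⇒x≡0 : ∀ x -> x ≡ - x -> x ≡ 0ℤ
  x≡-x⇒x≡0 (pos zero) e = refl
  x≡-x⇒x≡0 (pos (suc n)) ()
  x≡-x⇒x≡0 (-[1+ n ]) ()

  -- Reading the antidiagonal backwards (`ad-flip`) transposes F, so the sum equals its own
  -- negative.
  ad-anti : ∀ F -> (∀ u v -> F u v ≡ - F v u) -> ∀ b -> ad F b 0 ≡ 0ℤ
  ad-anti F e b = x≡-x⇒x≡0 _ (trans (ad-cong e b 0) (trans (ad-neg (\ u v -> F v u) b 0) (cong -_ (sym (ad-flip F b)))))

  ad-shˡ : ∀ k F b c -> ad (\ u v -> sh k (\ x -> F x v) u) b c ≡ sh k (\ b' -> ad F b' c) b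
  ad-shˡ k F zero c = t k
    where t : ∀ k -> sh k (\ x -> F x c) zero ≡ sh k (\ b' -> ad F b' c) zero
          t zero = refl
          t (suc k) = refl
  ad-shˡ k F (suc b) c = begin
    sh k (\ x -> F x c) (suc b) + ad (\ u v -> sh k (\ x -> F x v) u) b (suc c)
      ≡⟨ cong (sh k (\ x -> F x c) (suc b) +_) (ad-shˡ k F b (suc c)) ⟩
    sh k (\ x -> F x c) (suc b) + sh k (\ b' -> ad F b' (suc c)) b
      ≡⟨ cong (sh k (\ x -> F x c) (suc b) +_) (sym (t₁ k b)) ⟩
    sh k (\ x -> F x c) (suc b) + sh k (sh 1 (\ b' -> ad F b' (suc c))) (suc b)
      ≡⟨ sym (sh-+ k _ _ (suc b)) ⟩
    sh k (\ x -> F x c + sh 1 (\ b' -> ad F b' (suc c)) x) (suc b)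
      ≡⟨ sh-cong k (\ x -> sym (ad-unf F x c)) (suc b) ⟩
    sh k (\ b' -> ad F b' c) (suc b) ∎
    where
    t₁ : ∀ k b -> sh k (sh 1 (\ b' -> ad F b' (suc c))) (suc b) ≡ sh k (\ b' -> ad F b' (suc c)) b
    t₁ k b = sh-comm k 1 (\ b' -> ad F b' (suc c)) (suc b)

  ad-sh₀ : ∀ k F -> (∀ s -> ad F s 0 ≡ 0ℤ) -> ∀ b -> ad (\ u v -> sh k (F u) v) b 0 ≡ 0ℤ
  ad-sh₀ zero F z b = z b
  ad-sh₀ (suc k) F z zero = refl
  ad-sh₀ (suc k) F z (suc b) = trans (+-identityˡ _) (trans (ad-shiftʳ _ b 0) (ad-sh₀ k F z b))

  -- Multiplication by a power of y commutes with the quotient by y - x except at negative powers of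
  -- y. Their coefficients are the sums `ad F s 0`, so the hypothesis says that the quotient has
  -- none.
  ad-shʳ : ∀ k F -> (∀ s -> ad F s 0 ≡ 0ℤ) -> ∀ b c -> ad (\ u v -> sh k (F u) v) b (suc c) ≡ sh k (\ c' -> ad F b (suc c')) c
  ad-shʳ zero F z b c = refl
  ad-shʳ (suc k) F z b zero = trans (ad-shiftʳ _ b 0) (ad-sh₀ k F z b)
  ad-shʳ (suc k) F z b (suc c) = trans (ad-shiftʳ _ b (suc c)) (ad-shʳ k F z b c)

  -- Quotients by y - x and z - x commute: both sides run over all ways to move part of the exponent
  -- of x onto the two other variables.
  ad-ad : ∀ (F : ℕ -> ℕ -> ℕ -> ℤ) b c d ->
    ad (\ u v -> ad (\ u' w -> F u' w v) u c) b d ≡ ad (\ u w -> ad (\ u' v -> F u' w v) u d) b c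
  ad-ad F zero c d = refl
  ad-ad F (suc b) c d = begin
    ad (\ u v -> ad (\ u' w -> F u' w v) u c) (suc b) d
      ≡⟨ ad-cong (\ u v -> ad-unf (\ u' w -> F u' w v) u c) (suc b) d ⟩
    ad (\ u v -> F u c v + sh 1 (\ x -> ad (\ u' w -> F u' w v) x (suc c)) u) (suc b) d
      ≡⟨ ad-+ (\ u v -> F u c v) _ (suc b) d ⟩
    ad (\ u v -> F u c v) (suc b) d + ad (\ u v -> sh 1 (\ x -> ad (\ u' w -> F u' w v) x (suc c)) u) (suc b) d
      ≡⟨ cong (ad (\ u v -> F u c v) (suc b) d +_) (trans (ad-shˡ 1 (\ x v -> ad (\ u' w -> F u' w v) x (suc c)) (suc b) d) (ad-ad F b (suc c) d)) ⟩
    ad (\ u w -> ad (\ u' v -> F u' w v) u d) (suc b) c ∎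

  record Lin {N M : ℕ} (L : V N -> V M) : Set where
    field
      l-cong : ∀ {A B} -> A ≗ᵥ B -> L A ≗ᵥ L B
      l-+ : ∀ A B -> L (\ β -> A β + B β) ≗ᵥ (\ γ -> L A γ + L B γ)
      l-* : ∀ c A -> L (\ β -> c * A β) ≗ᵥ (\ γ -> c * L A γ)

    l-0 : L (\ _ -> 0ℤ) ≗ᵥ (\ _ -> 0ℤ)
    l-0 γ = l-* 0ℤ (\ _ -> 0ℤ) γ

    l-neg : ∀ A -> L (\ β -> - A β) ≗ᵥ (\ γ -> - L A γ)
    l-neg A γ = trans (l-cong (\ β -> sym (Z.-1*i≡-i (A β))) γ) (trans (l-* (- 1ℤ) A γ) (Z.-1*i≡-i _))

    l-- : ∀ A B -> L (\ β -> A β - B β) ≗ᵥ (\ γ -> L A γ - L B γ)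
    l-- A B γ = trans (l-+ A (\ β -> - B β) γ) (cong (_+_ (L A γ)) (l-neg B γ))

    l-sh : ∀ j (A : ℕ -> V N) b -> L (\ β -> sh j (\ x -> A x β) b) ≗ᵥ (\ γ -> sh j (\ x -> L (A x) γ) b)
    l-sh zero A b γ = refl
    l-sh (suc j) A zero γ = l-0 γ
    l-sh (suc j) A (suc b) γ = l-sh j A b γ

    l-ad : ∀ (A : ℕ -> ℕ -> V N) b c -> L (\ β -> ad (\ u v -> A u v β) b c) ≗ᵥ (\ γ -> ad (\ u v -> L (A u v) γ) b c)
    l-ad A zero c γ = refl
    l-ad A (suc b) c γ = trans (l-+ (A (suc b) c) _ γ) (cong (_+_ (L (A (suc b) c) γ)) (l-ad A b (suc c) γ))

  open Lin public

  -- P k is multiplication by the power sum p_k.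
  P : ℕ -> ∀ {N} -> V N -> V N
  P k A [] = 0ℤ
  P k A (b ∷ β) = sh k (\ x -> A (x ∷ β)) b + P k (\ β' -> A (b ∷ β')) β

  P-cong : ∀ k {N} {A B : V N} -> A ≗ᵥ B -> P k A ≗ᵥ P k B
  P-cong k e [] = refl
  P-cong k e (b ∷ β) = cong₂ _+_ (sh-cong k (\ x -> e (x ∷ β)) b) (P-cong k (\ β' -> e (b ∷ β')) β)

  P-+ : ∀ k {N} (A B : V N) -> P k (\ β -> A β + B β) ≗ᵥ (\ γ -> P k A γ + P k B γ)
  P-+ k A B [] = refl
  P-+ k A B (b ∷ β) = trans (cong₂ _+_ (sh-+ k _ _ b) (P-+ k _ _ β)) (+-swap (sh k (\ x -> A (x ∷ β)) b) _ _ _)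

  P-* : ∀ k {N} c (A : V N) -> P k (\ β -> c * A β) ≗ᵥ (\ γ -> c * P k A γ)
  P-* k c A [] = sym (*-zeroʳ c)
  P-* k c A (b ∷ β) = trans (cong₂ _+_ (sh-* k c _ b) (P-* k c _ β)) (sym (*-distribˡ-+ c _ _))

  Lin-P : ∀ k {N} -> Lin (P k {N})
  Lin-P k = record { l-cong = P-cong k ; l-+ = P-+ k ; l-* = P-* k }

  P-comm : ∀ j k {N} (A : V N) -> P j (P k A) ≗ᵥ P k (P j A)
  P-comm j k A [] = refl
  P-comm j k A (b ∷ β) = begin
    sh j (\ x -> sh k (\ y -> A (y ∷ β)) x + P k (\ β' -> A (x ∷ β')) β) b + P j (\ β' -> sh k (\ x -> A (x ∷ β')) b + P k (\ β'' -> A (b ∷ β'')) β') β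
      ≡⟨ cong₂ _+_ (sh-+ j _ _ b) (P-+ j _ _ β) ⟩
    (sh j (sh k (\ y -> A (y ∷ β))) b + sh j (\ x -> P k (\ β' -> A (x ∷ β')) β) b) + (P j (\ β' -> sh k (\ x -> A (x ∷ β')) b) β + P j (P k (\ β'' -> A (b ∷ β''))) β)
      ≡⟨ cong₂ _+_ (cong₂ _+_ (sh-comm j k _ b) (sym (l-sh (Lin-P k) j (\ x β' -> A (x ∷ β')) b β)))
                   (cong₂ _+_ (l-sh (Lin-P j) k (\ x β' -> A (x ∷ β')) b β) (P-comm j k _ β)) ⟩
    (sh k (sh j (\ y -> A (y ∷ β))) b + P k (\ β' -> sh j (\ x -> A (x ∷ β')) b) β) + (sh k (\ x -> P j (\ β' -> A (x ∷ β')) β) b + P k (P j (\ β'' -> A (b ∷ β''))) β)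
      ≡⟨ +-swap (sh k (sh j (\ y -> A (y ∷ β))) b) (P k (\ β' -> sh j (\ x -> A (x ∷ β')) b) β) (sh k (\ x -> P j (\ β' -> A (x ∷ β')) β) b) (P k (P j (\ β'' -> A (b ∷ β''))) β) ⟩
    (sh k (sh j (\ y -> A (y ∷ β))) b + sh k (\ x -> P j (\ β' -> A (x ∷ β')) β) b) + (P k (\ β' -> sh j (\ x -> A (x ∷ β')) b) β + P k (P j (\ β'' -> A (b ∷ β''))) β)
      ≡⟨ sym (cong₂ _+_ (sh-+ k _ _ b) (P-+ k _ _ β)) ⟩
    P k (P j A) (b ∷ β) ∎

  ins : ∀ {N} -> ℕ -> V (suc (suc N)) -> V (suc N)
  ins c A (b ∷ β) = A (b ∷ c ∷ β)

  ins₂ : ∀ {N} -> ℕ -> V (suc (suc (suc N))) -> V (suc (suc N))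
  ins₂ d A (b ∷ c ∷ β) = A (b ∷ c ∷ d ∷ β)

  -- The quotient by x₁ - x₀. Expanded in powers of x₀, 1/(x₁ - x₀) is the sum of x₀^m x₁^(-m-1),
  -- hence the offset in `suc c`.
  G₁ : ∀ {N} -> V (suc (suc N)) -> ℕ -> V (suc N)
  G₁ A c (b ∷ β) = ad (\ u v -> A (u ∷ v ∷ β)) b (suc c)

  -- Multiplication by ∏ⱼ (xⱼ − x₀) and division by it (as a power series in x₀).
  Π 𝒢 : ∀ {N} -> V (suc N) -> V (suc N)
  Π {zero} A = A
  Π {suc N} A (b ∷ c ∷ β) = sh 1 (\ c' -> Π (ins c' A) (b ∷ β)) c - sh 1 (\ b' -> Π (ins c A) (b' ∷ β)) b
  𝒢 {zero} A = A
  𝒢 {suc N} A (b ∷ c ∷ β) = 𝒢 (G₁ A c) (b ∷ β)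

  Lin-Π : ∀ {N} -> Lin (Π {N})
  Lin-Π {zero} = record { l-cong = \ e -> e ; l-+ = \ A B γ -> refl ; l-* = \ c A γ -> refl }
  Lin-Π {suc N} = record { l-cong = cg ; l-+ = pl ; l-* = ml }
    where
    LΠ = Lin-Π {N}
    cg : ∀ {A B : V (suc (suc N))} -> A ≗ᵥ B -> Π A ≗ᵥ Π B
    cg e (b ∷ c ∷ β) = cong₂ _-_ (sh-cong 1 (\ c' -> l-cong LΠ (\ { (x ∷ γ) -> e (x ∷ c' ∷ γ) }) (b ∷ β)) c)
                                 (sh-cong 1 (\ b' -> l-cong LΠ (\ { (x ∷ γ) -> e (x ∷ c ∷ γ) }) (b' ∷ β)) b)
    r : ∀ a b c d -> (a + b) - (c + d) ≡ (a - c) + (b - d)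
    r = solve-∀
    pl : ∀ A B -> Π (\ β -> A β + B β) ≗ᵥ (\ γ -> Π A γ + Π B γ)
    pl A B (b ∷ c ∷ β) = trans (cong₂ _-_
        (trans (sh-cong 1 (\ c' -> trans (l-cong LΠ (\ { (x ∷ γ) -> refl }) (b ∷ β)) (l-+ LΠ (ins c' A) (ins c' B) (b ∷ β))) c) (sh-+ 1 _ _ c))
        (trans (sh-cong 1 (\ b' -> trans (l-cong LΠ (\ { (x ∷ γ) -> refl }) (b' ∷ β)) (l-+ LΠ (ins c A) (ins c B) (b' ∷ β))) b) (sh-+ 1 _ _ b)))
        (r (sh 1 (\ c' -> Π (ins c' A) (b ∷ β)) c) _ _ _)
    r* : ∀ k a b -> k * a - k * b ≡ k * (a - b)
    r* = solve-∀
    ml : ∀ k A -> Π (\ β -> k * A β) ≗ᵥ (\ γ -> k * Π A γ)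
    ml k A (b ∷ c ∷ β) = trans (cong₂ _-_
        (trans (sh-cong 1 (\ c' -> trans (l-cong LΠ (\ { (x ∷ γ) -> refl }) (b ∷ β)) (l-* LΠ k (ins c' A) (b ∷ β))) c) (sh-* 1 k _ c))
        (trans (sh-cong 1 (\ b' -> trans (l-cong LΠ (\ { (x ∷ γ) -> refl }) (b' ∷ β)) (l-* LΠ k (ins c A) (b' ∷ β))) b) (sh-* 1 k _ b)))
        (r* k _ _)

  Lin-G₁ : ∀ {N} c -> Lin (\ (A : V (suc (suc N))) -> G₁ A c)
  Lin-G₁ c = record
    { l-cong = \ { e (b ∷ β) -> ad-cong (\ u v -> e (u ∷ v ∷ β)) b (suc c) }
    ; l-+ = \ { A B (b ∷ β) -> ad-+ _ _ b (suc c) }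
    ; l-* = \ { k A (b ∷ β) -> ad-* k _ b (suc c) } }

  Lin-𝒢 : ∀ {N} -> Lin (𝒢 {N})
  Lin-𝒢 {zero} = record { l-cong = \ e -> e ; l-+ = \ A B γ -> refl ; l-* = \ c A γ -> refl }
  Lin-𝒢 {suc N} = record
    { l-cong = \ { e (b ∷ c ∷ β) -> l-cong L (l-cong (Lin-G₁ c) e) (b ∷ β) }
    ; l-+ = \ { A B (b ∷ c ∷ β) -> trans (l-cong L (l-+ (Lin-G₁ c) A B) (b ∷ β)) (l-+ L (G₁ A c) (G₁ B c) (b ∷ β)) }
    ; l-* = \ { k A (b ∷ c ∷ β) -> trans (l-cong L (l-* (Lin-G₁ c) k A) (b ∷ β)) (l-* L k (G₁ A c) (b ∷ β)) } }
    where L = Lin-𝒢 {N}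

  -- Consecutive terms of the antidiagonal cancel. At its end the first exponent is 0, where the
  -- shifted term is 0, so only the leading term survives.
  ad-tele : ∀ (F : ℕ -> ℕ -> ℤ) b c -> ad (\ u v -> sh 1 (F u) v - sh 1 (\ u' -> F u' v) u) b (suc c) ≡ F b c
  ad-tele F zero c = +-identityʳ _
  ad-tele F (suc b) c = trans (cong (F (suc b) c - F b (suc c) +_) (ad-tele F b (suc c))) (l _ _)
    where l : ∀ x y -> (x - y) + y ≡ x
          l = solve-∀

  𝒢Π : ∀ {N} (A : V (suc N)) -> 𝒢 (Π A) ≗ᵥ A
  𝒢Π {zero} A β = refl
  𝒢Π {suc N} A (b ∷ c ∷ β) = trans (l-cong Lin-𝒢 (\ { (x ∷ γ) -> ad-tele (\ u v -> Π (ins v A) (u ∷ γ)) x c }) (b ∷ β)) (𝒢Π (ins c A) (b ∷ β))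

  -- All antidiagonal sums between x₀ and any other variable vanish.
  Z : ∀ {N} -> V (suc N) -> Set
  Z {zero} A = ⊤
  Z {suc N} A = (∀ s β -> ad (\ u v -> A (u ∷ v ∷ β)) s 0 ≡ 0ℤ) × (∀ c -> Z (ins c A))

  Z-resp : ∀ {N} {A B : V (suc N)} -> A ≗ᵥ B -> Z A -> Z B
  Z-resp {zero} e z = tt
  Z-resp {suc N} e (z , w) = (\ s β -> trans (ad-cong (\ u v -> sym (e (u ∷ v ∷ β))) s 0) (z s β)) , \ c -> Z-resp (\ { (x ∷ γ) -> e (x ∷ c ∷ γ) }) (w c)

  Z-neg : ∀ {N} {A : V (suc N)} -> Z A -> Z (\ β -> - A β)
  Z-neg {zero} z = tt
  Z-neg {suc N} (z , w) = (\ s β -> trans (ad-neg _ s 0) (cong -_ (z s β))) , \ c -> Z-resp (\ { (x ∷ γ) -> refl }) (Z-neg (w c))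

  Z-ins₂ : ∀ {N} {A : V (suc (suc (suc N)))} d -> Z A -> Z (ins₂ d A)
  Z-ins₂ d (z , w) = (\ s β -> z s (d ∷ β)) , \ c -> Z-resp (\ { (x ∷ γ) -> refl }) (snd (w c) d)

  -- By `ad-ad` the antidiagonal sum against a later variable may be taken before the division,
  -- where it is already 0.
  Z-G₁ : ∀ {N} {A : V (suc (suc N))} -> Z A -> ∀ c -> Z (G₁ A c)
  Z-G₁ {zero} z c = tt
  Z-G₁ {suc N} {A} (z , w) c = (\ s β -> go s (suc c) β) , \ d -> Z-resp (\ { (x ∷ γ) -> refl }) (Z-G₁ (Z-ins₂ d (z , w)) c)
    where
    go : ∀ s c β -> ad (\ u v -> ad (\ u' w -> A (u' ∷ w ∷ v ∷ β)) u c) s 0 ≡ 0ℤ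
    go s c β = trans (ad-ad (\ u' w v -> A (u' ∷ w ∷ v ∷ β)) s c 0)
      (trans (ad-cong {G = \ _ _ -> 0ℤ} (\ u w' -> fst (w w') u β) s c) (ad-0 s c))

  -- p_k splits into the powers of x₀, of x₁ and of the other variables. Only the power of x₁ uses
  -- `Z`, through `ad-shʳ`; its term is kept apart because the later divisions treat x₁ as a
  -- parameter.
  P-G₁ : ∀ k {N} (A : V (suc (suc N))) -> Z A -> ∀ c b β ->
    G₁ (P k A) c (b ∷ β) ≡ P k (G₁ A c) (b ∷ β) + sh k (\ c' -> G₁ A c' (b ∷ β)) c
  P-G₁ k A (z , w) c b β = begin
    ad (\ u v -> sh k (\ x -> A (x ∷ v ∷ β)) u + (sh k (\ y -> A (u ∷ y ∷ β)) v + P k (\ β' -> A (u ∷ v ∷ β')) β)) b (suc c)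
      ≡⟨ trans (ad-+ _ _ b (suc c)) (cong (ad (\ u v -> sh k (\ x -> A (x ∷ v ∷ β)) u) b (suc c) +_) (ad-+ _ _ b (suc c))) ⟩
    ad (\ u v -> sh k (\ x -> A (x ∷ v ∷ β)) u) b (suc c) + (ad (\ u v -> sh k (\ y -> A (u ∷ y ∷ β)) v) b (suc c) + ad (\ u v -> P k (\ β' -> A (u ∷ v ∷ β')) β) b (suc c))
      ≡⟨ cong₂ _+_ (ad-shˡ k _ b (suc c)) (cong₂ _+_ (ad-shʳ k _ (\ s -> z s β) b c) (sym (l-ad (Lin-P k) (\ u v β' -> A (u ∷ v ∷ β')) b (suc c) β))) ⟩
    sh k (\ x -> G₁ A c (x ∷ β)) b + (sh k (\ c' -> G₁ A c' (b ∷ β)) c + P k (\ β' -> G₁ A c (b ∷ β')) β)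
      ≡⟨ r (sh k (\ x -> G₁ A c (x ∷ β)) b) (sh k (\ c' -> G₁ A c' (b ∷ β)) c) (P k (\ β' -> G₁ A c (b ∷ β')) β) ⟩
    (sh k (\ x -> G₁ A c (x ∷ β)) b + P k (\ β' -> G₁ A c (b ∷ β')) β) + sh k (\ c' -> G₁ A c' (b ∷ β)) c ∎
    where r : ∀ x y z -> x + (y + z) ≡ (x + z) + y
          r = solve-∀

  𝒢P : ∀ k {N} (A : V (suc N)) -> Z A -> 𝒢 (P k A) ≗ᵥ P k (𝒢 A)
  𝒢P k {zero} A z (b ∷ []) = refl
  𝒢P k {suc N} A z (b ∷ c ∷ β) = begin
    𝒢 (G₁ (P k A) c) (b ∷ β)
      ≡⟨ l-cong Lin-𝒢 {B = \ γ -> P k (G₁ A c) γ + sh k (\ c' -> G₁ A c' γ) c} (\ { (x ∷ γ) -> P-G₁ k A z c x γ }) (b ∷ β) ⟩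
    𝒢 (\ γ -> P k (G₁ A c) γ + sh k (\ c' -> G₁ A c' γ) c) (b ∷ β)
      ≡⟨ l-+ Lin-𝒢 _ _ (b ∷ β) ⟩
    𝒢 (P k (G₁ A c)) (b ∷ β) + 𝒢 (\ γ -> sh k (\ c' -> G₁ A c' γ) c) (b ∷ β)
      ≡⟨ cong₂ _+_ (𝒢P k (G₁ A c) (Z-G₁ z c) (b ∷ β)) (l-sh Lin-𝒢 k (G₁ A) c (b ∷ β)) ⟩
    (sh k (\ x -> 𝒢 A (x ∷ c ∷ β)) b + P k (\ β' -> 𝒢 A (b ∷ c ∷ β')) β) + sh k (\ c' -> 𝒢 A (b ∷ c' ∷ β)) c
      ≡⟨ r (sh k (\ x -> 𝒢 A (x ∷ c ∷ β)) b) (sh k (\ c' -> 𝒢 A (b ∷ c' ∷ β)) c) (P k (\ β' -> 𝒢 A (b ∷ c ∷ β')) β) ⟩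
    sh k (\ x -> 𝒢 A (x ∷ c ∷ β)) b + (sh k (\ c' -> 𝒢 A (b ∷ c' ∷ β)) c + P k (\ β' -> 𝒢 A (b ∷ c ∷ β')) β) ∎
    where r : ∀ x y z -> (x + z) + y ≡ x + (y + z)
          r = solve-∀

  -- Adjacent transpositions generate the symmetric group, so a sign change at the front and,
  -- recursively, in every tail is antisymmetry in all variables.
  Anti : ∀ {N} -> V N -> Set
  Anti {zero} A = ⊤
  Anti {suc zero} A = ⊤
  Anti {suc (suc N)} A = (∀ a b β -> A (a ∷ b ∷ β) ≡ - A (b ∷ a ∷ β)) × (∀ a -> Anti (\ β -> A (a ∷ β)))

  Anti-tail : ∀ {N} {A : V (suc N)} -> Anti A -> ∀ a -> Anti (\ β -> A (a ∷ β))
  Anti-tail {zero} _ a = tt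
  Anti-tail {suc N} (_ , w) a = w a

  Anti-resp : ∀ {N} {A B : V N} -> A ≗ᵥ B -> Anti A -> Anti B
  Anti-resp {zero} e _ = tt
  Anti-resp {suc zero} e _ = tt
  Anti-resp {suc (suc N)} e (z , w) =
    (\ a b β -> trans (sym (e (a ∷ b ∷ β))) (trans (z a b β) (cong -_ (e (b ∷ a ∷ β))))) , \ a -> Anti-resp (\ β -> e (a ∷ β)) (w a)

  Anti-+ : ∀ {N} {A B : V N} -> Anti A -> Anti B -> Anti (\ β -> A β + B β)
  Anti-+ {zero} _ _ = tt
  Anti-+ {suc zero} _ _ = tt
  Anti-+ {suc (suc N)} {A} {B} (z , w) (z' , w') =
    (\ a b β -> trans (cong₂ _+_ (z a b β) (z' a b β)) (sym (neg-distrib-+ (A (b ∷ a ∷ β)) (B (b ∷ a ∷ β))))) , \ a -> Anti-+ (w a) (w' a)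

  Anti-* : ∀ {N} {A : V N} c -> Anti A -> Anti (\ β -> c * A β)
  Anti-* {zero} c _ = tt
  Anti-* {suc zero} c _ = tt
  Anti-* {suc (suc N)} c (z , w) =
    (\ a b β -> trans (cong (c *_) (z a b β)) (sym (Z.neg-distribʳ-* c _))) , \ a -> Anti-* c (w a)

  Anti-0 : ∀ {N} -> Anti {N} (\ _ -> 0ℤ)
  Anti-0 {zero} = tt
  Anti-0 {suc zero} = tt
  Anti-0 {suc (suc N)} = (\ _ _ _ -> refl) , \ _ -> Anti-0

  Anti-neg : ∀ {N} {A : V N} -> Anti A -> Anti (\ β -> - A β)
  Anti-neg h = Anti-resp (\ β -> Z.-1*i≡-i _) (Anti-* (- 1ℤ) h)

  Anti-sh : ∀ {N} j {A : ℕ -> V N} -> (∀ x -> Anti (A x)) -> ∀ b -> Anti (\ β -> sh j (\ x -> A x β) b)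
  Anti-sh zero h b = h b
  Anti-sh (suc j) h zero = Anti-0
  Anti-sh (suc j) h (suc b) = Anti-sh j h b

  Anti-ad : ∀ {N} {A : ℕ -> ℕ -> V N} -> (∀ u v -> Anti (A u v)) -> ∀ b c -> Anti (\ β -> ad (\ u v -> A u v β) b c)
  Anti-ad h zero c = h zero c
  Anti-ad h (suc b) c = Anti-+ (h (suc b) c) (Anti-ad h b (suc c))

  Anti-P : ∀ k {N} {A : V N} -> Anti A -> Anti (P k A)
  Anti-P k {zero} h = tt
  Anti-P k {suc zero} h = tt
  Anti-P k {suc (suc N)} {A} (z , w) = sw , \ a -> Anti-+ (Anti-sh k (\ x -> w x) a) (Anti-P k (w a))
    where
    r : ∀ x y z -> - x + (- y + - z) ≡ - (y + (x + z))
    r = solve-∀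
    sw : ∀ a b β -> P k A (a ∷ b ∷ β) ≡ - P k A (b ∷ a ∷ β)
    sw a b β = trans (cong₂ _+_ (trans (sh-cong k (\ x -> z x b β) a) (sh-neg k _ a))
        (cong₂ _+_ (trans (sh-cong k (\ x -> z a x β) b) (sh-neg k _ b)) (trans (P-cong k (\ β' -> z a b β') β) (l-neg (Lin-P k) _ β))))
      (r (sh k (\ x -> A (b ∷ x ∷ β)) a) (sh k (\ x -> A (x ∷ a ∷ β)) b) (P k (\ β' -> A (b ∷ a ∷ β')) β))

  Anti⇒Z : ∀ {N} {A : V (suc N)} -> Anti A -> Z A
  Anti⇒Z {zero} h = tt
  Anti⇒Z {suc N} {A} (z , w) = (\ s β -> ad-anti _ (\ u v -> z u v β) s) , \ c ->
    Z-resp (\ { (x ∷ γ) -> sym (z x c γ) }) (Z-neg (Anti⇒Z (w c)))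

  sh-- : ∀ k (g h : ℕ -> ℤ) b -> sh k (\ x -> g x - h x) b ≡ sh k g b - sh k h b
  sh-- k g h b = trans (sh-+ k g (\ x -> - h x) b) (cong (sh k g b +_) (sh-neg k h b))

  private
    q₄ : ∀ {x y z w x' y' z' w'} -> x ≡ x' -> y ≡ y' -> z ≡ z' -> w ≡ w' -> (x - y) - (z - w) ≡ (x' - y') - (z' - w')
    q₄ refl refl refl refl = refl

  -- The product of the xⱼ - x₀ is symmetric in the xⱼ. For x₁ and x₂ the two factors are multiplied
  -- out into the four terms of `E`, which the exchange permutes.
  Π-Anti : ∀ {N} {A : V (suc N)} -> (∀ b -> Anti (\ β -> A (b ∷ β))) -> ∀ b -> Anti (\ β -> Π A (b ∷ β))
  Π-Anti {zero} h b = tt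
  Π-Anti {suc zero} h b = tt
  Π-Anti {suc (suc N)} {A} h b = sw , \ c ->
      Anti-+ (Anti-sh 1 (\ c' -> Π-Anti {A = ins c' A} (\ x -> snd (h x) c') b) c)
             (Anti-neg (Anti-sh 1 (\ b' -> Π-Anti {A = ins c A} (\ x -> snd (h x) c) b') b))
    where
    X : Vec ℕ N -> ℕ -> ℕ -> ℕ -> ℤ
    X β c d b = Π (ins d (ins c A)) (b ∷ β)
    Xs : ∀ β c d b -> X β c d b ≡ - X β d c b
    Xs β c d b = trans (l-cong Lin-Π {B = \ γ -> - ins c (ins d A) γ} (\ { (x ∷ γ) -> fst (h x) c d γ }) (b ∷ β)) ((l-neg Lin-Π (ins c (ins d A)) (b ∷ β)))
    module _ (β : Vec ℕ N) where
      E : ℕ -> ℕ -> ℤ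
      E c d = (sh 1 (\ c' -> sh 1 (\ d' -> X β c' d' b) d) c - sh 1 (\ c' -> sh 1 (\ b' -> X β c' d b') b) c)
            - (sh 1 (\ b' -> sh 1 (\ d' -> X β c d' b') d) b - sh 1 (sh 1 (\ b' -> X β c d b')) b)
      expand : ∀ c d -> Π A (b ∷ c ∷ d ∷ β) ≡ E c d
      expand c d = cong₂ _-_ (sh-- 1 _ _ c) (sh-- 1 _ _ b)
      r : ∀ x y z w -> (- x - - y) - (- z - - w) ≡ - ((x - z) - (y - w))
      r = solve-∀
      n₂ : ∀ j k (g : ℕ -> ℕ -> ℤ) c d -> sh j (\ x -> sh k (\ y -> - g x y) d) c ≡ - sh j (\ x -> sh k (g x) d) c
      n₂ j k g c d = trans (sh-cong j (\ x -> sh-neg k (g x) d) c) (sh-neg j _ c)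
      Esw : ∀ c d -> E c d ≡ - E d c
      Esw c d = trans (q₄
          (trans (sh-cong 1 (\ c' -> sh-cong 1 (\ d' -> Xs β c' d' b) d) c) (trans (n₂ 1 1 (\ c' d' -> X β d' c' b) c d) (cong -_ (sh-comm₂ 1 1 (\ c' d' -> X β d' c' b) c d))))
          (trans (sh-cong 1 (\ c' -> sh-cong 1 (\ b' -> Xs β c' d b') b) c) (trans (n₂ 1 1 (\ c' b' -> X β d c' b') c b) (cong -_ (sh-comm₂ 1 1 (\ c' b' -> X β d c' b') c b))))
          (trans (sh-cong 1 (\ b' -> sh-cong 1 (\ d' -> Xs β c d' b') d) b) (trans (n₂ 1 1 (\ b' d' -> X β d' c b') b d) (cong -_ (sh-comm₂ 1 1 (\ b' d' -> X β d' c b') b d))))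
          (trans (sh-cong 1 (\ x -> sh-cong 1 (\ b' -> Xs β c d b') x) b) (trans (sh-cong 1 (\ x -> sh-neg 1 _ x) b) (sh-neg 1 _ b))))
        (r (sh 1 (\ d' -> sh 1 (\ c' -> X β d' c' b) c) d) (sh 1 (\ b' -> sh 1 (\ c' -> X β d c' b') c) b) (sh 1 (\ d' -> sh 1 (\ b' -> X β d' c b') b) d) (sh 1 (sh 1 (\ b' -> X β d c b')) b))
    sw : ∀ c d β -> Π A (b ∷ c ∷ d ∷ β) ≡ - Π A (b ∷ d ∷ c ∷ β)
    sw c d β = trans (expand β c d) (trans (Esw β c d) (cong -_ (sym (expand β d c))))

  uc : ∀ {N} -> (ℕ -> V N) -> V (suc N)
  uc f (b ∷ β) = f b β

  -- Multiplication by ∏ (xⱼ - x₀)(xⱼ - x₁) over j ≥ 2, with the exponents of x₀ and x₁ as separate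
  -- arguments.
  Π₂ : ∀ {N} -> (ℕ -> ℕ -> V N) -> ℕ -> ℕ -> V N
  Π₂ B b c β = Π (uc \ b' β' -> Π (uc (B b')) (c ∷ β')) (b ∷ β)

  Π₂-cong : ∀ {N} {B C : ℕ -> ℕ -> V N} -> (∀ b c β -> B b c β ≡ C b c β) -> ∀ b c β -> Π₂ B b c β ≡ Π₂ C b c β
  Π₂-cong e b c β = l-cong Lin-Π (\ { (x ∷ γ) -> l-cong Lin-Π (\ { (y ∷ γ') -> e x y γ' }) (c ∷ γ) }) (b ∷ β)

  Π₂-unf : ∀ {N} (B : ℕ -> ℕ -> V (suc N)) b c d β ->
    let Y = \ b c d -> Π₂ (\ b' c' β' -> B b' c' (d ∷ β')) b c β in
    Π₂ B b c (d ∷ β) ≡ (sh 1 (sh 1 (Y b c)) d - sh 1 (\ d' -> sh 1 (\ c' -> Y b c' d') c) d)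
                     - (sh 1 (\ b' -> sh 1 (Y b' c) d) b - sh 1 (\ b' -> sh 1 (\ c' -> Y b' c' d) c) b)
  Π₂-unf {N} B b c d β = cong₂ _-_
    (trans (sh-cong 1 (\ d' -> t d' b) d) (sh-- 1 _ _ d))
    (trans (sh-cong 1 (\ b' -> t d b') b) (sh-- 1 _ _ b))
    where
    Y : ℕ -> ℕ -> ℕ -> ℤ
    Y b c d = Π₂ (\ b' c' β' -> B b' c' (d ∷ β')) b c β
    t : ∀ d b -> Π (ins d (uc \ b' β' -> Π (uc (B b')) (c ∷ β'))) (b ∷ β) ≡ sh 1 (Y b c) d - sh 1 (\ c' -> Y b c' d) c
    t d b = trans (l-cong Lin-Π {B = \ γ -> sh 1 (\ d' -> W c d' γ) d - sh 1 (\ c' -> W c' d γ) c} (\ { (x ∷ γ) -> cong₂ _-_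
          (sh-cong 1 (\ d' -> l-cong Lin-Π (\ { (y ∷ γ') -> refl }) (c ∷ γ)) d)
          (sh-cong 1 (\ c' -> l-cong Lin-Π (\ { (y ∷ γ') -> refl }) (c' ∷ γ)) c) }) (b ∷ β))
       (trans (l-- Lin-Π _ _ (b ∷ β)) (cong₂ _-_ (l-sh Lin-Π 1 (W c) d (b ∷ β)) (l-sh Lin-Π 1 (\ c' -> W c' d) c (b ∷ β))))
      where
      W : ℕ -> ℕ -> V (suc N)
      W c d = uc \ b' β' -> Π (uc (\ c' β'' -> B b' c' (d ∷ β''))) (c ∷ β')

  Π₂-comm : ∀ {N} (B : ℕ -> ℕ -> V N) b c β -> Π₂ B b c β ≡ Π₂ (\ c b -> B b c) c b β
  Π₂-comm {zero} B b c [] = refl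
  Π₂-comm {suc N} B b c (d ∷ β) = trans (Π₂-unf B b c d β) (trans (q₄
      (sh-cong 1 (sh-cong 1 (\ d -> ih b c d)) d)
      (trans (sh-cong 1 (\ d' -> sh-cong 1 (\ c' -> ih b c' d') c) d) (sh-comm₂ 1 1 (\ d' c' -> Y' c' b d') d c))
      (trans (sh-cong 1 (\ b' -> sh-cong 1 (\ d' -> ih b' c d') d) b) (sh-comm₂ 1 1 (\ b' d' -> Y' c b' d') b d))
      (trans (sh-cong 1 (\ b' -> sh-cong 1 (\ c' -> ih b' c' d) c) b) (sh-comm₂ 1 1 (\ b' c' -> Y' c' b' d) b c)))
    (trans (r (sh 1 (sh 1 (Y' c b)) d) (sh 1 (\ c' -> sh 1 (\ d' -> Y' c' b d') d) c) (sh 1 (\ d' -> sh 1 (\ b' -> Y' c b' d') b) d) (sh 1 (\ c' -> sh 1 (\ b' -> Y' c' b' d) b) c))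
      (sym (Π₂-unf (\ c b -> B b c) c b d β))))
    where
    Y' : ℕ -> ℕ -> ℕ -> ℤ
    Y' c b d = Π₂ (\ c' b' β' -> B b' c' (d ∷ β')) c b β
    ih : ∀ b c d -> Π₂ (\ b' c' β' -> B b' c' (d ∷ β')) b c β ≡ Y' c b d
    ih b c d = Π₂-comm (\ b' c' β' -> B b' c' (d ∷ β')) b c β
    r : ∀ x y z w -> (x - y) - (z - w) ≡ (x - z) - (y - w)
    r = solve-∀

  e₀ : ∀ {N} -> V N -> V (suc N)
  e₀ A (zero ∷ β) = A β
  e₀ A (suc _ ∷ β) = 0ℤ

  one : ∀ {N} -> V N
  one {zero} [] = 1ℤ
  one {suc N} = e₀ one

  -- The Vandermonde product ∏_{i<j} (xⱼ − xᵢ).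
  van : ∀ {N} -> V N
  van {zero} [] = 1ℤ
  van {suc N} = Π (e₀ van)

  e₀-Anti : ∀ {N} {A : V N} -> Anti A -> ∀ b -> Anti (\ β -> e₀ A (b ∷ β))
  e₀-Anti h zero = h
  e₀-Anti h (suc b) = Anti-0

  -- Apart from the factor x₁ - x₀, the product is `Π₂` of a function symmetric in x₀ and x₁, so
  -- `Π₂-comm` makes this cofactor symmetric; the sign comes from x₁ - x₀ alone.
  Anti-van : ∀ {N} -> Anti (van {N})
  Anti-van {zero} = tt
  Anti-van {suc zero} = tt
  Anti-van {suc (suc N)} = sw , Π-Anti (e₀-Anti (Anti-van {suc N}))
    where
    B : ℕ -> ℕ -> V N
    B b c β = e₀ (e₀ van) (b ∷ c ∷ β)
    Bs : ∀ b c β -> B b c β ≡ B c b β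
    Bs zero zero β = refl
    Bs zero (suc c) β = refl
    Bs (suc b) zero β = refl
    Bs (suc b) (suc c) β = refl
    X : ℕ -> ℕ -> Vec ℕ N -> ℤ
    X b c β = Π (ins c (e₀ van)) (b ∷ β)
    t : ∀ b c β -> X b c β ≡ Π₂ B b c β
    t b c β = l-cong Lin-Π (\ { (zero ∷ γ) -> l-cong Lin-Π {B = uc (B zero)} (\ { (y ∷ γ') -> refl }) (c ∷ γ)
                              ; (suc x ∷ γ) -> sym (trans (l-cong Lin-Π {A = uc (B (suc x))} {B = \ _ -> 0ℤ} (\ { (y ∷ γ') -> refl }) (c ∷ γ)) (l-0 Lin-Π (c ∷ γ))) }) (b ∷ β)
    Xs : ∀ b c β -> X b c β ≡ X c b β
    Xs b c β = trans (t b c β) (trans (Π₂-comm B b c β) (trans (Π₂-cong (\ c b γ -> Bs b c γ) c b β) (sym (t c b β))))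
    r : ∀ x y -> x - y ≡ - (y - x)
    r = solve-∀
    sw : ∀ b c β -> van (b ∷ c ∷ β) ≡ - van (c ∷ b ∷ β)
    sw b c β = trans (cong₂ _-_ (sh-cong 1 (\ c' -> Xs b c' β) c) (sh-cong 1 (\ b' -> Xs b' c β) b)) (r (sh 1 (\ z -> X z b β) c) (sh 1 (\ z -> X c z β) b))

  𝒢-Anti : ∀ {N} {A : V (suc N)} -> (∀ b -> Anti (\ β -> A (b ∷ β))) -> ∀ b -> Anti (\ β -> 𝒢 A (b ∷ β))
  𝒢-Anti {zero} h b = tt
  𝒢-Anti {suc zero} h b = tt
  𝒢-Anti {suc (suc N)} {A} h b = sw , \ c -> 𝒢-Anti {A = G₁ A c} (\ x -> Anti-ad (\ u v -> snd (h u) v) x (suc c)) b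
    where
    sw : ∀ c d β -> 𝒢 A (b ∷ c ∷ d ∷ β) ≡ - 𝒢 A (b ∷ d ∷ c ∷ β)
    sw c d β = trans (l-cong Lin-𝒢 {A = G₁ (G₁ A c) d} {B = \ γ -> - G₁ (G₁ A d) c γ} (\ { (x ∷ γ) ->
        trans (ad-cong (\ u v -> trans (ad-cong (\ u' w -> fst (h u') w v γ) u (suc c)) (ad-neg (\ u' w -> A (u' ∷ v ∷ w ∷ γ)) u (suc c))) x (suc d))
       (trans (ad-neg (\ u v -> ad (\ u' w -> A (u' ∷ v ∷ w ∷ γ)) u (suc c)) x (suc d)) (cong -_ (ad-ad (\ u' w v -> A (u' ∷ v ∷ w ∷ γ)) x (suc c) (suc d)))) }) (b ∷ β))
      (l-neg Lin-𝒢 (G₁ (G₁ A d) c) (b ∷ β))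

  -- The coefficient of x^α in A / van, for antisymmetric A.
  Ev : ∀ {N} -> V N -> V N
  Ev {zero} A [] = A []
  Ev {suc N} A (a ∷ α) = Ev (\ β -> 𝒢 A (a ∷ β)) α

  Lin-Ev : ∀ {N} -> Lin (Ev {N})
  Lin-Ev {zero} = record { l-cong = \ { e [] -> e [] } ; l-+ = \ { A B [] -> refl } ; l-* = \ { c A [] -> refl } }
  Lin-Ev {suc N} = record
    { l-cong = \ { e (a ∷ α) -> l-cong L (\ β -> l-cong Lin-𝒢 e (a ∷ β)) α }
    ; l-+ = \ { A B (a ∷ α) -> trans (l-cong L (\ β -> l-+ Lin-𝒢 A B (a ∷ β)) α) (l-+ L _ _ α) }
    ; l-* = \ { c A (a ∷ α) -> trans (l-cong L (\ β -> l-* Lin-𝒢 c A (a ∷ β)) α) (l-* L c _ α) } }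
    where L = Lin-Ev {N}

  -- Each division commutes with p_k by `𝒢P`, and its result is antisymmetric in the remaining
  -- variables by `𝒢-Anti`, so the next division is covered too.
  Ev-P : ∀ k {N} {A : V N} -> Anti A -> Ev (P k A) ≗ᵥ P k (Ev A)
  Ev-P k {zero} h [] = refl
  Ev-P k {suc N} {A} h (a ∷ α) = begin
    Ev (\ β -> 𝒢 (P k A) (a ∷ β)) α
      ≡⟨ l-cong Lin-Ev (\ β -> 𝒢P k A (Anti⇒Z h) (a ∷ β)) α ⟩
    Ev (\ β -> sh k (\ x -> 𝒢 A (x ∷ β)) a + P k (\ β' -> 𝒢 A (a ∷ β')) β) α
      ≡⟨ l-+ Lin-Ev _ _ α ⟩
    Ev (\ β -> sh k (\ x -> 𝒢 A (x ∷ β)) a) α + Ev (P k (\ β' -> 𝒢 A (a ∷ β'))) α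
      ≡⟨ cong₂ _+_ (l-sh Lin-Ev k (\ x β -> 𝒢 A (x ∷ β)) a α) (Ev-P k (𝒢-Anti {A = A} (Anti-tail h) a) α) ⟩
    P k (Ev A) (a ∷ α) ∎

  Ev-van : ∀ {N} -> Ev (van {N}) ≗ᵥ one
  Ev-van {zero} [] = refl
  Ev-van {suc N} (zero ∷ α) = trans (l-cong Lin-Ev (\ β -> 𝒢Π (e₀ van) (0 ∷ β)) α) (Ev-van α)
  Ev-van {suc N} (suc a ∷ α) = trans (l-cong Lin-Ev (\ β -> 𝒢Π (e₀ van) (suc a ∷ β)) α) (l-0 Lin-Ev α)

  -- a_δ · p_λ
  alt : List ℕ -> ∀ {N} -> V N
  alt λ' = foldr (\ k A -> P k A) van λ'

  pow : List ℕ -> ∀ {N} -> V N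
  pow λ' = foldr (\ k A -> P k A) one λ'

  Anti-alt : ∀ λ' {N} -> Anti (alt λ' {N})
  Anti-alt []ᴸ = Anti-van
  Anti-alt (k ∷ᴸ λ') = Anti-P k (Anti-alt λ')

  Ev-alt : ∀ λ' {N} -> Ev (alt λ' {N}) ≗ᵥ pow λ'
  Ev-alt []ᴸ = Ev-van
  Ev-alt (k ∷ᴸ λ') α = trans (Ev-P k (Anti-alt λ') α) (P-cong k (Ev-alt λ') α)

  -- The derivations Σ xᵢ^(k+1) ∂ᵢ and the cut-and-join identity.

  D : ℕ -> ∀ {N} -> V N -> V N
  D k A [] = 0ℤ
  D k A (b ∷ β) = sh k (\ x -> pos x * A (x ∷ β)) b + D k (\ β' -> A (b ∷ β')) β

  private
    x*+ : ∀ x a b -> x * (a + b) ≡ x * a + x * b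
    x*+ = solve-∀
    x*c* : ∀ x c a -> x * (c * a) ≡ c * (x * a)
    x*c* = solve-∀

  Lin-D : ∀ k {N} -> Lin (D k {N})
  Lin-D k = record { l-cong = cg ; l-+ = pl ; l-* = ml }
    where
    cg : ∀ {N} {A B : V N} -> A ≗ᵥ B -> D k A ≗ᵥ D k B
    cg e [] = refl
    cg e (b ∷ β) = cong₂ _+_ (sh-cong k (\ x -> cong (pos x *_) (e (x ∷ β))) b) (cg (\ β' -> e (b ∷ β')) β)
    pl : ∀ {N} (A B : V N) -> D k (\ β -> A β + B β) ≗ᵥ (\ γ -> D k A γ + D k B γ)
    pl A B [] = refl
    pl A B (b ∷ β) = trans (cong₂ _+_ (trans (sh-cong k (\ x -> x*+ (pos x) (A (x ∷ β)) (B (x ∷ β))) b) (sh-+ k _ _ b)) (pl _ _ β))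
                           (+-swap (sh k (\ x -> pos x * A (x ∷ β)) b) _ _ _)
    ml : ∀ {N} c (A : V N) -> D k (\ β -> c * A β) ≗ᵥ (\ γ -> c * D k A γ)
    ml c A [] = sym (*-zeroʳ c)
    ml c A (b ∷ β) = trans (cong₂ _+_ (trans (sh-cong k (\ x -> x*c* (pos x) c (A (x ∷ β))) b) (sh-* k c _ b)) (ml c _ β)) (sym (*-distribˡ-+ c _ _))

  S₀ : ∀ {N} -> ℕ -> V (suc N) -> V (suc N)
  S₀ j A (b ∷ β) = sh j (\ x -> A (x ∷ β)) b

  S₁ : ∀ {N} -> ℕ -> V (suc (suc N)) -> V (suc (suc N))
  S₁ j A (b ∷ c ∷ β) = sh j (\ x -> A (b ∷ x ∷ β)) c

  sh-θsh : ∀ k j (g : ℕ -> ℤ) b -> sh k (\ x -> pos x * sh j g x) b ≡ sh j (sh k (\ x -> pos x * g x)) b + pos j * sh (k N.+ j) g b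
  sh-θsh k j g b = trans (sh-cong k (\ x -> sh-θ j g x) b) (trans (sh-+ k _ _ b)
    (cong₂ _+_ (sh-comm k j _ b) (trans (sh-* k (pos j) (sh j g) b) (cong (pos j *_) (sh-sh k j g b)))))

  -- Leibniz rule: the derivation sends p_j to j p_{k+j}.
  D-P : ∀ k j {N} (A : V N) γ -> D k (P j A) γ ≡ P j (D k A) γ + pos j * P (k N.+ j) A γ
  D-P k j A [] = r (pos j)
    where r : ∀ x -> 0ℤ ≡ 0ℤ + x * 0ℤ
          r = solve-∀
  D-P k j A (b ∷ β) = begin
    sh k (\ x -> pos x * (sh j g x + P j (\ β' -> A (x ∷ β')) β)) b + D k (\ β' -> sh j (\ x -> A (x ∷ β')) b + P j (\ β'' -> A (b ∷ β'')) β') β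
      ≡⟨ cong₂ _+_ (trans (sh-cong k (\ x -> x*+ (pos x) (sh j g x) (P j (\ β' -> A (x ∷ β')) β)) b) (sh-+ k _ _ b)) (l-+ (Lin-D k) _ _ β) ⟩
    (sh k (\ x -> pos x * sh j g x) b + u) + (D k (\ β' -> sh j (\ x -> A (x ∷ β')) b) β + D k (P j (\ β'' -> A (b ∷ β''))) β)
      ≡⟨ cong₂ _+_ (cong (_+ u) (sh-θsh k j g b)) (cong₂ _+_ (l-sh (Lin-D k) j (\ x β' -> A (x ∷ β')) b β) (D-P k j (\ β'' -> A (b ∷ β'')) β)) ⟩
    ((w + pos j * sh (k N.+ j) g b) + u) + (v + (z + pos j * P (k N.+ j) (\ β' -> A (b ∷ β')) β))
      ≡⟨ r (pos j) w (sh (k N.+ j) g b) u v z (P (k N.+ j) (\ β' -> A (b ∷ β')) β) ⟩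
    ((w + v) + (u + z)) + pos j * (sh (k N.+ j) g b + P (k N.+ j) (\ β' -> A (b ∷ β')) β)
      ≡⟨ cong (_+ pos j * P (k N.+ j) A (b ∷ β)) (cong₂ _+_ (sym (sh-+ j _ _ b))
           (cong (_+ z) (trans (sh-cong k (\ x -> sym (P-* j (pos x) (\ β' -> A (x ∷ β')) β)) b) (sym (l-sh (Lin-P j) k (\ x β' -> pos x * A (x ∷ β')) b β))))) ⟩
    (sh j (\ x -> sh k (\ y -> pos y * A (y ∷ β)) x + D k (\ β' -> A (x ∷ β')) β) b + (P j (\ β' -> sh k (\ x -> pos x * A (x ∷ β')) b) β + z)) + pos j * P (k N.+ j) A (b ∷ β)
      ≡⟨ cong (_+ pos j * P (k N.+ j) A (b ∷ β)) (cong (sh j (\ x -> sh k (\ y -> pos y * A (y ∷ β)) x + D k (\ β' -> A (x ∷ β')) β) b +_) (sym (P-+ j _ _ β))) ⟩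
    P j (D k A) (b ∷ β) + pos j * P (k N.+ j) A (b ∷ β) ∎
    where
    g = \ x -> A (x ∷ β)
    u = sh k (\ x -> pos x * P j (\ β' -> A (x ∷ β')) β) b
    v = sh j (\ x -> D k (\ β' -> A (x ∷ β')) β) b
    w = sh j (sh k (\ x -> pos x * g x)) b
    z = P j (D k (\ β'' -> A (b ∷ β''))) β
    r : ∀ j w s u v z p -> ((w + j * s) + u) + (v + (z + j * p)) ≡ ((w + v) + (u + z)) + j * (s + p)
    r = solve-∀

  P-S₀ : ∀ k j {N} (A : V (suc N)) -> P k (S₀ j A) ≗ᵥ S₀ j (P k A)
  P-S₀ k j A (b ∷ β) = trans (cong₂ _+_ (sh-comm k j _ b) (l-sh (Lin-P k) j (\ x β' -> A (x ∷ β')) b β)) (sym (sh-+ j _ _ b))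

  P-S₁ : ∀ k j {N} (A : V (suc (suc N))) -> P k (S₁ j A) ≗ᵥ S₁ j (P k A)
  P-S₁ k j A (b ∷ c ∷ β) = trans (cong₂ _+_ (sh-comm₂ k j (\ x y -> A (x ∷ y ∷ β)) b c) (P-S₀ k j (\ β' -> A (b ∷ β')) (c ∷ β))) (sym (sh-+ j _ _ c))

  D-S₀ : ∀ k j {N} (A : V (suc N)) γ -> D k (S₀ j A) γ ≡ S₀ j (D k A) γ + pos j * S₀ (k N.+ j) A γ
  D-S₀ k j A (b ∷ β) = trans (cong₂ _+_ (sh-θsh k j _ b) (l-sh (Lin-D k) j (\ x β' -> A (x ∷ β')) b β))
    (trans (r (sh j (sh k (\ x -> pos x * A (x ∷ β))) b) _ _) (cong (_+ pos j * sh (k N.+ j) (\ x -> A (x ∷ β)) b) (sym (sh-+ j _ _ b))))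
    where r : ∀ x y z -> (x + y) + z ≡ (x + z) + y
          r = solve-∀

  D-S₁ : ∀ k j {N} (A : V (suc (suc N))) γ -> D k (S₁ j A) γ ≡ S₁ j (D k A) γ + pos j * S₁ (k N.+ j) A γ
  D-S₁ k j A (b ∷ c ∷ β) = trans (cong₂ _+_ (trans (sh-cong k (\ x -> sym (sh-* j (pos x) _ c)) b) (sh-comm₂ k j (\ x y -> pos x * A (x ∷ y ∷ β)) b c)) (D-S₀ k j (\ β' -> A (b ∷ β')) (c ∷ β)))
    (trans (sym (+-assoc (sh j (\ y -> sh k (\ x -> pos x * A (x ∷ y ∷ β)) b) c) _ _)) (cong (_+ pos j * sh (k N.+ j) (\ x -> A (b ∷ x ∷ β)) c) (sym (sh-+ j _ _ c))))

  -- `Π` without its factor x₁ - x₀. Splitting this factor off (`Π-Ŵ`) is the induction step for all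
  -- statements about `Π`.
  Ŵ : ∀ {N} -> V (suc (suc N)) -> V (suc (suc N))
  Ŵ A (b ∷ c ∷ β) = Π (ins c A) (b ∷ β)

  Π-Ŵ : ∀ {N} (A : V (suc (suc N))) γ -> Π A γ ≡ S₁ 1 (Ŵ A) γ - S₀ 1 (Ŵ A) γ
  Π-Ŵ A (b ∷ c ∷ β) = refl

  Ŵ-S₁ : ∀ {N} j (A : V (suc (suc N))) -> Ŵ (S₁ j A) ≗ᵥ S₁ j (Ŵ A)
  Ŵ-S₁ j A (b ∷ c ∷ β) = trans (l-cong Lin-Π (\ { (x ∷ γ) -> refl }) (b ∷ β)) (l-sh Lin-Π j (\ x -> ins x A) c (b ∷ β))

  private
    S₁-cong : ∀ {N} j {A B : V (suc (suc N))} -> A ≗ᵥ B -> S₁ j A ≗ᵥ S₁ j B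
    S₁-cong j e (b ∷ c ∷ β) = sh-cong j (\ x -> e (b ∷ x ∷ β)) c
    S₀-cong : ∀ {N} j {A B : V (suc N)} -> A ≗ᵥ B -> S₀ j A ≗ᵥ S₀ j B
    S₀-cong j e (b ∷ β) = sh-cong j (\ x -> e (x ∷ β)) b
    S₀-S₁ : ∀ {N} j k (A : V (suc (suc N))) -> S₀ j (S₁ k A) ≗ᵥ S₁ k (S₀ j A)
    S₀-S₁ j k A (b ∷ c ∷ β) = sh-comm₂ j k (\ x y -> A (x ∷ y ∷ β)) b c
    S₀-S₀ : ∀ {N} j k (A : V (suc N)) -> S₀ j (S₀ k A) ≗ᵥ S₀ (j N.+ k) A
    S₀-S₀ j k A (b ∷ β) = sh-sh j k _ b
    S₁-S₁ : ∀ {N} j k (A : V (suc (suc N))) -> S₁ j (S₁ k A) ≗ᵥ S₁ (j N.+ k) A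
    S₁-S₁ j k A (b ∷ c ∷ β) = sh-sh j k _ c
    S₁-+ : ∀ {N} j (A B : V (suc (suc N))) γ -> S₁ j (\ β -> A β + B β) γ ≡ S₁ j A γ + S₁ j B γ
    S₁-+ j A B (b ∷ c ∷ β) = sh-+ j _ _ c
    S₀-+ : ∀ {N} j (A B : V (suc N)) γ -> S₀ j (\ β -> A β + B β) γ ≡ S₀ j A γ + S₀ j B γ
    S₀-+ j A B (b ∷ β) = sh-+ j _ _ b
    S₀-- : ∀ {N} j (A B : V (suc N)) γ -> S₀ j (\ β -> A β - B β) γ ≡ S₀ j A γ - S₀ j B γ
    S₀-- j A B (b ∷ β) = sh-- j _ _ b

  Π-S₀ : ∀ {N} j (A : V (suc N)) -> Π (S₀ j A) ≗ᵥ S₀ j (Π A)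
  Ŵ-S₀ : ∀ {N} j (A : V (suc (suc N))) -> Ŵ (S₀ j A) ≗ᵥ S₀ j (Ŵ A)
  Ŵ-S₀ j A (b ∷ c ∷ β) = trans (l-cong Lin-Π {B = S₀ j (ins c A)} (\ { (x ∷ γ) -> refl }) (b ∷ β)) (Π-S₀ j (ins c A) (b ∷ β))
  Π-S₀ {zero} j A γ = refl
  Π-S₀ {suc N} j A γ = trans (Π-Ŵ (S₀ j A) γ) (trans (cong₂ _-_
      (trans (S₁-cong 1 (Ŵ-S₀ j A) γ) (sym (S₀-S₁ j 1 (Ŵ A) γ)))
      (trans (S₀-cong 1 (Ŵ-S₀ j A) γ) (trans (S₀-S₀ 1 j (Ŵ A) γ) (trans (cong (\ t -> S₀ t (Ŵ A) γ) (N.+-comm 1 j)) (sym (S₀-S₀ j 1 (Ŵ A) γ))))))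
    (trans (sym (S₀-- j (S₁ 1 (Ŵ A)) (S₀ 1 (Ŵ A)) γ)) (S₀-cong j (\ γ -> sym (Π-Ŵ A γ)) γ)))

  Π-P : ∀ k {N} (A : V (suc N)) -> Π (P k A) ≗ᵥ P k (Π A)
  Ŵ-P : ∀ k {N} (A : V (suc (suc N))) -> Ŵ (P k A) ≗ᵥ P k (Ŵ A)
  Ŵ-P k A (b ∷ c ∷ β) = begin
    Π (ins c (P k A)) (b ∷ β)
      ≡⟨ l-cong Lin-Π {B = \ γ -> P k (ins c A) γ + sh k (\ y -> ins y A γ) c} (\ { (x ∷ γ) -> r (sh k (\ y -> A (y ∷ c ∷ γ)) x) (sh k (\ y -> A (x ∷ y ∷ γ)) c) (P k (\ γ' -> A (x ∷ c ∷ γ')) γ) }) (b ∷ β) ⟩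
    Π (\ γ -> P k (ins c A) γ + sh k (\ y -> ins y A γ) c) (b ∷ β)
      ≡⟨ trans (l-+ Lin-Π _ _ (b ∷ β)) (cong₂ _+_ (Π-P k (ins c A) (b ∷ β)) (l-sh Lin-Π k (\ y -> ins y A) c (b ∷ β))) ⟩
    P k (Π (ins c A)) (b ∷ β) + sh k (\ y -> Π (ins y A) (b ∷ β)) c
      ≡⟨ sym (r (sh k (\ y -> Π (ins c A) (y ∷ β)) b) (sh k (\ y -> Π (ins y A) (b ∷ β)) c) (P k (\ β' -> Π (ins c A) (b ∷ β')) β)) ⟩
    P k (Ŵ A) (b ∷ c ∷ β) ∎
    where r : ∀ x y z -> x + (y + z) ≡ (x + z) + y
          r = solve-∀
  Π-P k {zero} A (b ∷ []) = refl
  Π-P k {suc N} A γ = trans (Π-Ŵ (P k A) γ) (trans (cong₂ _-_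
      (trans (S₁-cong 1 (Ŵ-P k A) γ) (sym (P-S₁ k 1 (Ŵ A) γ)))
      (trans (S₀-cong 1 (Ŵ-P k A) γ) (sym (P-S₀ k 1 (Ŵ A) γ))))
    (trans (sym (l-- (Lin-P k) _ _ γ)) (P-cong k (\ γ -> sym (Π-Ŵ A γ)) γ)))

  -- Σ_{j ≥ 1} h_k(x₀, xⱼ)
  hh : ∀ {N} -> ℕ -> V (suc N) -> V (suc N)
  hh k A (b ∷ β) = ad (\ u v -> sh u (\ x -> P v (\ β' -> A (x ∷ β')) β) b) k 0

  -- The identity (y - x) h_k(x, y) = y^(k+1) - x^(k+1), with `f u v` in the role of x^u y^v.
  geom : ∀ (f : ℕ -> ℕ -> ℤ) k -> ad (\ u v -> f u (suc v)) k 0 - ad (\ u v -> f (suc u) v) k 0 ≡ f 0 (suc k) - f (suc k) 0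
  geom f k = l (sym (ad-shiftʳ f k 0)) (ad-last f k 0)
    where
    s₁ : ∀ a b c -> (a + b) - c - a ≡ b - c
    s₁ = solve-∀
    s₂ : ∀ a b c -> (a + b) - a - c ≡ b - c
    s₂ = solve-∀
    l : ∀ {p q x y z} -> p ≡ q -> x + q ≡ y + z -> p - y ≡ z - x
    l {p} {q} {x} {y} {z} refl e = begin
      p - y ≡⟨ sym (s₁ x p y) ⟩
      (x + p) - y - x ≡⟨ cong (\ t -> t - y - x) e ⟩
      (y + z) - y - x ≡⟨ s₂ y z x ⟩
      z - x ∎

  -- The derivation sends xⱼ - x₀ to xⱼ^(k+1) - x₀^(k+1), which is xⱼ - x₀ times h_k(x₀, xⱼ). Hence
  -- the product of these factors has logarithmic derivative `hh k`.
  D-Π : ∀ k {N} (A : V (suc N)) γ -> D k (Π A) γ ≡ Π (D k A) γ + Π (hh k A) γ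
  D-Π k {zero} A (b ∷ []) = sym (trans (cong (D k A (b ∷ []) +_) (trans (ad-cong (\ u v -> sh-0 u b) k 0) (ad-0 k 0))) (+-identityʳ _))
  D-Π k {suc N} A γ = begin
    D k (Π A) γ
      ≡⟨ trans (l-cong (Lin-D k) (Π-Ŵ A) γ) (l-- (Lin-D k) _ _ γ) ⟩
    D k (S₁ 1 W) γ - D k (S₀ 1 W) γ
      ≡⟨ cong₂ _-_ (D-S₁ k 1 W γ) (D-S₀ k 1 W γ) ⟩
    (S₁ 1 (D k W) γ + 1ℤ * S₁ (k N.+ 1) W γ) - (S₀ 1 (D k W) γ + 1ℤ * S₀ (k N.+ 1) W γ)
      ≡⟨ cong₂ _-_ (cong₂ _+_ (trans (S₁-cong 1 DW γ) (S₁-+ 1 _ _ γ)) (cong (\ t -> 1ℤ * S₁ t W γ) (N.+-comm k 1)))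
                   (cong₂ _+_ (trans (S₀-cong 1 DW γ) (S₀-+ 1 _ _ γ)) (cong (\ t -> 1ℤ * S₀ t W γ) (N.+-comm k 1))) ⟩
    ((S₁ 1 (Ŵ (D k A)) γ + S₁ 1 (Ŵ hr) γ) + 1ℤ * S₁ (suc k) W γ) - ((S₀ 1 (Ŵ (D k A)) γ + S₀ 1 (Ŵ hr) γ) + 1ℤ * S₀ (suc k) W γ)
      ≡⟨ r (S₁ 1 (Ŵ (D k A)) γ) (S₁ 1 (Ŵ hr) γ) (S₁ (suc k) W γ) (S₀ 1 (Ŵ (D k A)) γ) (S₀ 1 (Ŵ hr) γ) (S₀ (suc k) W γ) ⟩
    (S₁ 1 (Ŵ (D k A)) γ - S₀ 1 (Ŵ (D k A)) γ) + ((S₁ 1 (Ŵ hr) γ - S₀ 1 (Ŵ hr) γ) + (S₁ (suc k) W γ - S₀ (suc k) W γ))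
      ≡⟨ cong₂ _+_ (sym (Π-Ŵ (D k A) γ)) (cong₂ _+_ (sym (Π-Ŵ hr γ)) (sym gm)) ⟩
    Π (D k A) γ + (Π hr γ + Π (\ γ -> ad (\ u v -> S₀ u (S₁ v A) γ) k 0) γ)
      ≡⟨ cong (Π (D k A) γ +_) (trans (sym (l-+ Lin-Π hr _ γ)) (l-cong Lin-Π hh-split γ)) ⟩
    Π (D k A) γ + Π (hh k A) γ ∎
    where
    W = Ŵ A
    hr : V (suc (suc N))
    hr (b ∷ c ∷ β) = hh k (ins c A) (b ∷ β)
    r : ∀ a b c d e f -> ((a + b) + 1ℤ * c) - ((d + e) + 1ℤ * f) ≡ (a - d) + ((b - e) + (c - f))
    r = solve-∀
    r₂ : ∀ x y z -> x + (y + z) ≡ (x + z) + y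
    r₂ = solve-∀
    DW : ∀ γ -> D k W γ ≡ Ŵ (D k A) γ + Ŵ hr γ
    DW (b ∷ c ∷ β) = begin
      D k W (b ∷ c ∷ β)
        ≡⟨ r₂ (sh k (\ x -> pos x * Π (ins c A) (x ∷ β)) b) (sh k (\ y -> pos y * Π (ins y A) (b ∷ β)) c) (D k (\ β' -> Π (ins c A) (b ∷ β')) β) ⟩
      D k (Π (ins c A)) (b ∷ β) + sh k (\ y -> pos y * Π (ins y A) (b ∷ β)) c
        ≡⟨ cong₂ _+_ (D-Π k (ins c A) (b ∷ β)) (trans (sh-cong k (\ y -> sym (l-* Lin-Π (pos y) (ins y A) (b ∷ β))) c) (sym (l-sh Lin-Π k (\ y γ -> pos y * ins y A γ) c (b ∷ β)))) ⟩
      (Π (D k (ins c A)) (b ∷ β) + Π (hh k (ins c A)) (b ∷ β)) + Π (\ γ -> sh k (\ y -> pos y * ins y A γ) c) (b ∷ β)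
        ≡⟨ r₃ (Π (D k (ins c A)) (b ∷ β)) (Π (hh k (ins c A)) (b ∷ β)) _ ⟩
      (Π (D k (ins c A)) (b ∷ β) + Π (\ γ -> sh k (\ y -> pos y * ins y A γ) c) (b ∷ β)) + Π (hh k (ins c A)) (b ∷ β)
        ≡⟨ cong₂ _+_ (trans (sym (l-+ Lin-Π _ _ (b ∷ β))) (l-cong Lin-Π (\ { (x ∷ γ) -> sym (r₂ (sh k (\ y -> pos y * A (y ∷ c ∷ γ)) x) (sh k (\ y -> pos y * A (x ∷ y ∷ γ)) c) (D k (\ γ' -> A (x ∷ c ∷ γ')) γ)) }) (b ∷ β)))
                     (l-cong Lin-Π (\ { (x ∷ γ) -> refl }) (b ∷ β)) ⟩
      Ŵ (D k A) (b ∷ c ∷ β) + Ŵ hr (b ∷ c ∷ β) ∎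
      where r₃ : ∀ x y z -> (x + y) + z ≡ (x + z) + y
            r₃ = solve-∀
    hh-split : ∀ γ -> hr γ + ad (\ u v -> S₀ u (S₁ v A) γ) k 0 ≡ hh k A γ
    hh-split (b ∷ c ∷ β) = trans (sym (ad-+ _ _ k 0)) (ad-cong (\ u v -> trans (sym (sh-+ u _ _ b))
        (sh-cong u (\ x -> +-comm (P v (\ β' -> A (x ∷ c ∷ β')) β) (sh v (\ y -> A (x ∷ y ∷ β)) c)) b)) k 0)
    f : ℕ -> ℕ -> ℤ
    f u v = S₀ u (S₁ v W) γ
    gm : Π (\ γ -> ad (\ u v -> S₀ u (S₁ v A) γ) k 0) γ ≡ S₁ (suc k) W γ - S₀ (suc k) W γ
    gm = begin
      Π (\ γ -> ad (\ u v -> S₀ u (S₁ v A) γ) k 0) γ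
        ≡⟨ trans (l-ad Lin-Π (\ u v -> S₀ u (S₁ v A)) k 0 γ) (ad-cong (\ u v -> trans (Π-Ŵ (S₀ u (S₁ v A)) γ) (cong₂ _-_ (h₁ u v) (h₀ u v))) k 0) ⟩
      ad (\ u v -> f u (suc v) - f (suc u) v) k 0
        ≡⟨ trans (ad-+ (\ u v -> f u (suc v)) (\ u v -> - f (suc u) v) k 0) (cong (ad (\ u v -> f u (suc v)) k 0 +_) (ad-neg (\ u v -> f (suc u) v) k 0)) ⟩
      ad (\ u v -> f u (suc v)) k 0 - ad (\ u v -> f (suc u) v) k 0
        ≡⟨ geom f k ⟩
      f 0 (suc k) - f (suc k) 0
        ≡⟨ cong₂ _-_ (z₀ γ) (S₀-cong (suc k) z₁ γ) ⟩
      S₁ (suc k) W γ - S₀ (suc k) W γ ∎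
      where
      z₀ : ∀ γ -> S₀ 0 (S₁ (suc k) W) γ ≡ S₁ (suc k) W γ
      z₀ (b ∷ β) = refl
      z₁ : ∀ γ -> S₁ 0 W γ ≡ W γ
      z₁ (b ∷ c ∷ β) = refl
      base : ∀ u v -> Ŵ (S₀ u (S₁ v A)) ≗ᵥ S₀ u (S₁ v W)
      base u v γ = trans (Ŵ-S₀ u (S₁ v A) γ) (S₀-cong u (Ŵ-S₁ v A) γ)
      h₁ : ∀ u v -> S₁ 1 (Ŵ (S₀ u (S₁ v A))) γ ≡ f u (suc v)
      h₁ u v = trans (S₁-cong 1 (base u v) γ) (trans (sym (S₀-S₁ u 1 (S₁ v W) γ)) (S₀-cong u (S₁-S₁ 1 v W) γ))
      h₀ : ∀ u v -> S₀ 1 (Ŵ (S₀ u (S₁ v A))) γ ≡ f (suc u) v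
      h₀ u v = trans (S₀-cong 1 (base u v) γ) (S₀-S₀ 1 u (S₁ v W) γ)

  ad-diag : ∀ F x b c -> (∀ u v -> u N.+ v ≡ b N.+ c -> F u v ≡ x) -> ad F b c ≡ pos (suc b) * x
  ad-diag F x zero c h = trans (h zero c refl) (l x)
    where l : ∀ x -> x ≡ 1ℤ * x
          l = solve-∀
  ad-diag F x (suc b) c h = trans (cong₂ _+_ (h (suc b) c refl) (ad-diag F x b (suc c) (\ u v e -> h u v (trans e (N.+-suc b c))))) (l (pos b) x)
    where l : ∀ b x -> x + (1ℤ + b) * x ≡ (1ℤ + (1ℤ + b)) * x
          l = solve-∀

  PP : ∀ {N} -> ℕ -> V N -> V N
  PP k A β = ad (\ u v -> P u (P v A) β) k 0

  -- The products p_u p_v with u + v = k are sorted by how often they use x₀: twice, where all k + 1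
  -- terms agree; once, in two mirror halves that are both `hh`; or never.
  PP-∷ : ∀ {N} k (B : V (suc N)) b β ->
    PP k B (b ∷ β) ≡ (pos (suc k) * sh k (\ x -> B (x ∷ β)) b + pos 2 * hh k B (b ∷ β)) + PP k (\ β' -> B (b ∷ β')) β
  PP-∷ {N} k B b β = begin
    ad (\ u v -> P u (P v B) (b ∷ β)) k 0
      ≡⟨ ad-cong (\ u v -> trans (cong₂ _+_ (sh-+ u _ _ b) (P-+ u _ _ β)) (r (sh u (sh v g) b) (h₁ u v) (P u (\ β' -> sh v (\ x -> B (x ∷ β')) b) β) (P u (P v (\ β' -> B (b ∷ β'))) β))) k 0 ⟩
    ad (\ u v -> (sh u (sh v g) b + (h₁ u v + P u (\ β' -> sh v (\ x -> B (x ∷ β')) b) β)) + P u (P v (\ β' -> B (b ∷ β'))) β) k 0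
      ≡⟨ trans (ad-+ _ _ k 0) (cong (_+ PP k (\ β' -> B (b ∷ β')) β) (trans (ad-+ _ _ k 0) (cong₂ _+_
           (ad-diag _ (sh k g b) k 0 (\ u v e -> trans (sh-sh u v g b) (sh-≡ (trans e (N.+-identityʳ k)) g b)))
           (trans (ad-+ _ _ k 0) (trans (cong (hh k B (b ∷ β) +_) (trans (ad-cong (\ u v -> l-sh (Lin-P u) v (\ x β' -> B (x ∷ β')) b β) k 0) (ad-flip (\ u v -> h₁ v u) k))) (r₂ (hh k B (b ∷ β)))))))) ⟩
    (pos (suc k) * sh k g b + pos 2 * hh k B (b ∷ β)) + PP k (\ β' -> B (b ∷ β')) β ∎
    where
    g = \ x -> B (x ∷ β)
    h₁ : ℕ -> ℕ -> ℤ
    h₁ u v = sh u (\ x -> P v (\ β' -> B (x ∷ β')) β) b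
    r : ∀ a b c d -> (a + b) + (c + d) ≡ (a + (b + c)) + d
    r = solve-∀
    r₂ : ∀ x -> x + x ≡ pos 2 * x
    r₂ = solve-∀

  D-e₀ : ∀ {N} k (A : V N) -> D k (e₀ A) ≗ᵥ e₀ (D k A)
  D-e₀ k A (b ∷ β) = trans (cong₂ _+_ (trans (sh-cong k z b) (sh-0 k b)) (t b)) (+-identityˡ _)
    where
    z : ∀ x -> pos x * e₀ A (x ∷ β) ≡ 0ℤ
    z zero = refl
    z (suc x) = *-zeroʳ (pos (suc x))
    t : ∀ b -> D k (\ β' -> e₀ A (b ∷ β')) β ≡ e₀ (D k A) (b ∷ β)
    t zero = refl
    t (suc b) = l-0 (Lin-D k) β

  -- The power sums act on the Vandermonde product like (half of) a quadratic expression in power sums;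
  -- this is the logarithmic derivative of ∏ (xⱼ − xᵢ).
  D-van : ∀ k {N} (β : Vec ℕ N) -> pos 2 * D k van β ≡ PP k van β - pos (suc k) * P k van β
  D-van k {zero} [] = sym (trans (cong₂ _-_ (ad-0 k 0) (*-zeroʳ (pos (suc k)))) refl)
  D-van k {suc N} γ = begin
    pos 2 * D k (Π B) γ
      ≡⟨ cong (pos 2 *_) (trans (D-Π k B γ) (sym (l-+ Lin-Π (D k B) (hh k B) γ))) ⟩
    pos 2 * Π (\ γ -> D k B γ + hh k B γ) γ
      ≡⟨ sym (l-* Lin-Π (pos 2) _ γ) ⟩
    Π (\ γ -> pos 2 * (D k B γ + hh k B γ)) γ
      ≡⟨ l-cong Lin-Π pt γ ⟩
    Π (\ γ -> PP k B γ - pos (suc k) * P k B γ) γ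
      ≡⟨ trans (l-- Lin-Π (PP k B) _ γ) (cong₂ _-_ (trans (l-ad Lin-Π (\ u v -> P u (P v B)) k 0 γ) (ad-cong (\ u v -> trans (Π-P u (P v B) γ) (P-cong u (Π-P v B) γ)) k 0))
            (trans (l-* Lin-Π (pos (suc k)) (P k B) γ) (cong (pos (suc k) *_) (Π-P k B γ)))) ⟩
    PP k (Π B) γ - pos (suc k) * P k (Π B) γ ∎
    where
    B = e₀ (van {N})
    r : ∀ s g h p d P -> pos 2 * d ≡ p - s * P -> pos 2 * (d + h) ≡ ((s * g + pos 2 * h) + p) - s * (g + P)
    r s g h p d P e = trans (s₁ d h) (trans (cong (_+ pos 2 * h) e) (s₂ s g h p P))
      where
      s₁ : ∀ d h -> pos 2 * (d + h) ≡ pos 2 * d + pos 2 * h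
      s₁ = solve-∀
      s₂ : ∀ s g h p P -> p - s * P + pos 2 * h ≡ ((s * g + pos 2 * h) + p) - s * (g + P)
      s₂ = solve-∀
    ih : ∀ b β -> pos 2 * e₀ (D k van) (b ∷ β) ≡ PP k (\ β' -> B (b ∷ β')) β - pos (suc k) * P k (\ β' -> B (b ∷ β')) β
    ih zero β = D-van k β
    ih (suc b) β = sym (cong₂ _-_ (trans (ad-cong (\ u v -> trans (P-cong u (l-0 (Lin-P v)) β) (l-0 (Lin-P u) β)) k 0) (ad-0 k 0))
                                  (trans (cong (pos (suc k) *_) (l-0 (Lin-P k) β)) (*-zeroʳ (pos (suc k)))))
    pt : ∀ γ -> pos 2 * (D k B γ + hh k B γ) ≡ PP k B γ - pos (suc k) * P k B γ
    pt (b ∷ β) = trans (r (pos (suc k)) (sh k (\ x -> B (x ∷ β)) b) (hh k B (b ∷ β)) (PP k (\ β' -> B (b ∷ β')) β) (D k B (b ∷ β)) (P k (\ β' -> B (b ∷ β')) β)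
        (trans (cong (pos 2 *_) (D-e₀ k van (b ∷ β))) (ih b β)))
      (cong (_- pos (suc k) * P k B (b ∷ β)) (sym (PP-∷ k B b β)))

  -- Σ over the parts j of λ of j · a_δ p_{k+j} p_{λ∖j}
  join : ℕ -> List ℕ -> ∀ {N} -> V N
  join k []ᴸ β = 0ℤ
  join k (j ∷ᴸ λ') β = P j (join k λ') β + pos j * P (k N.+ j) (alt λ') β

  D-alt : ∀ k λ' {N} (β : Vec ℕ N) -> pos 2 * D k (alt λ') β ≡ (PP k (alt λ') β - pos (suc k) * P k (alt λ') β) + pos 2 * join k λ' β
  D-alt k []ᴸ β = trans (D-van k β) (sym (+-identityʳ _))
  D-alt k (j ∷ᴸ λ') β = begin
    pos 2 * D k (P j A) β
      ≡⟨ trans (cong (pos 2 *_) (D-P k j A β)) (r₁ (P j (D k A) β) (pos j * P (k N.+ j) A β)) ⟩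
    pos 2 * P j (D k A) β + pos 2 * (pos j * P (k N.+ j) A β)
      ≡⟨ cong (_+ pos 2 * (pos j * P (k N.+ j) A β)) (trans (sym (P-* j (pos 2) (D k A) β)) (P-cong j (D-alt k λ') β)) ⟩
    P j (\ β -> (PP k A β - pos (suc k) * P k A β) + pos 2 * join k λ' β) β + pos 2 * (pos j * P (k N.+ j) A β)
      ≡⟨ cong (_+ pos 2 * (pos j * P (k N.+ j) A β)) (trans (P-+ j _ _ β) (cong₂ _+_
           (trans (l-- (Lin-P j) _ _ β) (cong₂ _-_
              (trans (l-ad (Lin-P j) (\ u v -> P u (P v A)) k 0 β) (ad-cong (\ u v -> trans (P-comm j u (P v A) β) (P-cong u (P-comm j v A) β)) k 0))
              (trans (P-* j (pos (suc k)) (P k A) β) (cong (pos (suc k) *_) (P-comm j k A β)))))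
           (P-* j (pos 2) (join k λ') β))) ⟩
    ((PP k (P j A) β - pos (suc k) * P k (P j A) β) + pos 2 * P j (join k λ') β) + pos 2 * (pos j * P (k N.+ j) A β)
      ≡⟨ r₂ (PP k (P j A) β - pos (suc k) * P k (P j A) β) (P j (join k λ') β) (pos j * P (k N.+ j) A β) ⟩
    (PP k (P j A) β - pos (suc k) * P k (P j A) β) + pos 2 * join k (j ∷ᴸ λ') β ∎
    where
    A : ∀ {N} -> V N
    A = alt λ'
    r₁ : ∀ x y -> pos 2 * (x + y) ≡ pos 2 * x + pos 2 * y
    r₁ = solve-∀
    r₂ : ∀ x y z -> (x + pos 2 * y) + pos 2 * z ≡ x + pos 2 * (y + z)
    r₂ = solve-∀

  qs : ∀ {N} -> V N
  qs [] = 0ℤ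
  qs (b ∷ β) = pos b * pos b + qs β

  sh-θ² : ∀ k (g : ℕ -> ℤ) b -> pos b * pos b * sh k g b ≡ sh k (\ x -> pos x * pos x * g x) b + (pos 2 * pos k * sh k (\ x -> pos x * g x) b + pos k * pos k * sh k g b)
  sh-θ² k g b = begin
    pos b * pos b * sh k g b ≡⟨ Z.*-assoc (pos b) (pos b) _ ⟩
    pos b * (pos b * sh k g b) ≡⟨ cong (pos b *_) (sh-θ k g b) ⟩
    pos b * (t + pos k * s) ≡⟨ r₁ (pos b) t (pos k) s ⟩
    pos b * t + pos k * (pos b * s) ≡⟨ cong₂ _+_ (sh-θ k (\ x -> pos x * g x) b) (cong (pos k *_) (sh-θ k g b)) ⟩
    (sh k (\ x -> pos x * (pos x * g x)) b + pos k * t) + pos k * (t + pos k * s)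
      ≡⟨ cong (\ z -> (z + pos k * t) + pos k * (t + pos k * s)) (sh-cong k (\ x -> sym (Z.*-assoc (pos x) (pos x) (g x))) b) ⟩
    (sh k (\ x -> pos x * pos x * g x) b + pos k * t) + pos k * (t + pos k * s) ≡⟨ r₂ (sh k (\ x -> pos x * pos x * g x) b) (pos k) t s ⟩
    sh k (\ x -> pos x * pos x * g x) b + (pos 2 * pos k * t + pos k * pos k * s) ∎
    where
    s = sh k g b
    t = sh k (\ x -> pos x * g x) b
    r₁ : ∀ b t k s -> b * (t + k * s) ≡ b * t + k * (b * s)
    r₁ = solve-∀
    r₂ : ∀ q k t s -> (q + k * t) + k * (t + k * s) ≡ q + (pos 2 * k * t + k * k * s)
    r₂ = solve-∀

  -- `qs β` is the eigenvalue of Σ θᵢ² at the monomial with exponent β, where θᵢ = xᵢ∂ᵢ. Moving xᵢ^k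
  -- across replaces θᵢ by θᵢ + k, and (θ + k)² - θ² = 2kθ + k².
  Q-P : ∀ k {N} (A : V N) β -> qs β * P k A β ≡ P k (\ γ -> qs γ * A γ) β + (pos k * (pos 2 * D k A β) + pos k * pos k * P k A β)
  Q-P k A [] = r (pos k)
    where r : ∀ k -> 0ℤ * 0ℤ ≡ 0ℤ + (k * (pos 2 * 0ℤ) + k * k * 0ℤ)
          r = solve-∀
  Q-P k A (b ∷ β) = begin
    (pos b * pos b + q) * (s + p) ≡⟨ r₁ (pos b * pos b) q s p ⟩
    (pos b * pos b * s + q * s) + (pos b * pos b * p + q * p)
      ≡⟨ cong₂ _+_ (cong (_+ q * s) (sh-θ² k g b)) (cong (pos b * pos b * p +_) (Q-P k (\ β' -> A (b ∷ β')) β)) ⟩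
    ((s₂ + (pos 2 * pos k * s₁ + pos k * pos k * s)) + q * s) + (pos b * pos b * p + (pq + (pos k * (pos 2 * d) + pos k * pos k * p)))
      ≡⟨ r₂ s₂ (pos k) s₁ s (q * s) (pos b * pos b * p) pq d p ⟩
    ((s₂ + q * s) + (pos b * pos b * p + pq)) + (pos k * (pos 2 * (s₁ + d)) + pos k * pos k * (s + p))
      ≡⟨ cong (_+ (pos k * (pos 2 * (s₁ + d)) + pos k * pos k * (s + p))) (cong₂ _+_
           (trans (cong (s₂ +_) (sym (sh-* k q g b))) (trans (sym (sh-+ k _ _ b)) (sh-cong k (\ x -> sym (Z.*-distribʳ-+ (g x) (pos x * pos x) q)) b)))
           (trans (cong (_+ pq) (sym (P-* k (pos b * pos b) (\ β' -> A (b ∷ β')) β))) (trans (sym (P-+ k _ _ β)) (P-cong k (\ β' -> sym (Z.*-distribʳ-+ (A (b ∷ β')) (pos b * pos b) (qs β'))) β)))) ⟩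
    P k (\ γ -> qs γ * A γ) (b ∷ β) + (pos k * (pos 2 * D k A (b ∷ β)) + pos k * pos k * P k A (b ∷ β)) ∎
    where
    q = qs β
    g = \ x -> A (x ∷ β)
    s = sh k g b
    s₁ = sh k (\ x -> pos x * g x) b
    s₂ = sh k (\ x -> pos x * pos x * g x) b
    p = P k (\ β' -> A (b ∷ β')) β
    pq = P k (\ β' -> qs β' * A (b ∷ β')) β
    d = D k (\ β' -> A (b ∷ β')) β
    r₁ : ∀ b q s p -> (b + q) * (s + p) ≡ (b * s + q * s) + (b * p + q * p)
    r₁ = solve-∀
    r₂ : ∀ s₂ k s₁ s qs bp pq d p -> ((s₂ + (pos 2 * k * s₁ + k * k * s)) + qs) + (bp + (pq + (k * (pos 2 * d) + k * k * p)))
       ≡ ((s₂ + qs) + (bp + pq)) + (k * (pos 2 * (s₁ + d)) + k * k * (s + p))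
    r₂ = solve-∀

  P-0 : ∀ {N} (A : V N) β -> P 0 A β ≡ pos N * A β
  P-0 A [] = refl
  P-0 {suc N} A (b ∷ β) = trans (cong (A (b ∷ β) +_) (P-0 (\ β' -> A (b ∷ β')) β)) (r (pos N) (A (b ∷ β)))
    where r : ∀ n a -> a + n * a ≡ (1ℤ + n) * a
          r = solve-∀

  -- Splittings of a cycle of length k = suc m into two cycles.
  splitΣ : (ℕ -> ℕ -> ℤ) -> ℕ -> ℤ
  splitΣ f zero = 0ℤ
  splitΣ f (suc m) = ad (\ p q -> f (suc p) (suc q)) m 0

  -- The two end terms of the convolution contain p₀, which is the number of variables; the inner
  -- terms are genuine splittings of a cycle.
  PP-split : ∀ {N} m (A : V N) β -> PP (suc m) A β ≡ pos 2 * pos N * P (suc m) A β + splitΣ (\ p q -> P p (P q A) β) m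
  PP-split {N} zero A β = trans (cong₂ _+_ (P-cong 1 (P-0 A) β) (P-0 (P 1 A) β)) (trans (cong (_+ pos N * P 1 A β) (P-* 1 (pos N) A β)) (r (pos N) (P 1 A β)))
    where r : ∀ n a -> n * a + n * a ≡ pos 2 * n * a + 0ℤ
          r = solve-∀
  PP-split {N} (suc m) A β = begin
    f (suc (suc m)) 0 + ad f (suc m) 1
      ≡⟨ cong (f (suc (suc m)) 0 +_) (trans (ad-shiftʳ f (suc m) 0) (ad-last (\ u v -> f u (suc v)) m 0)) ⟩
    f (suc (suc m)) 0 + (splitΣ f (suc m) + f 0 (suc (suc m)))
      ≡⟨ cong₂ (\ x y -> x + (splitΣ f (suc m) + y)) (trans (P-cong (suc (suc m)) (P-0 A) β) (P-* (suc (suc m)) (pos N) A β)) (P-0 (P (suc (suc m)) A) β) ⟩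
    pos N * p + (splitΣ f (suc m) + pos N * p)
      ≡⟨ r (pos N) p (splitΣ f (suc m)) ⟩
    pos 2 * pos N * p + splitΣ f (suc m) ∎
    where
    f : ℕ -> ℕ -> ℤ
    f u v = P u (P v A) β
    p = P (suc (suc m)) A β
    r : ∀ n p s -> n * p + (s + n * p) ≡ pos 2 * n * p + s
    r = solve-∀

  -- Cut and join: Σ_i kᵢ (splittings of kᵢ) + Σ_{i≠j} kᵢ kⱼ (joins).  Parts are given as predecessors.
  cutjoin : List ℕ -> ∀ {N} -> V N
  sucs : List ℕ -> List ℕ
  sucs []ᴸ = []ᴸ
  sucs (m ∷ᴸ λ') = suc m ∷ᴸ sucs λ'
  cutjoin []ᴸ β = 0ℤ
  cutjoin (m ∷ᴸ λ') β = P (suc m) (cutjoin λ') β + pos (suc m) * (splitΣ (\ p q -> P p (P q (alt (sucs λ'))) β) m + pos 2 * join (suc m) (sucs λ') β)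

  lsum : List ℕ -> ℤ
  lsum []ᴸ = 0ℤ
  lsum (k ∷ᴸ λ') = pos k + lsum λ'

  -- Σ θᵢ² is applied to a_δ p_λ in two ways: on monomials, and by commuting it past the factors of
  -- p_λ. For a part k the scalar terms are 2Nk from p₀, -k(k + 1) from the diagonal and k² from
  -- `Q-P`; they add up to (2N - 1)k.
  Q-alt : ∀ λ' {N} (Q₀ : ℤ) -> (∀ (β : Vec ℕ N) -> qs β * van β ≡ Q₀ * van β) -> ∀ (β : Vec ℕ N) ->
    qs β * alt (sucs λ') β ≡ (Q₀ + (pos 2 * pos N - 1ℤ) * lsum (sucs λ')) * alt (sucs λ') β + cutjoin λ' β
  Q-alt []ᴸ {N} Q₀ h β = trans (h β) (r Q₀ (pos N) (van β))
    where r : ∀ q n v -> q * v ≡ (q + (pos 2 * n - 1ℤ) * 0ℤ) * v + 0ℤ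
          r = solve-∀
  Q-alt (m ∷ᴸ λ') {N} Q₀ h β = begin
    qs β * P k A β
      ≡⟨ Q-P k A β ⟩
    P k (\ γ -> qs γ * A γ) β + (pos k * (pos 2 * D k A β) + pos k * pos k * P k A β)
      ≡⟨ cong₂ (\ x y -> x + (pos k * y + pos k * pos k * P k A β))
           (trans (P-cong k (Q-alt λ' Q₀ h) β) (trans (P-+ k _ _ β) (cong (_+ P k (cutjoin λ') β) (P-* k c A β))))
           (trans (D-alt k (sucs λ') β) (cong (\ t -> (t - pos (suc k) * P k A β) + pos 2 * join k (sucs λ') β) (PP-split m A β))) ⟩
    (c * P k A β + P k (cutjoin λ') β) + (pos k * (((pos 2 * pos N * P k A β + sp) - pos (suc k) * P k A β) + pos 2 * join k (sucs λ') β) + pos k * pos k * P k A β)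
      ≡⟨ r Q₀ (pos N) (lsum (sucs λ')) (pos k) (P k A β) (P k (cutjoin λ') β) sp (join k (sucs λ') β) ⟩
    (Q₀ + (pos 2 * pos N - 1ℤ) * (pos k + lsum (sucs λ'))) * P k A β + (P k (cutjoin λ') β + pos k * (sp + pos 2 * join k (sucs λ') β)) ∎
    where
    k = suc m
    A : ∀ {N} -> V N
    A = alt (sucs λ')
    c = Q₀ + (pos 2 * pos N - 1ℤ) * lsum (sucs λ')
    sp = splitΣ (\ p q -> P p (P q A) β) m
    r : ∀ Q n l k p x s j -> ((Q + (pos 2 * n - 1ℤ) * l) * p + x) + (k * (((pos 2 * n * p + s) - (1ℤ + k) * p) + pos 2 * j) + k * k * p)
      ≡ (Q + (pos 2 * n - 1ℤ) * (k + l)) * p + (x + k * (s + pos 2 * j))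
    r = solve-∀

  -- Strict exponent vectors and homogeneity.

  sumV : ∀ {N} -> Vec ℕ N -> ℕ
  sumV [] = 0
  sumV (b ∷ β) = b N.+ sumV β

  Str : ∀ {N} -> ℕ -> Vec ℕ N -> Set
  Str lo [] = ⊤
  Str lo (b ∷ β) = (lo N.≤ b) × Str (suc b) β

  Str-mono : ∀ {N lo lo'} {β : Vec ℕ N} -> lo' N.≤ lo -> Str lo β -> Str lo' β
  Str-mono {β = []} l s = tt
  Str-mono {β = b ∷ β} l (p , s) = N.≤-trans l p , s

  δ : ℕ -> ∀ N -> Vec ℕ N
  δ lo zero = []
  δ lo (suc N) = lo ∷ δ (suc lo) N

  δ-suc : ∀ lo N -> δ (suc lo) N ≡ map suc (δ lo N)
  δ-suc lo zero = refl
  δ-suc lo (suc N) = cong (suc lo ∷_) (δ-suc (suc lo) N)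

  Str-sum : ∀ {N} lo (β : Vec ℕ N) -> Str lo β -> sumV (δ lo N) N.≤ sumV β
  Str-sum lo [] s = z≤n
  Str-sum lo (b ∷ β) (p , s) = N.+-mono-≤ p (Str-sum (suc lo) β (Str-mono (s≤s p) s))

  Str-≡δ : ∀ {N} lo (β : Vec ℕ N) -> Str lo β -> sumV β ≡ sumV (δ lo N) -> β ≡ δ lo N
  Str-≡δ lo [] s e = refl
  Str-≡δ {suc N} lo (b ∷ β) (p , s) e with N.m≤n⇒m<n∨m≡n p
  ... | inj₂ refl = cong (lo ∷_) (Str-≡δ (suc lo) β s (N.+-cancelˡ-≡ lo _ _ e))
  ... | inj₁ lt = ⊥-elim (N.<-irrefl (sym e) (N.+-mono-<-≤ lt (Str-sum (suc lo) β (Str-mono (s≤s p) s))))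

  -- Reduction of antisymmetric functions to strict vectors: a repeated entry kills them, otherwise
  -- sorting costs a sign. `qs` and `sumV` are symmetric and therefore kept.
  data Sorted {N} (γ : Vec ℕ N) : Set where
    vanish : (∀ {A : V N} -> Anti A -> A γ ≡ 0ℤ) -> Sorted γ
    sorted : ∀ β -> Str 0 β -> (s : ℤ) -> (∀ {A : V N} -> Anti A -> A γ ≡ s * A β) -> qs γ ≡ qs β -> sumV γ ≡ sumV β -> Sorted γ

  private
    data Ins {N} (lo : ℕ) (γ : Vec ℕ N) : Set where
      vanish : (∀ {A : V N} -> Anti A -> A γ ≡ 0ℤ) -> Ins lo γ
      sorted : ∀ β -> Str lo β -> (s : ℤ) -> (∀ {A : V N} -> Anti A -> A γ ≡ s * A β) -> qs γ ≡ qs β -> sumV γ ≡ sumV β -> Ins lo γ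

    one* : ∀ x -> x ≡ 1ℤ * x
    one* = solve-∀
    neg* : ∀ s x -> - (s * x) ≡ (- s) * x
    neg* = solve-∀

    insert : ∀ {N} lo a (β : Vec ℕ N) -> lo N.≤ a -> Str lo β -> Ins lo (a ∷ β)
    insert lo a [] l s = sorted (a ∷ []) (l , tt) 1ℤ (\ _ -> one* _) refl refl
    insert lo a (b ∷ β) l (p , s) with N.<-cmp a b
    ... | tri< a<b _ _ = sorted (a ∷ b ∷ β) (l , a<b , s) 1ℤ (\ _ -> one* _) refl refl
    ... | tri≈ _ refl _ = vanish (\ h -> x≡-x⇒x≡0 _ (fst h a a β))
    ... | tri> _ _ b<a with insert (suc b) a β b<a s
    ... | vanish z = vanish (\ h -> trans (fst h a b β) (cong -_ (z (snd h b))))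
    ... | sorted β' s' sg e q t = sorted (b ∷ β') (p , s') (- sg)
              (\ {A} h -> trans (fst h a b β) (trans (cong -_ (e (snd h b))) (neg* sg (A (b ∷ β')))))
              (trans (r (pos a * pos a) (pos b * pos b) (qs β)) (cong (pos b * pos b +_) q))
              (trans (sw a b (sumV β)) (cong (b N.+_) t))
      where
      r : ∀ x y z -> x + (y + z) ≡ y + (x + z)
      r = solve-∀
      sw : ∀ x y z -> x N.+ (y N.+ z) ≡ y N.+ (x N.+ z)
      sw x y z = trans (sym (N.+-assoc x y z)) (trans (cong (N._+ z) (N.+-comm x y)) (N.+-assoc y x z))

  sortV : ∀ {N} (γ : Vec ℕ N) -> Sorted γ
  sortV [] = sorted [] tt 1ℤ (\ _ -> one* _) refl refl
  sortV (a ∷ γ) with sortV γ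
  ... | vanish z = vanish (\ {A} h -> z (Anti-tail {A = A} h a))
  ... | sorted β s sg e q t with insert 0 a β z≤n s
  ... | vanish z = vanish (\ {A} h -> trans (e (Anti-tail {A = A} h a)) (trans (cong (sg *_) (z h)) (*-zeroʳ sg)))
  ... | sorted β' s' sg' e' q' t' = sorted β' s' (sg * sg')
            (\ {A} h -> trans (e (Anti-tail {A = A} h a)) (trans (cong (sg *_) (e' {A = A} h)) (sym (Z.*-assoc sg sg' _))))
            (trans (cong (pos a * pos a +_) q) q') (trans (cong (a N.+_) t) t')

  Anti-zero : ∀ {N} {A : V N} -> Anti A -> (∀ β -> Str 0 β -> A β ≡ 0ℤ) -> ∀ γ -> A γ ≡ 0ℤ
  Anti-zero h z γ with sortV γ
  ... | vanish v = v h
  ... | sorted β s sg e _ _ = trans (e h) (trans (cong (sg *_) (z β s)) (*-zeroʳ sg))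

  -- The offset `o` holds the exponents already read, so that homogeneity passes to functions of a
  -- tail.
  Hom : ∀ {N} -> ℕ -> ℕ -> V N -> Set
  Hom o d A = ∀ β -> o N.+ sumV β ≢ d -> A β ≡ 0ℤ

  sh-hom : ∀ k (g : ℕ -> ℤ) s d -> (∀ x -> x N.+ s ≢ d -> g x ≡ 0ℤ) -> ∀ b -> b N.+ s ≢ k N.+ d -> sh k g b ≡ 0ℤ
  sh-hom zero g s d h b ne = h b ne
  sh-hom (suc k) g s d h zero ne = refl
  sh-hom (suc k) g s d h (suc b) ne = sh-hom k g s d h b (\ e -> ne (cong suc e))

  private
    as : ∀ o b s -> o N.+ (b N.+ s) ≡ b N.+ (o N.+ s)
    as o b s = trans (sym (N.+-assoc o b s)) (trans (cong (N._+ s) (N.+-comm o b)) (N.+-assoc b o s))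

  Hom-P : ∀ k {N} {A : V N} o d -> Hom o d A -> Hom o (k N.+ d) (P k A)
  Hom-P k o d h [] ne = refl
  Hom-P k {A = A} o d h (b ∷ β) ne = cong₂ _+_
    (sh-hom k _ (o N.+ sumV β) d (\ x e -> h (x ∷ β) (\ e' -> e (trans (sym (as o x (sumV β))) e'))) b (\ e -> ne (trans (as o b (sumV β)) e)))
    (Hom-P k {A = \ β' -> A (b ∷ β')} (o N.+ b) d (\ β' e -> h (b ∷ β') (\ e' -> e (trans (N.+-assoc o b (sumV β')) e'))) β (\ e -> ne (trans (sym (N.+-assoc o b (sumV β))) e)))

  Hom-Π : ∀ {N} {A : V (suc N)} o d -> Hom o d A -> Hom o (N N.+ d) (Π A)
  Hom-Π {zero} o d h γ ne = h γ ne
  Hom-Π {suc N} {A} o d h (b ∷ c ∷ β) ne = cong₂ _-_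
    (sh-hom 1 (\ c' -> Π (ins c' A) (b ∷ β)) (o N.+ (b N.+ sumV β)) (N N.+ d) (\ c' ne' -> ih c' b (\ e -> ne' (trans (N.+-comm c' _) (trans (shuf₁ o b (sumV β) c') e)))) c
       (\ e -> ne (trans (sym (trans (N.+-comm c _) (shuf₂ o b (sumV β) c))) e)))
    (sh-hom 1 (\ b' -> Π (ins c A) (b' ∷ β)) (o N.+ (c N.+ sumV β)) (N N.+ d) (\ b' ne' -> ih c b' (\ e -> ne' (trans (sym (as o b' (c N.+ sumV β))) (trans (shuf₃ o b' c (sumV β)) e)))) b
       (\ e -> ne (trans (as o b (c N.+ sumV β)) e)))
    where
    shuf₁ : ∀ o b s c -> o N.+ (b N.+ s) N.+ c ≡ (o N.+ c) N.+ (b N.+ s)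
    shuf₁ o b s c = trans (N.+-assoc o (b N.+ s) c) (trans (cong (o N.+_) (N.+-comm (b N.+ s) c)) (sym (N.+-assoc o c (b N.+ s))))
    shuf₃ : ∀ o b c s -> o N.+ (b N.+ (c N.+ s)) ≡ (o N.+ c) N.+ (b N.+ s)
    shuf₃ o b c s = trans (cong (o N.+_) (as b c s)) (sym (N.+-assoc o c (b N.+ s)))
    shuf₂ : ∀ o b s c -> o N.+ (b N.+ s) N.+ c ≡ o N.+ (b N.+ (c N.+ s))
    shuf₂ o b s c = trans (shuf₁ o b s c) (sym (shuf₃ o b c s))
    ih : ∀ c b -> (o N.+ c) N.+ (b N.+ sumV β) ≢ N N.+ d -> Π (ins c A) (b ∷ β) ≡ 0ℤ
    ih c b ne' = Hom-Π {A = ins c A} (o N.+ c) d (\ { (x ∷ γ) ne'' -> h (x ∷ c ∷ γ) (\ e -> ne'' (trans (sym (shuf₃ o x c (sumV γ))) e)) }) (b ∷ β) ne'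

  Hom-e₀ : ∀ {N} {A : V N} d -> Hom 0 d A -> Hom 0 d (e₀ A)
  Hom-e₀ d h (zero ∷ β) ne = h β ne
  Hom-e₀ d h (suc b ∷ β) ne = refl

  δsum : ∀ lo N -> sumV (δ (suc lo) N) ≡ N N.+ sumV (δ lo N)
  δsum lo zero = refl
  δsum lo (suc N) = cong suc (trans (cong (lo N.+_) (δsum (suc lo) N)) (as lo N _))

  tri : ℕ -> ℕ
  tri N = sumV (δ 0 N)

  Hom-van : ∀ {N} -> Hom 0 (tri N) (van {N})
  Hom-van {zero} [] ne = ⊥-elim (ne refl)
  Hom-van {suc N} β ne = Hom-Π {A = e₀ van} 0 (tri N) (Hom-e₀ (tri N) (Hom-van {N})) β (\ e -> ne (trans e (sym (δsum 0 N))))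

  lsumℕ : List ℕ -> ℕ
  lsumℕ []ᴸ = 0
  lsumℕ (k ∷ᴸ λ') = k N.+ lsumℕ λ'

  Hom-alt : ∀ λ' {N} -> Hom 0 (lsumℕ λ' N.+ tri N) (alt λ' {N})
  Hom-alt []ᴸ = Hom-van
  Hom-alt (k ∷ᴸ λ') {N} β ne = Hom-P k 0 _ (Hom-alt λ') β (\ e -> ne (trans e (sym (N.+-assoc k (lsumℕ λ') (tri N)))))

  Q₀ : ℕ -> ℤ
  Q₀ N = qs (δ 0 N)

  -- The only strict vector of sum `tri N` is δ. So the monomials of the Vandermonde product are
  -- permutations of δ, and `qs` is constant on them.
  Q-van : ∀ {N} (γ : Vec ℕ N) -> qs γ * van γ ≡ Q₀ N * van γ
  Q-van {N} γ with sortV γ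
  ... | vanish z = trans (cong (qs γ *_) (z Anti-van)) (trans (*-zeroʳ (qs γ)) (sym (trans (cong (Q₀ N *_) (z Anti-van)) (*-zeroʳ (Q₀ N)))))
  ... | sorted β s sg e q t with sumV β N.≟ tri N
  ... | yes eq = cong (_* van γ) (trans q (cong qs (Str-≡δ 0 β s eq)))
  ... | no ne = trans (cong (qs γ *_) z) (trans (*-zeroʳ (qs γ)) (sym (trans (cong (Q₀ N *_) z) (*-zeroʳ (Q₀ N)))))
    where z : van γ ≡ 0ℤ
          z = trans (e Anti-van) (trans (cong (sg *_) (Hom-van β ne)) (*-zeroʳ sg))

  Inc : ∀ {N} -> V N -> V N
  Inc B [] = 0ℤ
  Inc B (c ∷ γ) = B (suc c ∷ γ) + Inc (\ γ' -> B (c ∷ γ')) γ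

  -- The coefficients of x₀⁰ and x₀¹: stability and branching.

  𝒢-0 : ∀ {N} (A : V (suc N)) β -> 𝒢 A (0 ∷ β) ≡ A (0 ∷ map suc β)
  𝒢-0 A [] = refl
  𝒢-0 A (c ∷ β) = 𝒢-0 (G₁ A c) β

  𝒢-1 : ∀ {N} (A : V (suc N)) β -> 𝒢 A (1 ∷ β) ≡ Inc A (0 ∷ map suc β)
  𝒢-1 A [] = sym (+-identityʳ _)
  𝒢-1 A (c ∷ β) = trans (𝒢-1 (G₁ A c) β) (+-assoc (A (1 ∷ suc c ∷ map suc β)) _ _)

  -- Both sides are the x₀⁰ coefficient of the quotient by the product of the xⱼ - x₀. In that
  -- coefficient a power of x₀ from a power sum cannot occur as long as the indices are positive,
  -- which the form `sucs κ` guarantees. In terms of shapes, a zero part is added.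
  alt-stable : ∀ κ {N} (β : Vec ℕ N) -> alt (sucs κ) (0 ∷ map suc β) ≡ alt (sucs κ) β
  𝒢alt-0 : ∀ κ {N} (β : Vec ℕ N) -> 𝒢 (alt (sucs κ)) (0 ∷ β) ≡ alt (sucs κ) β
  𝒢alt-0 []ᴸ β = 𝒢Π (e₀ van) (0 ∷ β)
  𝒢alt-0 (m ∷ᴸ κ) β = trans (𝒢P (suc m) (alt (sucs κ)) (Anti⇒Z (Anti-alt (sucs κ))) (0 ∷ β)) (trans (+-identityˡ _) (P-cong (suc m) (𝒢alt-0 κ) β))
  alt-stable κ β = trans (sym (𝒢-0 (alt (sucs κ)) β)) (𝒢alt-0 κ β)

  -- The derivative with respect to p₁; parts are stored as predecessors, so `zero` is the part 1.
  del₁ : List ℕ -> ∀ {N} -> V N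
  del₁ []ᴸ β = 0ℤ
  del₁ (zero ∷ᴸ κ) β = alt (sucs κ) β + P 1 (del₁ κ) β
  del₁ (suc m ∷ᴸ κ) β = P (suc (suc m)) (del₁ κ) β

  𝒢alt-1 : ∀ κ {N} (β : Vec ℕ N) -> 𝒢 (alt (sucs κ)) (1 ∷ β) ≡ del₁ κ β
  𝒢alt-1 []ᴸ β = 𝒢Π (e₀ van) (1 ∷ β)
  𝒢alt-1 (zero ∷ᴸ κ) β = trans (𝒢P 1 (alt (sucs κ)) (Anti⇒Z (Anti-alt (sucs κ))) (1 ∷ β)) (cong₂ _+_ (𝒢alt-0 κ β) (P-cong 1 (𝒢alt-1 κ) β))
  𝒢alt-1 (suc m ∷ᴸ κ) β = trans (𝒢P (suc (suc m)) (alt (sucs κ)) (Anti⇒Z (Anti-alt (sucs κ))) (1 ∷ β)) (trans (+-identityˡ _) (P-cong (suc (suc m)) (𝒢alt-1 κ) β))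

  -- Adding a box: the branching rule dual to deleting a fixed point.
  Inc-alt : ∀ κ {N} (β : Vec ℕ N) -> Inc (alt (sucs κ)) (0 ∷ map suc β) ≡ del₁ κ β
  Inc-alt κ β = trans (sym (𝒢-1 (alt (sucs κ)) β)) (𝒢alt-1 κ β)

open Alternants

open import Data.Integer using (ℤ; -[1+_]; _+_; _*_; _-_; -_; 0ℤ; 1ℤ) renaming (+_ to pos)
open import Data.Integer.Properties using (+-identityˡ; +-identityʳ; +-comm; +-assoc; *-zeroʳ; *-distribˡ-+)
open import Data.Integer.Tactic.RingSolver using (solve-∀)
open import Data.Vec using (Vec)
open import Data.List using ([]; _++_; map; length; concatMap; allFin; foldr)
import Data.List.Properties as Lₚ
open import Data.List.Membership.Propositional using (_∈_; _∉_)
open import Data.List.Membership.Propositional.Properties using (∈-++⁺ˡ; ∈-++⁺ʳ; ∈-++⁻; ∈-allFin; ∈-∃++)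
open import Data.List.Relation.Unary.Any using (here; there)
open import Data.List.Relation.Unary.All as All using (All; []; _∷_)
import Data.List.Relation.Unary.All.Properties as Allₚ
open import Data.List.Relation.Unary.AllPairs using ([]; _∷_)
open import Data.List.Relation.Unary.Unique.Propositional using (Unique)
open import Data.List.Relation.Unary.Unique.Propositional.Properties using (allFin⁺)
open import Data.List.Relation.Binary.Permutation.Propositional as ↭ using (_↭_; ↭-refl; ↭-sym; ↭-trans; ↭-reflexive)
import Data.List.Relation.Binary.Permutation.Propositional.Properties as ↭ₚ
open import Data.Fin as Fin using (Fin; punchIn)
import Data.Fin.Properties as Finₚ
open import Data.Fin.Permutation using (inverseˡ; inverseʳ; transpose; remove; lift₀; lift₀-remove; punchIn-permute; flip; _≈_; insert; insert-remove; remove-insert) renaming (_∘ₚ_ to _⨾_; Permutation′ to Sym; _⟨$⟩ʳ_ to _▸_; _⟨$⟩ˡ_ to _◂_)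
import Data.Fin.Permutation.Components as PC
open import Data.Product using (_,_; ∃-syntax; Σ-syntax) renaming (proj₁ to fst; proj₂ to snd)
open import Data.Sum using (inj₁; inj₂)
open import Data.Empty using (⊥; ⊥-elim)
open import Function using (_∘_; id)
open import Relation.Nullary using (yes; no; ¬_)
open import Relation.Binary.PropositionalEquality using (_≡_; _≢_; _≗_; refl; sym; trans; cong; cong₂; subst; module ≡-Reasoning)
open ≡-Reasoning
open import Relation.Nullary using (Dec)
import Data.Vec as Vec
import Data.Vec.Properties as Vecₚ
open import Data.Unit using (⊤; tt)
open import Data.List using (upTo; filterᵇ; reverse)
open import Data.Fin using (_↑ˡ_; _↑ʳ_; splitAt) renaming (join to joinF)
import Data.Fin.Permutation as Perm
import Data.Sum as Sum
open import Data.List.Membership.Propositional using (find; lose)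
open import Data.List.Membership.Propositional.Properties using (∈-map⁺; ∈-map⁻; ∈-concatMap⁺; ∈-concatMap⁻; ∈-upTo⁺; ∈-upTo⁻; ∈-filter⁺; ∈-filter⁻)
import Data.List.Relation.Unary.Unique.Propositional.Properties as Uₚ
open import Data.Bool using (Bool; true; false; T; not; if_then_else_; _∨_; _∧_)
open import Data.Bool.Properties using (T?)
open import Relation.Binary.Definitions using (Tri; tri<; tri≈; tri>)

-- Cycles of permutations

∑ : {A : Set} -> List A -> (A -> ℤ) -> ℤ
∑ [] f = 0ℤ
∑ (x ∷ xs) f = f x + ∑ xs f

module _ {A : Set} where
  ∑-cong-∈ : ∀ (xs : List A) {f g : A -> ℤ} -> (∀ {x} -> x ∈ xs -> f x ≡ g x) -> ∑ xs f ≡ ∑ xs g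
  ∑-cong-∈ [] e = refl
  ∑-cong-∈ (x ∷ xs) e = cong₂ _+_ (e (here refl)) (∑-cong-∈ xs (e ∘ there))

  ∑-cong : ∀ (xs : List A) {f g : A -> ℤ} -> (∀ x -> f x ≡ g x) -> ∑ xs f ≡ ∑ xs g
  ∑-cong xs e = ∑-cong-∈ xs (\ {x} _ -> e x)

  ∑-++ : ∀ (xs ys : List A) f -> ∑ (xs ++ ys) f ≡ ∑ xs f + ∑ ys f
  ∑-++ [] ys f = sym (+-identityˡ _)
  ∑-++ (x ∷ xs) ys f = trans (cong (f x +_) (∑-++ xs ys f)) (sym (+-assoc (f x) _ _))

  ∑-↭ : ∀ {xs ys : List A} -> xs ↭ ys -> ∀ f -> ∑ xs f ≡ ∑ ys f
  ∑-↭ ↭.refl f = refl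
  ∑-↭ (↭.prep x p) f = cong (f x +_) (∑-↭ p f)
  ∑-↭ (↭.swap x y p) f = trans (sym (+-assoc (f x) (f y) _)) (trans (cong₂ _+_ (+-comm (f x) (f y)) (∑-↭ p f)) (+-assoc (f y) (f x) _))
  ∑-↭ (↭.trans p q) f = trans (∑-↭ p f) (∑-↭ q f)

  ∑-+ : ∀ (xs : List A) f g -> ∑ xs (\ x -> f x + g x) ≡ ∑ xs f + ∑ xs g
  ∑-+ [] f g = refl
  ∑-+ (x ∷ xs) f g = trans (cong (f x + g x +_) (∑-+ xs f g)) (+-swap (f x) (g x) _ _)

  ∑-* : ∀ (xs : List A) c f -> ∑ xs (\ x -> c * f x) ≡ c * ∑ xs f
  ∑-* [] c f = sym (*-zeroʳ c)
  ∑-* (x ∷ xs) c f = trans (cong (c * f x +_) (∑-* xs c f)) (sym (*-distribˡ-+ c _ _))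

  ∑-0 : ∀ (xs : List A) -> ∑ xs (\ _ -> 0ℤ) ≡ 0ℤ
  ∑-0 [] = refl
  ∑-0 (x ∷ xs) = trans (+-identityˡ _) (∑-0 xs)

  ∑-const : ∀ (xs : List A) c -> ∑ xs (\ _ -> c) ≡ pos (length xs) * c
  ∑-const [] c = refl
  ∑-const (x ∷ xs) c = trans (cong (c +_) (∑-const xs c)) (r (pos (length xs)) c)
    where r : ∀ n c -> c + n * c ≡ (1ℤ + n) * c
          r = solve-∀

∑-map : ∀ {A B : Set} (h : A -> B) xs f -> ∑ (map h xs) f ≡ ∑ xs (f ∘ h)
∑-map h [] f = refl
∑-map h (x ∷ xs) f = cong (f (h x) +_) (∑-map h xs f)

∑-swap : ∀ {A B : Set} (xs : List A) (ys : List B) (f : A -> B -> ℤ) -> ∑ xs (\ x -> ∑ ys (f x)) ≡ ∑ ys (\ y -> ∑ xs (\ x -> f x y))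
∑-swap [] ys f = sym (∑-0 ys)
∑-swap (x ∷ xs) ys f = trans (cong (∑ ys (f x) +_) (∑-swap xs ys f)) (sym (∑-+ ys (f x) _))

Unique-↭ : ∀ {A : Set} {xs ys : List A} -> xs ↭ ys -> Unique xs -> Unique ys
Unique-↭ ↭.refl u = u
Unique-↭ (↭.prep x p) (a ∷ u) = ↭ₚ.All-resp-↭ p a ∷ Unique-↭ p u
Unique-↭ (↭.swap x y p) ((x≢y ∷ a) ∷ (b ∷ u)) = ((x≢y ∘ sym) ∷ ↭ₚ.All-resp-↭ p b) ∷ (↭ₚ.All-resp-↭ p a ∷ Unique-↭ p u)
Unique-↭ (↭.trans p q) u = Unique-↭ q (Unique-↭ p u)

module _ {n : ℕ} where

  Cy : Set
  Cy = Fin n × List (Fin n)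

  toL : Cy -> List (Fin n)
  toL (x , u) = x ∷ u

  supp : List Cy -> List (Fin n)
  supp = concatMap toL

  lens : List Cy -> List ℕ
  lens = map (length ∘ snd)

  Path : (Fin n -> Fin n) -> Fin n -> List (Fin n) -> Fin n -> Set
  Path ρ x [] y = ρ x ≡ y
  Path ρ x (z ∷ zs) y = ρ x ≡ z × Path ρ z zs y

  IsCy : (Fin n -> Fin n) -> Cy -> Set
  IsCy ρ (x , u) = Path ρ x u x

  CycD : (Fin n -> Fin n) -> List Cy -> Set
  CycD ρ cs = All (IsCy ρ) cs × supp cs ↭ allFin n

  path-++⁻ : ∀ ρ x u y v z -> Path ρ x (u ++ y ∷ v) z -> Path ρ x u y × Path ρ y v z
  path-++⁻ ρ x [] y v z (e , p) = e , p
  path-++⁻ ρ x (a ∷ u) y v z (e , p) = let (q , r) = path-++⁻ ρ a u y v z p in (e , q) , r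

  path-++⁺ : ∀ ρ x u y v z -> Path ρ x u y -> Path ρ y v z -> Path ρ x (u ++ y ∷ v) z
  path-++⁺ ρ x [] y v z e q = e , q
  path-++⁺ ρ x (a ∷ u) y v z (e , p) q = e , path-++⁺ ρ a u y v z p q

  path-shift : ∀ {ρ ρ' : Fin n -> Fin n} {x x'} u {y} -> ρ' x' ≡ ρ x -> (∀ {s} -> s ∈ u -> ρ' s ≡ ρ s) -> Path ρ x u y -> Path ρ' x' u y
  path-shift [] e h p = trans e p
  path-shift (z ∷ u) e h (q , p) = trans e q , path-shift u (h (here refl)) (h ∘ there) p

  cyc-agree : ∀ {ρ ρ' : Fin n -> Fin n} cs -> (∀ {s} -> s ∈ supp cs -> ρ' s ≡ ρ s) -> All (IsCy ρ) cs -> All (IsCy ρ') cs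
  cyc-agree [] h [] = []
  cyc-agree ((x , u) ∷ cs) h (p ∷ ps) = path-shift u (h (here refl)) (\ m -> h (there (∈-++⁺ˡ m))) p ∷ cyc-agree cs (\ m -> h (∈-++⁺ʳ (x ∷ u) m)) ps

  -- A decomposition that lists the cycle of x first and starts it at x. The data needed elsewhere,
  -- points and lengths, are compared only up to permutation.
  record Focus (ρ : Fin n -> Fin n) (cs : List Cy) (x : Fin n) : Set where
    constructor focus
    field
      u : List (Fin n)
      rest : List Cy
      cyc : All (IsCy ρ) ((x , u) ∷ rest)
      sup : supp cs ↭ supp ((x , u) ∷ rest)
      len : lens cs ↭ length u ∷ lens rest

  rot : ∀ {ρ z w x} -> Path ρ z w z -> x ∈ z ∷ w -> ∃[ u ] (Path ρ x u x × (z ∷ w ↭ x ∷ u) × (length w ≡ length u))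
  rot {w = w} p (here refl) = w , p , ↭-refl , refl
  rot {ρ} {z} {x = x} p (there m) with ∈-∃++ m
  ... | w₁ , w₂ , refl = let (p₁ , p₂) = path-++⁻ ρ z w₁ x w₂ z p in
      w₂ ++ z ∷ w₁ , path-++⁺ ρ x w₂ z w₁ x p₂ p₁ , ↭ₚ.++-comm (z ∷ w₁) (x ∷ w₂) ,
      trans (Lₚ.length-++ w₁) (trans (N.+-suc (length w₁) (length w₂)) (trans (cong suc (N.+-comm (length w₁) (length w₂)))
        (trans (sym (N.+-suc (length w₂) (length w₁))) (sym (Lₚ.length-++ w₂)))))

  getFocus : ∀ {ρ} cs {x} -> All (IsCy ρ) cs -> x ∈ supp cs -> Focus ρ cs x
  getFocus ((z , w) ∷ cs) (p ∷ ps) m with ∈-++⁻ (z ∷ w) m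
  ... | inj₁ m' = let (u , q , pm , l) = rot p m' in focus u cs (q ∷ ps) (↭ₚ.++⁺ʳ (supp cs) pm) (↭-reflexive (cong (_∷ lens cs) l))
  ... | inj₂ m' with getFocus cs ps m'
  ... | focus u rest (q ∷ qs) s l = focus u ((z , w) ∷ rest) (q ∷ p ∷ qs)
            (↭-trans (↭ₚ.++⁺ˡ (z ∷ w) s) (↭ₚ.shifts (z ∷ w) (_ ∷ u)))
            (↭-trans (↭.prep (length w) l) (↭.swap (length w) (length u) ↭-refl))

  swp : Fin n -> Fin n -> Fin n -> Fin n
  swp = PC.transpose

  swp-ˡ : ∀ x y -> swp x y x ≡ y
  swp-ˡ x y with x Finₚ.≟ x
  ... | yes _ = refl
  ... | no ne = ⊥-elim (ne refl)

  swp-ʳ : ∀ x y -> swp x y y ≡ x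
  swp-ʳ x y with y Finₚ.≟ x
  ... | yes e = e
  ... | no _ with y Finₚ.≟ y
  ... | yes _ = refl
  ... | no ne = ⊥-elim (ne refl)

  swp-≢ : ∀ x y {s} -> x ≢ s -> y ≢ s -> swp x y s ≡ s
  swp-≢ x y {s} nx ny with s Finₚ.≟ x
  ... | yes e = ⊥-elim (nx (sym e))
  ... | no _ with s Finₚ.≟ y
  ... | yes e = ⊥-elim (ny (sym e))
  ... | no _ = refl

  swp-id : ∀ x s -> swp x x s ≡ s
  swp-id x s with s Finₚ.≟ x
  ... | yes e = sym e
  ... | no _ with s Finₚ.≟ x
  ... | yes e = sym e
  ... | no _ = refl

  CycD-resp : ∀ {ρ ρ'} -> ρ' ≗ ρ -> ∀ {cs} -> CycD ρ cs -> CycD ρ' cs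
  CycD-resp e {cs} (a , s) = cyc-agree cs (\ {s} _ -> e s) a , s

  private
    uniq : ∀ {xs} -> xs ↭ allFin n -> Unique xs
    uniq p = Unique-↭ (↭-sym p) (allFin⁺ n)

    mv : ∀ (x y : Fin n) u₁ u₂ R -> (x ∷ u₁ ++ y ∷ u₂) ++ R ↭ x ∷ y ∷ (u₁ ++ u₂ ++ R)
    mv x y u₁ u₂ R = ↭.prep x (↭-trans (↭-reflexive (Lₚ.++-assoc u₁ (y ∷ u₂) R)) (↭ₚ.shift y u₁ (u₂ ++ R)))

  module Swap (ρ : Fin n -> Fin n) (x y : Fin n) where
    ρ' : Fin n -> Fin n
    ρ' s = ρ (swp x y s)

    agree : ∀ {xs} -> Unique (x ∷ y ∷ xs) -> ∀ {s} -> s ∈ xs -> ρ' s ≡ ρ s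
    agree ((_ ∷ a) ∷ (b ∷ _)) m = cong ρ (swp-≢ x y (All.lookup a m) (All.lookup b m))

    -- After composition with the transposition, x has the old image of y and conversely. So the
    -- path from x follows the second arc back to x, and the path from y follows the first arc back
    -- to y.
    cut : ∀ u₁ u₂ rest -> CycD ρ ((x , u₁ ++ y ∷ u₂) ∷ rest) -> CycD ρ' ((x , u₂) ∷ (y , u₁) ∷ rest)
    cut u₁ u₂ rest (p ∷ ps , s) =
        (path-shift u₂ (cong ρ (swp-ˡ x y)) (\ m -> ag (∈-++⁺ʳ u₁ (∈-++⁺ˡ m))) p₂
       ∷ path-shift u₁ (cong ρ (swp-ʳ x y)) (\ m -> ag (∈-++⁺ˡ m)) p₁
       ∷ cyc-agree rest (\ m -> ag (∈-++⁺ʳ u₁ (∈-++⁺ʳ u₂ m))) ps)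
      , ↭-trans (↭.prep x (↭-trans (↭ₚ.shift y u₂ (u₁ ++ supp rest)) (↭.prep y (↭ₚ.shifts u₂ u₁)))) (↭-trans (↭-sym (mv x y u₁ u₂ (supp rest))) s)
      where
      pp = path-++⁻ ρ x u₁ y u₂ x p
      p₁ = fst pp
      p₂ = snd pp
      ag = agree (uniq (↭-trans (↭-sym (mv x y u₁ u₂ (supp rest))) s))

    merge : ∀ u w rest -> CycD ρ ((x , u) ∷ (y , w) ∷ rest) -> CycD ρ' ((x , w ++ y ∷ u) ∷ rest)
    merge u w rest (p ∷ q ∷ ps , s) =
        (path-++⁺ ρ' x w y u x (path-shift w (cong ρ (swp-ˡ x y)) (\ m -> ag (∈-++⁺ʳ u (∈-++⁺ˡ m))) q)
                               (path-shift u (cong ρ (swp-ʳ x y)) (\ m -> ag (∈-++⁺ˡ m)) p)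
       ∷ cyc-agree rest (\ m -> ag (∈-++⁺ʳ u (∈-++⁺ʳ w m))) ps)
      , ↭-trans (mv x y w u (supp rest)) (↭-trans (↭.prep x (↭.prep y (↭ₚ.shifts w u))) (↭-trans (↭-sym r) s))
      where
      r : supp ((x , u) ∷ (y , w) ∷ rest) ↭ x ∷ y ∷ (u ++ w ++ supp rest)
      r = ↭.prep x (↭ₚ.shift y u (w ++ supp rest))
      ag = agree (uniq (↭-trans (↭-sym r) s))

  swapCyc : ∀ {ρ cs} -> CycD ρ cs -> ∀ x y -> ∃[ cs' ] CycD (\ s -> ρ (swp x y s)) cs'
  swapCyc {ρ} {cs} (a , s) x y with x Finₚ.≟ y
  ... | yes refl = cs , CycD-resp (\ s -> cong ρ (swp-id x s)) (a , s)
  ... | no x≢y with getFocus cs a (↭ₚ.∈-resp-↭ (↭-sym s) (∈-allFin x))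
  ... | focus u rest (p ∷ ps) s₁ _ with ∈-++⁻ (x ∷ u) (↭ₚ.∈-resp-↭ (↭-trans (↭-sym s) s₁) (∈-allFin y))
  ... | inj₁ (here e) = ⊥-elim (x≢y (sym e))
  ... | inj₁ (there m) with ∈-∃++ m
  ... | u₁ , u₂ , refl = _ , Swap.cut ρ x y u₁ u₂ rest (p ∷ ps , ↭-trans (↭-sym s₁) s)
  swapCyc {ρ} {cs} (a , s) x y | no x≢y | focus u rest (p ∷ ps) s₁ _ | inj₂ m with getFocus rest ps m
  ... | focus w rest' (q ∷ qs) s₂ _ = _ , Swap.merge ρ x y u w rest' (p ∷ q ∷ qs , ↭-trans (↭ₚ.++⁺ˡ (x ∷ u) (↭-sym s₂)) (↭-trans (↭-sym s₁) s))

  path-unique : ∀ {ρ x y} u u' -> Path ρ y u x -> Path ρ y u' x -> x ∉ u -> x ∉ u' -> u ≡ u'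
  path-unique [] [] p q _ _ = refl
  path-unique [] (z ∷ u') p (e , q) _ n' = ⊥-elim (n' (here (trans (sym p) e)))
  path-unique (z ∷ u) [] (e , p) q n _ = ⊥-elim (n (here (trans (sym q) e)))
  path-unique (z ∷ u) (z' ∷ u') (e , p) (e' , q) n n' with trans (sym e) e'
  ... | refl = cong (z ∷_) (path-unique u u' p q (n ∘ there) (n' ∘ there))

  private
    head∉ : ∀ {x : Fin n} {u R} -> Unique (x ∷ u ++ R) -> x ∉ u
    head∉ (a ∷ _) m = All.lookup a (∈-++⁺ˡ m) refl
    cancel : ∀ (u : List (Fin n)) {xs ys} -> u ++ xs ↭ u ++ ys -> xs ↭ ys
    cancel [] p = p
    cancel (x ∷ u) p = cancel u (↭ₚ.drop-∷ p)
    Unique-drop : ∀ (u : List (Fin n)) {xs} -> Unique (u ++ xs) -> Unique xs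
    Unique-drop [] p = p
    Unique-drop (x ∷ u) (_ ∷ p) = Unique-drop u p

  -- The second decomposition is rotated to the base point of the first cycle. The two cycles
  -- through that point are then equal by `path-unique` and can be cancelled.
  type-unique : ∀ {ρ} cs cs' -> All (IsCy ρ) cs -> All (IsCy ρ) cs' -> supp cs ↭ supp cs' -> Unique (supp cs) -> lens cs ↭ lens cs'
  type-unique [] [] _ _ _ _ = ↭-refl
  type-unique [] ((z , w) ∷ cs') _ _ s _ with ↭ₚ.↭-empty-inv (↭-sym s)
  ... | ()
  type-unique ((x , u) ∷ cs) cs' (p ∷ ps) qs s un with getFocus cs' qs (↭ₚ.∈-resp-↭ s (here refl))
  ... | focus u' rest (q ∷ qs') s' l with path-unique u u' p q (head∉ un) (head∉ (Unique-↭ (↭-trans s s') un))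
  ... | refl = ↭-trans (↭.prep (length u) (type-unique cs rest ps qs' (cancel (x ∷ u) (↭-trans s s')) (Unique-drop (x ∷ u) un))) (↭-sym l)

  CycD-unique : ∀ {ρ cs cs'} -> CycD ρ cs -> CycD ρ cs' -> lens cs ↭ lens cs'
  CycD-unique {cs = cs} {cs'} (a , s) (a' , s') = type-unique cs cs' a a' (↭-trans s (↭-sym s')) (uniq s)

mapC : ∀ {m n} -> (Fin m -> Fin n) -> Cy {m} -> Cy {n}
mapC h (x , u) = h x , map h u

lens-mapC : ∀ {m n} (h : Fin m -> Fin n) cs -> lens (map (mapC h) cs) ≡ lens cs
lens-mapC h [] = refl
lens-mapC h ((x , u) ∷ cs) = cong₂ _∷_ (Lₚ.length-map h u) (lens-mapC h cs)

supp-mapC : ∀ {m n} (h : Fin m -> Fin n) cs -> supp (map (mapC h) cs) ≡ map h (supp cs)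
supp-mapC h [] = refl
supp-mapC h ((x , u) ∷ cs) = cong (h x ∷_) (trans (cong (map h u ++_) (supp-mapC h cs)) (sym (Lₚ.map-++ h u (supp cs))))

path-map : ∀ {m n} (h : Fin m -> Fin n) {ρ σ} -> (∀ x -> σ (h x) ≡ h (ρ x)) -> ∀ x u y -> Path ρ x u y -> Path σ (h x) (map h u) (h y)
path-map h e x [] y p = trans (e x) (cong h p)
path-map h e x (z ∷ u) y (q , p) = trans (e x) (cong h q) , path-map h e z u y p

cyc-map : ∀ {m n} (h : Fin m -> Fin n) {ρ σ} -> (∀ x -> σ (h x) ≡ h (ρ x)) -> ∀ cs -> All (IsCy ρ) cs -> All (IsCy σ) (map (mapC h) cs)
cyc-map h e [] [] = []
cyc-map h e ((x , u) ∷ cs) (p ∷ ps) = path-map h e x u x p ∷ cyc-map h e cs ps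

allFin-suc : ∀ n -> allFin (suc n) ≡ Fin.zero ∷ map Fin.suc (allFin n)
allFin-suc n = cong (Fin.zero ∷_) (sym (Lₚ.map-tabulate id Fin.suc))

punchIn-allFin : ∀ {n} (i : Fin (suc n)) -> i ∷ map (punchIn i) (allFin n) ↭ allFin (suc n)
punchIn-allFin {n} Fin.zero = ↭-reflexive (sym (allFin-suc n))
punchIn-allFin {suc n} (Fin.suc i) = ↭-trans
  (↭-reflexive (cong (\ t -> Fin.suc i ∷ map (punchIn (Fin.suc i)) t) (allFin-suc n)))
  (↭-trans (↭.swap (Fin.suc i) Fin.zero (↭-reflexive (trans (sym (Lₚ.map-∘ (allFin n))) (Lₚ.map-∘ (allFin n)))))
  (↭-trans (↭.prep Fin.zero (↭ₚ.map⁺ Fin.suc (punchIn-allFin i))) (↭-reflexive (sym (allFin-suc (suc n))))))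

-- Exchanging 0 with its preimage makes 0 a fixed point. The rest is decomposed by induction, and
-- `swapCyc` undoes the exchange.
cycles : ∀ {n} (ρ : Sym n) -> ∃[ cs ] CycD (ρ ▸_) cs
cycles {zero} ρ = [] , [] , ↭-refl
cycles {suc n} ρ = let (cs , a , s) = cycles (remove Fin.zero ρ₁)
                       c₁ : CycD (ρ₁ ▸_) ((Fin.zero , []) ∷ map (mapC Fin.suc) cs)
                       c₁ = ρ₁0 ∷ cyc-map Fin.suc (\ z -> sym (lift₀-remove ρ₁ ρ₁0 (Fin.suc z))) cs a
                          , ↭-trans (↭.prep Fin.zero (↭-trans (↭-reflexive (supp-mapC Fin.suc cs)) (↭ₚ.map⁺ Fin.suc s))) (↭-reflexive (sym (allFin-suc n)))
                       (cs' , c') = swapCyc c₁ Fin.zero x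
                   in cs' , CycD-resp (\ z -> cong (ρ ▸_) (sym (inv z))) c'
  where
  x = ρ ◂ Fin.zero
  ρ₁ = transpose Fin.zero x ⨾ ρ
  ρ₁0 : ρ₁ ▸ Fin.zero ≡ Fin.zero
  ρ₁0 = trans (cong (ρ ▸_) (swp-ˡ Fin.zero x)) (inverseʳ ρ)
  inv : ∀ z -> swp Fin.zero x (swp Fin.zero x z) ≡ z
  inv z with z Finₚ.≟ Fin.zero
  ... | yes refl = swp-ʳ Fin.zero x
  ... | no nz with z Finₚ.≟ x
  ... | yes refl = refl
  ... | no nx = swp-≢ Fin.zero x (nz ∘ sym) (nx ∘ sym)

-- Characters of the symmetric group

𝟙 : {P : Set} -> Dec P -> ℤ
𝟙 (yes _) = 1ℤ
𝟙 (no _) = 0ℤ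

𝟙-yes : {P : Set} (d : Dec P) -> P -> 𝟙 d ≡ 1ℤ
𝟙-yes (yes _) p = refl
𝟙-yes (no np) p = ⊥-elim (np p)

𝟙-no : {P : Set} (d : Dec P) -> ¬ P -> 𝟙 d ≡ 0ℤ
𝟙-no (yes p) np = ⊥-elim (np p)
𝟙-no (no _) np = refl

𝟙-⇔ : {P Q : Set} (d : Dec P) (e : Dec Q) -> (P -> Q) -> (Q -> P) -> 𝟙 d ≡ 𝟙 e
𝟙-⇔ (yes p) e f g = sym (𝟙-yes e (f p))
𝟙-⇔ (no np) e f g = sym (𝟙-no e (np ∘ g))

↭-from-⊆ : ∀ {A : Set} (xs ys : List A) -> Unique xs -> Unique ys -> (∀ {x} -> x ∈ xs -> x ∈ ys) -> (∀ {x} -> x ∈ ys -> x ∈ xs) -> xs ↭ ys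
↭-from-⊆ [] [] _ _ _ _ = ↭-refl
↭-from-⊆ [] (y ∷ ys) _ _ f g with g (here refl)
... | ()
↭-from-⊆ (x ∷ xs) ys (a ∷ u) v f g with ∈-∃++ (f (here refl))
... | ys₁ , ys₂ , refl with Unique-↭ (↭ₚ.shift x ys₁ ys₂) v
... | b ∷ v' = ↭-trans (↭.prep x (↭-from-⊆ xs (ys₁ ++ ys₂) u v' f' g')) (↭-sym (↭ₚ.shift x ys₁ ys₂))
  where
  f' : ∀ {z} -> z ∈ xs -> z ∈ ys₁ ++ ys₂
  f' m with ↭ₚ.∈-resp-↭ (↭ₚ.shift x ys₁ ys₂) (f (there m))
  ... | here refl = ⊥-elim (All.lookup a m refl)
  ... | there m' = m'
  g' : ∀ {z} -> z ∈ ys₁ ++ ys₂ -> z ∈ xs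
  g' m with g (↭ₚ.∈-resp-↭ (↭-sym (↭ₚ.shift x ys₁ ys₂)) (there m))
  ... | here refl = ⊥-elim (All.lookup b m refl)
  ... | there m' = m'

perm-allFin : ∀ {n} (h : Sym n) -> map (h ▸_) (allFin n) ↭ allFin n
perm-allFin {n} h = ↭-from-⊆ _ _ (map⁺ inj (allFin⁺ n)) (allFin⁺ n) (\ {x} _ -> ∈-allFin x)
  (\ {x} _ -> subst (_∈ map (h ▸_) (allFin n)) (inverseʳ h) (∈-map⁺ (h ▸_) (∈-allFin (h ◂ x))))
  where
  open import Data.List.Relation.Unary.Unique.Propositional.Properties using (map⁺)
  open import Data.List.Membership.Propositional.Properties using (∈-map⁺)
  inj : ∀ {x y} -> h ▸ x ≡ h ▸ y -> x ≡ y
  inj e = trans (sym (inverseˡ h)) (trans (cong (h ◂_) e) (inverseˡ h))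

alt-↭ : ∀ {κ κ'} -> κ ↭ κ' -> ∀ {N} (β : Vec ℕ N) -> alt (sucs κ) β ≡ alt (sucs κ') β
alt-↭ ↭.refl β = refl
alt-↭ (↭.prep x p) β = P-cong (suc x) (alt-↭ p) β
alt-↭ (↭.swap {xs} {ys} x y p) β = trans (P-comm (suc x) (suc y) (alt (sucs xs)) β) (P-cong (suc y) (P-cong (suc x) (alt-↭ p)) β)
alt-↭ (↭.trans p q) β = trans (alt-↭ p β) (alt-↭ q β)

typ : ∀ {n} -> Sym n -> List ℕ
typ ρ = lens (fst (cycles ρ))

-- The character value at ρ, as a function of the exponent vector β = ν + δ.
ch : ∀ {n} -> Sym n -> ∀ {N} -> V N
ch ρ = alt (sucs (typ ρ))

typ-cyc : ∀ {n} (ρ : Sym n) {cs} -> CycD (ρ ▸_) cs -> typ ρ ↭ lens cs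
typ-cyc ρ c = CycD-unique (snd (cycles ρ)) c

ch-cyc : ∀ {n} (ρ : Sym n) {cs} -> CycD (ρ ▸_) cs -> ∀ {N} (β : Vec ℕ N) -> ch ρ β ≡ alt (sucs (lens cs)) β
ch-cyc ρ c = alt-↭ (typ-cyc ρ c)

typ-≈ : ∀ {n} {ρ σ : Sym n} -> ρ ≈ σ -> typ ρ ↭ typ σ
typ-≈ {ρ = ρ} {σ} e = typ-cyc ρ (CycD-resp e (snd (cycles σ)))

ch-≈ : ∀ {n} {ρ σ : Sym n} -> ρ ≈ σ -> ∀ {N} (β : Vec ℕ N) -> ch ρ β ≡ ch σ β
ch-≈ {ρ = ρ} {σ} e = alt-↭ (typ-≈ {ρ = ρ} {σ} e)

typ-conj : ∀ {n} (ρ σ h : Sym n) -> (∀ x -> σ ▸ (h ▸ x) ≡ h ▸ (ρ ▸ x)) -> typ σ ↭ typ ρ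
typ-conj ρ σ h e = let (cs , a , s) = cycles ρ in
  ↭-trans (typ-cyc σ {map (mapC (h ▸_)) cs} (cyc-map (h ▸_) e cs a
    , ↭-trans (↭-reflexive (supp-mapC (h ▸_) cs)) (↭-trans (↭ₚ.map⁺ (h ▸_) s) (perm-allFin h))))
  (↭-reflexive (lens-mapC (h ▸_) cs))

ch-conj : ∀ {n} (ρ σ h : Sym n) -> (∀ x -> σ ▸ (h ▸ x) ≡ h ▸ (ρ ▸ x)) -> ∀ {N} (β : Vec ℕ N) -> ch σ β ≡ ch ρ β
ch-conj ρ σ h e = alt-↭ (typ-conj ρ σ h e)

sel : List ℕ -> List (ℕ × List ℕ)
sel [] = []
sel (m ∷ κ) = (m , κ) ∷ map (\ { (m' , κ') -> m' , m ∷ κ' }) (sel κ)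

-- H is constant on each cycle, so a sum over points becomes a sum over parts weighted by their
-- lengths. The hypothesis is stated for any order of cycles and any base point, because rotation
-- and reordering are what the induction produces.
sum-sel : ∀ {n} {ρ : Fin n -> Fin n} (cs : List (Cy {n})) (H : Fin n -> ℤ) (G : ℕ -> List ℕ -> ℤ) -> All (IsCy ρ) cs ->
  (∀ x u rest -> All (IsCy ρ) ((x , u) ∷ rest) -> supp ((x , u) ∷ rest) ↭ supp cs -> H x ≡ G (length u) (lens rest)) ->
  ∑ (supp cs) H ≡ ∑ (sel (lens cs)) (\ { (m , κ) -> pos (suc m) * G m κ })
sum-sel [] H G _ h = refl
sum-sel {ρ = ρ} ((z , w) ∷ cs) H G (p ∷ ps) h = begin
  ∑ ((z ∷ w) ++ supp cs) H ≡⟨ ∑-++ (z ∷ w) (supp cs) H ⟩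
  ∑ (z ∷ w) H + ∑ (supp cs) H ≡⟨ cong₂ _+_
    (trans (∑-cong-∈ (z ∷ w) {g = \ _ -> G (length w) (lens cs)} first) (∑-const (z ∷ w) (G (length w) (lens cs))))
    (trans (sum-sel cs H (\ m κ -> G m (length w ∷ κ)) ps second) (sym (∑-map (\ { (m' , κ') -> m' , length w ∷ κ' }) (sel (lens cs)) (\ { (m , κ) -> pos (suc m) * G m κ })))) ⟩
  ∑ (sel (lens ((z , w) ∷ cs))) (\ { (m , κ) -> pos (suc m) * G m κ }) ∎
  where
  first : ∀ {x} -> x ∈ z ∷ w -> H x ≡ G (length w) (lens cs)
  first m = let (u , q , pm , l) = rot p m in trans (h _ u cs (q ∷ ps) (↭ₚ.++⁺ʳ (supp cs) (↭-sym pm))) (cong (\ t -> G t (lens cs)) (sym l))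
  second : ∀ x u rest -> All (IsCy ρ) ((x , u) ∷ rest) -> supp ((x , u) ∷ rest) ↭ supp cs -> H x ≡ G (length u) (length w ∷ lens rest)
  second x u rest (q ∷ qs) s = h x u ((z , w) ∷ rest) (q ∷ p ∷ qs) (↭-trans (↭ₚ.shifts (x ∷ u) (z ∷ w)) (↭ₚ.++⁺ˡ (z ∷ w) s))

l-∑ : ∀ {N M} {L : V N -> V M} -> Lin L -> ∀ {A : Set} (xs : List A) (f : A -> V N) γ -> L (\ β -> ∑ xs (\ x -> f x β)) γ ≡ ∑ xs (\ x -> L (f x) γ)
l-∑ {L = L} l [] f γ = l-0 l γ
l-∑ {L = L} l (x ∷ xs) f γ = trans (l-+ l (f x) _ γ) (cong (L (f x) γ +_) (l-∑ l xs f γ))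

join-sel : ∀ a κ {N} (β : Vec ℕ N) -> join (suc a) (sucs κ) β ≡ ∑ (sel κ) (\ { (m , κ') -> pos (suc m) * alt (sucs ((a N.+ suc m) ∷ κ')) β })
join-sel a [] β = refl
join-sel a (m ∷ κ) β = trans (+-comm (P (suc m) (join (suc a) (sucs κ)) β) _) (cong (pos (suc m) * alt (sucs ((a N.+ suc m) ∷ κ)) β +_) (begin
  P (suc m) (join (suc a) (sucs κ)) β
    ≡⟨ P-cong (suc m) (join-sel a κ) β ⟩
  P (suc m) (\ γ -> ∑ (sel κ) (\ { (m' , κ') -> pos (suc m') * alt (sucs ((a N.+ suc m') ∷ κ')) γ })) β
    ≡⟨ l-∑ (Lin-P (suc m)) (sel κ) (\ { (m' , κ') γ -> pos (suc m') * alt (sucs ((a N.+ suc m') ∷ κ')) γ }) β ⟩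
  ∑ (sel κ) (\ mk -> P (suc m) (\ γ -> pos (suc (fst mk)) * alt (sucs ((a N.+ suc (fst mk)) ∷ snd mk)) γ) β)
    ≡⟨ ∑-cong (sel κ) (\ { (m' , κ') -> trans (P-* (suc m) (pos (suc m')) _ β) (cong (pos (suc m') *_) (P-comm (suc m) (suc (a N.+ suc m')) (alt (sucs κ')) β)) }) ⟩
  ∑ (sel κ) (\ mk -> pos (suc (fst mk)) * alt (sucs ((a N.+ suc (fst mk)) ∷ m ∷ snd mk)) β)
    ≡⟨ sym (∑-map _ (sel κ) _) ⟩
  ∑ (map (\ { (m' , κ') -> m' , m ∷ κ' }) (sel κ)) (\ { (m' , κ') -> pos (suc m') * alt (sucs ((a N.+ suc m') ∷ κ')) β }) ∎))

spl : ℕ -> List ℕ -> ∀ {N} -> V N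
spl m κ β = splitΣ (\ p q -> P p (P q (alt (sucs κ))) β) m

spl-∷ : ∀ m₀ m κ {N} (β : Vec ℕ N) -> spl m (m₀ ∷ κ) β ≡ P (suc m₀) (spl m κ) β
spl-∷ m₀ zero κ β = sym (l-0 (Lin-P (suc m₀)) β)
spl-∷ m₀ (suc m) κ β = trans (ad-cong (\ p q -> trans (P-cong (suc p) (P-comm (suc q) (suc m₀) (alt (sucs κ))) β) (P-comm (suc p) (suc m₀) (P (suc q) (alt (sucs κ))) β)) m 0)
  (sym (l-ad (Lin-P (suc m₀)) (\ p q -> P (suc p) (P (suc q) (alt (sucs κ)))) m 0 β))

-- A join of two different parts is met from either of them, which accounts for the factor 2 in
-- `cutjoin`.
cutjoin-sel : ∀ κ {N} (β : Vec ℕ N) -> ∑ (sel κ) (\ { (m , κ') -> pos (suc m) * (spl m κ' β + join (suc m) (sucs κ') β) }) ≡ cutjoin κ β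
cutjoin-sel [] β = refl
cutjoin-sel (m ∷ κ) β = begin
  pos (suc m) * (s + j) + ∑ (map (\ { (m' , κ') -> m' , m ∷ κ' }) (sel κ)) (\ { (m' , κ') -> pos (suc m') * (spl m' κ' β + join (suc m') (sucs κ') β) })
    ≡⟨ cong (pos (suc m) * (s + j) +_) (trans (∑-map _ (sel κ) _) (trans (∑-cong (sel κ) pt) (trans (∑-+ (sel κ) f g) (cong₂ _+_ fΣ gΣ)))) ⟩
  pos (suc m) * (s + j) + (P (suc m) (cutjoin κ) β + pos (suc m) * j)
    ≡⟨ r (pos (suc m)) s j (P (suc m) (cutjoin κ) β) ⟩
  P (suc m) (cutjoin κ) β + pos (suc m) * (s + pos 2 * j) ∎
  where
  s = spl m κ β
  j = join (suc m) (sucs κ) β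
  r : ∀ m s j x -> m * (s + j) + (x + m * j) ≡ x + m * (s + pos 2 * j)
  r = solve-∀
  h : ℕ × List ℕ -> V _
  h (m' , κ') γ = pos (suc m') * (spl m' κ' γ + join (suc m') (sucs κ') γ)
  f g : ℕ × List ℕ -> ℤ
  f mk = P (suc m) (h mk) β
  g (m' , κ') = pos (suc m) * (pos (suc m') * alt (sucs ((m N.+ suc m') ∷ κ')) β)
  r₂ : ∀ a s j b x -> a * (s + (j + b * x)) ≡ a * (s + j) + b * (a * x)
  r₂ = solve-∀
  pt : ∀ mk -> pos (suc (fst mk)) * (spl (fst mk) (m ∷ snd mk) β + join (suc (fst mk)) (sucs (m ∷ snd mk)) β) ≡ f mk + g mk
  pt (m' , κ') = begin
    pos (suc m') * (spl m' (m ∷ κ') β + (P (suc m) (join (suc m') (sucs κ')) β + pos (suc m) * P (suc m' N.+ suc m) (alt (sucs κ')) β))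
      ≡⟨ r₂ (pos (suc m')) (spl m' (m ∷ κ') β) (P (suc m) (join (suc m') (sucs κ')) β) (pos (suc m)) _ ⟩
    pos (suc m') * (spl m' (m ∷ κ') β + P (suc m) (join (suc m') (sucs κ')) β) + pos (suc m) * (pos (suc m') * P (suc m' N.+ suc m) (alt (sucs κ')) β)
      ≡⟨ cong₂ _+_ (trans (cong (pos (suc m') *_) (trans (cong (_+ P (suc m) (join (suc m') (sucs κ')) β) (spl-∷ m m' κ' β)) (sym (P-+ (suc m) _ _ β)))) (sym (P-* (suc m) (pos (suc m')) _ β)))
           (cong (\ t -> pos (suc m) * (pos (suc m') * P t (alt (sucs κ')) β)) (cong suc (trans (N.+-suc m' m) (trans (cong suc (N.+-comm m' m)) (sym (N.+-suc m m')))))) ⟩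
    f (m' , κ') + g (m' , κ') ∎
  fΣ : ∑ (sel κ) f ≡ P (suc m) (cutjoin κ) β
  fΣ = trans (sym (l-∑ (Lin-P (suc m)) (sel κ) h β)) (P-cong (suc m) (\ γ -> trans (∑-cong (sel κ) (\ _ -> refl)) (cutjoin-sel κ γ)) β)
  gΣ : ∑ (sel κ) g ≡ pos (suc m) * j
  gΣ = trans (∑-* (sel κ) (pos (suc m)) (\ mk -> pos (suc (fst mk)) * alt (sucs ((m N.+ suc (fst mk)) ∷ snd mk)) β)) (cong (pos (suc m) *_) (sym (join-sel m κ β)))

sel-const : ∀ κ {N} (β : Vec ℕ N) -> ∑ (sel κ) (\ { (m , κ') -> pos (suc m) * alt (sucs (m ∷ κ')) β }) ≡ lsum (sucs κ) * alt (sucs κ) β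
sel-const [] β = refl
sel-const (m ∷ κ) β = begin
  pos (suc m) * alt (sucs (m ∷ κ)) β + ∑ (map (\ { (m' , κ') -> m' , m ∷ κ' }) (sel κ)) (\ { (m' , κ') -> pos (suc m') * alt (sucs (m' ∷ κ')) β })
    ≡⟨ cong (pos (suc m) * alt (sucs (m ∷ κ)) β +_) (trans (∑-map _ (sel κ) _)
         (trans (∑-cong (sel κ) (\ { (m' , κ') -> trans (cong (pos (suc m') *_) (P-comm (suc m') (suc m) (alt (sucs κ')) β)) (sym (P-* (suc m) (pos (suc m')) (alt (sucs (m' ∷ κ'))) β)) }))
         (trans (sym (l-∑ (Lin-P (suc m)) (sel κ) (\ mk γ -> pos (suc (fst mk)) * alt (sucs (fst mk ∷ snd mk)) γ) β))
         (trans (P-cong (suc m) (\ γ -> trans (∑-cong (sel κ) (\ _ -> refl)) (sel-const κ γ)) β) (P-* (suc m) (lsum (sucs κ)) (alt (sucs κ)) β))))) ⟩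
  pos (suc m) * alt (sucs (m ∷ κ)) β + lsum (sucs κ) * alt (sucs (m ∷ κ)) β
    ≡⟨ sym (Z.*-distribʳ-+ (alt (sucs (m ∷ κ)) β) (pos (suc m)) (lsum (sucs κ))) ⟩
  lsum (sucs (m ∷ κ)) * alt (sucs (m ∷ κ)) β ∎

lsum-lens : ∀ {n} (cs : List (Cy {n})) -> lsum (sucs (lens cs)) ≡ pos (length (supp cs))
lsum-lens [] = refl
lsum-lens ((x , u) ∷ cs) = trans (cong (pos (suc (length u)) +_) (lsum-lens cs)) (cong pos (cong suc (sym (Lₚ.length-++ u))))

lsum-CycD : ∀ {n ρ} {cs : List (Cy {n})} -> CycD ρ cs -> lsum (sucs (lens cs)) ≡ pos n
lsum-CycD {n} {cs = cs} (_ , s) = trans (lsum-lens cs) (cong pos (trans (↭ₚ.↭-length s) (Lₚ.length-tabulate id)))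

module _ {n : ℕ} (ρ : Sym n) {N : ℕ} (β : Vec ℕ N) where
  private
    H : Fin n -> Fin n -> ℤ
    H x y = ch (transpose x y ⨾ ρ) β

    -- As y moves along the cycle of x, the two arcs run once through all ordered splittings of the
    -- length; `pre` counts the points already passed.
    cut-sum : ∀ x u rest (c : CycD (ρ ▸_) ((x , u) ∷ rest)) -> ∑ u (H x) ≡ spl (length u) (lens rest) β
    cut-sum x [] rest c = refl
    cut-sum x (z ∷ zs) rest c = go [] z zs (\ _ _ _ e -> e)
      where
      f : ℕ -> ℕ -> ℤ
      f p q = P p (P q (alt (sucs (lens rest)))) β
      go : ∀ pre z' zs' -> (∀ u₁ y u₂ -> pre ++ z' ∷ zs' ≡ u₁ ++ y ∷ u₂ -> z ∷ zs ≡ u₁ ++ y ∷ u₂) ->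
        ∑ (z' ∷ zs') (H x) ≡ ad (\ p q -> f (suc p) (suc q)) (length zs') (length pre)
      val : ∀ u₁ y u₂ -> z ∷ zs ≡ u₁ ++ y ∷ u₂ -> H x y ≡ f (suc (length u₂)) (suc (length u₁))
      val u₁ y u₂ e = ch-cyc (transpose x y ⨾ ρ) (Swap.cut (ρ ▸_) x y u₁ u₂ rest (subst (\ t -> CycD (ρ ▸_) ((x , t) ∷ rest)) e c)) β
      go pre z' [] h = trans (+-identityʳ _) (val pre z' [] (h pre z' [] refl))
      go pre z' (z₂ ∷ zs') h = cong₂ _+_ (val pre z' (z₂ ∷ zs') (h pre z' _ refl))
        (trans (go (pre ++ z' ∷ []) z₂ zs' (\ u₁ y u₂ e -> h u₁ y u₂ (trans (sym (Lₚ.++-assoc pre (z' ∷ []) _)) e)))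
               (cong (ad (\ p q -> f (suc p) (suc q)) (length zs')) (trans (Lₚ.length-++ pre) (N.+-comm (length pre) 1))))

    -- The second point is x itself, another point of its cycle, or a point of a different cycle:
    -- nothing happens, the cycle is cut, or two cycles merge.
    inner : ∀ x u rest -> CycD (ρ ▸_) ((x , u) ∷ rest) ->
      ∑ (allFin n) (H x) ≡ alt (sucs (length u ∷ lens rest)) β + (spl (length u) (lens rest) β + join (suc (length u)) (sucs (lens rest)) β)
    inner x u rest c@(p ∷ ps , s) = begin
      ∑ (allFin n) (H x) ≡⟨ ∑-↭ (↭-sym s) (H x) ⟩
      H x x + ∑ (u ++ supp rest) (H x) ≡⟨ cong (H x x +_) (∑-++ u (supp rest) (H x)) ⟩
      H x x + (∑ u (H x) + ∑ (supp rest) (H x)) ≡⟨ cong₂ _+_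
        (ch-cyc (transpose x x ⨾ ρ) (CycD-resp (\ z -> cong (ρ ▸_) (swp-id x z)) c) β)
        (cong₂ _+_ (cut-sum x u rest c)
          (trans (sum-sel rest (H x) (\ m κ -> alt (sucs ((length u N.+ suc m) ∷ κ)) β) ps
                   (\ { y w rest' (q ∷ qs) s' -> trans (ch-cyc (transpose x y ⨾ ρ) (Swap.merge (ρ ▸_) x y u w rest' (p ∷ q ∷ qs , ↭-trans (↭ₚ.++⁺ˡ (x ∷ u) s') s)) β)
                       (cong (\ t -> alt (sucs (t ∷ lens rest')) β) (trans (Lₚ.length-++ w) (trans (N.+-suc (length w) (length u)) (trans (cong suc (N.+-comm (length w) (length u))) (sym (N.+-suc (length u) (length w))))))) }))
                 (sym (trans (join-sel (length u) (lens rest) β) (∑-cong (sel (lens rest)) (\ _ -> refl)))))) ⟩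
      alt (sucs (length u ∷ lens rest)) β + (spl (length u) (lens rest) β + join (suc (length u)) (sucs (lens rest)) β) ∎

  -- The class sum of transpositions acts by a scalar that depends only on β.
  eig : ℤ
  eig = qs β - Q₀ N - (pos 2 * pos N - pos 2) * pos n

  -- The pairs with x ≠ y add up to `cutjoin`, which `Q-alt` evaluates. The n pairs with x = y give
  -- n copies of ρ, which is why `eig` has 2N - 2 where `Q-alt` has 2N - 1.
  transpose-sum : ∑ (allFin n) (\ x -> ∑ (allFin n) (\ y -> ch (transpose x y ⨾ ρ) β)) ≡ eig * ch ρ β
  transpose-sum = begin
    ∑ (allFin n) (\ x -> ∑ (allFin n) (H x))
      ≡⟨ ∑-↭ (↭-sym s) _ ⟩
    ∑ (supp cs) (\ x -> ∑ (allFin n) (H x))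
      ≡⟨ sum-sel cs (\ x -> ∑ (allFin n) (H x)) (\ m κ -> alt (sucs (m ∷ κ)) β + (spl m κ β + join (suc m) (sucs κ) β)) a (\ x u rest q s' -> inner x u rest (q , ↭-trans s' s)) ⟩
    ∑ (sel κ) (\ { (m , κ) -> pos (suc m) * (alt (sucs (m ∷ κ)) β + (spl m κ β + join (suc m) (sucs κ) β)) })
      ≡⟨ trans (∑-cong (sel κ) (\ { (m , κ') -> *-distribˡ-+ (pos (suc m)) (alt (sucs (m ∷ κ')) β) (spl m κ' β + join (suc m) (sucs κ') β) })) (∑-+ (sel κ) _ _) ⟩
    ∑ (sel κ) (\ mk -> pos (suc (fst mk)) * alt (sucs (fst mk ∷ snd mk)) β) + ∑ (sel κ) (\ mk -> pos (suc (fst mk)) * (spl (fst mk) (snd mk) β + join (suc (fst mk)) (sucs (snd mk)) β))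
      ≡⟨ cong₂ _+_ (trans (∑-cong (sel κ) (\ _ -> refl)) (sel-const κ β)) (trans (∑-cong (sel κ) (\ _ -> refl)) (cutjoin-sel κ β)) ⟩
    lsum (sucs κ) * A + cutjoin κ β
      ≡⟨ cong (\ t -> t * A + cutjoin κ β) ln ⟩
    pos n * A + cutjoin κ β
      ≡⟨ fin (qs β) (Q₀ N) (pos N) (pos n) A (cutjoin κ β) (trans (Q-alt κ (Q₀ N) Q-van β) (cong (\ t -> (Q₀ N + (pos 2 * pos N - 1ℤ) * t) * A + cutjoin κ β) ln)) ⟩
    eig * A ∎
    where
    cs = fst (cycles ρ)
    a = fst (snd (cycles ρ))
    s = snd (snd (cycles ρ))
    κ = lens cs
    A = alt (sucs κ) β
    ln : lsum (sucs κ) ≡ pos n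
    ln = lsum-CycD (snd (cycles ρ))
    fin : ∀ q q₀ N n A c -> q * A ≡ (q₀ + (pos 2 * N - 1ℤ) * n) * A + c -> n * A + c ≡ (q - q₀ - (pos 2 * N - pos 2) * n) * A
    fin q q₀ N n A c e = sym (trans (s₁ q q₀ N n A) (trans (cong (_- (q₀ + (pos 2 * N - pos 2) * n) * A) e) (s₂ q₀ N n A c)))
      where
      s₁ : ∀ q q₀ N n A -> (q - q₀ - (pos 2 * N - pos 2) * n) * A ≡ q * A - (q₀ + (pos 2 * N - pos 2) * n) * A
      s₁ = solve-∀
      s₂ : ∀ q₀ N n A c -> (q₀ + (pos 2 * N - 1ℤ) * n) * A + c - (q₀ + (pos 2 * N - pos 2) * n) * A ≡ n * A + c
      s₂ = solve-∀

-- Positive definiteness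

concat-∑ : ∀ {A B : Set} (h : A -> List B) xs f -> ∑ (concatMap h xs) f ≡ ∑ xs (\ x -> ∑ (h x) f)
concat-∑ h [] f = refl
concat-∑ h (x ∷ xs) f = trans (∑-++ (h x) (concatMap h xs) f) (cong (∑ (h x) f +_) (concat-∑ h xs f))

del : ℕ -> List ℕ -> ∀ {N} -> V N
del zero κ β = alt (sucs κ) β
del (suc m) κ β = 0ℤ

del-∷ : ∀ m₀ m κ {N} (β : Vec ℕ N) -> del m (m₀ ∷ κ) β ≡ P (suc m₀) (del m κ) β
del-∷ m₀ zero κ β = refl
del-∷ m₀ (suc m) κ β = sym (l-0 (Lin-P (suc m₀)) β)

del₁-sel : ∀ κ {N} (β : Vec ℕ N) -> ∑ (sel κ) (\ mk -> pos (suc (fst mk)) * del (fst mk) (snd mk) β) ≡ del₁ κ β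
del₁-sel [] β = refl
del₁-sel (m ∷ κ) β = trans (cong (pos (suc m) * del m κ β +_) rest) (fin m)
  where
  rest : ∑ (map (\ { (m' , κ') -> m' , m ∷ κ' }) (sel κ)) (\ mk -> pos (suc (fst mk)) * del (fst mk) (snd mk) β) ≡ P (suc m) (del₁ κ) β
  rest = begin
    ∑ (map (\ { (m' , κ') -> m' , m ∷ κ' }) (sel κ)) (\ mk -> pos (suc (fst mk)) * del (fst mk) (snd mk) β)
      ≡⟨ ∑-map _ (sel κ) _ ⟩
    ∑ (sel κ) (\ mk -> pos (suc (fst mk)) * del (fst mk) (m ∷ snd mk) β)
      ≡⟨ ∑-cong (sel κ) (\ { (m' , κ') -> trans (cong (pos (suc m') *_) (del-∷ m m' κ' β)) (sym (P-* (suc m) (pos (suc m')) (del m' κ') β)) }) ⟩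
    ∑ (sel κ) (\ mk -> P (suc m) (\ γ -> pos (suc (fst mk)) * del (fst mk) (snd mk) γ) β)
      ≡⟨ sym (l-∑ (Lin-P (suc m)) (sel κ) (\ mk γ -> pos (suc (fst mk)) * del (fst mk) (snd mk) γ) β) ⟩
    P (suc m) (\ γ -> ∑ (sel κ) (\ mk -> pos (suc (fst mk)) * del (fst mk) (snd mk) γ)) β
      ≡⟨ P-cong (suc m) (del₁-sel κ) β ⟩
    P (suc m) (del₁ κ) β ∎
  fin : ∀ m -> pos (suc m) * del m κ β + P (suc m) (del₁ κ) β ≡ del₁ (m ∷ κ) β
  fin zero = cong (_+ P 1 (del₁ κ) β) (Z.*-identityˡ (alt (sucs κ) β))
  fin (suc m) = trans (cong (_+ P (suc (suc m)) (del₁ κ) β) (*-zeroʳ (pos (suc (suc m))))) (+-identityˡ _)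

remove-CycD : ∀ {n} (ρ : Sym (suc n)) i -> ρ ▸ i ≡ i -> ∀ {cs} -> CycD (remove i ρ ▸_) cs -> CycD (ρ ▸_) ((i , []) ∷ map (mapC (punchIn i)) cs)
remove-CycD ρ i e {cs} (a , s) = e ∷ cyc-map (punchIn i) (\ x -> trans (punchIn-permute ρ i x) (cong (\ t -> punchIn t (remove i ρ ▸ x)) e)) cs a
  , ↭-trans (↭.prep i (↭-trans (↭-reflexive (supp-mapC (punchIn i) cs)) (↭ₚ.map⁺ (punchIn i) s))) (punchIn-allFin i)

second≢ : ∀ {A : Set} {x z : A} {xs} -> Unique (x ∷ z ∷ xs) -> x ≢ z
second≢ ((x≢z ∷ _) ∷ _) = x≢z

-- Induction from S_n to S_{n+1} of a class function, evaluated through fixed points.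
remove-sum : ∀ {n} (ρ : Sym (suc n)) {N} (β : Vec ℕ N) ->
  ∑ (allFin (suc n)) (\ i -> 𝟙 ((ρ ▸ i) Finₚ.≟ i) * ch (remove i ρ) β) ≡ del₁ (typ ρ) β
remove-sum {n} ρ β = trans (∑-↭ (↭-sym s) _) (trans (sum-sel cs _ (\ m κ -> del m κ β) a pt) (trans (∑-cong (sel (lens cs)) (\ _ -> refl)) (del₁-sel (lens cs) β)))
  where
  cs = fst (cycles ρ)
  a = fst (snd (cycles ρ))
  s = snd (snd (cycles ρ))
  pt : ∀ x u rest -> All (IsCy (ρ ▸_)) ((x , u) ∷ rest) -> supp ((x , u) ∷ rest) ↭ supp cs ->
    𝟙 ((ρ ▸ x) Finₚ.≟ x) * ch (remove x ρ) β ≡ del (length u) (lens rest) β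
  pt x [] rest (p ∷ ps) s' = trans (cong (_* ch (remove x ρ) β) (𝟙-yes (_ Finₚ.≟ x) p)) (trans (Z.*-identityˡ _)
    (alt-↭ (↭ₚ.drop-∷ (↭-trans (↭-reflexive (cong (0 ∷_) (sym (lens-mapC (punchIn x) (fst (cycles (remove x ρ)))))))
      (CycD-unique (remove-CycD ρ x p (snd (cycles (remove x ρ)))) (p ∷ ps , ↭-trans s' s)))) β))
  pt x (z ∷ u) rest ((e , p) ∷ ps) s' = trans (cong (_* ch (remove x ρ) β) (𝟙-no (_ Finₚ.≟ x) ne)) refl
    where
    ne : ρ ▸ x ≢ x
    ne e' = second≢ (Unique-↭ (↭-sym (↭-trans s' s)) (allFin⁺ (suc n))) (trans (sym e') e)

-- Positive definiteness with integer witnesses: a positive multiple of the matrix with entries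
-- Φ(στ⁻¹) is a sum of rank one matrices. The multiple absorbs the divisions made when a constituent
-- is isolated.
record Gram {n : ℕ} (Φ : Sym n -> ℤ) : Set₁ where
  field
    scale : ℕ
    vecs : List (Sym n -> ℤ)
    gram : ∀ σ τ -> pos (suc scale) * Φ (σ ⨾ flip τ) ≡ ∑ vecs (\ g -> g σ * g τ)
open Gram public

Gram-resp : ∀ {n} {Φ Ψ : Sym n -> ℤ} -> (∀ ρ -> Φ ρ ≡ Ψ ρ) -> Gram Φ -> Gram Ψ
Gram-resp e G = record { scale = scale G ; vecs = vecs G ; gram = \ σ τ -> trans (cong (pos (suc (scale G)) *_) (sym (e _))) (gram G σ τ) }

Gram-0 : ∀ {n} -> Gram {n} (\ _ -> 0ℤ)
Gram-0 = record { scale = 0 ; vecs = [] ; gram = \ _ _ -> refl }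

Gram-1 : ∀ {n} -> Gram {n} (\ _ -> 1ℤ)
Gram-1 = record { scale = 0 ; vecs = (\ _ -> 1ℤ) ∷ [] ; gram = \ _ _ -> refl }

Gram-÷ : ∀ {n} {Φ : Sym n -> ℤ} c -> Gram (\ ρ -> pos (suc c) * Φ ρ) -> Gram Φ
Gram-÷ {Φ = Φ} c G = record { scale = c N.+ scale G N.* suc c ; vecs = vecs G ; gram = \ σ τ ->
  trans (trans (cong (_* Φ (σ ⨾ flip τ)) (Z.pos-* (suc (scale G)) (suc c))) (Z.*-assoc (pos (suc (scale G))) (pos (suc c)) _)) (gram G σ τ) }

private
  𝟙-split : ∀ {n} (i j : Fin n) -> 𝟙 (i Finₚ.≟ j) ≡ ∑ (allFin n) (\ k -> 𝟙 (i Finₚ.≟ k) * 𝟙 (j Finₚ.≟ k))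
  𝟙-split {n} i j = sym (trans (∑-↭ (↭-sym p) _) (trans (cong₂ _+_ (trans (cong (_* 𝟙 (j Finₚ.≟ i)) (𝟙-yes (i Finₚ.≟ i) refl)) (Z.*-identityˡ _))
      (trans (∑-cong-∈ rest (\ {k} m -> cong (_* 𝟙 (j Finₚ.≟ k)) (𝟙-no (i Finₚ.≟ k) (All.lookup (nn (Unique-↭ (↭-sym p) (allFin⁺ n))) m)))) (∑-0 rest)))
    (trans (+-identityʳ _) (𝟙-⇔ (j Finₚ.≟ i) (i Finₚ.≟ j) sym sym))))
    where
    ex = ∈-∃++ (∈-allFin i)
    rest = fst ex ++ fst (snd ex)
    p : i ∷ rest ↭ allFin n
    p = ↭-trans (↭-sym (↭ₚ.shift i (fst ex) (fst (snd ex)))) (↭-reflexive (sym (snd (snd ex))))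
    nn : Unique (i ∷ rest) -> All (i ≢_) rest
    nn (a ∷ _) = a

  remove-div : ∀ {n} (σ τ : Sym (suc n)) i -> σ ▸ i ≡ τ ▸ i -> remove i (σ ⨾ flip τ) ≈ remove i σ ⨾ flip (remove i τ)
  remove-div σ τ i e x = inj (begin
      remove i τ ▸ (remove i ρ ▸ x) ≡⟨ Finₚ.punchIn-injective (τ ▸ i) _ _ (begin
        punchIn (τ ▸ i) (remove i τ ▸ (remove i ρ ▸ x)) ≡⟨ sym (punchIn-permute τ i _) ⟩
        τ ▸ punchIn i (remove i ρ ▸ x) ≡⟨ cong (\ t -> τ ▸ punchIn t (remove i ρ ▸ x)) (sym fx) ⟩
        τ ▸ punchIn (ρ ▸ i) (remove i ρ ▸ x) ≡⟨ cong (τ ▸_) (sym (punchIn-permute ρ i x)) ⟩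
        τ ▸ (ρ ▸ punchIn i x) ≡⟨ inverseʳ τ ⟩
        σ ▸ punchIn i x ≡⟨ punchIn-permute σ i x ⟩
        punchIn (σ ▸ i) (remove i σ ▸ x) ≡⟨ cong (\ t -> punchIn t (remove i σ ▸ x)) e ⟩
        punchIn (τ ▸ i) (remove i σ ▸ x) ∎) ⟩
      remove i σ ▸ x ≡⟨ sym (inverseʳ (remove i τ)) ⟩
      remove i τ ▸ (remove i τ ◂ (remove i σ ▸ x)) ∎)
    where
    ρ = σ ⨾ flip τ
    fx : ρ ▸ i ≡ i
    fx = trans (cong (τ ◂_) e) (inverseˡ τ)
    inj : ∀ {a b} -> remove i τ ▸ a ≡ remove i τ ▸ b -> a ≡ b
    inj q = trans (sym (inverseˡ (remove i τ))) (trans (cong (remove i τ ◂_) q) (inverseˡ (remove i τ)))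

-- The induced function sums over the points i fixed by στ⁻¹, that is with σ i = τ i. Writing this
-- condition as a sum over j of the product of the conditions σ i = j and τ i = j separates σ from
-- τ.
Gram-induce : ∀ {n N} (β : Vec ℕ N) -> Gram {n} (\ ρ -> ch ρ β) -> Gram {suc n} (\ ρ -> del₁ (typ ρ) β)
Gram-induce {n} β G = record
  { scale = scale G
  ; vecs = concatMap h₂ F
  ; gram = pf }
  where
  F = allFin (suc n)
  w : Fin (suc n) -> Fin (suc n) -> (Sym n -> ℤ) -> Sym (suc n) -> ℤ
  w i j g σ = 𝟙 ((σ ▸ i) Finₚ.≟ j) * g (remove i σ)
  h₁ : Fin (suc n) -> Fin (suc n) -> List (Sym (suc n) -> ℤ)
  h₁ i j = map (w i j) (vecs G)
  h₂ : Fin (suc n) -> List (Sym (suc n) -> ℤ)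
  h₂ i = concatMap (h₁ i) F
  M = pos (suc (scale G))
  r : ∀ a x b y -> (a * x) * (b * y) ≡ (a * b) * (x * y)
  r = solve-∀
  r' : ∀ M a x -> M * (a * x) ≡ a * (M * x)
  r' = solve-∀
  pt : ∀ σ τ i -> M * (𝟙 ((τ ◂ (σ ▸ i)) Finₚ.≟ i) * ch (remove i (σ ⨾ flip τ)) β)
     ≡ ∑ F (\ j -> ∑ (vecs G) (\ g -> (𝟙 ((σ ▸ i) Finₚ.≟ j) * g (remove i σ)) * (𝟙 ((τ ▸ i) Finₚ.≟ j) * g (remove i τ))))
  pt σ τ i = begin
    M * (𝟙 ((τ ◂ (σ ▸ i)) Finₚ.≟ i) * ch (remove i (σ ⨾ flip τ)) β)
      ≡⟨ r' M (𝟙 ((τ ◂ (σ ▸ i)) Finₚ.≟ i)) (ch (remove i (σ ⨾ flip τ)) β) ⟩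
    𝟙 ((τ ◂ (σ ▸ i)) Finₚ.≟ i) * (M * ch (remove i (σ ⨾ flip τ)) β)
      ≡⟨ lem ((σ ▸ i) Finₚ.≟ (τ ▸ i)) ⟩
    𝟙 ((σ ▸ i) Finₚ.≟ (τ ▸ i)) * S
      ≡⟨ cong (_* S) (𝟙-split (σ ▸ i) (τ ▸ i)) ⟩
    ∑ F (\ j -> 𝟙 ((σ ▸ i) Finₚ.≟ j) * 𝟙 ((τ ▸ i) Finₚ.≟ j)) * S
      ≡⟨ trans (Z.*-comm (∑ F (\ j -> 𝟙 ((σ ▸ i) Finₚ.≟ j) * 𝟙 ((τ ▸ i) Finₚ.≟ j))) S) (sym (∑-* F S _)) ⟩
    ∑ F (\ j -> S * (𝟙 ((σ ▸ i) Finₚ.≟ j) * 𝟙 ((τ ▸ i) Finₚ.≟ j)))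
      ≡⟨ ∑-cong F (\ j -> trans (Z.*-comm S (𝟙 ((σ ▸ i) Finₚ.≟ j) * 𝟙 ((τ ▸ i) Finₚ.≟ j))) (trans (sym (∑-* (vecs G) (𝟙 ((σ ▸ i) Finₚ.≟ j) * 𝟙 ((τ ▸ i) Finₚ.≟ j)) _))
           (∑-cong (vecs G) (\ g -> sym (r (𝟙 ((σ ▸ i) Finₚ.≟ j)) (g (remove i σ)) (𝟙 ((τ ▸ i) Finₚ.≟ j)) (g (remove i τ))))))) ⟩
    _ ∎
    where
    S = ∑ (vecs G) (\ g -> g (remove i σ) * g (remove i τ))
    lem : (d : Dec (σ ▸ i ≡ τ ▸ i)) -> 𝟙 ((τ ◂ (σ ▸ i)) Finₚ.≟ i) * (M * ch (remove i (σ ⨾ flip τ)) β) ≡ 𝟙 d * S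
    lem (yes e) = cong₂ _*_ (𝟙-yes (_ Finₚ.≟ i) (trans (cong (τ ◂_) e) (inverseˡ τ)))
      (trans (cong (M *_) (ch-≈ {ρ = remove i (σ ⨾ flip τ)} {remove i σ ⨾ flip (remove i τ)} (remove-div σ τ i e) β)) (gram G (remove i σ) (remove i τ)))
    lem (no ne) = cong (_* (M * ch (remove i (σ ⨾ flip τ)) β)) (𝟙-no (_ Finₚ.≟ i) (\ q -> ne (trans (sym (inverseʳ τ)) (cong (τ ▸_) q))))
  pf : ∀ σ τ -> M * del₁ (typ (σ ⨾ flip τ)) β ≡ ∑ (concatMap h₂ F) (\ g -> g σ * g τ)
  pf σ τ = begin
    M * del₁ (typ (σ ⨾ flip τ)) β ≡⟨ cong (M *_) (sym (remove-sum (σ ⨾ flip τ) β)) ⟩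
    M * ∑ F k ≡⟨ sym (∑-* F M k) ⟩
    ∑ F (\ i -> M * k i) ≡⟨ ∑-cong F (pt σ τ) ⟩
    ∑ F (\ i -> ∑ F (\ j -> ∑ (vecs G) (\ g -> w i j g σ * w i j g τ)))
      ≡⟨ ∑-cong F (\ i -> trans (∑-cong F (\ j -> sym (∑-map (w i j) (vecs G) (\ g -> g σ * g τ)))) (sym (concat-∑ (h₁ i) F (\ g -> g σ * g τ)))) ⟩
    ∑ F (\ i -> ∑ (h₂ i) (\ g -> g σ * g τ))
      ≡⟨ sym (concat-∑ h₂ F (\ g -> g σ * g τ)) ⟩
    ∑ (concatMap h₂ F) (\ g -> g σ * g τ) ∎
    where
    k : Fin (suc n) -> ℤ
    k i = 𝟙 ((τ ◂ (σ ▸ i)) Finₚ.≟ i) * ch (remove i (σ ⨾ flip τ)) β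

cancelˡ : ∀ a b c -> a + b ≡ a + c -> b ≡ c
cancelˡ a b c e = trans (sym (r a b)) (trans (cong (_+ - a) e) (r a c))
  where r : ∀ a b -> (a + b) + - a ≡ b
        r = solve-∀

cancelʳ : ∀ a b c -> b + a ≡ c + a -> b ≡ c
cancelʳ a b c e = cancelˡ a b c (trans (+-comm a b) (trans e (+-comm c a)))

private
  sq : ℤ -> ℤ
  sq x = x * x

bumps : ∀ {N} -> Vec ℕ N -> List (Vec ℕ N)
bumps Vec.[] = []
bumps (c Vec.∷ γ) = (suc c Vec.∷ γ) ∷ map (c Vec.∷_) (bumps γ)

Inc-∑ : ∀ {N} (B : V N) γ -> Inc B γ ≡ ∑ (bumps γ) B
Inc-∑ B Vec.[] = refl
Inc-∑ B (c Vec.∷ γ) = cong (B (suc c Vec.∷ γ) +_) (trans (Inc-∑ (\ γ' -> B (c Vec.∷ γ')) γ) (sym (∑-map (c Vec.∷_) (bumps γ) B)))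

data Bump : ∀ {N} -> Vec ℕ N -> Vec ℕ N -> Set where
  here : ∀ {N c} {γ : Vec ℕ N} -> Bump (c Vec.∷ γ) (suc c Vec.∷ γ)
  there : ∀ {N c} {γ γ' : Vec ℕ N} -> Bump γ γ' -> Bump (c Vec.∷ γ) (c Vec.∷ γ')

Bump-sum : ∀ {N} {γ γ' : Vec ℕ N} -> Bump γ γ' -> sumV γ' ≡ suc (sumV γ)
Bump-sum here = refl
Bump-sum (there {c = c} b) = trans (cong (c N.+_) (Bump-sum b)) (N.+-suc c _)

bump-qs : ∀ {N} lo (γ : Vec ℕ N) -> Str lo γ -> ∀ {γ'} -> γ' ∈ bumps γ -> ∃[ d ] (lo N.≤ d × qs γ' ≡ qs γ + (pos 2 * pos d + 1ℤ))
bump-qs lo (c Vec.∷ γ) (l , s) (here refl) = c , l , r (pos c) (qs γ)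
  where r : ∀ c q -> (1ℤ + c) * (1ℤ + c) + q ≡ c * c + q + (pos 2 * c + 1ℤ)
        r = solve-∀
bump-qs lo (c Vec.∷ γ) (l , s) (there m) with ∈-map⁻ (c Vec.∷_) m
... | γ' , m' , refl = let (d , l' , e) = bump-qs (suc c) γ s m' in
  d , N.≤-trans l (N.≤-trans (N.n≤1+n c) l') , trans (cong (pos c * pos c +_) e) (sym (+-assoc (pos c * pos c) (qs γ) _))

private
  ≢-bump : ∀ {c d : ℕ} q -> c N.< d -> q + (pos 2 * pos c + 1ℤ) ≢ q + (pos 2 * pos d + 1ℤ)
  ≢-bump {c} {d} q l e = N.<-irrefl (Z.+-injective (Z.*-cancelˡ-≡ (pos 2) (pos c) (pos d) (cancelʳ 1ℤ (pos 2 * pos c) (pos 2 * pos d) (cancelˡ q _ _ e)))) l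

-- Raising an entry c adds 2c + 1 to `qs`, and the entries of a strict vector are distinct. Raised
-- vectors that are no longer strict are separated as well.
bump-split : ∀ {N} lo {γ γ' : Vec ℕ N} -> Str lo γ -> Bump γ γ' ->
  ∃[ pre ] ∃[ post ] (bumps γ ≡ pre ++ γ' ∷ post × All (\ b -> qs b ≢ qs γ') (pre ++ post))
bump-split lo {c Vec.∷ γ} (l , s) here = [] , _ , refl , Allₚ.map⁺ (All.tabulate (\ {b} m e ->
    let (d , c<d , q) = bump-qs (suc c) γ s m in
    ≢-bump (pos c * pos c + qs γ) c<d (trans (sym (r (pos c) (qs γ))) (trans (sym e) (trans (cong (pos c * pos c +_) q) (sym (+-assoc (pos c * pos c) (qs γ) _)))))))
  where r : ∀ c q -> (1ℤ + c) * (1ℤ + c) + q ≡ c * c + q + (pos 2 * c + 1ℤ)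
        r = solve-∀
bump-split lo {c Vec.∷ γ} {_ Vec.∷ γ'} (l , s) (there b) = let (pre , post , e , a) = bump-split (suc c) s b in
    (suc c Vec.∷ γ) ∷ map (c Vec.∷_) pre , map (c Vec.∷_) post ,
    cong ((suc c Vec.∷ γ) ∷_) (trans (cong (map (c Vec.∷_)) e) (Lₚ.map-++ (c Vec.∷_) pre (γ' ∷ post))) ,
    (\ q -> let (d , c<d , q') = bump-qs (suc c) γ s (subst (γ' ∈_) (sym e) (∈-++⁺ʳ pre (here refl))) in
       ≢-bump (pos c * pos c + qs γ) c<d (trans (sym (r (pos c) (qs γ))) (trans q (trans (cong (pos c * pos c +_) q') (sym (+-assoc (pos c * pos c) (qs γ) _))))))
    ∷ subst (All _) (Lₚ.map-++ (c Vec.∷_) pre post) (Allₚ.map⁺ (All.map (\ ne q -> ne (cancelˡ (pos c * pos c) _ _ q)) a))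
  where r : ∀ c q -> (1ℤ + c) * (1ℤ + c) + q ≡ c * c + q + (pos 2 * c + 1ℤ)
        r = solve-∀

unbump : ∀ {N} lo (b : Vec ℕ N) -> Str lo b -> b ≢ δ lo N -> ∃[ b⁻ ] (Str lo b⁻ × Bump b⁻ b)
unbump lo Vec.[] s ne = ⊥-elim (ne refl)
unbump lo (b Vec.∷ β) (l , s) ne with N.m≤n⇒m<n∨m≡n l
unbump lo (suc b Vec.∷ β) (l , s) ne | inj₁ (s≤s l') = b Vec.∷ β , (l' , Str-mono (N.n≤1+n _) s) , here
... | inj₂ refl = let (β⁻ , s⁻ , bp) = unbump (suc lo) β s (\ e -> ne (cong (lo Vec.∷_) e)) in lo Vec.∷ β⁻ , (N.≤-refl , s⁻) , there bp

unsuc : ∀ {N} lo (β : Vec ℕ N) -> Str (suc lo) β -> ∃[ β' ] (β ≡ Vec.map suc β' × Str lo β')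
unsuc lo Vec.[] s = Vec.[] , refl , tt
unsuc lo (suc b Vec.∷ β) (s≤s l , s) = let (β' , e , s') = unsuc (suc b) β s in b Vec.∷ β' , cong (suc b Vec.∷_) e , l , s'

-- If the degree is below the number of variables, some part is 0: a strict vector with positive
-- entries has sum at least that of δ plus the number of variables.
headZero : ∀ {N} (b : Vec ℕ (suc N)) -> Str 0 b -> sumV b N.< suc N N.+ tri (suc N) -> ∃[ β' ] (b ≡ 0 Vec.∷ Vec.map suc β' × Str 0 β')
headZero {N} (zero Vec.∷ β) (_ , s) l = let (β' , e , s') = unsuc 0 β s in β' , cong (0 Vec.∷_) e , s'
headZero {N} (suc b Vec.∷ β) (_ , s) l = ⊥-elim (N.<⇒≱ l (N.≤-trans (N.≤-reflexive (sym (δsum 0 (suc N)))) (Str-sum 1 (suc b Vec.∷ β) (s≤s z≤n , s))))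

-- Positivity is inherited by (T₀ − e)² Φ, where T₀ is the class sum of transpositions.
module _ {n N : ℕ} (bs : List (Vec ℕ N)) where
  Φ : (Vec ℕ N -> ℤ) -> Sym n -> ℤ
  Φ w ρ = ∑ bs (\ b -> w b * ch ρ b)

  private
    F = allFin n
    ev : Vec ℕ N -> ℤ
    ev b = qs b - Q₀ N - (pos 2 * pos N - pos 2) * pos n

    T₀ : (Sym n -> ℤ) -> Sym n -> ℤ
    T₀ g σ = ∑ F (\ x -> ∑ F (\ y -> g (transpose x y ⨾ σ)))

    T₀-cong : ∀ {g h : Sym n -> ℤ} -> (∀ σ -> g σ ≡ h σ) -> ∀ σ -> T₀ g σ ≡ T₀ h σ
    T₀-cong e σ = ∑-cong F (\ x -> ∑-cong F (\ y -> e _))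

    T₀-* : ∀ c g σ -> T₀ (\ σ -> c * g σ) σ ≡ c * T₀ g σ
    T₀-* c g σ = trans (∑-cong F (\ x -> ∑-* F c _)) (∑-* F c _)

    T₀-∑ : ∀ {A : Set} (xs : List A) (g : A -> Sym n -> ℤ) σ -> T₀ (\ σ -> ∑ xs (\ a -> g a σ)) σ ≡ ∑ xs (\ a -> T₀ (g a) σ)
    T₀-∑ xs g σ = trans (∑-cong F (\ x -> ∑-swap F xs (\ y a -> g a (transpose x y ⨾ σ)))) (∑-swap F xs (\ x a -> ∑ F (\ y -> g a (transpose x y ⨾ σ))))

    Φ-eig : ∀ w ρ -> T₀ (Φ w) ρ ≡ Φ (\ b -> w b * ev b) ρ
    Φ-eig w ρ = trans (T₀-∑ bs (\ b ρ -> w b * ch ρ b) ρ) (∑-cong bs (\ b -> trans (T₀-* (w b) (\ ρ -> ch ρ b) ρ) (trans (cong (w b *_) (transpose-sum ρ b)) (sym (Z.*-assoc (w b) (ev b) (ch ρ b))))))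

    Φ-conj : ∀ w ρ σ h -> (∀ x -> σ ▸ (h ▸ x) ≡ h ▸ (ρ ▸ x)) -> Φ w σ ≡ Φ w ρ
    Φ-conj w ρ σ h e = ∑-cong bs (\ b -> cong (w b *_) (ch-conj ρ σ h e b))

    Φ-flip : ∀ w (σ τ : Sym n) x y -> Φ w (σ ⨾ flip (transpose x y ⨾ τ)) ≡ Φ w (transpose y x ⨾ (σ ⨾ flip τ))
    Φ-flip w σ τ x y = Φ-conj w (transpose y x ⨾ (σ ⨾ flip τ)) (σ ⨾ flip (transpose x y ⨾ τ)) (transpose y x) (\ z -> refl)

    T₀-flip : ∀ w (σ τ : Sym n) -> ∑ F (\ x -> ∑ F (\ y -> Φ w (σ ⨾ flip (transpose x y ⨾ τ)))) ≡ T₀ (Φ w) (σ ⨾ flip τ)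
    T₀-flip w σ τ = trans (∑-cong F (\ x -> ∑-cong F (\ y -> Φ-flip w σ τ x y))) (∑-swap F F (\ x y -> Φ w (transpose y x ⨾ (σ ⨾ flip τ))))

    T₀-left : ∀ w (σ τ : Sym n) -> T₀ (\ σ -> Φ w (σ ⨾ flip τ)) σ ≡ T₀ (Φ w) (σ ⨾ flip τ)
    T₀-left w σ τ = ∑-cong F (\ x -> ∑-cong F (\ y -> Φ-conj w (transpose x y ⨾ (σ ⨾ flip τ)) ((transpose x y ⨾ σ) ⨾ flip τ) (Data.Fin.Permutation.id) (\ z -> refl)))
      where import Data.Fin.Permutation

  -- Transpositions are their own inverses and Φ is a class function, so T₀ acts alike through σ and
  -- through τ in Φ(στ⁻¹). Applying T₀ - e to every Gram vector therefore multiplies the eigenvalue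
  -- by a square.
  Gram-kill : ∀ w e -> Gram (Φ w) -> Gram (Φ (\ b -> w b * sq (ev b - e)))
  Gram-kill w e G = record { scale = scale G ; vecs = map g' (vecs G) ; gram = pf }
    where
    g' : (Sym n -> ℤ) -> Sym n -> ℤ
    g' g σ = T₀ g σ - e * g σ
    M = pos (suc (scale G))
    vs = vecs G
    K : Sym n -> Sym n -> ℤ
    K σ τ = ∑ vs (\ g -> g σ * g τ)
    r : ∀ a b c d e -> (a - e * b) * (c - e * d) ≡ (a * c + (- e) * (b * c)) + ((- e) * (a * d) + e * e * (b * d))
    r = solve-∀
    KT₂ : ∀ (σ τ : Sym n) -> ∑ vs (\ g -> g σ * T₀ g τ) ≡ M * T₀ (Φ w) (σ ⨾ flip τ)
    KT₂ σ τ = begin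
      ∑ vs (\ g -> g σ * T₀ g τ) ≡⟨ ∑-cong vs (\ g -> sym (T₀-* (g σ) g τ)) ⟩
      ∑ vs (\ g -> T₀ (\ τ -> g σ * g τ) τ) ≡⟨ sym (T₀-∑ vs (\ g τ -> g σ * g τ) τ) ⟩
      T₀ (\ τ -> K σ τ) τ ≡⟨ T₀-cong (\ τ -> sym (gram G σ τ)) τ ⟩
      T₀ (\ τ -> M * Φ w (σ ⨾ flip τ)) τ ≡⟨ T₀-* M (\ τ -> Φ w (σ ⨾ flip τ)) τ ⟩
      M * T₀ (\ τ -> Φ w (σ ⨾ flip τ)) τ ≡⟨ cong (M *_) (T₀-flip w σ τ) ⟩
      M * T₀ (Φ w) (σ ⨾ flip τ) ∎
    KT₁ : ∀ (σ τ : Sym n) -> ∑ vs (\ g -> T₀ g σ * g τ) ≡ M * T₀ (Φ w) (σ ⨾ flip τ)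
    KT₁ σ τ = begin
      ∑ vs (\ g -> T₀ g σ * g τ) ≡⟨ ∑-cong vs (\ g -> trans (Z.*-comm (T₀ g σ) (g τ)) (sym (T₀-* (g τ) g σ))) ⟩
      ∑ vs (\ g -> T₀ (\ σ -> g τ * g σ) σ) ≡⟨ sym (T₀-∑ vs (\ g σ -> g τ * g σ) σ) ⟩
      T₀ (\ σ -> ∑ vs (\ g -> g τ * g σ)) σ ≡⟨ T₀-cong (\ σ -> trans (∑-cong vs (\ g -> Z.*-comm (g τ) (g σ))) (sym (gram G σ τ))) σ ⟩
      T₀ (\ σ -> M * Φ w (σ ⨾ flip τ)) σ ≡⟨ T₀-* M (\ σ -> Φ w (σ ⨾ flip τ)) σ ⟩
      M * T₀ (\ σ -> Φ w (σ ⨾ flip τ)) σ ≡⟨ cong (M *_) (T₀-left w σ τ) ⟩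
      M * T₀ (Φ w) (σ ⨾ flip τ) ∎
    KTT : ∀ (σ τ : Sym n) -> ∑ vs (\ g -> T₀ g σ * T₀ g τ) ≡ M * Φ (\ b -> w b * ev b * ev b) (σ ⨾ flip τ)
    KTT σ τ = begin
      ∑ vs (\ g -> T₀ g σ * T₀ g τ) ≡⟨ ∑-cong vs (\ g -> trans (Z.*-comm (T₀ g σ) (T₀ g τ)) (sym (T₀-* (T₀ g τ) g σ))) ⟩
      ∑ vs (\ g -> T₀ (\ σ -> T₀ g τ * g σ) σ) ≡⟨ sym (T₀-∑ vs (\ g σ -> T₀ g τ * g σ) σ) ⟩
      T₀ (\ σ -> ∑ vs (\ g -> T₀ g τ * g σ)) σ ≡⟨ T₀-cong (\ σ -> trans (∑-cong vs (\ g -> Z.*-comm (T₀ g τ) (g σ))) (trans (KT₂ σ τ) (cong (M *_) (Φ-eig w (σ ⨾ flip τ))))) σ ⟩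
      T₀ (\ σ -> M * Φ w' (σ ⨾ flip τ)) σ ≡⟨ T₀-* M (\ σ -> Φ w' (σ ⨾ flip τ)) σ ⟩
      M * T₀ (\ σ -> Φ w' (σ ⨾ flip τ)) σ ≡⟨ cong (M *_) (trans (T₀-left w' σ τ) (Φ-eig w' (σ ⨾ flip τ))) ⟩
      M * Φ (\ b -> w b * ev b * ev b) (σ ⨾ flip τ) ∎
      where w' = \ b -> w b * ev b
    pf : ∀ σ τ -> M * Φ (\ b -> w b * sq (ev b - e)) (σ ⨾ flip τ) ≡ ∑ (map g' vs) (\ g -> g σ * g τ)
    pf σ τ = sym (begin
      ∑ (map g' vs) (\ g -> g σ * g τ) ≡⟨ ∑-map g' vs (\ g -> g σ * g τ) ⟩
      ∑ vs (\ g -> g' g σ * g' g τ) ≡⟨ ∑-cong vs (\ g -> r (T₀ g σ) (g σ) (T₀ g τ) (g τ) e) ⟩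
      ∑ vs (\ g -> (T₀ g σ * T₀ g τ + (- e) * (g σ * T₀ g τ)) + ((- e) * (T₀ g σ * g τ) + e * e * (g σ * g τ)))
        ≡⟨ trans (∑-+ vs _ _) (cong₂ _+_ (trans (∑-+ vs _ _) (cong₂ _+_ (KTT σ τ) (trans (∑-* vs (- e) _) (cong ((- e) *_) (trans (KT₂ σ τ) (cong (M *_) (Φ-eig w ρ)))))))
                                         (trans (∑-+ vs _ _) (cong₂ _+_ (trans (∑-* vs (- e) _) (cong ((- e) *_) (trans (KT₁ σ τ) (cong (M *_) (Φ-eig w ρ))))) (trans (∑-* vs (e * e) _) (cong ((e * e) *_) (sym (gram G σ τ))))))) ⟩
      (M * Φ w₂ ρ + (- e) * (M * Φ w₁ ρ)) + ((- e) * (M * Φ w₁ ρ) + e * e * (M * Φ w ρ))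
        ≡⟨ r₂ M (Φ w₂ ρ) (Φ w₁ ρ) (Φ w ρ) e ⟩
      M * ((Φ w₂ ρ + (- (e + e)) * Φ w₁ ρ) + e * e * Φ w ρ)
        ≡⟨ cong (M *_) (trans (cong₂ _+_ (trans (cong (Φ w₂ ρ +_) (sym (∑-* bs (- (e + e)) _))) (sym (∑-+ bs _ _))) (sym (∑-* bs (e * e) _))) (trans (sym (∑-+ bs _ _)) (∑-cong bs (\ b -> r₃ (w b) (ev b) e (ch ρ b))))) ⟩
      M * Φ (\ b -> w b * sq (ev b - e)) ρ ∎)
      where
      ρ = σ ⨾ flip τ
      w₁ = \ b -> w b * ev b
      w₂ = \ b -> w b * ev b * ev b
      r₂ : ∀ M x y z e -> (M * x + (- e) * (M * y)) + ((- e) * (M * y) + e * e * (M * z)) ≡ M * ((x + (- (e + e)) * y) + e * e * z)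
      r₂ = solve-∀
      r₃ : ∀ w v e c -> (w * v * v * c + (- (e + e)) * (w * v * c)) + e * e * (w * c) ≡ w * ((v - e) * (v - e)) * c
      r₃ = solve-∀

  wts : List (Vec ℕ N) -> Vec ℕ N -> ℤ
  wts [] b = 1ℤ
  wts (e ∷ es) b = wts es b * sq (ev b - ev e)

  Gram-kills : Gram (Φ (\ _ -> 1ℤ)) -> ∀ es -> Gram (Φ (wts es))
  Gram-kills G [] = G
  Gram-kills G (e ∷ es) = Gram-kill (wts es) (ev e) (Gram-kills G es)

  wts-zero : ∀ es {b} -> b ∈ es -> wts es b ≡ 0ℤ
  wts-zero (e ∷ es) {b} (here refl) = trans (cong (\ t -> wts es b * (t * t)) (+-inverse (ev b))) (*-zeroʳ (wts es b))
    where +-inverse : ∀ x -> x - x ≡ 0ℤ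
          +-inverse = Z.+-inverseʳ
  wts-zero (e ∷ es) {b} (there m) = cong (_* sq (ev b - ev e)) (wts-zero es m)

  wts-pos : ∀ es {b} -> All (\ e -> qs e ≢ qs b) es -> ∃[ c ] wts es b ≡ pos (suc c)
  wts-pos [] [] = 0 , refl
  wts-pos (e ∷ es) {b} (ne ∷ nes) with wts-pos es nes | ev b - ev e in eq
  ... | c , p | pos zero = ⊥-elim (ne (sym (ev-inj (Z.i-j≡0⇒i≡j (ev b) (ev e) eq))))
    where
    ev-inj : ev b ≡ ev e -> qs b ≡ qs e
    ev-inj q = cancelʳ (- Q₀ N) _ _ (cancelʳ (- ((pos 2 * pos N - pos 2) * pos n)) _ _ q)
  ... | c , p | pos (suc k) = _ , trans (cong (_* (pos (suc k) * pos (suc k))) p) (sym (Z.pos-* (suc c) (suc (k N.+ k N.* suc k))))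
  ... | c , p | -[1+ k ] = _ , trans (cong (_* (pos (suc k) * pos (suc k))) p) (sym (Z.pos-* (suc c) (suc (k N.+ k N.* suc k))))

lsumℕ-CycD : ∀ {n ρ} {cs : List (Cy {n})} -> CycD ρ cs -> lsumℕ (sucs (lens cs)) ≡ n
lsumℕ-CycD {n} {ρ} {cs} c = Z.+-injective (trans (t (sucs (lens cs))) (lsum-CycD {ρ = ρ} {cs} c))
  where t : ∀ λ' -> pos (lsumℕ λ') ≡ lsum λ'
        t [] = refl
        t (k ∷ λ') = cong (pos k +_) (t λ')

ch-hom : ∀ {n} (ρ : Sym n) {N} (b : Vec ℕ N) -> sumV b ≢ n N.+ tri N -> ch ρ b ≡ 0ℤ
ch-hom ρ {N} b ne = Hom-alt (sucs (typ ρ)) b (\ e -> ne (trans e (cong (N._+ tri N) (lsumℕ-CycD (snd (cycles ρ))))))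

Π-δ : ∀ {N} (A : V (suc N)) β -> Π A (0 Vec.∷ Vec.map suc β) ≡ A (0 Vec.∷ β)
Π-δ A Vec.[] = refl
Π-δ A (c Vec.∷ β) = trans (+-identityʳ _) (Π-δ (ins c A) β)

van-δ : ∀ N -> van (δ 0 N) ≡ 1ℤ
van-δ zero = refl
van-δ (suc N) = trans (cong (\ t -> van (0 Vec.∷ t)) (δ-suc 0 N)) (trans (Π-δ (e₀ van) (δ 0 N)) (van-δ N))

-- Induction on n. A box is removed from b, and n ≤ N ensures that the smaller shape has a zero part
-- to strip. Inducing its Gram form gives, by `Inc-alt`, the sum over all ways to add a box; the
-- squares at the other additions leave a positive multiple of the function of b. In a wrong degree
-- the function is 0.
gram-ch : ∀ n {N} -> n N.≤ N -> (b : Vec ℕ N) -> Str 0 b -> Gram {n} (\ ρ -> ch ρ b)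
gram-step : ∀ n {N} -> suc n N.≤ N -> (b : Vec ℕ N) -> Str 0 b -> sumV b ≡ suc n N.+ tri N -> Gram {suc n} (\ ρ -> ch ρ b)
gram-dec : ∀ n {N} -> n N.≤ N -> (b : Vec ℕ N) -> Str 0 b -> Dec (sumV b ≡ n N.+ tri N) -> Gram {n} (\ ρ -> ch ρ b)
gram-ch n {N} le b s = gram-dec n le b s (sumV b N.≟ (n N.+ tri N))
gram-dec n le b s (no ne) = Gram-resp (\ ρ -> sym (ch-hom ρ b ne)) Gram-0
gram-dec zero {N} le b s (yes e) = Gram-resp (\ ρ -> sym (trans (cong (\ t -> van t) (Str-≡δ 0 b s e)) (van-δ N))) Gram-1
gram-dec (suc n) le b s (yes e) = gram-step n le b s e
gram-step n {suc N} (s≤s le) b s e = Gram-÷ c (Gram-resp pick (Gram-kills bs (Gram-resp start (Gram-induce β' (gram-ch n le β' s'))) (pre ++ post)))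
  where
  nd : b ≢ δ 0 (suc N)
  nd refl = N.<-irrefl e (s≤s (N.m≤n+m _ n))
  ub = unbump 0 b s nd
  b⁻ = fst ub
  s⁻ = fst (snd ub)
  bp = snd (snd ub)
  sum⁻ : sumV b⁻ ≡ n N.+ tri (suc N)
  sum⁻ = N.suc-injective (trans (sym (Bump-sum bp)) e)
  hz = headZero b⁻ s⁻ (N.≤-trans (N.≤-reflexive (cong suc sum⁻)) (N.+-monoˡ-≤ (tri (suc N)) (s≤s le)))
  β' = fst hz
  s' = snd (snd hz)
  bs = bumps b⁻
  sp = bump-split 0 s⁻ bp
  pre = fst sp
  post = fst (snd sp)
  eqb : bs ≡ pre ++ b ∷ post
  eqb = fst (snd (snd sp))
  nes : All (\ b' -> qs b' ≢ qs b) (pre ++ post)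
  nes = snd (snd (snd sp))
  cw = wts-pos {suc n} bs (pre ++ post) nes
  c = fst cw
  start : ∀ ρ -> del₁ (typ ρ) β' ≡ Φ bs (\ _ -> 1ℤ) ρ
  start ρ = trans (sym (Inc-alt (typ ρ) β')) (trans (cong (Inc (ch ρ)) (sym (fst (snd hz)))) (trans (Inc-∑ (ch ρ) b⁻) (∑-cong bs (\ b' -> sym (Z.*-identityˡ (ch ρ b'))))))
  pick : ∀ ρ -> Φ bs (wts {suc n} bs (pre ++ post)) ρ ≡ pos (suc c) * ch ρ b
  pick ρ = begin
    ∑ bs f ≡⟨ cong (\ t -> ∑ t f) eqb ⟩
    ∑ (pre ++ b ∷ post) f ≡⟨ ∑-↭ (↭ₚ.shift b pre post) f ⟩
    f b + ∑ (pre ++ post) f ≡⟨ cong₂ _+_ (cong (_* ch ρ b) (snd cw)) (trans (∑-cong-∈ (pre ++ post) (\ {b'} m -> cong (_* ch ρ b') (wts-zero {suc n} bs (pre ++ post) m))) (∑-0 (pre ++ post))) ⟩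
    pos (suc c) * ch ρ b + 0ℤ ≡⟨ +-identityʳ _ ⟩
    pos (suc c) * ch ρ b ∎
    where f = \ b' -> wts {suc n} bs (pre ++ post) b' * ch ρ b'

-- Quadratic forms on the group algebra.

0≤_ : ℤ -> Set
0≤ x = 0ℤ Z.≤ x

0≤-+ : ∀ {x y} -> 0≤ x -> 0≤ y -> 0≤ (x + y)
0≤-+ p q = Z.+-mono-≤ p q

0≤-* : ∀ {x y} -> 0≤ x -> 0≤ y -> 0≤ (x * y)
0≤-* {pos x} {pos y} p q = subst 0≤_ (Z.pos-* x y) (Z.+≤+ z≤n)

0≤-sq : ∀ x -> 0≤ (x * x)
0≤-sq (pos x) = 0≤-* {pos x} {pos x} (Z.+≤+ z≤n) (Z.+≤+ z≤n)
0≤-sq -[1+ x ] = Z.+≤+ z≤n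

0≤-∑ : ∀ {A : Set} (xs : List A) {f : A -> ℤ} -> (∀ {x} -> x ∈ xs -> 0≤ f x) -> 0≤ ∑ xs f
0≤-∑ [] h = Z.+≤+ z≤n
0≤-∑ (x ∷ xs) h = 0≤-+ (h (here refl)) (0≤-∑ xs (h ∘ there))

0≤-÷ : ∀ c {x} -> 0≤ (pos (suc c) * x) -> 0≤ x
0≤-÷ c {pos x} h = Z.+≤+ z≤n
0≤-÷ c { -[1+ x ]} ()

LX : ℕ -> Set
LX n = List (ℤ × Sym n)

ev : ∀ {n} -> LX n -> (Sym n -> ℤ) -> ℤ
ev X g = ∑ X (\ cσ -> fst cσ * g (snd cσ))

ev-cong : ∀ {n} (X : LX n) {g h} -> (∀ σ -> g σ ≡ h σ) -> ev X g ≡ ev X h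
ev-cong X e = ∑-cong X (\ cσ -> cong (fst cσ *_) (e (snd cσ)))

ev-* : ∀ {n} (X : LX n) c g -> ev X (\ σ -> c * g σ) ≡ c * ev X g
ev-* X c g = trans (∑-cong X (\ cσ -> r (fst cσ) c (g (snd cσ)))) (∑-* X c _)
  where r : ∀ a b c -> a * (b * c) ≡ b * (a * c)
        r = solve-∀

ev-∑ : ∀ {n} (X : LX n) {A : Set} (xs : List A) (g : A -> Sym n -> ℤ) -> ev X (\ σ -> ∑ xs (\ a -> g a σ)) ≡ ∑ xs (\ a -> ev X (g a))
ev-∑ X xs g = trans (∑-cong X (\ cσ -> sym (∑-* xs (fst cσ) (\ a -> g a (snd cσ))))) (∑-swap X xs (\ cσ a -> fst cσ * g a (snd cσ)))

quad : ∀ {n} -> LX n -> (Sym n -> ℤ) -> ℤ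
quad X Φ = ev X (\ σ -> ev X (\ τ -> Φ (σ ⨾ flip τ)))

quad-cong : ∀ {n} (X : LX n) {Φ Ψ : Sym n -> ℤ} -> (∀ ρ -> Φ ρ ≡ Ψ ρ) -> quad X Φ ≡ quad X Ψ
quad-cong X e = ev-cong X (\ σ -> ev-cong X (\ τ -> e _))

quad-* : ∀ {n} (X : LX n) c Φ -> quad X (\ ρ -> c * Φ ρ) ≡ c * quad X Φ
quad-* X c Φ = trans (ev-cong X (\ σ -> ev-* X c (\ τ -> Φ (σ ⨾ flip τ)))) (ev-* X c (\ σ -> ev X (\ τ -> Φ (σ ⨾ flip τ))))

ev-+ : ∀ {n} (X : LX n) g h -> ev X (\ σ -> g σ + h σ) ≡ ev X g + ev X h
ev-+ X g h = trans (∑-cong X (\ cσ -> *-distribˡ-+ (fst cσ) (g (snd cσ)) (h (snd cσ)))) (∑-+ X _ _)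

quad-+ : ∀ {n} (X : LX n) Φ Ψ -> quad X (\ ρ -> Φ ρ + Ψ ρ) ≡ quad X Φ + quad X Ψ
quad-+ X Φ Ψ = trans (ev-cong X (\ σ -> ev-+ X (\ τ -> Φ (σ ⨾ flip τ)) (\ τ -> Ψ (σ ⨾ flip τ)))) (ev-+ X _ _)

quad-∑ : ∀ {n} (X : LX n) {A : Set} (xs : List A) (Φ : A -> Sym n -> ℤ) -> quad X (\ ρ -> ∑ xs (\ a -> Φ a ρ)) ≡ ∑ xs (\ a -> quad X (Φ a))
quad-∑ X xs Φ = trans (ev-cong X (\ σ -> ev-∑ X xs (\ a τ -> Φ a (σ ⨾ flip τ)))) (ev-∑ X xs (\ a σ -> ev X (\ τ -> Φ a (σ ⨾ flip τ))))

quad-pos : ∀ {n} (X : LX n) {Φ : Sym n -> ℤ} -> Gram Φ -> 0≤ quad X Φ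
quad-pos X {Φ} G = 0≤-÷ (scale G) (subst 0≤_ (sym eq) (0≤-∑ (vecs G) (\ {g} _ -> 0≤-sq (ev X g))))
  where
  eq : pos (suc (scale G)) * quad X Φ ≡ ∑ (vecs G) (\ g -> ev X g * ev X g)
  eq = begin
    pos (suc (scale G)) * quad X Φ ≡⟨ sym (quad-* X (pos (suc (scale G))) Φ) ⟩
    ev X (\ σ -> ev X (\ τ -> pos (suc (scale G)) * Φ (σ ⨾ flip τ))) ≡⟨ ev-cong X (\ σ -> ev-cong X (\ τ -> gram G σ τ)) ⟩
    ev X (\ σ -> ev X (\ τ -> ∑ (vecs G) (\ g -> g σ * g τ))) ≡⟨ ev-cong X (\ σ -> trans (ev-∑ X (vecs G) (\ g τ -> g σ * g τ)) (∑-cong (vecs G) (\ g -> trans (ev-* X (g σ) g) (Z.*-comm (g σ) (ev X g))))) ⟩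
    ev X (\ σ -> ∑ (vecs G) (\ g -> ev X g * g σ)) ≡⟨ trans (ev-∑ X (vecs G) (\ g σ -> ev X g * g σ)) (∑-cong (vecs G) (\ g -> ev-* X (ev X g) g)) ⟩
    ∑ (vecs G) (\ g -> ev X g * ev X g) ∎

module _ {n : ℕ} where
  private F = allFin n

  𝕋 : (Sym n -> ℤ) -> Sym n -> ℤ
  𝕋 g σ = ∑ F (\ x -> ∑ F (\ y -> g (transpose x y ⨾ σ)))

  tl : ℤ -> LX n -> LX n
  tl e = concatMap (\ cσ -> ((- e) * fst cσ , snd cσ) ∷ concatMap (\ x -> map (\ y -> fst cσ , transpose x y ⨾ snd cσ) F) F)

  ev-tl : ∀ e X g -> ev (tl e X) g ≡ ev X (\ σ -> 𝕋 g σ - e * g σ)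
  ev-tl e X g = trans (concat-∑ h X f) (∑-cong X pt)
    where
    f : ℤ × Sym n -> ℤ
    f cσ = fst cσ * g (snd cσ)
    h : ℤ × Sym n -> LX n
    h cσ = ((- e) * fst cσ , snd cσ) ∷ concatMap (\ x -> map (\ y -> fst cσ , transpose x y ⨾ snd cσ) F) F
    r : ∀ e c s t -> (- e) * c * s + c * t ≡ c * (t - e * s)
    r = solve-∀
    pt : ∀ cσ -> ∑ (h cσ) f ≡ fst cσ * (𝕋 g (snd cσ) - e * g (snd cσ))
    pt (c , σ) = trans (cong ((- e) * c * g σ +_) (trans (concat-∑ (\ x -> map (\ y -> c , transpose x y ⨾ σ) F) F f)
        (trans (∑-cong F (\ x -> trans (∑-map (\ y -> c , transpose x y ⨾ σ) F f) (∑-* F c (\ y -> g (transpose x y ⨾ σ))))) (∑-* F c (\ x -> ∑ F (\ y -> g (transpose x y ⨾ σ)))))))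
      (r e c (g σ) (𝕋 g σ))

  evl : ∀ {N} -> Vec ℕ N -> ℤ
  evl {N} ζ = qs ζ - Q₀ N - (pos 2 * pos N - pos 2) * pos n

  chT₁ : ∀ {N} (ζ : Vec ℕ N) (σ τ : Sym n) -> 𝕋 (\ σ -> ch (σ ⨾ flip τ) ζ) σ ≡ evl ζ * ch (σ ⨾ flip τ) ζ
  chT₁ ζ σ τ = trans (∑-cong F (\ x -> ∑-cong F (\ y -> ch-≈ {ρ = (transpose x y ⨾ σ) ⨾ flip τ} {transpose x y ⨾ (σ ⨾ flip τ)} (\ z -> refl) ζ))) (transpose-sum (σ ⨾ flip τ) ζ)

  chT₂ : ∀ {N} (ζ : Vec ℕ N) (σ τ : Sym n) -> 𝕋 (\ τ -> ch (σ ⨾ flip τ) ζ) τ ≡ evl ζ * ch (σ ⨾ flip τ) ζ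
  chT₂ ζ σ τ = trans (∑-cong F (\ x -> ∑-cong F (\ y -> ch-conj (transpose y x ⨾ (σ ⨾ flip τ)) (σ ⨾ flip (transpose x y ⨾ τ)) (transpose y x) (\ z -> refl) ζ)))
    (trans (∑-swap F F (\ x y -> ch (transpose y x ⨾ (σ ⨾ flip τ)) ζ)) (transpose-sum (σ ⨾ flip τ) ζ))

  -- The group algebra counterpart of `Gram-kill`: here the element is multiplied by T - e instead
  -- of the function, and the form at ζ changes by the square of the eigenvalue difference.
  quad-tl : ∀ e X {N} (ζ : Vec ℕ N) -> quad (tl e X) (\ ρ -> ch ρ ζ) ≡ (evl ζ - e) * (evl ζ - e) * quad X (\ ρ -> ch ρ ζ)
  quad-tl e X ζ = begin
    ev (tl e X) (\ σ -> ev (tl e X) (K σ))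
      ≡⟨ ev-cong (tl e X) (\ σ -> trans (ev-tl e X (K σ)) (trans (ev-cong X (\ τ -> trans (cong (_- e * K σ τ) (chT₂ ζ σ τ)) (r v e (K σ τ)))) (ev-* X (v - e) (K σ)))) ⟩
    ev (tl e X) (\ σ -> (v - e) * ev X (K σ))
      ≡⟨ ev-* (tl e X) (v - e) (\ σ -> ev X (K σ)) ⟩
    (v - e) * ev (tl e X) (\ σ -> ev X (K σ))
      ≡⟨ cong ((v - e) *_) (trans (ev-tl e X (\ σ -> ev X (K σ))) (trans (ev-cong X pt) (ev-* X (v - e) (\ σ -> ev X (K σ))))) ⟩
    (v - e) * ((v - e) * quad X (\ ρ -> ch ρ ζ))
      ≡⟨ sym (Z.*-assoc (v - e) (v - e) _) ⟩
    (v - e) * (v - e) * quad X (\ ρ -> ch ρ ζ) ∎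
    where
    v = evl ζ
    K : Sym n -> Sym n -> ℤ
    K σ τ = ch (σ ⨾ flip τ) ζ
    r : ∀ v e k -> v * k - e * k ≡ (v - e) * k
    r = solve-∀
    TX : ∀ σ -> 𝕋 (\ σ -> ev X (K σ)) σ ≡ v * ev X (K σ)
    TX σ = begin
      ∑ F (\ x -> ∑ F (\ y -> ev X (K (transpose x y ⨾ σ)))) ≡⟨ ∑-cong F (\ x -> sym (ev-∑ X F (\ y -> K (transpose x y ⨾ σ)))) ⟩
      ∑ F (\ x -> ev X (\ τ -> ∑ F (\ y -> K (transpose x y ⨾ σ) τ))) ≡⟨ sym (ev-∑ X F (\ x τ -> ∑ F (\ y -> K (transpose x y ⨾ σ) τ))) ⟩
      ev X (\ τ -> 𝕋 (\ σ -> K σ τ) σ) ≡⟨ ev-cong X (\ τ -> chT₁ ζ σ τ) ⟩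
      ev X (\ τ -> v * K σ τ) ≡⟨ ev-* X v (K σ) ⟩
      v * ev X (K σ) ∎
    pt : ∀ σ -> 𝕋 (\ σ -> ev X (K σ)) σ - e * ev X (K σ) ≡ (v - e) * ev X (K σ)
    pt σ = trans (cong (_- e * ev X (K σ)) (TX σ)) (r v e (ev X (K σ)))

  wsq : ∀ {N} -> List (Vec ℕ N) -> Vec ℕ N -> ℤ
  wsq [] ζ = 1ℤ
  wsq (e ∷ es) ζ = (evl ζ - evl e) * (evl ζ - evl e) * wsq es ζ

  tls : ∀ {N} -> List (Vec ℕ N) -> LX n -> LX n
  tls [] X = X
  tls (e ∷ es) X = tl (evl e) (tls es X)

  quad-tls : ∀ {N} es X (ζ : Vec ℕ N) -> quad (tls es X) (\ ρ -> ch ρ ζ) ≡ wsq es ζ * quad X (\ ρ -> ch ρ ζ)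
  quad-tls [] X ζ = sym (Z.*-identityˡ _)
  quad-tls (e ∷ es) X ζ = trans (quad-tl (evl e) (tls es X) ζ) (trans (cong ((evl ζ - evl e) * (evl ζ - evl e) *_) (quad-tls es X ζ)) (sym (Z.*-assoc ((evl ζ - evl e) * (evl ζ - evl e)) (wsq es ζ) _)))

  wsq-zero : ∀ {N} (es : List (Vec ℕ N)) {ζ} -> ζ ∈ es -> wsq es ζ ≡ 0ℤ
  wsq-zero (e ∷ es) {ζ} (here refl) = cong (\ t -> t * t * wsq es ζ) (Z.+-inverseʳ (evl ζ))
  wsq-zero (e ∷ es) {ζ} (there m) = trans (cong ((evl ζ - evl e) * (evl ζ - evl e) *_) (wsq-zero es m)) (*-zeroʳ ((evl ζ - evl e) * (evl ζ - evl e)))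

  evl-inj : ∀ {N} {a b : Vec ℕ N} -> evl a ≡ evl b -> qs a ≡ qs b
  evl-inj {N} {a} {b} q = cancelʳ (- Q₀ N) (qs a) (qs b) (cancelʳ (- ((pos 2 * pos N - pos 2) * pos n)) (qs a - Q₀ N) (qs b - Q₀ N) q)

  wsq-pos : ∀ {N} (es : List (Vec ℕ N)) {ζ} -> All (\ e -> qs e ≢ qs ζ) es -> ∃[ c ] wsq es ζ ≡ pos (suc c)
  wsq-pos [] [] = 0 , refl
  wsq-pos (e ∷ es) {ζ} (ne ∷ nes) with wsq-pos es nes | evl ζ - evl e in eq
  ... | c , p | pos zero = ⊥-elim (ne (sym (evl-inj {a = ζ} {e} (Z.i-j≡0⇒i≡j (evl ζ) (evl e) eq))))
  ... | c , p | pos (suc k) = _ , trans (cong (pos (suc k) * pos (suc k) *_) p) (sym (Z.pos-* (suc (k N.+ k N.* suc k)) (suc c)))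
  ... | c , p | -[1+ k ] = _ , trans (cong (pos (suc k) * pos (suc k) *_) p) (sym (Z.pos-* (suc (k N.+ k N.* suc k)) (suc c)))

typ-lift₀ : ∀ {n} (ρ : Sym n) -> typ (lift₀ ρ) ↭ 0 ∷ typ ρ
typ-lift₀ {n} ρ = let (cs , a , s) = cycles ρ in
  ↭-trans (typ-cyc (lift₀ ρ) {(Fin.zero , []) ∷ map (mapC Fin.suc) cs} (refl ∷ cyc-map Fin.suc (\ x -> refl) cs a
    , ↭-trans (↭.prep Fin.zero (↭-trans (↭-reflexive (supp-mapC Fin.suc cs)) (↭ₚ.map⁺ Fin.suc s))) (↭-reflexive (sym (allFin-suc n)))))
  (↭-reflexive (cong (0 ∷_) (lens-mapC Fin.suc cs)))

liftX : ∀ {n} -> LX n -> LX (suc n)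
liftX = map (\ cσ -> fst cσ , lift₀ (snd cσ))

Anti-∑ : ∀ {N} {A : Set} (xs : List A) {f : A -> V N} -> (∀ x -> Anti (f x)) -> Anti (\ β -> ∑ xs (\ x -> f x β))
Anti-∑ [] h = Anti-0
Anti-∑ (x ∷ xs) h = Anti-+ (h x) (Anti-∑ xs h)

quadV : ∀ {n} -> LX n -> ∀ {N} -> V N
quadV X β = quad X (\ ρ -> ch ρ β)

Anti-quadV : ∀ {n} (X : LX n) {N} -> Anti (quadV X {N})
Anti-quadV X = Anti-∑ X (\ cσ -> Anti-* (fst cσ) (Anti-∑ X (\ cτ -> Anti-* (fst cτ) (Anti-alt (sucs (typ (snd cσ ⨾ flip (snd cτ))))))))

P-ev : ∀ k {n} (X : LX n) {N} (A : Sym n -> V N) γ -> P k (\ β -> ev X (\ σ -> A σ β)) γ ≡ ev X (\ σ -> P k (A σ) γ)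
P-ev k X A γ = trans (l-∑ (Lin-P k) X (\ cσ β -> fst cσ * A (snd cσ) β) γ) (∑-cong X (\ cσ -> P-* k (fst cσ) (A (snd cσ)) γ))

-- Letting permutations act on one more, fixed point adds a part 1 to every cycle type: restriction
-- of characters is dual to multiplication by p₁.
quad-lift : ∀ {n} (X : LX n) {N} (ζ : Vec ℕ N) -> quadV (liftX X) ζ ≡ P 1 (quadV X) ζ
quad-lift X ζ = trans (∑-map _ X _) (trans (∑-cong X (\ cσ -> cong (fst cσ *_) (trans (∑-map _ X _) (ev-cong X (\ τ ->
    trans (ch-≈ {ρ = lift₀ (snd cσ) ⨾ flip (lift₀ τ)} {lift₀ (snd cσ ⨾ flip τ)} (\ { Fin.zero -> refl ; (Fin.suc z) -> refl }) ζ) (alt-↭ (typ-lift₀ (snd cσ ⨾ flip τ)) ζ))))))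
  (sym (trans (P-ev 1 X (\ σ β -> ev X (\ τ -> ch (σ ⨾ flip τ) β)) ζ) (ev-cong X (\ σ -> P-ev 1 X (\ τ -> ch (σ ⨾ flip τ)) ζ)))))

downs : ∀ {N} -> Vec ℕ N -> List (Vec ℕ N)
downs Vec.[] = []
downs (zero Vec.∷ γ) = map (zero Vec.∷_) (downs γ)
downs (suc c Vec.∷ γ) = (c Vec.∷ γ) ∷ map (suc c Vec.∷_) (downs γ)

P1-downs : ∀ {N} (A : V N) γ -> P 1 A γ ≡ ∑ (downs γ) A
P1-downs A Vec.[] = refl
P1-downs A (zero Vec.∷ γ) = trans (+-identityˡ _) (trans (P1-downs _ γ) (sym (∑-map (zero Vec.∷_) (downs γ) A)))
P1-downs A (suc c Vec.∷ γ) = cong (A (c Vec.∷ γ) +_) (trans (P1-downs _ γ) (sym (∑-map (suc c Vec.∷_) (downs γ) A)))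

downs-Bump : ∀ {N} (γ : Vec ℕ N) {γ⁻} -> γ⁻ ∈ downs γ -> Bump γ⁻ γ
downs-Bump (zero Vec.∷ γ) m with ∈-map⁻ (zero Vec.∷_) m
... | γ⁻ , m' , refl = there (downs-Bump γ m')
downs-Bump (suc c Vec.∷ γ) (here refl) = here
downs-Bump (suc c Vec.∷ γ) (there m) with ∈-map⁻ (suc c Vec.∷_) m
... | γ⁻ , m' , refl = there (downs-Bump γ m')

Bump-downs : ∀ {N} {γ⁻ γ : Vec ℕ N} -> Bump γ⁻ γ -> γ⁻ ∈ downs γ
Bump-downs here = here refl
Bump-downs (there {c = zero} b) = ∈-map⁺ (zero Vec.∷_) (Bump-downs b)
Bump-downs (there {c = suc c} b) = there (∈-map⁺ (suc c Vec.∷_) (Bump-downs b))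

Bump-bumps : ∀ {N} {γ γ' : Vec ℕ N} -> Bump γ γ' -> γ' ∈ bumps γ
Bump-bumps here = here refl
Bump-bumps (there {c = c} b) = there (∈-map⁺ (c Vec.∷_) (Bump-bumps b))

Bump-Str : ∀ {N} lo {γ⁻ γ : Vec ℕ N} -> Bump γ⁻ γ -> Str (suc lo) γ -> ∀ {A : V (suc N)} -> Anti A -> Str lo (lo Vec.∷ γ⁻) ⊎ A (lo Vec.∷ γ⁻) ≡ 0ℤ
Bump-Str lo (here {c = c} {γ}) (s≤s l , s) {A} h with N.m≤n⇒m<n∨m≡n l
... | inj₁ lt = inj₁ (N.≤-refl , lt , Str-mono (N.n≤1+n _) s)
... | inj₂ refl = inj₂ (x≡-x⇒x≡0 _ (fst h lo lo γ))
Bump-Str lo (there {c = c} b) (l , s) {A} h with Bump-Str c b s {A = \ β -> A (lo Vec.∷ β)} (snd h lo)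
... | inj₁ (_ , s') = inj₁ (N.≤-refl , l , s')
... | inj₂ z = inj₂ z

Bump-Str₀ : ∀ {N} {γ⁻ γ : Vec ℕ N} -> Bump γ⁻ γ -> Str 0 γ -> ∀ {A : V N} -> Anti A -> Str 0 γ⁻ ⊎ A γ⁻ ≡ 0ℤ
Bump-Str₀ here (l , s) h = inj₁ (z≤n , Str-mono (N.n≤1+n _) s)
Bump-Str₀ (there {c = c} b) (l , s) {A} h with Bump-Str c b s {A = A} h
... | inj₁ (_ , s') = inj₁ (l , s')
... | inj₂ z = inj₂ z

-- The substitute for a primitive idempotent: on shapes of any size in N rows, the quadratic form of
-- `zX` is a positive multiple of the indicator of η.
record Zη (n : ℕ) {N : ℕ} (η : Vec ℕ N) : Set where
  field
    zX : LX n
    z-off : ∀ ζ -> Str 0 ζ -> ζ ≢ η -> quadV zX ζ ≡ 0ℤ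
    zc : ℕ
    z-on : quadV zX η ≡ pos (suc zc)
open Zη public

van-strict : ∀ {N} (ζ : Vec ℕ N) -> Str 0 ζ -> ζ ≢ δ 0 N -> van ζ ≡ 0ℤ
van-strict ζ s ne = Hom-van ζ (\ e -> ne (Str-≡δ 0 ζ s e))

module _ {N : ℕ} (A : V N) (η : Vec ℕ N) {c : ℕ} (on : A η ≡ pos (suc c)) where
  private
    _≟ᵥ_ = Vecₚ.≡-dec {n = N} N._≟_

  count : ∀ L -> (∀ {ζ} -> ζ ∈ L -> ζ ≢ η -> A ζ ≡ 0ℤ) -> ∃[ k ] ∑ L A ≡ pos k
  count₁ : ∀ z L -> (∀ {ζ} -> ζ ∈ z ∷ L -> ζ ≢ η -> A ζ ≡ 0ℤ) -> Dec (z ≡ η) -> (∃[ k ] ∑ L A ≡ pos k) -> ∃[ k ] ∑ (z ∷ L) A ≡ pos k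
  count [] h = 0 , refl
  count (z ∷ L) h = count₁ z L h (z ≟ᵥ η) (count L (h ∘ there))
  count₁ z L h (yes e) (k , q) = suc c N.+ k , cong₂ _+_ (trans (cong A e) on) q
  count₁ z L h (no ne) (k , q) = k , trans (cong₂ _+_ (h (here refl) ne) q) (+-identityˡ _)

  count-pos : ∀ L -> η ∈ L -> (∀ {ζ} -> ζ ∈ L -> ζ ≢ η -> A ζ ≡ 0ℤ) -> ∃[ k ] ∑ L A ≡ pos (suc k)
  count-pos₁ : ∀ z L -> (∀ {ζ} -> ζ ∈ z ∷ L -> ζ ≢ η -> A ζ ≡ 0ℤ) -> Dec (z ≡ η) -> (∃[ k ] ∑ L A ≡ pos (suc k)) -> ∃[ k ] ∑ (z ∷ L) A ≡ pos (suc k)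
  count-pos (z ∷ L) (here e)  h = let (k , q) = count L (h ∘ there) in c N.+ k , cong₂ _+_ (trans (cong A (sym e)) on) q
  count-pos (z ∷ L) (there m) h = count-pos₁ z L h (z ≟ᵥ η) (count-pos L m (h ∘ there))
  count-pos₁ z L h (yes e) (k , q) = c N.+ suc k , cong₂ _+_ (trans (cong A e) on) q
  count-pos₁ z L h (no ne) (k , q) = k , trans (cong₂ _+_ (h (here refl) ne) q) (+-identityˡ _)

∈-shift⁻ : ∀ {A : Set} {x y : A} pre post -> x ∈ pre ++ y ∷ post -> x ≢ y -> x ∈ pre ++ post
∈-shift⁻ pre post m ne with ↭ₚ.∈-resp-↭ (↭ₚ.shift _ pre post) m
... | here q = ⊥-elim (ne q)
... | there m' = m'

δ-≢ : ∀ {N n} {η : Vec ℕ N} -> sumV η ≡ suc n N.+ tri N -> η ≢ δ 0 N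
δ-≢ {N} {n} e q = N.<-irrefl (trans (sym (cong sumV q)) e) (s≤s (N.m≤n+m (tri N) n))

-- The element for η with one box removed is lifted. By `P1-downs` the lifted form is 0 except at
-- shapes that arise by adding a box, and it is positive at η; squares annihilate the other
-- additions.
zη : ∀ n {N} (η : Vec ℕ N) -> Str 0 η -> sumV η ≡ n N.+ tri N -> Zη n η
zη zero {N} η s e = subst (Zη 0) (sym (Str-≡δ 0 η s e)) (record { zX = (1ℤ , Perm.id) ∷ [] ; z-off = \ ζ s ne -> trans (r (van ζ)) (van-strict ζ s ne) ; zc = 0 ; z-on = trans (r (van (δ 0 N))) (van-δ N) })
  where
  r : ∀ x -> 1ℤ * (1ℤ * x + 0ℤ) + 0ℤ ≡ x
  r = solve-∀
zη (suc n) {N} η s e = record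
  { zX = tls others (liftX X⁻)
  ; z-off = offp
  ; zc = fst onp
  ; z-on = snd onp }
  where
  ub = unbump 0 η s (δ-≢ e)
  η⁻ = fst ub
  s⁻ = fst (snd ub)
  bp = snd (snd ub)
  rec = zη n η⁻ s⁻ (N.suc-injective (trans (sym (Bump-sum bp)) e))
  X⁻ = zX rec
  sp = bump-split 0 s⁻ bp
  others = fst sp ++ fst (snd sp)
  eqb : bumps η⁻ ≡ fst sp ++ η ∷ fst (snd sp)
  eqb = fst (snd (snd sp))
  nes : All (\ b' -> qs b' ≢ qs η) others
  nes = snd (snd (snd sp))
  A : V N
  A = quadV X⁻
  term : ∀ ζ -> Str 0 ζ -> ∀ {ζ⁻} -> ζ⁻ ∈ downs ζ -> ζ⁻ ≢ η⁻ -> A ζ⁻ ≡ 0ℤ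
  term ζ sζ {ζ⁻} m ne = Sum.[ (\ s' -> z-off rec ζ⁻ s' ne) , id ]′ (Bump-Str₀ (downs-Bump ζ m) sζ {A = A} (Anti-quadV X⁻))
  lift0 : ∀ ζ -> Str 0 ζ -> ¬ (ζ ∈ bumps η⁻) -> quadV (liftX X⁻) ζ ≡ 0ℤ
  lift0 ζ sζ nm = trans (quad-lift X⁻ ζ) (trans (P1-downs A ζ) (trans (∑-cong-∈ (downs ζ) {g = \ _ -> 0ℤ} (\ m -> term ζ sζ m (\ q -> nm (Bump-bumps (subst (\ t -> Bump t ζ) q (downs-Bump ζ m)))))) (∑-0 (downs ζ))))
  offp : ∀ ζ -> Str 0 ζ -> ζ ≢ η -> quadV (tls others (liftX X⁻)) ζ ≡ 0ℤ
  offd : ∀ ζ -> Str 0 ζ -> ζ ≢ η -> Dec (ζ ∈ bumps η⁻) -> quadV (tls others (liftX X⁻)) ζ ≡ 0ℤ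
  offp ζ sζ ne = offd ζ sζ ne (ζ ∈? bumps η⁻)
    where open import Data.List.Membership.DecPropositional (Vecₚ.≡-dec N._≟_) using (_∈?_)
  offd ζ sζ ne (no nm) = trans (quad-tls others (liftX X⁻) ζ) (trans (cong (wsq others ζ *_) (lift0 ζ sζ nm)) (*-zeroʳ (wsq others ζ)))
  offd ζ sζ ne (yes m) = trans (quad-tls others (liftX X⁻) ζ) (cong (_* quadV (liftX X⁻) ζ) (wsq-zero others (∈-shift⁻ (fst sp) (fst (snd sp)) (subst (ζ ∈_) eqb m) ne)))
  liftη : ∃[ k ] quadV (liftX X⁻) η ≡ pos (suc k)
  liftη = let (k , q) = count-pos A η⁻ (z-on rec) (downs η) (Bump-downs bp) (\ m -> term η s m) in k , trans (quad-lift X⁻ η) (trans (P1-downs A η) q)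
  onp : ∃[ c ] quadV (tls others (liftX X⁻)) η ≡ pos (suc c)
  onp = let (w , wq) = wsq-pos others nes ; (k , q) = liftη in _ , trans (quad-tls others (liftX X⁻) η) (trans (cong₂ _*_ wq q) (sym (Z.pos-* (suc w) (suc k))))

-- Products of Schur-positive functions

_⊕_ : ∀ {m k} -> Sym m -> Sym k -> Sym (m N.+ k)
_⊕_ {m} {k} σ π = Perm.permutation (go (σ ▸_) (π ▸_)) (go (σ ◂_) (π ◂_))
    (\ z -> inv (σ ◂_) (π ◂_) (σ ▸_) (π ▸_) (\ _ -> inverseʳ σ) (\ _ -> inverseʳ π) z)
    (\ z -> inv (σ ▸_) (π ▸_) (σ ◂_) (π ◂_) (\ _ -> inverseˡ σ) (\ _ -> inverseˡ π) z)
  where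
  go : (Fin m -> Fin m) -> (Fin k -> Fin k) -> Fin (m N.+ k) -> Fin (m N.+ k)
  go f g z = joinF m k (Sum.map f g (splitAt m z))
  inv : ∀ f g f' g' -> (∀ x -> f' (f x) ≡ x) -> (∀ y -> g' (g y) ≡ y) -> ∀ z -> go f' g' (go f g z) ≡ z
  inv f g f' g' e e' z = trans (cong (\ t -> joinF m k (Sum.map f' g' t)) (Finₚ.splitAt-join m k (Sum.map f g (splitAt m z))))
      (trans (cong (joinF m k) (cc (splitAt m z))) (Finₚ.join-splitAt m k z))
    where cc : ∀ s -> Sum.map f' g' (Sum.map f g s) ≡ s
          cc (inj₁ x) = cong inj₁ (e x)
          cc (inj₂ y) = cong inj₂ (e' y)

⊕-div : ∀ {m k} (σ σ' : Sym m) (π π' : Sym k) -> (σ ⊕ π) ⨾ flip (σ' ⊕ π') ≈ (σ ⨾ flip σ') ⊕ (π ⨾ flip π')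
⊕-div {m} {k} σ σ' π π' z = trans (cong (\ t -> joinF m k (Sum.map (σ' ◂_) (π' ◂_) t)) (Finₚ.splitAt-join m k (Sum.map (σ ▸_) (π ▸_) (splitAt m z)))) (cong (joinF m k) (cc (splitAt m z)))
  where cc : ∀ s -> Sum.map (σ' ◂_) (π' ◂_) (Sum.map (σ ▸_) (π ▸_) s) ≡ Sum.map ((σ ⨾ flip σ') ▸_) ((π ⨾ flip π') ▸_) s
        cc (inj₁ x) = refl
        cc (inj₂ y) = refl

allFin-+ : ∀ m k -> map (_↑ˡ k) (allFin m) ++ map (m ↑ʳ_) (allFin k) ↭ allFin (m N.+ k)
allFin-+ m k = ↭-from-⊆ _ _ (Uₚ.++⁺ (Uₚ.map⁺ (\ {x} {y} -> Finₚ.↑ˡ-injective k x y) (allFin⁺ m)) (Uₚ.map⁺ (\ {x} {y} -> Finₚ.↑ʳ-injective m x y) (allFin⁺ k)) disj) (allFin⁺ _)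
  (\ {x} _ -> ∈-allFin x) (\ {z} _ -> mem z (splitAt m z) (Finₚ.join-splitAt m k z))
  where
  open import Data.List.Membership.Propositional.Properties using (∈-map⁻)
  no-both : ∀ x y -> x ↑ˡ k ≡ m ↑ʳ y -> ⊥
  no-both x y e with trans (sym (Finₚ.splitAt-↑ˡ m x k)) (trans (cong (splitAt m) e) (Finₚ.splitAt-↑ʳ m k y))
  ... | ()
  disj : ∀ {z} -> z ∈ map (_↑ˡ k) (allFin m) × z ∈ map (m ↑ʳ_) (allFin k) -> ⊥
  disj (p , q) = let (x , _ , e) = ∈-map⁻ (_↑ˡ k) p ; (y , _ , e') = ∈-map⁻ (m ↑ʳ_) q in no-both x y (trans (sym e) e')
  mem : ∀ z s -> joinF m k s ≡ z -> z ∈ map (_↑ˡ k) (allFin m) ++ map (m ↑ʳ_) (allFin k)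
  mem z (inj₁ x) e = subst (_∈ _) e (∈-++⁺ˡ (∈-map⁺ (_↑ˡ k) (∈-allFin x)))
  mem z (inj₂ y) e = subst (_∈ _) e (∈-++⁺ʳ (map (_↑ˡ k) (allFin m)) (∈-map⁺ (m ↑ʳ_) (∈-allFin y)))

supp-++ : ∀ {n} (cs cs' : List (Cy {n})) -> supp (cs ++ cs') ≡ supp cs ++ supp cs'
supp-++ cs cs' = Lₚ.concatMap-++ toL cs cs'

typ-⊕ : ∀ {m k} (σ : Sym m) (π : Sym k) -> typ (σ ⊕ π) ↭ typ σ ++ typ π
typ-⊕ {m} {k} σ π = let (cs , a , s) = cycles σ ; (cs' , a' , s') = cycles π
                        L = map (mapC (_↑ˡ k)) cs ; R = map (mapC (m ↑ʳ_)) cs' in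
  ↭-trans (typ-cyc (σ ⊕ π) {L ++ R}
      ( Allₚ.++⁺ (cyc-map (_↑ˡ k) (\ x -> cong (\ t -> joinF m k (Sum.map (σ ▸_) (π ▸_) t)) (Finₚ.splitAt-↑ˡ m x k)) cs a)
                 (cyc-map (m ↑ʳ_) (\ x -> cong (\ t -> joinF m k (Sum.map (σ ▸_) (π ▸_) t)) (Finₚ.splitAt-↑ʳ m k x)) cs' a')
      , ↭-trans (↭-reflexive (trans (supp-++ L R) (cong₂ _++_ (supp-mapC (_↑ˡ k) cs) (supp-mapC (m ↑ʳ_) cs'))))
          (↭-trans (↭ₚ.++⁺ (↭ₚ.map⁺ (_↑ˡ k) s) (↭ₚ.map⁺ (m ↑ʳ_) s')) (allFin-+ m k))))
  (↭-reflexive (trans (Lₚ.map-++ (length ∘ snd) L R) (cong₂ _++_ (lens-mapC (_↑ˡ k) cs) (lens-mapC (m ↑ʳ_) cs'))))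

pmul : List ℕ -> ∀ {N} -> V N -> V N
pmul κ A = foldr (\ m B -> P (suc m) B) A κ

Lin-pmul : ∀ κ {N} -> Lin (pmul κ {N})
Lin-pmul [] = record { l-cong = \ e -> e ; l-+ = \ A B γ -> refl ; l-* = \ c A γ -> refl }
Lin-pmul (m ∷ κ) = record
  { l-cong = \ e -> P-cong (suc m) (l-cong L e)
  ; l-+ = \ A B γ -> trans (P-cong (suc m) (l-+ L A B) γ) (P-+ (suc m) _ _ γ)
  ; l-* = \ c A γ -> trans (P-cong (suc m) (l-* L c A) γ) (P-* (suc m) c _ γ) }
  where L = Lin-pmul κ

pmul-alt : ∀ κ κ' {N} (β : Vec ℕ N) -> pmul κ (alt (sucs κ')) β ≡ alt (sucs (κ ++ κ')) β
pmul-alt [] κ' β = refl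
pmul-alt (m ∷ κ) κ' β = P-cong (suc m) (pmul-alt κ κ') β

l-ev : ∀ {N M} {L : V N -> V M} -> Lin L -> ∀ {n} (X : LX n) (A : Sym n -> V N) γ -> L (\ β -> ev X (\ σ -> A σ β)) γ ≡ ev X (\ σ -> L (A σ) γ)
l-ev l X A γ = trans (l-∑ l X (\ cσ β -> fst cσ * A (snd cσ) β) γ) (∑-cong X (\ cσ -> l-* l (fst cσ) (A (snd cσ)) γ))

l-quad : ∀ {N M} {L : V N -> V M} -> Lin L -> ∀ {n} (X : LX n) (A : Sym n -> V N) γ -> L (\ β -> quad X (\ ρ -> A ρ β)) γ ≡ quad X (\ ρ -> L (A ρ) γ)
l-quad l X A γ = trans (l-ev l X (\ σ β -> ev X (\ τ -> A (σ ⨾ flip τ) β)) γ) (ev-cong X (\ σ -> l-ev l X (\ τ -> A (σ ⨾ flip τ)) γ))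

_⊗_ : ∀ {m k} -> LX m -> LX k -> LX (m N.+ k)
X ⊗ Y = concatMap (\ cσ -> map (\ dπ -> fst cσ * fst dπ , snd cσ ⊕ snd dπ) Y) X

ev-⊗ : ∀ {m k} (X : LX m) (Y : LX k) g -> ev (X ⊗ Y) g ≡ ev X (\ σ -> ev Y (\ π -> g (σ ⊕ π)))
ev-⊗ X Y g = trans (concat-∑ _ X _) (∑-cong X (\ cσ -> trans (∑-map _ Y _) (trans (∑-cong Y (\ dπ -> Z.*-assoc (fst cσ) (fst dπ) (g (snd cσ ⊕ snd dπ)))) (∑-* Y (fst cσ) (\ dπ -> fst dπ * g (snd cσ ⊕ snd dπ))))))

ev-swap : ∀ {m k} (X : LX m) (Y : LX k) (g : Sym m -> Sym k -> ℤ) -> ev X (\ σ -> ev Y (g σ)) ≡ ev Y (\ π -> ev X (\ σ -> g σ π))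
ev-swap X Y g = trans (ev-∑ X Y (\ dπ σ -> fst dπ * g σ (snd dπ))) (∑-cong Y (\ dπ -> ev-* X (fst dπ) (\ σ -> g σ (snd dπ))))

quad-⊗ : ∀ {m k} (X : LX m) (Y : LX k) {N} (ν : Vec ℕ N) ->
  quadV (X ⊗ Y) ν ≡ quad X (\ ρ -> quad Y (\ ρ' -> alt (sucs (typ ρ ++ typ ρ')) ν))
quad-⊗ X Y ν = begin
  ev (X ⊗ Y) (\ s -> ev (X ⊗ Y) (\ t -> ch (s ⨾ flip t) ν)) ≡⟨ ev-⊗ X Y _ ⟩
  ev X (\ σ -> ev Y (\ π -> ev (X ⊗ Y) (\ t -> ch ((σ ⊕ π) ⨾ flip t) ν)))
    ≡⟨ ev-cong X (\ σ -> ev-cong Y (\ π -> trans (ev-⊗ X Y (\ t -> ch ((σ ⊕ π) ⨾ flip t) ν)) (ev-cong X (\ σ' -> ev-cong Y (\ π' -> val σ σ' π π'))))) ⟩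
  ev X (\ σ -> ev Y (\ π -> ev X (\ σ' -> ev Y (\ π' -> K σ σ' π π'))))
    ≡⟨ ev-cong X (\ σ -> ev-swap Y X (\ π σ' -> ev Y (\ π' -> K σ σ' π π'))) ⟩
  quad X (\ ρ -> quad Y (\ ρ' -> alt (sucs (typ ρ ++ typ ρ')) ν)) ∎
  where
  K : _ -> _ -> _ -> _ -> ℤ
  K σ σ' π π' = alt (sucs (typ (σ ⨾ flip σ') ++ typ (π ⨾ flip π'))) ν
  val : ∀ σ σ' π π' -> ch ((σ ⊕ π) ⨾ flip (σ' ⊕ π')) ν ≡ K σ σ' π π'
  val σ σ' π π' = trans (ch-≈ {ρ = (σ ⊕ π) ⨾ flip (σ' ⊕ π')} {(σ ⨾ flip σ') ⊕ (π ⨾ flip π')} (⊕-div σ σ' π π') ν) (alt-↭ (typ-⊕ (σ ⨾ flip σ') (π ⨾ flip π')) ν)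

box : ∀ N -> ℕ -> List (Vec ℕ N)
box zero B = Vec.[] ∷ []
box (suc N) B = concatMap (\ x -> map (x Vec.∷_) (box N B)) (upTo (suc B))

∈-box : ∀ {N} (ζ : Vec ℕ N) B -> sumV ζ N.≤ B -> ζ ∈ box N B
∈-box Vec.[] B l = here refl
∈-box {suc N} (x Vec.∷ ζ) B l = ∈-concatMap⁺ (\ x -> map (x Vec.∷_) (box N B)) {xs = upTo (suc B)}
  (lose (∈-upTo⁺ (s≤s (N.≤-trans (N.m≤m+n x (sumV ζ)) l))) (∈-map⁺ (x Vec.∷_) (∈-box ζ B (N.≤-trans (N.m≤n+m (sumV ζ) x) l))))

Str? : ∀ {N} lo (β : Vec ℕ N) -> Dec (Str lo β)
Str? lo Vec.[] = yes tt
Str? lo (b Vec.∷ β) with lo N.≤? b | Str? (suc b) β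
... | yes p | yes q = yes (p , q)
... | no np | _ = no (np ∘ fst)
... | _ | no nq = no (nq ∘ snd)

PosV : ∀ {N} -> V N -> Set
PosV {N} A = ∀ ζ -> Str 0 ζ -> 0≤ A ζ

HomV : ∀ {N} -> ℕ -> V N -> Set
HomV {N} d A = ∀ ζ -> Str 0 ζ -> sumV ζ ≢ d N.+ tri N -> A ζ ≡ 0ℤ

record Funct {N} (L : V N -> ℤ) : Set where
  field
    f-cong : ∀ {A B} -> A ≗ᵥ B -> L A ≡ L B
    f-+ : ∀ A B -> L (\ β -> A β + B β) ≡ L A + L B
    f-* : ∀ c A -> L (\ β -> c * A β) ≡ c * L A
open Funct public

-- A nonnegative antisymmetric function is peeled off, one strict exponent at a time, by the functions quadV.
module Peel {N} (d : ℕ) {L : V N -> ℤ} (F : Funct L)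
            (h : ∀ (κ : Vec ℕ N) (s : Str 0 κ) (e : sumV κ ≡ d N.+ tri N) -> 0≤ L (quadV (zX (zη d κ s e)))) where
  private
    _≟ᵥ_ = Vecₚ.≡-dec {n = N} N._≟_

  peel : ∀ S (A : V N) -> Anti A -> PosV A -> HomV d A -> (∀ ζ -> Str 0 ζ -> ¬ (ζ ∈ S) -> A ζ ≡ 0ℤ) -> 0≤ L A
  peel₁ : ∀ κ S (A : V N) -> Anti A -> PosV A -> HomV d A -> (∀ ζ -> Str 0 ζ -> ¬ (ζ ∈ κ ∷ S) -> A ζ ≡ 0ℤ) -> Dec (Str 0 κ) -> Dec (sumV κ ≡ d N.+ tri N) -> 0≤ L A
  peel [] A a p hm v = subst 0≤_ (sym (trans (f-cong F {A} {λ β -> 0ℤ * A β} (Anti-zero a (\ β s -> v β s (\ ())))) (f-* F 0ℤ A))) (Z.+≤+ z≤n)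
  peel (κ ∷ S) A a p hm v = peel₁ κ S A a p hm v (Str? 0 κ) (sumV κ N.≟ (d N.+ tri N))
  peel₁ κ S A a p hm v (no ns) _ = peel S A a p hm (\ ζ s nm -> v ζ s (\ { (here refl) -> ns s ; (there m) -> nm m }))
  peel₁ κ S A a p hm v (yes s) (no ne) = peel S A a p hm (\ ζ s' nm -> out ζ s' nm (ζ ≟ᵥ κ))
    where
    out : ∀ ζ -> Str 0 ζ -> ¬ (ζ ∈ S) -> Dec (ζ ≡ κ) -> A ζ ≡ 0ℤ
    out ζ s' nm (yes refl) = hm ζ s' ne
    out ζ s' nm (no nk) = v ζ s' (\ { (here q) -> nk q ; (there m) -> nm m })
  peel₁ κ S A a p hm v (yes s) (yes e) = 0≤-÷ (zc Zk) (subst 0≤_ (sym eq) (0≤-+ (peel S A' a' p' hm' v') (0≤-* (p κ s) (h κ s e))))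
    where
    Zk = zη d κ s e
    B : V N
    B = quadV (zX Zk)
    C = pos (suc (zc Zk))
    -- Scaling by C, the value of B at κ, avoids division: A' is 0 at κ and C times A at every other
    -- strict vector, so it stays nonnegative with one place less in its support.
    A' : V N
    A' β = C * A β + (- A κ) * B β
    a' : Anti A'
    a' = Anti-+ (Anti-* C a) (Anti-* (- A κ) (Anti-quadV (zX Zk)))
    atκ : A' κ ≡ 0ℤ
    atκ = trans (cong (\ t -> C * A κ + (- A κ) * t) (z-on Zk)) (r C (A κ))
      where r : ∀ c a -> c * a + (- a) * c ≡ 0ℤ
            r = solve-∀
    offκ : ∀ ζ -> Str 0 ζ -> ζ ≢ κ -> A' ζ ≡ C * A ζ
    offκ ζ s' ne = trans (cong (\ t -> C * A ζ + (- A κ) * t) (z-off Zk ζ s' ne)) (r (C * A ζ) (A κ))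
      where r : ∀ x a -> x + (- a) * 0ℤ ≡ x
            r = solve-∀
    p' : PosV A'
    p' ζ s' = go (ζ ≟ᵥ κ)
      where go : Dec (ζ ≡ κ) -> 0≤ A' ζ
            go (yes q) = subst 0≤_ (sym (trans (cong A' q) atκ)) (Z.+≤+ z≤n)
            go (no ne) = subst 0≤_ (sym (offκ ζ s' ne)) (0≤-* {C} {A ζ} (Z.+≤+ z≤n) (p ζ s'))
    hm' : HomV d A'
    hm' ζ s' ns = trans (offκ ζ s' (\ q -> ns (trans (cong sumV q) e))) (trans (cong (C *_) (hm ζ s' ns)) (*-zeroʳ C))
    v' : ∀ ζ -> Str 0 ζ -> ¬ (ζ ∈ S) -> A' ζ ≡ 0ℤ
    v' ζ s' nm = go (ζ ≟ᵥ κ)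
      where go : Dec (ζ ≡ κ) -> A' ζ ≡ 0ℤ
            go (yes q) = trans (cong A' q) atκ
            go (no ne) = trans (offκ ζ s' ne) (trans (cong (C *_) (v ζ s' (\ { (here q) -> ne q ; (there m) -> nm m }))) (*-zeroʳ C))
    eq : C * L A ≡ L A' + A κ * L B
    eq = sym (trans (cong (_+ A κ * L B) (trans (f-+ F (\ β -> C * A β) (\ β -> (- A κ) * B β)) (cong₂ _+_ (f-* F C A) (f-* F (- A κ) B)))) (r (C * L A) (A κ) (L B)))
      where r : ∀ x a b -> (x + (- a) * b) + a * b ≡ x
            r = solve-∀

  functional-pos : ∀ (A : V N) -> Anti A -> PosV A -> HomV d A -> 0≤ L A
  functional-pos A a p hm = peel (box N (d N.+ tri N)) A a p hm (\ ζ s nm -> hm ζ s (\ e -> nm (∈-box ζ (d N.+ tri N) (N.≤-reflexive e))))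

-- Integer combinations of power sums p_λ; the parts of λ are listed as their predecessors.
Comb : Set
Comb = List (ℤ × List ℕ)

term : ∀ {N} -> Vec ℕ N -> ℤ × List ℕ -> ℤ
term β cκ = fst cκ * alt (sucs (snd cκ)) β

val : Comb -> ∀ {N} -> V N
val x β = ∑ x (term β)

Deg : ℕ -> Comb -> Set
Deg d x = All (\ cκ -> lsumℕ (sucs (snd cκ)) ≡ d) x

SPos : ℕ -> Comb -> Set
SPos N x = PosV (val x {N})

_⊛_ : Comb -> Comb -> Comb
x ⊛ y = concatMap (\ cκ -> map (\ dμ -> fst cκ * fst dμ , snd cκ ++ snd dμ) y) x

Anti-val : ∀ x {N} -> Anti (val x {N})
Anti-val x = Anti-∑ x (\ cκ -> Anti-* (fst cκ) (Anti-alt (sucs (snd cκ))))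

Hom-val : ∀ d x {N} -> Deg d x -> HomV {N} d (val x)
Hom-val d [] [] ζ s ne = refl
Hom-val d (cκ ∷ x) {N} (e ∷ es) ζ s ne = cong₂ _+_ (trans (cong (fst cκ *_) (Hom-alt (sucs (snd cκ)) ζ (\ q -> ne (trans q (cong (N._+ tri N) e))))) (*-zeroʳ (fst cκ))) (Hom-val d x es ζ s ne)

val-⊛ : ∀ x y {N} (ν : Vec ℕ N) -> val (x ⊛ y) ν ≡ ∑ x (\ cκ -> fst cκ * pmul (snd cκ) (val y) ν)
val-⊛ x y ν = trans (concat-∑ _ x _) (∑-cong x (\ cκ -> trans (∑-map _ y _) (trans (∑-cong y (\ dμ ->
      trans (Z.*-assoc (fst cκ) (fst dμ) _) (cong (\ t -> fst cκ * (fst dμ * t)) (sym (pmul-alt (snd cκ) (snd dμ) ν))))) (trans (∑-* y (fst cκ) (\ dμ -> fst dμ * pmul (snd cκ) (alt (sucs (snd dμ))) ν))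
    (cong (fst cκ *_) (sym (trans (l-∑ (Lin-pmul (snd cκ)) y (\ dμ β -> fst dμ * alt (sucs (snd dμ)) β) ν) (∑-cong y (\ dμ -> l-* (Lin-pmul (snd cκ)) (fst dμ) (alt (sucs (snd dμ))) ν)))))))))

-- The value of the product at ν is linear in each factor. Peeling reduces first y and then x to
-- quadratic forms of the elements `zX`; for two of these the value is the quadratic form of their
-- tensor product on the character of ν, nonnegative by `gram-ch`. Commutativity of power sums
-- (`L₁₂`) allows the change of factor.
spos-⊛ : ∀ {N m k} x y -> Deg m x -> Deg k y -> k N.+ m N.≤ N -> SPos N x -> SPos N y -> SPos N (x ⊛ y)
spos-⊛ {N} {m} {k} x y dx dy le px py ν sν = subst 0≤_ (sym (val-⊛ x y ν)) (Peel.functional-pos k F₁ step₁ (val y) (Anti-val y) py (Hom-val k y dy))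
  where
  L₁ : V N -> ℤ
  L₁ A = ∑ x (\ cκ -> fst cκ * pmul (snd cκ) A ν)
  F₁ : Funct L₁
  F₁ = record
    { f-cong = \ e -> ∑-cong x (\ cκ -> cong (fst cκ *_) (l-cong (Lin-pmul (snd cκ)) e ν))
    ; f-+ = \ A B -> trans (∑-cong x (\ cκ -> trans (cong (fst cκ *_) (l-+ (Lin-pmul (snd cκ)) A B ν)) (*-distribˡ-+ (fst cκ) _ _))) (∑-+ x _ _)
    ; f-* = \ c A -> trans (∑-cong x (\ cκ -> trans (cong (fst cκ *_) (l-* (Lin-pmul (snd cκ)) c A ν)) (r (fst cκ) c _))) (∑-* x c _) }
    where r : ∀ a c z -> a * (c * z) ≡ c * (a * z)
          r = solve-∀
  module _ (Y : LX k) where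
    L₂ : V N -> ℤ
    L₂ A = quad Y (\ ρ -> pmul (typ ρ) A ν)
    F₂ : Funct L₂
    F₂ = record
      { f-cong = \ e -> quad-cong Y (\ ρ -> l-cong (Lin-pmul (typ ρ)) e ν)
      ; f-+ = \ A B -> trans (quad-cong Y (\ ρ -> l-+ (Lin-pmul (typ ρ)) A B ν)) (quad-+ Y (\ ρ -> pmul (typ ρ) A ν) (\ ρ -> pmul (typ ρ) B ν))
      ; f-* = \ c A -> trans (quad-cong Y (\ ρ -> l-* (Lin-pmul (typ ρ)) c A ν)) (quad-* Y c (\ ρ -> pmul (typ ρ) A ν)) }
    step₂ : ∀ (η : Vec ℕ N) (s : Str 0 η) (e : sumV η ≡ m N.+ tri N) -> 0≤ L₂ (quadV (zX (zη m η s e)))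
    step₂ η s e = subst 0≤_ (trans (quad-⊗ Y Z' ν) (quad-cong Y (\ ρ -> sym (trans (l-quad (Lin-pmul (typ ρ)) Z' (\ ρ' -> ch ρ') ν) (quad-cong Z' (\ ρ' -> pmul-alt (typ ρ) (typ ρ') ν))))))
      (quad-pos (Y ⊗ Z') (gram-ch (k N.+ m) le ν sν))
      where Z' = zX (zη m η s e)
    L₁₂ : L₁ (quadV Y) ≡ L₂ (val x)
    L₁₂ = begin
      ∑ x (\ cκ -> fst cκ * pmul (snd cκ) (quadV Y) ν)
        ≡⟨ ∑-cong x (\ cκ -> trans (cong (fst cκ *_) (l-quad (Lin-pmul (snd cκ)) Y (\ ρ -> ch ρ) ν)) (sym (quad-* Y (fst cκ) (\ ρ -> pmul (snd cκ) (ch ρ) ν)))) ⟩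
      ∑ x (\ cκ -> quad Y (\ ρ -> fst cκ * pmul (snd cκ) (ch ρ) ν))
        ≡⟨ sym (quad-∑ Y x (\ cκ ρ -> fst cκ * pmul (snd cκ) (ch ρ) ν)) ⟩
      quad Y (\ ρ -> ∑ x (\ cκ -> fst cκ * pmul (snd cκ) (ch ρ) ν))
        ≡⟨ quad-cong Y (\ ρ -> ∑-cong x (\ cκ -> cong (fst cκ *_) (trans (pmul-alt (snd cκ) (typ ρ) ν) (trans (alt-↭ (↭ₚ.++-comm (snd cκ) (typ ρ)) ν) (sym (pmul-alt (typ ρ) (snd cκ) ν)))))) ⟩
      quad Y (\ ρ -> ∑ x (\ cκ -> fst cκ * pmul (typ ρ) (alt (sucs (snd cκ))) ν))
        ≡⟨ quad-cong Y (\ ρ -> sym (trans (l-∑ (Lin-pmul (typ ρ)) x (\ cκ β -> fst cκ * alt (sucs (snd cκ)) β) ν) (∑-cong x (\ cκ -> l-* (Lin-pmul (typ ρ)) (fst cκ) (alt (sucs (snd cκ))) ν)))) ⟩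
      L₂ (val x) ∎
  step₁ : ∀ (κ : Vec ℕ N) (s : Str 0 κ) (e : sumV κ ≡ k N.+ tri N) -> 0≤ L₁ (quadV (zX (zη k κ s e)))
  step₁ κ s e = subst 0≤_ (sym (L₁₂ (zX (zη k κ s e)))) (Peel.functional-pos m (F₂ (zX (zη k κ s e))) (step₂ (zX (zη k κ s e))) (val x) (Anti-val x) px (Hom-val m x dx))

-- Averages over centralisers

_≈?_ : ∀ {n} (σ τ : Sym n) -> Dec (σ ≈ τ)
σ ≈? τ = Finₚ.all? (\ i -> (σ ▸ i) Finₚ.≟ (τ ▸ i))

Resp : ∀ {n} -> (Sym n -> ℤ) -> Set
Resp {n} Φ = ∀ {σ τ : Sym n} -> σ ≈ τ -> Φ σ ≡ Φ τ

-- One permutation for each bijection up to `≈`, since permutations with equal values need not be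
-- equal as records; functions summed over it have to respect `≈`.
allP : ∀ n -> List (Sym n)
allP zero = Perm.id ∷ []
allP (suc n) = concatMap (\ j -> map (insert Fin.zero j) (allP n)) (allFin (suc n))

remove-cong : ∀ {n} i {σ τ : Sym (suc n)} -> σ ≈ τ -> remove i σ ≈ remove i τ
remove-cong i {σ} {τ} e x = Finₚ.punchIn-injective (σ ▸ i) _ _ (trans (sym (punchIn-permute σ i x)) (trans (e (punchIn i x)) (trans (punchIn-permute τ i x) (cong (\ t -> punchIn t (remove i τ ▸ x)) (sym (e i))))))

insert-cong : ∀ {n} j {σ τ : Sym n} -> σ ≈ τ -> insert Fin.zero j σ ≈ insert Fin.zero j τ
insert-cong j {σ} {τ} e Fin.zero = refl
insert-cong j {σ} {τ} e (Fin.suc x) = cong (punchIn j) (e x)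

∑-𝟙-Fin : ∀ {n} (i : Fin n) (f : Fin n -> ℤ) -> ∑ (allFin n) (\ j -> 𝟙 (j Finₚ.≟ i) * f j) ≡ f i
∑-𝟙-Fin {n} i f = let (xs , ys , e) = ∈-∃++ (∈-allFin i)
                      p : i ∷ xs ++ ys ↭ allFin n
                      p = ↭-trans (↭-sym (↭ₚ.shift i xs ys)) (↭-reflexive (sym e)) in
  trans (∑-↭ (↭-sym p) _) (trans (cong₂ _+_ (trans (cong (_* f i) (𝟙-yes (i Finₚ.≟ i) refl)) (Z.*-identityˡ (f i)))
    (trans (∑-cong-∈ (xs ++ ys) (\ {k} m -> cong (_* f k) (𝟙-no (k Finₚ.≟ i) (\ q -> nn (Unique-↭ (↭-sym p) (allFin⁺ n)) m (sym q))))) (∑-0 (xs ++ ys)))) (+-identityʳ (f i)))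
  where
  nn : ∀ {i : Fin n} {zs k} -> Unique (i ∷ zs) -> k ∈ zs -> i ≢ k
  nn (a ∷ _) m = All.lookup a m

-- The form in which it is used that every permutation occurs exactly once in `allP`.
∑-δ : ∀ {n} (τ : Sym n) (Φ : Sym n -> ℤ) -> Resp Φ -> ∑ (allP n) (\ σ -> 𝟙 (σ ≈? τ) * Φ σ) ≡ Φ τ
∑-δ {zero} τ Φ r = trans (+-identityʳ _) (trans (cong (_* Φ Perm.id) (𝟙-yes (Perm.id ≈? τ) (\ ()))) (trans (Z.*-identityˡ _) (r {Perm.id} {τ} (\ ()))))
∑-δ {suc n} τ Φ r = begin
  ∑ (concatMap (\ j -> map (ins₀ j) (allP n)) F) f
    ≡⟨ concat-∑ (\ j -> map (ins₀ j) (allP n)) F f ⟩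
  ∑ F (\ j -> ∑ (map (ins₀ j) (allP n)) f)
    ≡⟨ ∑-cong F (\ j -> ∑-map (ins₀ j) (allP n) f) ⟩
  ∑ F (\ j -> ∑ (allP n) (\ π -> 𝟙 (ins₀ j π ≈? τ) * Φ (ins₀ j π)))
    ≡⟨ ∑-cong F (\ j -> trans (∑-cong (allP n) (\ π -> trans (cong (_* Φ (ins₀ j π)) (split j π)) (Z.*-assoc (𝟙 (j Finₚ.≟ τ₀)) (𝟙 (π ≈? τ')) (Φ (ins₀ j π)))))
         (trans (∑-* (allP n) (𝟙 (j Finₚ.≟ τ₀)) (\ π -> 𝟙 (π ≈? τ') * Φ (ins₀ j π))) (cong (𝟙 (j Finₚ.≟ τ₀) *_) (∑-δ τ' (\ π -> Φ (ins₀ j π)) (\ {σ} {ρ} e -> r {ins₀ j σ} {ins₀ j ρ} (insert-cong j {σ} {ρ} e)))))) ⟩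
  ∑ F (\ j -> 𝟙 (j Finₚ.≟ τ₀) * Φ (ins₀ j τ'))
    ≡⟨ ∑-𝟙-Fin τ₀ (\ j -> Φ (ins₀ j τ')) ⟩
  Φ (ins₀ τ₀ τ')
    ≡⟨ r {ins₀ τ₀ τ'} {τ} (insert-remove Fin.zero τ) ⟩
  Φ τ ∎
  where
  F = allFin (suc n)
  ins₀ : Fin (suc n) -> Sym n -> Sym (suc n)
  ins₀ j π = insert Fin.zero j π
  f : Sym (suc n) -> ℤ
  f σ = 𝟙 (σ ≈? τ) * Φ σ
  τ₀ = τ ▸ Fin.zero
  τ' = remove Fin.zero τ
  fwd : ∀ j π -> ins₀ j π ≈ τ -> j ≡ τ₀ × π ≈ τ'
  fwd j π e = e Fin.zero , \ x -> trans (sym (remove-insert Fin.zero j π x)) (remove-cong Fin.zero {ins₀ j π} {τ} e x)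
  bwd : ∀ j π -> j ≡ τ₀ -> π ≈ τ' -> ins₀ j π ≈ τ
  bwd j π q e x = trans (cong (\ t -> ins₀ t π ▸ x) q) (trans (insert-cong τ₀ {π} {τ'} e x) (insert-remove Fin.zero τ x))
  split : ∀ j π -> 𝟙 (ins₀ j π ≈? τ) ≡ 𝟙 (j Finₚ.≟ τ₀) * 𝟙 (π ≈? τ')
  split j π = go (j Finₚ.≟ τ₀) (π ≈? τ')
    where
    go : (d : Dec (j ≡ τ₀)) (e : Dec (π ≈ τ')) -> 𝟙 (ins₀ j π ≈? τ) ≡ 𝟙 d * 𝟙 e
    go (yes p) (yes q) = 𝟙-yes (ins₀ j π ≈? τ) (bwd j π p q)
    go (yes p) (no nq) = 𝟙-no (ins₀ j π ≈? τ) (\ e -> nq (snd (fwd j π e)))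
    go (no np) e' = 𝟙-no (ins₀ j π ≈? τ) (\ e -> np (fst (fwd j π e)))

∑-reindex : ∀ {n} (f g : Sym n -> Sym n) ->
  (∀ {σ τ : Sym n} -> τ ≈ f σ -> σ ≈ g τ) -> (∀ {σ τ : Sym n} -> σ ≈ g τ -> τ ≈ f σ) -> ∀ (Φ : Sym n -> ℤ) -> Resp Φ -> ∑ (allP n) (\ σ -> Φ (f σ)) ≡ ∑ (allP n) Φ
∑-reindex {n} f g fw bw Φ r = begin
  ∑ G (\ σ -> Φ (f σ)) ≡⟨ ∑-cong G (\ σ -> sym (∑-δ (f σ) Φ r)) ⟩
  ∑ G (\ σ -> ∑ G (\ τ -> 𝟙 (τ ≈? f σ) * Φ τ)) ≡⟨ ∑-swap G G (\ σ τ -> 𝟙 (τ ≈? f σ) * Φ τ) ⟩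
  ∑ G (\ τ -> ∑ G (\ σ -> 𝟙 (τ ≈? f σ) * Φ τ)) ≡⟨ ∑-cong G (\ τ -> trans (∑-cong G (\ σ -> cong (_* Φ τ) (𝟙-⇔ (τ ≈? f σ) (σ ≈? g τ) fw bw))) (∑-δ (g τ) (\ _ -> Φ τ) (\ _ -> refl))) ⟩
  ∑ G Φ ∎
  where G = allP n

module _ {n : ℕ} where
  private
    G = allP n

    cancel-∘ : ∀ (σ τ h : Sym n) -> σ ⨾ h ≈ τ -> σ ≈ τ ⨾ flip h
    cancel-∘ σ τ h e x = trans (sym (inverseˡ h)) (cong (h ◂_) (e x))

    uncancel-∘ : ∀ (σ τ h : Sym n) -> σ ≈ τ ⨾ flip h -> σ ⨾ h ≈ τ
    uncancel-∘ σ τ h e x = trans (cong (h ▸_) (e x)) (inverseʳ h)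

  ∑-∘ : ∀ (h : Sym n) (Φ : Sym n -> ℤ) -> Resp Φ -> ∑ G (\ σ -> Φ (σ ⨾ h)) ≡ ∑ G Φ
  ∑-∘ h = ∑-reindex (_⨾ h) (_⨾ flip h) (\ {σ} {τ} e -> cancel-∘ σ τ h (\ x -> sym (e x))) (\ {σ} {τ} e x -> sym (uncancel-∘ σ τ h e x))

  Commute : Sym n -> Sym n -> Set
  Commute τ g = g ⨾ τ ≈ τ ⨾ g

  cm : Sym n -> Sym n -> ℤ
  cm τ g = 𝟙 ((g ⨾ τ) ≈? (τ ⨾ g))

  Zn : Sym n -> ℤ
  Zn τ = ∑ G (cm τ)

  Θ : (Sym n -> ℤ) -> Sym n -> ℤ
  Θ Φ τ = ∑ G (\ g -> cm τ g * Φ g)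

  Conj : Sym n -> Sym n -> Sym n -> Set
  Conj r τ h = r ⨾ h ≈ h ⨾ τ

  cj : Sym n -> Sym n -> Sym n -> ℤ
  cj r τ h = 𝟙 ((r ⨾ h) ≈? (h ⨾ τ))

  Class : (Sym n -> ℤ) -> Set
  Class Φ = ∀ r τ h -> Conj r τ h -> Φ r ≡ Φ τ

  Class⇒Resp : ∀ {Φ} -> Class Φ -> Resp Φ
  Class⇒Resp c {σ} {τ} e = c σ τ Perm.id e

  cm-sym : ∀ τ g -> cm τ g ≡ cm g τ
  cm-sym τ g = 𝟙-⇔ ((g ⨾ τ) ≈? (τ ⨾ g)) ((τ ⨾ g) ≈? (g ⨾ τ)) (\ e x -> sym (e x)) (\ e x -> sym (e x))

  cm-resp : ∀ τ -> Resp (cm τ)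
  cm-resp τ {σ} {ρ} e = 𝟙-⇔ ((σ ⨾ τ) ≈? (τ ⨾ σ)) ((ρ ⨾ τ) ≈? (τ ⨾ ρ))
    (\ q x -> trans (cong (τ ▸_) (sym (e x))) (trans (q x) (e _))) (\ q x -> trans (cong (τ ▸_) (e x)) (trans (q x) (sym (e _))))

  cm-∘ : ∀ τ g h -> Commute τ h -> cm τ (g ⨾ h) ≡ cm τ g
  cm-∘ τ g h c = 𝟙-⇔ (((g ⨾ h) ⨾ τ) ≈? (τ ⨾ (g ⨾ h))) ((g ⨾ τ) ≈? (τ ⨾ g))
    (\ q x -> trans (sym (inverseˡ h)) (trans (cong (h ◂_) (trans (sym (c (g ▸ x))) (q x))) (inverseˡ h)))
    (\ q x -> trans (c (g ▸ x)) (cong (h ▸_) (q x)))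

  conjBy : Sym n -> Sym n -> Sym n
  conjBy h g = flip h ⨾ g ⨾ h

  Θ-class : ∀ {Φ} -> Class Φ -> Class (Θ Φ)
  Θ-class {Φ} c r τ h e = begin
    ∑ G (\ g -> cm r g * Φ g) ≡⟨ ∑-cong G (\ g -> cong₂ _*_ (tr g) (c g (conjBy h g) h (\ x -> sym (cong (\ t -> h ▸ (g ▸ t)) (inverseˡ h))))) ⟩
    ∑ G (\ g -> cm τ (conjBy h g) * Φ (conjBy h g)) ≡⟨ ∑-reindex (conjBy h) (conjBy (flip h)) (\ {σ} {ρ} -> fw {σ} {ρ}) (\ {σ} {ρ} -> bw {σ} {ρ}) (\ g -> cm τ g * Φ g) (\ {σ} {ρ} q -> cong₂ _*_ (cm-resp τ {σ} {ρ} q) (Class⇒Resp {Φ} c {σ} {ρ} q)) ⟩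
    ∑ G (\ g -> cm τ g * Φ g) ∎
    where
    ri : ∀ {x} -> h ▸ (h ◂ x) ≡ x
    ri = inverseʳ h
    li : ∀ {x} -> h ◂ (h ▸ x) ≡ x
    li = inverseˡ h
    fw : ∀ {σ ρ : Sym n} -> ρ ≈ conjBy h σ -> σ ≈ conjBy (flip h) ρ
    fw {σ} {ρ} q x = sym (trans (cong (h ◂_) (q (h ▸ x))) (trans li (cong (σ ▸_) li)))
    bw : ∀ {σ ρ : Sym n} -> σ ≈ conjBy (flip h) ρ -> ρ ≈ conjBy h σ
    bw {σ} {ρ} q x = sym (trans (cong (h ▸_) (q (h ◂ x))) (trans ri (cong (ρ ▸_) ri)))
    tr : ∀ g -> cm r g ≡ cm τ (conjBy h g)
    tr g = 𝟙-⇔ ((g ⨾ r) ≈? (r ⨾ g)) ((conjBy h g ⨾ τ) ≈? (τ ⨾ conjBy h g))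
      (\ q x -> trans (sym (e (g ▸ (h ◂ x)))) (trans (cong (h ▸_) (q (h ◂ x))) (cong (\ t -> h ▸ (g ▸ t)) (trans (sym li) (cong (h ◂_) (trans (e (h ◂ x)) (cong (τ ▸_) ri)))))))
      (\ q x -> trans (sym li) (trans (cong (h ◂_) (trans (e (g ▸ x)) (trans (cong (\ t -> τ ▸ (h ▸ (g ▸ t))) (sym li)) (trans (q (h ▸ x)) (cong (\ t -> h ▸ (g ▸ (h ◂ t))) (sym (e x))))))) (trans li (cong (g ▸_) li))))

  Zn-class : Class Zn
  Zn-class r τ h e = trans (∑-cong G (\ g -> sym (Z.*-identityʳ (cm r g)))) (trans (Θ-class {λ _ -> 1ℤ} (\ _ _ _ _ -> refl) r τ h e) (∑-cong G (\ g -> Z.*-identityʳ (cm τ g))))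

  -- For h in the centraliser, g ↦ gh⁻¹ permutes the centraliser, so all inner sums are equal. Hence
  -- positive definiteness gives nonnegative sums over centralisers.
  quad-centraliser : ∀ {Φ : Sym n -> ℤ} -> Class Φ -> ∀ τ -> quad (map (\ g -> cm τ g , g) G) Φ ≡ Zn τ * Θ Φ τ
  quad-centraliser {Φ} c τ = begin
    quad L Φ ≡⟨ trans (∑-map (\ g -> cm τ g , g) G _) (∑-cong G (\ g -> cong (cm τ g *_) (∑-map (\ g -> cm τ g , g) G _))) ⟩
    ∑ G (\ g -> cm τ g * ∑ G (\ h -> cm τ h * Φ (g ⨾ flip h)))
      ≡⟨ ∑-cong G (\ g -> sym (∑-* G (cm τ g) (\ h -> cm τ h * Φ (g ⨾ flip h)))) ⟩
    ∑ G (\ g -> ∑ G (\ h -> cm τ g * (cm τ h * Φ (g ⨾ flip h))))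
      ≡⟨ ∑-swap G G (\ g h -> cm τ g * (cm τ h * Φ (g ⨾ flip h))) ⟩
    ∑ G (\ h -> ∑ G (\ g -> cm τ g * (cm τ h * Φ (g ⨾ flip h))))
      ≡⟨ ∑-cong G (\ h -> inner h ((h ⨾ τ) ≈? (τ ⨾ h))) ⟩
    ∑ G (\ h -> cm τ h * Θ Φ τ)
      ≡⟨ trans (∑-cong G (\ h -> Z.*-comm (cm τ h) (Θ Φ τ))) (trans (∑-* G (Θ Φ τ) (cm τ)) (Z.*-comm (Θ Φ τ) (Zn τ))) ⟩
    Zn τ * Θ Φ τ ∎
    where
    L = map (\ g -> cm τ g , g) G
    inner : ∀ h (d : Dec (Commute τ h)) -> ∑ G (\ g -> cm τ g * (𝟙 d * Φ (g ⨾ flip h))) ≡ 𝟙 d * Θ Φ τ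
    inner h (no _) = trans (∑-cong G (\ g -> *-zeroʳ (cm τ g))) (∑-0 G)
    inner h (yes q) = begin
      ∑ G (\ g -> cm τ g * (1ℤ * Φ (g ⨾ flip h))) ≡⟨ ∑-cong G (\ g -> cong₂ _*_ (sym (cm-∘ τ g (flip h) q')) (Z.*-identityˡ _)) ⟩
      ∑ G (\ g -> cm τ (g ⨾ flip h) * Φ (g ⨾ flip h)) ≡⟨ ∑-∘ (flip h) (\ g -> cm τ g * Φ g) (\ {σ} {ρ} e -> cong₂ _*_ (cm-resp τ {σ} {ρ} e) (Class⇒Resp {Φ} c {σ} {ρ} e)) ⟩
      Θ Φ τ ≡⟨ sym (Z.*-identityˡ _) ⟩
      1ℤ * Θ Φ τ ∎
      where
      q' : Commute τ (flip h)
      q' x = sym (trans (cong (\ t -> h ◂ (τ ▸ t)) (sym (inverseʳ h))) (trans (cong (h ◂_) (q (h ◂ x))) (inverseˡ h)))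

  -- `cls` encodes a system of representatives: exactly one of them is conjugate to τ, and the
  -- conjugating elements are as many as the centraliser of τ has.
  module ClassEq {R : Set} (rs : List R) (rp : R -> Sym n) (cls : ∀ τ -> ∑ rs (\ r -> ∑ G (cj (rp r) τ)) ≡ Zn τ) where
    N! : ℤ
    N! = ∑ G (\ _ -> 1ℤ)

    -- Triples (r, h, τ) with h conjugating r to τ are counted twice: r and h determine τ, and for
    -- given τ their number is the order of its centraliser.
    class-eq : ∀ Φ -> Class Φ -> N! * ∑ rs (\ r -> Φ (rp r)) ≡ ∑ G (\ τ -> Zn τ * Φ τ)
    class-eq Φ c = begin
      N! * ∑ rs (\ r -> Φ (rp r)) ≡⟨ sym (∑-* rs N! (\ r -> Φ (rp r))) ⟩
      ∑ rs (\ r -> N! * Φ (rp r)) ≡⟨ ∑-cong rs (\ r -> trans (Z.*-comm N! (Φ (rp r))) (trans (sym (∑-* G (Φ (rp r)) (\ _ -> 1ℤ))) (∑-cong G (\ h -> Z.*-identityʳ (Φ (rp r)))))) ⟩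
      ∑ rs (\ r -> ∑ G (\ h -> Φ (rp r))) ≡⟨ ∑-cong rs (\ r -> ∑-cong G (\ h -> sym (pt (rp r) h))) ⟩
      ∑ rs (\ r -> ∑ G (\ h -> ∑ G (\ τ -> cj (rp r) τ h * Φ τ))) ≡⟨ ∑-cong rs (\ r -> ∑-swap G G (\ h τ -> cj (rp r) τ h * Φ τ)) ⟩
      ∑ rs (\ r -> ∑ G (\ τ -> ∑ G (\ h -> cj (rp r) τ h * Φ τ))) ≡⟨ ∑-swap rs G (\ r τ -> ∑ G (\ h -> cj (rp r) τ h * Φ τ)) ⟩
      ∑ G (\ τ -> ∑ rs (\ r -> ∑ G (\ h -> cj (rp r) τ h * Φ τ)))
        ≡⟨ ∑-cong G (\ τ -> trans (∑-cong rs (\ r -> trans (∑-cong G (\ h -> Z.*-comm (cj (rp r) τ h) (Φ τ))) (∑-* G (Φ τ) (cj (rp r) τ)))) (trans (∑-* rs (Φ τ) (\ r -> ∑ G (cj (rp r) τ))) (trans (cong (Φ τ *_) (cls τ)) (Z.*-comm (Φ τ) (Zn τ))))) ⟩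
      ∑ G (\ τ -> Zn τ * Φ τ) ∎
      where
      pt : ∀ r h -> ∑ G (\ τ -> cj r τ h * Φ τ) ≡ Φ r
      pt r h = trans (∑-cong G (\ τ -> cong (_* Φ τ) (𝟙-⇔ ((r ⨾ h) ≈? (h ⨾ τ)) (τ ≈? conjBy h r)
          (\ e x -> trans (cong (τ ▸_) (sym (inverseʳ h))) (sym (e (h ◂ x)))) (\ e x -> sym (trans (e (h ▸ x)) (cong (\ t -> h ▸ (r ▸ t)) (inverseˡ h)))))))
        (trans (∑-δ (conjBy h r) Φ (\ {σ} {ρ} -> Class⇒Resp {Φ} c {σ} {ρ})) (sym (c r (conjBy h r) h (\ x -> sym (cong (\ t -> h ▸ (r ▸ t)) (inverseˡ h))))))

    -- The weights are w = D / |centraliser|.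
    average : ∀ Φ -> Class Φ -> (w : Sym n -> ℤ) -> Class w -> ∀ D -> (∀ τ -> w τ * Zn τ ≡ D) ->
      N! * (D * ∑ rs (\ r -> Φ (rp r))) ≡ N! * ∑ rs (\ r -> w (rp r) * Θ Φ (rp r))
    average Φ c w cw D wD = begin
      N! * (D * ∑ rs (\ r -> Φ (rp r))) ≡⟨ r₁ N! D (∑ rs (\ r -> Φ (rp r))) ⟩
      D * (N! * ∑ rs (\ r -> Φ (rp r))) ≡⟨ cong (D *_) (class-eq Φ c) ⟩
      -- This is a sum of Φ τ over commuting pairs (τ, g), and commuting is symmetric; summing over
      -- τ first gives Θ Φ at g.
      D * ∑ G (\ τ -> Zn τ * Φ τ) ≡⟨ cong (D *_) (begin
          ∑ G (\ τ -> Zn τ * Φ τ) ≡⟨ ∑-cong G (\ τ -> trans (Z.*-comm (Zn τ) (Φ τ)) (trans (sym (∑-* G (Φ τ) (cm τ))) (∑-cong G (\ g -> trans (Z.*-comm (Φ τ) (cm τ g)) (cong (_* Φ τ) (cm-sym τ g)))))) ⟩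
          ∑ G (\ τ -> ∑ G (\ g -> cm g τ * Φ τ)) ≡⟨ ∑-swap G G (\ τ g -> cm g τ * Φ τ) ⟩
          ∑ G (Θ Φ) ∎) ⟩
      D * ∑ G (Θ Φ) ≡⟨ sym (∑-* G D (Θ Φ)) ⟩
      ∑ G (\ τ -> D * Θ Φ τ) ≡⟨ ∑-cong G (\ τ -> trans (cong (_* Θ Φ τ) (trans (sym (wD τ)) (Z.*-comm (w τ) (Zn τ)))) (Z.*-assoc (Zn τ) (w τ) (Θ Φ τ))) ⟩
      ∑ G (\ τ -> Zn τ * (w τ * Θ Φ τ)) ≡⟨ sym (class-eq (\ τ -> w τ * Θ Φ τ) (\ r τ h e -> cong₂ _*_ (cw r τ h e) (Θ-class {Φ} c r τ h e))) ⟩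
      N! * ∑ rs (\ r -> w (rp r) * Θ Φ (rp r)) ∎
      where r₁ : ∀ a b c -> a * (b * c) ≡ b * (a * c)
            r₁ = solve-∀

-- Conjugacy, cycle types and representatives.

matching : ∀ {n} (xs ys : List (Fin n)) -> Unique xs -> Unique ys -> length xs ≡ length ys -> ∃[ h ] map (h ▸_) xs ≡ ys
matching [] [] _ _ _ = Perm.id , refl
matching {n} (x ∷ xs) (y ∷ ys) (a ∷ u) (b ∷ v) e = h' ⨾ transpose z y , cong₂ _∷_ (swp-ˡ z y) (trans (Lₚ.map-∘ xs) (trans (cong (map (transpose z y ▸_)) q) (fix ys (\ m -> z∉ m) b)))
  where
  rec = matching xs ys u v (N.suc-injective e)
  h' = fst rec
  q = snd rec
  z = h' ▸ x
  z∉ : ∀ {w} -> w ∈ ys -> z ≢ w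
  z∉ {w} m r = let (x' , m' , e') = ∈-map⁻ (h' ▸_) (subst (w ∈_) (sym q) m) in
    All.lookup a m' (trans (sym (inverseˡ h')) (trans (cong (h' ◂_) (trans r e')) (inverseˡ h')))
  fix : ∀ ws -> (∀ {w} -> w ∈ ws -> z ≢ w) -> All (y ≢_) ws -> map (transpose z y ▸_) ws ≡ ws
  fix [] _ _ = refl
  fix (w ∷ ws) nz (ny ∷ a) = cong₂ _∷_ (swp-≢ z y (nz (here refl)) ny) (fix ws (nz ∘ there) a)

module _ {n : ℕ} (h : Fin n -> Fin n) where
  private
    ++-inj : ∀ (u v : List (Fin n)) {xs ys} -> length u ≡ length v -> u ++ xs ≡ v ++ ys -> u ≡ v × xs ≡ ys
    ++-inj [] [] _ e = refl , e
    ++-inj (x ∷ u) (y ∷ v) l e = let (p , q) = ++-inj u v (N.suc-injective l) (Lₚ.∷-injectiveʳ e) in cong₂ _∷_ (Lₚ.∷-injectiveˡ e) p , q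

  shape : ∀ (cs ds : List (Cy {n})) -> lens cs ≡ lens ds -> map h (supp cs) ≡ supp ds -> map (mapC h) cs ≡ ds
  shape [] [] _ _ = refl
  shape ((x , u) ∷ cs) ((y , v) ∷ ds) l e =
    let (p , q) = ++-inj (map h u) v (trans (Lₚ.length-map h u) (Lₚ.∷-injectiveˡ l)) (trans (sym (Lₚ.map-++ h u (supp cs))) (Lₚ.∷-injectiveʳ e))
    in cong₂ _∷_ (cong₂ _,_ (Lₚ.∷-injectiveˡ e) p) (shape cs ds (Lₚ.∷-injectiveʳ l) q)

  path-conj : ∀ {ρ σ} x u y -> Path ρ x u y -> Path σ (h x) (map h u) (h y) -> ∀ {z} -> z ∈ x ∷ u -> σ (h z) ≡ h (ρ z)
  path-conj x [] y p q (here refl) = trans q (cong h (sym p))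
  path-conj x (w ∷ u) y (e , p) (e' , q) (here refl) = trans e' (cong h (sym e))
  path-conj x (w ∷ u) y (e , p) (e' , q) (there m) = path-conj w u y p q m

  cyc-conj : ∀ {ρ σ} cs -> All (IsCy ρ) cs -> All (IsCy σ) (map (mapC h) cs) -> ∀ {z} -> z ∈ supp cs -> σ (h z) ≡ h (ρ z)
  cyc-conj ((x , u) ∷ cs) (p ∷ ps) (q ∷ qs) m with ∈-++⁻ (x ∷ u) m
  ... | inj₁ m' = path-conj x u x p q m'
  ... | inj₂ m' = cyc-conj cs ps qs m'

-- Once the cycles of σ are reordered to have the same lengths in the same places, a permutation
-- that carries one listing of the points onto the other maps cycles to cycles.
types-conj : ∀ {n} (ρ σ : Sym n) -> typ ρ ↭ typ σ -> ∃[ h ] Conj ρ σ h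
types-conj {n} ρ σ e = h , \ z -> sym (cyc-conj (h ▸_) cs a (subst (All (IsCy (σ ▸_))) (sym sh') (↭ₚ.All-resp-↭ pm b)) (↭ₚ.∈-resp-↭ (↭-sym s) (∈-allFin z)))
  where
  cs = fst (cycles ρ)
  a = fst (snd (cycles ρ))
  s = snd (snd (cycles ρ))
  ds = fst (cycles σ)
  b = fst (snd (cycles σ))
  t = snd (snd (cycles σ))
  mi = ↭ₚ.↭-map-inv (length ∘ snd) (↭-sym e)
  ds' = fst mi
  l : lens cs ≡ lens ds'
  l = fst (snd mi)
  pm : ds ↭ ds'
  pm = snd (snd mi)
  supp-↭ : ∀ {cs ds : List (Cy {n})} -> cs ↭ ds -> supp cs ↭ supp ds
  supp-↭ ↭.refl = ↭-refl
  supp-↭ (↭.prep c p) = ↭ₚ.++⁺ˡ (toL c) (supp-↭ p)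
  supp-↭ (↭.swap c d p) = ↭-trans (↭ₚ.++⁺ˡ (toL c) (↭ₚ.++⁺ˡ (toL d) (supp-↭ p))) (↭ₚ.shifts (toL c) (toL d))
  supp-↭ (↭.trans p q) = ↭-trans (supp-↭ p) (supp-↭ q)
  t' : supp ds' ↭ allFin n
  t' = ↭-trans (↭-sym (supp-↭ pm)) t
  mt = matching (supp cs) (supp ds') (Unique-↭ (↭-sym s) (allFin⁺ n)) (Unique-↭ (↭-sym t') (allFin⁺ n)) (trans (↭ₚ.↭-length s) (sym (↭ₚ.↭-length t')))
  h = fst mt
  sh' : map (mapC (h ▸_)) cs ≡ ds'
  sh' = shape (h ▸_) cs ds' l (snd mt)

conj-types : ∀ {n} (ρ σ h : Sym n) -> Conj ρ σ h -> typ ρ ↭ typ σ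
conj-types ρ σ h e = ↭-sym (typ-conj ρ σ h (\ x -> sym (e x)))

rot-cyc : ∀ m -> Σ[ ρ ∈ Sym (suc m) ] Σ[ u ∈ List (Fin (suc m)) ] (CycD (ρ ▸_) ((Fin.zero , u) ∷ []) × length u ≡ m)
rot-cyc zero = Perm.id , [] , (refl ∷ [] , ↭-refl) , refl
rot-cyc (suc m) = transpose Fin.zero (Fin.suc Fin.zero) ⨾ lift₀ ρ , map Fin.suc u ++ Fin.suc Fin.zero ∷ [] ,
    Swap.merge (lift₀ ρ ▸_) Fin.zero (Fin.suc Fin.zero) [] (map Fin.suc u) [] (refl ∷ cyc-map Fin.suc (\ x -> refl) _ a
      , ↭-trans (↭.prep Fin.zero (↭-trans (↭-reflexive (supp-mapC Fin.suc ((Fin.zero , u) ∷ []))) (↭ₚ.map⁺ Fin.suc s))) (↭-reflexive (sym (allFin-suc (suc m)))))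
  , trans (Lₚ.length-++ (map Fin.suc u)) (trans (N.+-comm _ 1) (cong suc (trans (Lₚ.length-map Fin.suc u) l)))
  where
  rec = rot-cyc m
  ρ = fst rec
  u = fst (snd rec)
  a = fst (fst (snd (snd rec)))
  s = snd (fst (snd (snd rec)))
  l = snd (snd (snd rec))

rotP : ∀ m -> Sym (suc m)
rotP m = fst (rot-cyc m)

typ-rotP : ∀ m -> typ (rotP m) ↭ m ∷ []
typ-rotP m = let (ρ , u , c , l) = rot-cyc m in ↭-trans (typ-cyc (rotP m) c) (↭-reflexive (cong (_∷ []) l))

repr : (κ : List ℕ) -> Sym (lsumℕ (sucs κ))
repr [] = Perm.id
repr (m ∷ κ) = rotP m ⊕ repr κ

typ-repr : ∀ κ -> typ (repr κ) ↭ κ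
typ-repr [] = ↭-refl
typ-repr (m ∷ κ) = ↭-trans (typ-⊕ (rotP m) (repr κ)) (↭ₚ.++⁺ (typ-rotP m) (typ-repr κ))

-- The identity is a default for lists of the wrong size; members of `reps n` always have the right
-- one.
rp′ : ∀ n κ -> Dec (lsumℕ (sucs κ) ≡ n) -> Sym n
rp′ n κ (yes e) = subst Sym e (repr κ)
rp′ n κ (no _) = Perm.id

rp : ∀ n -> List ℕ -> Sym n
rp n κ = rp′ n κ (lsumℕ (sucs κ) N.≟ n)

typ-rp : ∀ {n κ} -> lsumℕ (sucs κ) ≡ n -> typ (rp n κ) ↭ κ
typ-rp {n} {κ} e = go (lsumℕ (sucs κ) N.≟ n)
  where go : ∀ d -> typ (rp′ n κ d) ↭ κ
        go (yes refl) = typ-repr κ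
        go (no ne) = ⊥-elim (ne e)

-- Partitions with bounded parts.

data Par : ℕ -> ℕ -> List ℕ -> Set where
  nil : ∀ {m} -> Par 0 m []
  cons : ∀ {n m k λ'} -> 1 N.≤ k -> k N.≤ m -> Par n k λ' -> Par (k N.+ n) m (k ∷ λ')

private
  ∈-rng : ∀ {k n m} -> 1 N.≤ k -> k N.≤ suc n -> k N.≤ m -> k ∈ filterᵇ (\ k -> k N.≤ᵇ m) (range 1 (suc n))
  ∈-rng {suc k} {n} {m} _ (s≤s l) l' = ∈-filter⁺ (T? ∘ (\ k -> k N.≤ᵇ m)) (∈-map⁺ suc (∈-upTo⁺ (s≤s l))) (N.≤⇒≤ᵇ l')

  rng-∈ : ∀ {k n m} -> k ∈ filterᵇ (\ k -> k N.≤ᵇ m) (range 1 (suc n)) -> 1 N.≤ k × k N.≤ suc n × k N.≤ m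
  rng-∈ {k} {n} {m} p = let (q , r) = ∈-filter⁻ (T? ∘ (\ k -> k N.≤ᵇ m)) {xs = range 1 (suc n)} p ; (x , q' , e) = ∈-map⁻ suc q in
    subst (1 N.≤_) (sym e) (s≤s z≤n) , subst (N._≤ suc n) (sym e) (∈-upTo⁻ q') , N.≤ᵇ⇒≤ k m r

Par⇒∈ : ∀ f {n m λ'} -> n N.≤ f -> Par n m λ' -> λ' ∈ partsF f n m
Par⇒∈ zero le nil = here refl
Par⇒∈ zero le (cons {k = suc k} p q r) = ⊥-elim (N.<⇒≱ (s≤s z≤n) le)
Par⇒∈ (suc f) le nil = here refl
Par⇒∈ (suc f) {m = m} le (cons {n} {k = suc k} {λ'} p q r) =
  ∈-concatMap⁺ (\ k' -> map (k' ∷_) (partsF f (suc (k N.+ n) N.∸ k') k')) (lose (∈-rng {suc k} {k N.+ n} p (s≤s (N.m≤m+n k n)) q)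
    (∈-map⁺ (suc k ∷_) (subst (\ t -> λ' ∈ partsF f t (suc k)) (sym (N.m+n∸m≡n k n)) (Par⇒∈ f (N.≤-trans (N.m≤n+m n k) (N.s≤s⁻¹ le)) r))))

∈⇒Par : ∀ f {n m λ'} -> λ' ∈ partsF f n m -> Par n m λ'
∈⇒Par zero {zero} (here refl) = nil
∈⇒Par (suc f) {zero} (here refl) = nil
∈⇒Par (suc f) {suc n} {m} p = let (k , q , r) = find (∈-concatMap⁻ (\ k -> map (k ∷_) (partsF f (suc n N.∸ k) k)) {xs = filterᵇ (\ k -> k N.≤ᵇ m) (range 1 (suc n))} p)
                                  (λ'' , r' , e) = ∈-map⁻ (k ∷_) r ; (a , b , c) = rng-∈ {k} {n} q
  in subst (Par (suc n) m) (sym e) (subst (\ t -> Par t m (k ∷ λ'')) (N.m+[n∸m]≡n b) (cons a c (∈⇒Par f r')))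

partsF-unique : ∀ f n m -> Unique (partsF f n m)
partsF-unique zero zero m = [] ∷ []
partsF-unique zero (suc n) m = []
partsF-unique (suc f) zero m = [] ∷ []
partsF-unique (suc f) (suc n) m = go (filterᵇ (\ k -> k N.≤ᵇ m) (range 1 (suc n))) (Uₚ.filter⁺ (T? ∘ (\ k -> k N.≤ᵇ m)) (Uₚ.map⁺ N.suc-injective (Uₚ.upTo⁺ (suc n))))
  where
  h : ℕ -> List (List ℕ)
  h k = map (k ∷_) (partsF f (suc n N.∸ k) k)
  go : ∀ ks -> Unique ks -> Unique (concatMap h ks)
  go [] [] = []
  go (k ∷ ks) (a ∷ u) = Uₚ.++⁺ (Uₚ.map⁺ Lₚ.∷-injectiveʳ (partsF-unique f (suc n N.∸ k) k)) (go ks u) disj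
    where
    disj : ∀ {λ'} -> λ' ∈ h k × λ' ∈ concatMap h ks -> ⊥
    disj (p , q) = let (x , _ , e) = ∈-map⁻ (k ∷_) p ; (k' , m , q') = find (∈-concatMap⁻ h {xs = ks} q) ; (y , _ , e') = ∈-map⁻ (k' ∷_) q' in
      All.lookup a m (Lₚ.∷-injectiveˡ (trans (sym e) e'))

Par⇒∈partitions : ∀ {n λ'} -> Par n n λ' -> λ' ∈ partitions n
Par⇒∈partitions = Par⇒∈ _ N.≤-refl

preds : List ℕ -> List ℕ
preds = map N.pred

sucs-preds : ∀ {n m λ'} -> Par n m λ' -> sucs (preds λ') ≡ λ'
sucs-preds nil = refl
sucs-preds (cons {k = suc k} p q r) = cong (suc k ∷_) (sucs-preds r)

Par-sum : ∀ {n m λ'} -> Par n m λ' -> lsumℕ λ' ≡ n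
Par-sum nil = refl
Par-sum (cons {k = k} p q r) = cong (k N.+_) (Par-sum r)

private
  Par-max : ∀ {n m λ' k} -> Par n m λ' -> k ∈ λ' -> k N.≤ m
  Par-max (cons p q r) (here refl) = q
  Par-max (cons p q r) (there m) = N.≤-trans (Par-max r m) q

Par-sorted : ∀ {n m λ' n' m' μ} -> Par n m λ' -> Par n' m' μ -> λ' ↭ μ -> λ' ≡ μ
Par-sorted nil nil _ = refl
Par-sorted nil (cons _ _ _) p with ↭ₚ.↭-empty-inv (↭-sym p)
... | ()
Par-sorted (cons _ _ _) nil p with ↭ₚ.↭-empty-inv p
... | ()
Par-sorted (cons {k = k} a b r) (cons {k = k'} a' b' r') p with N.≤-antisym (hd r' (↭ₚ.∈-resp-↭ p (here refl))) (hd r (↭ₚ.∈-resp-↭ (↭-sym p) (here refl)))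
  where
  hd : ∀ {n k λ' x} -> Par n k λ' -> x ∈ k ∷ λ' -> x N.≤ k
  hd r (here refl) = N.≤-refl
  hd r (there m) = Par-max r m
... | refl = cong (k ∷_) (Par-sorted r r' (↭ₚ.drop-∷ p))

Par-mono : ∀ {n m m' λ'} -> m N.≤ m' -> Par n m λ' -> Par n m' λ'
Par-mono l nil = nil
Par-mono l (cons p q r) = cons p (N.≤-trans q l) r

private
  ins-Par : ∀ {n m λ'} k -> Par n m λ' -> k N.≤ m -> ∃[ μ ] (Par (suc k N.+ n) (suc m) μ × μ ↭ suc k ∷ λ')
  ins-Par' : ∀ {n m λ'} k -> Par n m λ' -> suc k N.≤ m -> ∃[ μ ] (Par (suc k N.+ n) m μ × μ ↭ suc k ∷ λ')
  ins-Par k r l = ins-Par' k (Par-mono (N.n≤1+n _) r) (s≤s l)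
  ins-Par' k nil l = _ , cons (s≤s z≤n) l nil , ↭-refl
  ins-Par' k (cons {n} {m} {j} p q r) l with suc k N.≤? j
  ... | yes le = let (μ , r' , e) = ins-Par' k r le in j ∷ μ , subst (\ t -> Par t m (j ∷ μ)) (sw j (suc k) n) (cons p q r') , ↭-trans (↭.prep j e) (↭.swap j (suc k) ↭-refl)
    where sw : ∀ x y z -> x N.+ (y N.+ z) ≡ y N.+ (x N.+ z)
          sw x y z = trans (sym (N.+-assoc x y z)) (trans (cong (N._+ z) (N.+-comm x y)) (N.+-assoc y x z))
  ... | no ¬le = _ , cons (s≤s z≤n) l (cons p (N.<⇒≤ (N.≰⇒> ¬le)) r) , ↭-refl

sortPar : ∀ κ -> ∃[ λ' ] (Par (lsumℕ (sucs κ)) (lsumℕ (sucs κ)) λ' × λ' ↭ sucs κ)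
sortPar [] = [] , nil , ↭-refl
sortPar (m ∷ κ) = let (λ' , r , e) = sortPar κ
                      (μ , r' , e') = ins-Par' m (Par-mono (N.m≤n+m (lsumℕ (sucs κ)) (suc m)) r) (N.m≤m+n (suc m) (lsumℕ (sucs κ)))
                  in μ , r' , ↭-trans e' (↭.prep (suc m) e)

preds-sucs : ∀ κ -> preds (sucs κ) ≡ κ
preds-sucs [] = refl
preds-sucs (m ∷ κ) = cong (m ∷_) (preds-sucs κ)

reps : ℕ -> List (List ℕ)
reps n = map preds (partitions n)

∑-single : ∀ {A : Set} (xs : List A) x f -> Unique xs -> x ∈ xs -> (∀ {y} -> y ∈ xs -> y ≢ x -> f y ≡ 0ℤ) -> ∑ xs f ≡ f x
∑-single xs x f u m z = let (as , bs , e) = ∈-∃++ m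
                            p : xs ↭ x ∷ as ++ bs
                            p = ↭-trans (↭-reflexive e) (↭ₚ.shift x as bs) in
  trans (∑-↭ p f) (trans (cong (f x +_) (trans (∑-cong-∈ (as ++ bs) {g = \ _ -> 0ℤ} (\ {y} m' -> z (↭ₚ.∈-resp-↭ (↭-sym p) (there m')) (\ q -> nn (Unique-↭ p u) m' (sym q)))) (∑-0 (as ++ bs)))) (+-identityʳ (f x)))
  where
  nn : ∀ {A : Set} {i : A} {zs k} -> Unique (i ∷ zs) -> k ∈ zs -> i ≢ k
  nn (a ∷ _) m = All.lookup a m

-- Only the sorted cycle type λ₀ of τ contributes, because equal types after sorting means equal
-- partitions. For λ₀, composition with one fixed conjugating element `h₀` turns conjugating
-- elements into elements of the centraliser.
classes : ∀ n (τ : Sym n) -> ∑ (reps n) (\ κ -> ∑ (allP n) (cj (rp n κ) τ)) ≡ Zn τ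
classes n τ = trans (∑-map preds (partitions n) (\ κ -> ∑ (allP n) (cj (rp n κ) τ)))
    (trans (∑-single (partitions n) λ₀ _ (partsF-unique n n n) (Par⇒∈partitions par₀) other) main)
  where
  κτ = typ τ
  len : lsumℕ (sucs κτ) ≡ n
  len = lsumℕ-CycD (snd (cycles τ))
  sp = sortPar κτ
  λ₀ = fst sp
  par₀ : Par n n λ₀
  par₀ = subst (\ t -> Par t t λ₀) len (fst (snd sp))
  p₀ : preds λ₀ ↭ κτ
  p₀ = ↭-trans (↭ₚ.map⁺ N.pred (snd (snd sp))) (↭-reflexive (preds-sucs κτ))
  good : ∀ {λ'} -> Par n n λ' -> lsumℕ (sucs (preds λ')) ≡ n
  good r = trans (cong lsumℕ (sucs-preds r)) (Par-sum r)
  other : ∀ {λ'} -> λ' ∈ partitions n -> λ' ≢ λ₀ -> ∑ (allP n) (cj (rp n (preds λ')) τ) ≡ 0ℤ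
  other {λ'} m ne = trans (∑-cong (allP n) (\ h -> 𝟙-no ((rp n (preds λ') ⨾ h) ≈? (h ⨾ τ)) (\ e -> ne (Par-sorted r par₀ (sucs↭ (↭-trans (↭-trans (↭-sym (typ-rp (good r))) (conj-types (rp n (preds λ')) τ h e)) (↭-sym p₀))))))) (∑-0 (allP n))
    where
    r = ∈⇒Par n m
    sucs≡map : ∀ κ -> sucs κ ≡ map suc κ
    sucs≡map [] = refl
    sucs≡map (m ∷ κ) = cong (suc m ∷_) (sucs≡map κ)
    sucs↭ : preds λ' ↭ preds λ₀ -> λ' ↭ λ₀
    sucs↭ q = ↭-trans (↭-reflexive (trans (sym (sucs-preds r)) (sucs≡map (preds λ')))) (↭-trans (↭ₚ.map⁺ suc q) (↭-reflexive (trans (sym (sucs≡map (preds λ₀))) (sucs-preds par₀))))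
  r₀ = rp n (preds λ₀)
  cj₀ = types-conj r₀ τ (↭-trans (typ-rp (good par₀)) p₀)
  h₀ = fst cj₀
  e₀' : Conj r₀ τ h₀
  e₀' = snd cj₀
  main : ∑ (allP n) (cj r₀ τ) ≡ Zn τ
  main = trans (∑-cong (allP n) (\ h -> 𝟙-⇔ ((r₀ ⨾ h) ≈? (h ⨾ τ)) (((flip h₀ ⨾ h) ⨾ τ) ≈? (τ ⨾ (flip h₀ ⨾ h))) (to h) (fro h)))
    (∑-reindex (flip h₀ ⨾_) (h₀ ⨾_) (\ {σ} {ρ} q x -> sym (trans (q (h₀ ▸ x)) (cong (σ ▸_) (inverseˡ h₀)))) (\ {σ} {ρ} q x -> sym (trans (q (h₀ ◂ x)) (cong (ρ ▸_) (inverseʳ h₀)))) (cm τ) (\ {σ} {ρ} -> cm-resp τ {σ} {ρ}))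
    where
    e₁ : ∀ x -> h₀ ◂ (τ ▸ x) ≡ r₀ ▸ (h₀ ◂ x)
    e₁ x = trans (cong (\ t -> h₀ ◂ (τ ▸ t)) (sym (inverseʳ h₀))) (trans (cong (h₀ ◂_) (sym (e₀' (h₀ ◂ x)))) (inverseˡ h₀))
    to : ∀ h -> Conj r₀ τ h -> Commute τ (flip h₀ ⨾ h)
    to h q x = trans (sym (q (h₀ ◂ x))) (cong (h ▸_) (sym (e₁ x)))
    fro : ∀ h -> Commute τ (flip h₀ ⨾ h) -> Conj r₀ τ h
    fro h q x = trans (cong (h ▸_) (trans (cong (r₀ ▸_) (sym (inverseˡ h₀))) (sym (e₁ (h₀ ▸ x))))) (trans (sym (q (h₀ ▸ x))) (cong (\ t -> τ ▸ (h ▸ t)) (inverseˡ h₀)))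

-- The centraliser of a permutation with one long cycle.

it : ∀ {A : Set} -> (A -> A) -> ℕ -> A -> A
it f zero x = x
it f (suc t) x = it f t (f x)

it-suc : ∀ {A : Set} (f : A -> A) t x -> it f (suc t) x ≡ f (it f t x)
it-suc f zero x = refl
it-suc f (suc t) x = it-suc f t (f x)

it-comm : ∀ {A B : Set} (f : A -> A) (f' : B -> B) (g : A -> B) -> (∀ x -> f' (g x) ≡ g (f x)) -> ∀ t x -> it f' t (g x) ≡ g (it f t x)
it-comm f f' g e zero x = refl
it-comm f f' g e (suc t) x = trans (cong (it f' t) (e x)) (it-comm f f' g e t (f x))

path-end : ∀ {n} {ρ : Fin n -> Fin n} x u y -> Path ρ x u y -> it ρ (suc (length u)) x ≡ y
path-end x [] y p = p
path-end {ρ = ρ} x (z ∷ u) y (e , p) = trans (cong (it ρ (suc (length u))) e) (path-end z u y p)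

path-mid : ∀ {n} {ρ : Fin n -> Fin n} x u y -> Path ρ x u y -> ∀ t -> t N.< length u -> it ρ (suc t) x ∈ u
path-mid x (z ∷ u) y (e , p) zero l = here e
path-mid {ρ = ρ} x (z ∷ u) y (e , p) (suc t) (s≤s l) = there (subst (\ s -> it ρ (suc t) s ∈ u) (sym e) (path-mid z u y p t l))

private
  head∉′ : ∀ {A : Set} {x : A} {u R} -> Unique (x ∷ u ++ R) -> x ∉ u
  head∉′ (a ∷ _) m = All.lookup a (∈-++⁺ˡ m) refl

period : ∀ {n} (ρ : Sym n) y -> ∃[ t ] (t N.< n × it (ρ ▸_) (suc t) y ≡ y)
period {n} ρ y = go (getFocus cs a (↭ₚ.∈-resp-↭ (↭-sym s) (∈-allFin y)))
  where
  cs = fst (cycles ρ)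
  a = fst (snd (cycles ρ))
  s = snd (snd (cycles ρ))
  go : Focus (ρ ▸_) cs y -> _
  go (focus u rest (p ∷ _) s' _) = length u , subst (suc (length u) N.≤_) (trans (sym (↭ₚ.↭-length s')) (trans (↭ₚ.↭-length s) (Lₚ.length-tabulate id)))
      (s≤s (subst (length u N.≤_) (sym (Lₚ.length-++ u)) (N.m≤m+n (length u) _))) , path-end y u y p

rot-focus : ∀ m x -> ∃[ u ] (Path (rotP m ▸_) x u x × (x ∷ u ↭ allFin (suc m)) × length u ≡ m)
rot-focus m x = let (ρ , w , c , l) = rot-cyc m
                    p = All.head (fst c)
                    s = snd c
                    s₁ = ↭-trans (↭-reflexive (sym (Lₚ.++-identityʳ (Fin.zero ∷ w)))) s
                    (u , q , pm , l') = rot p (↭ₚ.∈-resp-↭ (↭-sym s₁) (∈-allFin x))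
                in u , q , ↭-trans (↭-sym pm) s₁ , trans (sym l') l

rot-free : ∀ m x t -> t N.< m -> it (rotP m ▸_) (suc t) x ≢ x
rot-free m x t l e = let (u , p , s , q) = rot-focus m x in
  head∉′ {R = []} (subst Unique (sym (Lₚ.++-identityʳ (x ∷ u))) (Unique-↭ (↭-sym s) (allFin⁺ (suc m)))) (subst (_∈ u) e (path-mid x u x p t (subst (t N.<_) (sym q) l)))

module _ {i k : ℕ} where
  ⊕-ˡ : ∀ (σ : Sym i) (π : Sym k) x -> (σ ⊕ π) ▸ (x ↑ˡ k) ≡ (σ ▸ x) ↑ˡ k
  ⊕-ˡ σ π x = cong (\ t -> joinF i k (Sum.map (σ ▸_) (π ▸_) t)) (Finₚ.splitAt-↑ˡ i x k)

  ⊕-ʳ : ∀ (σ : Sym i) (π : Sym k) y -> (σ ⊕ π) ▸ (i ↑ʳ y) ≡ i ↑ʳ (π ▸ y)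
  ⊕-ʳ σ π y = cong (\ t -> joinF i k (Sum.map (σ ▸_) (π ▸_) t)) (Finₚ.splitAt-↑ʳ i k y)

  data Side (z : Fin (i N.+ k)) : Set where
    isL : ∀ x -> z ≡ x ↑ˡ k -> Side z
    isR : ∀ y -> z ≡ i ↑ʳ y -> Side z

  side : ∀ z -> Side z
  side z = go (splitAt i z) (Finₚ.join-splitAt i k z)
    where go : ∀ s -> joinF i k s ≡ z -> Side z
          go (inj₁ x) e = isL x (sym e)
          go (inj₂ y) e = isR y (sym e)

  L≢R : ∀ x y -> x ↑ˡ k ≢ i ↑ʳ y
  L≢R x y e with trans (sym (Finₚ.splitAt-↑ˡ i x k)) (trans (cong (splitAt i) e) (Finₚ.splitAt-↑ʳ i k y))
  ... | ()

  ⊕-ext : ∀ {g h : Sym (i N.+ k)} -> (∀ x -> g ▸ (x ↑ˡ k) ≡ h ▸ (x ↑ˡ k)) -> (∀ y -> g ▸ (i ↑ʳ y) ≡ h ▸ (i ↑ʳ y)) -> g ≈ h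
  ⊕-ext {g} {h} l r z = go (side z)
    where go : Side z -> g ▸ z ≡ h ▸ z
          go (isL x e) = subst (\ z -> g ▸ z ≡ h ▸ z) (sym e) (l x)
          go (isR y e) = subst (\ z -> g ▸ z ≡ h ▸ z) (sym e) (r y)

  ⊕-inj : ∀ (g₁ h₁ : Sym i) (g₂ h₂ : Sym k) -> g₁ ⊕ g₂ ≈ h₁ ⊕ h₂ -> g₁ ≈ h₁ × g₂ ≈ h₂
  ⊕-inj g₁ h₁ g₂ h₂ e = (\ x -> Finₚ.↑ˡ-injective k _ _ (trans (sym (⊕-ˡ g₁ g₂ x)) (trans (e (x ↑ˡ k)) (⊕-ˡ h₁ h₂ x))))
                      , (\ y -> Finₚ.↑ʳ-injective i _ _ (trans (sym (⊕-ʳ g₁ g₂ y)) (trans (e (i ↑ʳ y)) (⊕-ʳ h₁ h₂ y))))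

  ⊕-cong : ∀ {g₁ h₁ : Sym i} {g₂ h₂ : Sym k} -> g₁ ≈ h₁ -> g₂ ≈ h₂ -> g₁ ⊕ g₂ ≈ h₁ ⊕ h₂
  ⊕-cong {g₁} {h₁} {g₂} {h₂} e e' = ⊕-ext {g₁ ⊕ g₂} {h₁ ⊕ h₂} (\ x -> trans (⊕-ˡ g₁ g₂ x) (trans (cong (_↑ˡ k) (e x)) (sym (⊕-ˡ h₁ h₂ x)))) (\ y -> trans (⊕-ʳ g₁ g₂ y) (trans (cong (i ↑ʳ_) (e' y)) (sym (⊕-ʳ h₁ h₂ y))))

  ⊕-Commute : ∀ (σ g₁ : Sym i) (ρ g₂ : Sym k) -> Commute σ g₁ -> Commute ρ g₂ -> Commute (σ ⊕ ρ) (g₁ ⊕ g₂)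
  ⊕-Commute σ g₁ ρ g₂ c₁ c₂ = ⊕-ext {(g₁ ⊕ g₂) ⨾ (σ ⊕ ρ)} {(σ ⊕ ρ) ⨾ (g₁ ⊕ g₂)}
    (\ x -> trans (cong ((σ ⊕ ρ) ▸_) (⊕-ˡ g₁ g₂ x)) (trans (⊕-ˡ σ ρ _) (trans (cong (_↑ˡ k) (c₁ x)) (trans (sym (⊕-ˡ g₁ g₂ _)) (cong ((g₁ ⊕ g₂) ▸_) (sym (⊕-ˡ σ ρ x)))))))
    (\ y -> trans (cong ((σ ⊕ ρ) ▸_) (⊕-ʳ g₁ g₂ y)) (trans (⊕-ʳ σ ρ _) (trans (cong (i ↑ʳ_) (c₂ y)) (trans (sym (⊕-ʳ g₁ g₂ _)) (cong ((g₁ ⊕ g₂) ▸_) (sym (⊕-ʳ σ ρ y)))))))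

  split-⊕ : ∀ (g : Sym (i N.+ k)) -> (∀ x -> ∃[ x' ] g ▸ (x ↑ˡ k) ≡ x' ↑ˡ k) -> (∀ x -> ∃[ x' ] g ◂ (x ↑ˡ k) ≡ x' ↑ˡ k) ->
    Σ[ g₁ ∈ Sym i ] Σ[ g₂ ∈ Sym k ] g ≈ g₁ ⊕ g₂
  split-⊕ g fw bw = g₁ , g₂ , ⊕-ext {g} {g₁ ⊕ g₂} (\ x -> trans (snd (fw x)) (sym (⊕-ˡ g₁ g₂ x))) (\ y -> trans (snd (rf y)) (sym (⊕-ʳ g₁ g₂ y)))
    where
    rgt : ∀ (h h' : Fin (i N.+ k) -> Fin (i N.+ k)) -> (∀ z -> h' (h z) ≡ z) -> (∀ x -> ∃[ x' ] h' (x ↑ˡ k) ≡ x' ↑ˡ k) -> ∀ y -> ∃[ y' ] h (i ↑ʳ y) ≡ i ↑ʳ y'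
    rgt h h' e l y = go (side (h (i ↑ʳ y)))
      where go : Side (h (i ↑ʳ y)) -> ∃[ y' ] h (i ↑ʳ y) ≡ i ↑ʳ y'
            go (isR y' q) = y' , q
            go (isL x q) = ⊥-elim (L≢R _ y (trans (sym (snd (l x))) (trans (cong h' (sym q)) (e (i ↑ʳ y)))))
    rf = rgt (g ▸_) (g ◂_) (\ _ -> inverseˡ g) bw
    rb = rgt (g ◂_) (g ▸_) (\ _ -> inverseʳ g) fw
    g₁ : Sym i
    g₁ = Perm.permutation (fst ∘ fw) (fst ∘ bw)
      (\ x -> Finₚ.↑ˡ-injective k _ _ (trans (sym (snd (fw _))) (trans (cong (g ▸_) (sym (snd (bw x)))) (inverseʳ g))))
      (\ x -> Finₚ.↑ˡ-injective k _ _ (trans (sym (snd (bw _))) (trans (cong (g ◂_) (sym (snd (fw x)))) (inverseˡ g))))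
    g₂ : Sym k
    g₂ = Perm.permutation (fst ∘ rf) (fst ∘ rb)
      (\ x -> Finₚ.↑ʳ-injective i _ _ (trans (sym (snd (rf _))) (trans (cong (g ▸_) (sym (snd (rb x)))) (inverseʳ g))))
      (\ x -> Finₚ.↑ʳ-injective i _ _ (trans (sym (snd (rb _))) (trans (cong (g ◂_) (sym (snd (rf x)))) (inverseˡ g))))

module Centraliser (m k : ℕ) (k≤m : k N.≤ m) (ρ : Sym k) where
  private
    i = suc m
    c = rotP m
    σ = c ⊕ ρ
    Gi = allP i
    Gk = allP k
    G = allP (i N.+ k)

    -- An element that commutes with σ preserves the lengths of orbits. Points on the right have
    -- orbits of at most k ≤ m points, points of c have m + 1, so none of the latter can move to the
    -- right.
    left : ∀ (g : Sym (i N.+ k)) -> Commute σ g -> ∀ x -> ∃[ x' ] g ▸ (x ↑ˡ k) ≡ x' ↑ˡ k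
    left g cg x = go (side (g ▸ (x ↑ˡ k)))
      where
      go : Side (g ▸ (x ↑ˡ k)) -> ∃[ x' ] g ▸ (x ↑ˡ k) ≡ x' ↑ˡ k
      go (isL x' e) = x' , e
      go (isR y e) = let (t , l , q) = period ρ y in ⊥-elim (rot-free m x t (N.<-≤-trans l k≤m) (Finₚ.↑ˡ-injective k _ _ (begin
        it (c ▸_) (suc t) x ↑ˡ k ≡⟨ sym (it-comm (c ▸_) (σ ▸_) (_↑ˡ k) (⊕-ˡ c ρ) (suc t) x) ⟩
        it (σ ▸_) (suc t) (x ↑ˡ k) ≡⟨ sym (inverseˡ g) ⟩
        g ◂ (g ▸ it (σ ▸_) (suc t) (x ↑ˡ k)) ≡⟨ cong (g ◂_) (sym (it-comm (σ ▸_) (σ ▸_) (g ▸_) cg (suc t) (x ↑ˡ k))) ⟩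
        g ◂ (it (σ ▸_) (suc t) (g ▸ (x ↑ˡ k))) ≡⟨ cong (\ z -> g ◂ (it (σ ▸_) (suc t) z)) e ⟩
        g ◂ (it (σ ▸_) (suc t) (i ↑ʳ y)) ≡⟨ cong (g ◂_) (it-comm (ρ ▸_) (σ ▸_) (i ↑ʳ_) (⊕-ʳ c ρ) (suc t) y) ⟩
        g ◂ (i ↑ʳ it (ρ ▸_) (suc t) y) ≡⟨ cong (\ z -> g ◂ (i ↑ʳ z)) q ⟩
        g ◂ (i ↑ʳ y) ≡⟨ cong (g ◂_) (sym e) ⟩
        g ◂ (g ▸ (x ↑ˡ k)) ≡⟨ inverseˡ g ⟩
        x ↑ˡ k ∎)))

    flip-Commute : ∀ (g : Sym (i N.+ k)) -> Commute σ g -> Commute σ (flip g)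
    flip-Commute g q x = sym (trans (cong (\ t -> g ◂ (σ ▸ t)) (sym (inverseʳ g))) (trans (cong (g ◂_) (q (g ◂ x))) (inverseˡ g)))

    bracket : ∀ g -> ∑ Gi (\ g₁ -> ∑ Gk (\ g₂ -> (cm c g₁ * cm ρ g₂) * 𝟙 (g ≈? (g₁ ⊕ g₂)))) ≡ cm σ g
    bracket g = go ((g ⨾ σ) ≈? (σ ⨾ g))
      where
      go : (d : Dec (Commute σ g)) -> ∑ Gi (\ g₁ -> ∑ Gk (\ g₂ -> (cm c g₁ * cm ρ g₂) * 𝟙 (g ≈? (g₁ ⊕ g₂)))) ≡ 𝟙 d
      go (no ng) = trans (∑-cong Gi (\ g₁ -> trans (∑-cong Gk (\ g₂ -> z g₁ g₂ ((g₁ ⨾ c) ≈? (c ⨾ g₁)) ((g₂ ⨾ ρ) ≈? (ρ ⨾ g₂)))) (∑-0 Gk))) (∑-0 Gi)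
        where
        z : ∀ g₁ g₂ (d₁ : Dec (Commute c g₁)) (d₂ : Dec (Commute ρ g₂)) -> (𝟙 d₁ * 𝟙 d₂) * 𝟙 (g ≈? (g₁ ⊕ g₂)) ≡ 0ℤ
        z g₁ g₂ (no _) d₂ = refl
        z g₁ g₂ (yes _) (no _) = refl
        z g₁ g₂ (yes p) (yes q) = cong (1ℤ *_) (𝟙-no (g ≈? (g₁ ⊕ g₂)) (\ e -> ng (\ x ->
          trans (cong (σ ▸_) (e x)) (trans (⊕-Commute c g₁ ρ g₂ p q x) (sym (e (σ ▸ x)))))))
      go (yes cg) = begin
        ∑ Gi (\ g₁ -> ∑ Gk (\ g₂ -> (cm c g₁ * cm ρ g₂) * 𝟙 (g ≈? (g₁ ⊕ g₂))))
          ≡⟨ ∑-cong Gi (\ g₁ -> trans (∑-cong Gk (\ g₂ -> trans (cong ((cm c g₁ * cm ρ g₂) *_) (sep g₁ g₂)) (r (cm c g₁) (cm ρ g₂) (𝟙 (g₁ ≈? h₁)) (𝟙 (g₂ ≈? h₂)))))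
               (trans (∑-* Gk (𝟙 (g₁ ≈? h₁) * cm c g₁) (\ g₂ -> 𝟙 (g₂ ≈? h₂) * cm ρ g₂)) (cong (𝟙 (g₁ ≈? h₁) * cm c g₁ *_) (∑-δ h₂ (cm ρ) (\ {s} {t} -> cm-resp ρ {s} {t}))))) ⟩
        ∑ Gi (\ g₁ -> 𝟙 (g₁ ≈? h₁) * cm c g₁ * cm ρ h₂)
          ≡⟨ trans (∑-cong Gi (\ g₁ -> Z.*-comm (𝟙 (g₁ ≈? h₁) * cm c g₁) (cm ρ h₂))) (trans (∑-* Gi (cm ρ h₂) (\ g₁ -> 𝟙 (g₁ ≈? h₁) * cm c g₁)) (cong (cm ρ h₂ *_) (∑-δ h₁ (cm c) (\ {s} {t} -> cm-resp c {s} {t})))) ⟩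
        cm ρ h₂ * cm c h₁
          ≡⟨ cong₂ _*_ (𝟙-yes ((h₂ ⨾ ρ) ≈? (ρ ⨾ h₂)) (snd cc)) (𝟙-yes ((h₁ ⨾ c) ≈? (c ⨾ h₁)) (fst cc)) ⟩
        1ℤ ∎
        where
        sp = split-⊕ g (left g cg) (left (flip g) (flip-Commute g cg))
        h₁ = fst sp
        h₂ = fst (snd sp)
        eg : g ≈ h₁ ⊕ h₂
        eg = snd (snd sp)
        r : ∀ a b p q -> (a * b) * (p * q) ≡ (p * a) * (q * b)
        r = solve-∀
        comm' : ∀ z -> (σ ▸ ((h₁ ⊕ h₂) ▸ z)) ≡ (h₁ ⊕ h₂) ▸ (σ ▸ z)
        comm' z = trans (cong (σ ▸_) (sym (eg z))) (trans (cg z) (eg (σ ▸ z)))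
        cc : Commute c h₁ × Commute ρ h₂
        cc = (\ x -> Finₚ.↑ˡ-injective k _ _ (trans (sym (⊕-ˡ c ρ _)) (trans (cong (σ ▸_) (sym (⊕-ˡ h₁ h₂ x))) (trans (comm' (x ↑ˡ k)) (trans (cong ((h₁ ⊕ h₂) ▸_) (⊕-ˡ c ρ x)) (⊕-ˡ h₁ h₂ _))))))
           , (\ y -> Finₚ.↑ʳ-injective i _ _ (trans (sym (⊕-ʳ c ρ _)) (trans (cong (σ ▸_) (sym (⊕-ʳ h₁ h₂ y))) (trans (comm' (i ↑ʳ y)) (trans (cong ((h₁ ⊕ h₂) ▸_) (⊕-ʳ c ρ y)) (⊕-ʳ h₁ h₂ _))))))
        sep : ∀ g₁ g₂ -> 𝟙 (g ≈? (g₁ ⊕ g₂)) ≡ 𝟙 (g₁ ≈? h₁) * 𝟙 (g₂ ≈? h₂)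
        sep g₁ g₂ = fin (g₁ ≈? h₁) (g₂ ≈? h₂)
          where
          inj : g ≈ g₁ ⊕ g₂ -> g₁ ≈ h₁ × g₂ ≈ h₂
          inj e = ⊕-inj g₁ h₁ g₂ h₂ (\ z -> trans (sym (e z)) (eg z))
          fin : (d : Dec (g₁ ≈ h₁)) (d' : Dec (g₂ ≈ h₂)) -> 𝟙 (g ≈? (g₁ ⊕ g₂)) ≡ 𝟙 d * 𝟙 d'
          fin (yes p) (yes q) = 𝟙-yes (g ≈? (g₁ ⊕ g₂)) (\ z -> trans (eg z) (sym (⊕-cong {g₁ = g₁} {h₁} {g₂} {h₂} p q z)))
          fin (yes p) (no nq) = 𝟙-no (g ≈? (g₁ ⊕ g₂)) (\ e -> nq (snd (inj e)))
          fin (no np) d' = 𝟙-no (g ≈? (g₁ ⊕ g₂)) (\ e -> np (fst (inj e)))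

  Θ-⊕ : ∀ Φ -> Resp Φ -> Θ Φ σ ≡ ∑ Gi (\ g₁ -> cm c g₁ * Θ (\ g₂ -> Φ (g₁ ⊕ g₂)) ρ)
  Θ-⊕ Φ rΦ = sym (begin
    ∑ Gi (\ g₁ -> cm c g₁ * ∑ Gk (\ g₂ -> cm ρ g₂ * Φ (g₁ ⊕ g₂)))
      ≡⟨ ∑-cong Gi (\ g₁ -> trans (sym (∑-* Gk (cm c g₁) (\ g₂ -> cm ρ g₂ * Φ (g₁ ⊕ g₂)))) (∑-cong Gk (\ g₂ -> trans (sym (Z.*-assoc (cm c g₁) (cm ρ g₂) (Φ (g₁ ⊕ g₂))))
           (trans (cong (cm c g₁ * cm ρ g₂ *_) (sym (∑-δ (g₁ ⊕ g₂) Φ rΦ))) (sym (∑-* G (cm c g₁ * cm ρ g₂) (\ g -> 𝟙 (g ≈? (g₁ ⊕ g₂)) * Φ g))))))) ⟩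
    ∑ Gi (\ g₁ -> ∑ Gk (\ g₂ -> ∑ G (\ g -> K g₁ g₂ g)))
      ≡⟨ trans (∑-cong Gi (\ g₁ -> ∑-swap Gk G (K g₁))) (∑-swap Gi G (\ g₁ g -> ∑ Gk (\ g₂ -> K g₁ g₂ g))) ⟩
    ∑ G (\ g -> ∑ Gi (\ g₁ -> ∑ Gk (\ g₂ -> K g₁ g₂ g)))
      ≡⟨ ∑-cong G (\ g -> trans (∑-cong Gi (\ g₁ -> trans (∑-cong Gk (\ g₂ -> r (cm c g₁ * cm ρ g₂) (𝟙 (g ≈? (g₁ ⊕ g₂))) (Φ g))) (∑-* Gk (Φ g) (B g g₁))))
           (trans (∑-* Gi (Φ g) (\ g₁ -> ∑ Gk (B g g₁))) (trans (cong (Φ g *_) (bracket g)) (Z.*-comm (Φ g) (cm σ g))))) ⟩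
    ∑ G (\ g -> cm σ g * Φ g) ∎)
    where
    B : Sym (i N.+ k) -> Sym i -> Sym k -> ℤ
    B g g₁ g₂ = (cm c g₁ * cm ρ g₂) * 𝟙 (g ≈? (g₁ ⊕ g₂))
    K : Sym i -> Sym k -> Sym (i N.+ k) -> ℤ
    K g₁ g₂ g = cm c g₁ * cm ρ g₂ * (𝟙 (g ≈? (g₁ ⊕ g₂)) * Φ g)
    r : ∀ a b c -> a * (b * c) ≡ c * (a * b)
    r = solve-∀

  Zn-⊕ : Zn σ ≡ Zn c * Zn ρ
  Zn-⊕ = trans (∑-cong G (\ g -> sym (Z.*-identityʳ (cm σ g)))) (trans (Θ-⊕ (\ _ -> 1ℤ) (\ _ -> refl)) (trans (∑-cong Gi (\ g₁ -> trans (cong (cm c g₁ *_) (∑-cong Gk (\ g₂ -> Z.*-identityʳ (cm ρ g₂)))) (Z.*-comm (cm c g₁) (Zn ρ))))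
    (trans (∑-* Gi (Zn ρ) (cm c)) (Z.*-comm (Zn ρ) (Zn c)))))

open import Data.Nat.Divisibility using (∣-trans; m≤n⇒m!∣n!; m∣m*n)
import Data.Nat.DivMod as DM
open import Data.Nat.ListAction using (sum)
import Data.Nat.ListAction.Properties as LAₚ
open import Data.Vec using (toList)
open import Data.List.Relation.Unary.Linked as Linked using (Linked)

-- A lower bound for the sum of all p_λ

∑-≤ : ∀ {A : Set} (xs : List A) {f g : A -> ℤ} -> (∀ x -> f x Z.≤ g x) -> ∑ xs f Z.≤ ∑ xs g
∑-≤ [] h = Z.≤-refl
∑-≤ (x ∷ xs) h = Z.+-mono-≤ (h x) (∑-≤ xs h)

∑-𝟙 : ∀ {A : Set} (xs : List A) {P : A -> Set} (d : ∀ x -> Dec (P x)) -> ∃[ c ] (c N.≤ length xs × ∑ xs (\ x -> 𝟙 (d x)) ≡ pos c)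
∑-𝟙 [] d = 0 , z≤n , refl
∑-𝟙 (x ∷ xs) d = let (c , l , e) = ∑-𝟙 xs d in go (d x) c l e
  where
  go : ∀ {P : Set} (d' : Dec P) c -> c N.≤ length xs -> ∑ xs (\ x -> 𝟙 (d x)) ≡ pos c -> ∃[ c' ] (c' N.≤ suc (length xs) × 𝟙 d' + ∑ xs (\ x -> 𝟙 (d x)) ≡ pos c')
  go (yes _) c l e = suc c , s≤s l , cong (1ℤ +_) e
  go (no _) c l e = c , N.≤-trans l (N.n≤1+n _) , cong (0ℤ +_) e

ch-class : ∀ {n N} (β : Vec ℕ N) -> Class {n} (\ ρ -> ch ρ β)
ch-class β r τ h e = sym (ch-conj r τ h (\ x -> sym (e x)) β)

Zn-pos : ∀ {n} (τ : Sym n) -> ∃[ c ] (suc c N.≤ length (allP n) × Zn τ ≡ pos (suc c))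
Zn-pos {n} τ = let (c , l , e) = ∑-𝟙 (allP n) (\ g -> (g ⨾ τ) ≈? (τ ⨾ g)) in go c l e (subst₂ Z._≤_ (trans (∑-δ {n} Perm.id (\ _ -> 1ℤ) (\ _ -> refl)) refl) e (∑-≤ (allP n) (\ g -> le g (g ≈? Perm.id))))
  where
  open import Relation.Binary.PropositionalEquality using (subst₂)
  le : ∀ g (d : Dec (g ≈ Perm.id)) -> 𝟙 d * 1ℤ Z.≤ cm τ g
  le g (yes e) = Z.≤-reflexive (sym (𝟙-yes ((g ⨾ τ) ≈? (τ ⨾ g)) (\ x -> trans (cong (τ ▸_) (e x)) (sym (e (τ ▸ x))))))
  le g (no _) = nn ((g ⨾ τ) ≈? (τ ⨾ g))
    where nn : ∀ {P : Set} (d : Dec P) -> 0ℤ Z.≤ 𝟙 d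
          nn (yes _) = Z.+≤+ z≤n
          nn (no _) = Z.+≤+ z≤n
  go : ∀ c -> c N.≤ length (allP n) -> Zn τ ≡ pos c -> 1ℤ Z.≤ pos c -> ∃[ c ] (suc c N.≤ length (allP n) × Zn τ ≡ pos (suc c))
  go zero l e (Z.+≤+ ())
  go (suc c) l e _ = c , l , e

!-pos : ∀ F -> ∃[ f ] F ! ≡ suc f
!-pos F = go (F !) (N.1≤n! F)
  where go : ∀ x -> 1 N.≤ x -> ∃[ f ] x ≡ suc f
        go (suc x) _ = x , refl

*-cancelˡ : ∀ c {x y} -> pos (suc c) * x ≡ pos (suc c) * y -> x ≡ y
*-cancelˡ c {x} {y} e = Z.*-cancelˡ-≡ (pos (suc c)) x y e

-- `Dn` is a common multiple of all centraliser orders: each of them lies between 1 and F, hence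
-- divides F!. So the weights 1/|C(τ)| of the class equation become the integers `w τ`.
module Level (n : ℕ) where
  F : ℕ
  F = length (allP n)

  Dn : ℤ
  Dn = pos (F !)

  Dn-pos : ∃[ f ] Dn ≡ pos (suc f)
  Dn-pos = let (f , e) = !-pos F in f , cong pos e

  quo : ℕ -> ℤ
  quo zero = 0ℤ
  quo (suc c) = pos ((F !) DM./ suc c)

  w : Sym n -> ℤ
  w τ = quo Z.∣ Zn τ ∣

  0≤w : ∀ τ -> 0≤ w τ
  0≤w τ = go Z.∣ Zn τ ∣
    where go : ∀ c -> 0≤ quo c
          go zero = Z.+≤+ z≤n
          go (suc c) = Z.+≤+ z≤n

  w-Zn : ∀ τ -> w τ * Zn τ ≡ Dn
  w-Zn τ = let (c , l , e) = Zn-pos τ in trans (cong (\ z -> quo Z.∣ z ∣ * z) e)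
    (trans (sym (Z.pos-* ((F !) DM./ suc c) (suc c))) (cong pos (DM.m/n*n≡m (∣-trans (m∣m*n (c !)) (m≤n⇒m!∣n! l)))))

  w-class : Class w
  w-class r τ h e = cong (\ z -> quo Z.∣ z ∣) (Zn-class r τ h e)

  class-average : ∀ Φ -> Class Φ -> Dn * ∑ (reps n) (\ κ -> Φ (rp n κ)) ≡ ∑ (reps n) (\ κ -> w (rp n κ) * Θ Φ (rp n κ))
  class-average Φ c = go F refl (let (c , l , _) = Zn-pos (Perm.id {n}) in N.≤-trans (s≤s z≤n) l)
    where
    open ClassEq (reps n) (rp n) (classes n)
    go : ∀ f -> f ≡ F -> 1 N.≤ F -> Dn * ∑ (reps n) (\ κ -> Φ (rp n κ)) ≡ ∑ (reps n) (\ κ -> w (rp n κ) * Θ Φ (rp n κ))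
    go zero e l = ⊥-elim (N.<-irrefl e l)
    go (suc f) e l = *-cancelˡ f (trans (cong (_* (Dn * S)) N!≡) (trans (average Φ c w w-class Dn w-Zn) (cong (_* T') (sym N!≡))))
      where
      S = ∑ (reps n) (\ κ -> Φ (rp n κ))
      T' = ∑ (reps n) (\ κ -> w (rp n κ) * Θ Φ (rp n κ))
      N!≡ : pos (suc f) ≡ N!
      N!≡ = trans (cong pos e) (sym (trans (∑-const (allP n) 1ℤ) (Z.*-identityʳ _)))

pad : ∀ j {N} -> Vec ℕ N -> Vec ℕ (j N.+ N)
pad zero β = β
pad (suc j) β = 0 Vec.∷ Vec.map suc (pad j β)

Str-suc : ∀ {N} lo (β : Vec ℕ N) -> Str lo β -> Str (suc lo) (Vec.map suc β)
Str-suc lo Vec.[] s = tt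
Str-suc lo (b Vec.∷ β) (p , s) = s≤s p , Str-suc (suc b) β s

Str-pad : ∀ j {N} {β : Vec ℕ N} -> Str 0 β -> Str 0 (pad j β)
Str-pad zero s = s
Str-pad (suc j) {β = β} s = z≤n , Str-suc 0 (pad j β) (Str-pad j s)

alt-pad : ∀ κ j {N} (β : Vec ℕ N) -> alt (sucs κ) (pad j β) ≡ alt (sucs κ) β
alt-pad κ zero β = refl
alt-pad κ (suc j) β = trans (alt-stable κ (pad j β)) (alt-pad κ j β)

-- Adding n zero parts leaves the character unchanged (`alt-pad`) and provides the number of
-- variables that `gram-ch` asks for.
gram-ch′ : ∀ n {N} (β : Vec ℕ N) -> Str 0 β -> Gram {n} (\ ρ -> ch ρ β)
gram-ch′ n {N} β s = Gram-resp (\ ρ -> alt-pad (typ ρ) n β) (gram-ch n (N.m≤m+n n N) (pad n β) (Str-pad n s))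

0≤-÷′ : ∀ {z x} -> ∃[ c ] z ≡ pos (suc c) -> 0≤ (z * x) -> 0≤ x
0≤-÷′ {x = x} (c , e) h = 0≤-÷ c (subst (\ z -> 0≤ (z * x)) e h)

Zn-suc : ∀ {n} (τ : Sym n) -> ∃[ c ] Zn τ ≡ pos (suc c)
Zn-suc τ = let (c , _ , e) = Zn-pos τ in c , e

Θ-pos : ∀ {n N} (β : Vec ℕ N) -> Str 0 β -> ∀ (τ : Sym n) -> 0≤ Θ (\ ρ -> ch ρ β) τ
Θ-pos {n} β s τ = 0≤-÷′ (Zn-suc τ) (subst 0≤_ (quad-centraliser (ch-class β) τ) (quad-pos (map (\ g -> cm τ g , g) (allP n)) (gram-ch′ n β s)))

∑-⊆ : ∀ {A : Set} (ys xs : List A) (f : A -> ℤ) -> Unique ys -> (∀ {y} -> y ∈ ys -> y ∈ xs) -> (∀ {x} -> x ∈ xs -> 0≤ f x) -> ∑ ys f Z.≤ ∑ xs f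
∑-⊆ [] xs f u i p = 0≤-∑ xs p
∑-⊆ (y ∷ ys) xs f (a ∷ u) i p = let (as , bs , e) = ∈-∃++ (i (here refl))
                                    q : xs ↭ y ∷ as ++ bs
                                    q = ↭-trans (↭-reflexive e) (↭ₚ.shift y as bs) in
  Z.≤-trans (Z.+-monoʳ-≤ (f y) (∑-⊆ ys (as ++ bs) f u (\ {z} m -> out z (All.lookup a m) (↭ₚ.∈-resp-↭ q (i (there m)))) (\ m -> p (↭ₚ.∈-resp-↭ (↭-sym q) (there m)))))
    (Z.≤-reflexive (sym (∑-↭ q f)))
  where out : ∀ z {zs} -> y ≢ z -> z ∈ y ∷ zs -> z ∈ zs
        out z ne (here e) = ⊥-elim (ne (sym e))
        out z ne (there m) = m

-- The partitions whose first part is n ∸ k with k < K; the remaining parts form a member of S k.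
blocks : (ℕ -> List (List ℕ)) -> ℕ -> ℕ -> List (List ℕ)
blocks S n K = concatMap (\ k -> map (n N.∸ k ∷_) (S k)) (upTo K)

∈-blocks : ∀ S {n K k λ'} -> k N.< K -> λ' ∈ S k -> (n N.∸ k ∷ λ') ∈ blocks S n K
∈-blocks S {n} {k = k} l m = ∈-concatMap⁺ (\ k -> map (n N.∸ k ∷_) (S k)) (lose (∈-upTo⁺ l) (∈-map⁺ (n N.∸ k ∷_) m))

blocks-∈ : ∀ S {n K λ'} -> λ' ∈ blocks S n K -> ∃[ k ] ∃[ λ'' ] (k N.< K × λ'' ∈ S k × λ' ≡ n N.∸ k ∷ λ'')
blocks-∈ S {n} {K} m = let (k , l , q) = find (∈-concatMap⁻ (\ k -> map (n N.∸ k ∷_) (S k)) {xs = upTo K} m) ; (λ'' , r , e) = ∈-map⁻ (n N.∸ k ∷_) q in k , λ'' , ∈-upTo⁻ l , r , e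

blocks-unique : ∀ S n K -> (∀ k -> Unique (S k)) -> K N.≤ suc n -> Unique (blocks S n K)
blocks-unique S n K us le = go (upTo K) (Uₚ.upTo⁺ K) (\ m -> N.≤-pred (N.≤-trans (∈-upTo⁻ m) le))
  where
  h = \ k -> map (n N.∸ k ∷_) (S k)
  go : ∀ ks -> Unique ks -> (∀ {k} -> k ∈ ks -> k N.≤ n) -> Unique (concatMap h ks)
  go [] [] b = []
  go (k ∷ ks) (a ∷ u) b = Uₚ.++⁺ (Uₚ.map⁺ Lₚ.∷-injectiveʳ (us k)) (go ks u (b ∘ there)) disj
    where
    disj : ∀ {λ'} -> λ' ∈ h k × λ' ∈ concatMap h ks -> ⊥
    disj (p , q) = let (x , _ , e) = ∈-map⁻ (n N.∸ k ∷_) p ; (k' , m , q') = find (∈-concatMap⁻ h {xs = ks} q) ; (y , _ , e') = ∈-map⁻ (n N.∸ k' ∷_) q' in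
      All.lookup a m (N.∸-cancelˡ-≡ (b (here refl)) (b (there m)) (Lₚ.∷-injectiveˡ (trans (sym e) e')))

∑-blocks : ∀ S n K f -> ∑ (blocks S n K) f ≡ ∑ (upTo K) (\ k -> ∑ (S k) (\ λ' -> f (n N.∸ k ∷ λ')))
∑-blocks S n K f = trans (concat-∑ (\ k -> map (n N.∸ k ∷_) (S k)) (upTo K) f) (∑-cong (upTo K) (\ k -> ∑-map (n N.∸ k ∷_) (S k) f))

-- ψ_{(n)}, the sum of all p_λ with λ ⊢ n
ψc : ℕ -> Comb
ψc n = map (1ℤ ,_) (reps n)

-- |C| L_{m+1}: the sum of p_{type g} over the centraliser of an (m+1)-cycle.
Lc : ℕ -> Comb
Lc m = map (\ g -> cm (rotP m) g , typ g) (allP (suc m))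

val-ψc : ∀ n {N} (β : Vec ℕ N) -> val (ψc n) β ≡ ∑ (reps n) (\ κ -> alt (sucs κ) β)
val-ψc n β = trans (∑-map (1ℤ ,_) (reps n) (term β)) (∑-cong (reps n) (\ κ -> Z.*-identityˡ (alt (sucs κ) β)))

val-Lc : ∀ m {N} (β : Vec ℕ N) -> val (Lc m) β ≡ Θ (\ ρ -> ch ρ β) (rotP m)
val-Lc m β = ∑-map (\ g -> cm (rotP m) g , typ g) (allP (suc m)) (term β)

reps-sum : ∀ n {κ} -> κ ∈ reps n -> lsumℕ (sucs κ) ≡ n
reps-sum n m = let (λ' , q , e) = ∈-map⁻ preds m ; r = ∈⇒Par n q in trans (cong (lsumℕ ∘ sucs) e) (trans (cong lsumℕ (sucs-preds r)) (Par-sum r))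

ch-rp : ∀ n {κ} -> κ ∈ reps n -> ∀ {N} (β : Vec ℕ N) -> ch (rp n κ) β ≡ alt (sucs κ) β
ch-rp n {κ} m β = alt-↭ {typ (rp n κ)} {κ} (typ-rp (reps-sum n m)) β

-- The contribution to the class equation of S_n of the classes with a cycle of length m + 1 and the
-- remaining cycles given by a partition of k.
part : ∀ n m k {N} -> Vec ℕ N -> ℤ
part n m k β = ∑ (reps k) (\ κ -> w (rp n (m ∷ κ)) * Θ (\ ρ -> ch ρ β) (rp n (m ∷ κ)))
  where open Level n

-- For k ≤ m the centraliser is a product, so both Θ and the weights factor. The sum over the
-- centralisers of the remaining cycles is again a class equation, now of S_k, and collapses to ψ_k;
-- the cycle of length m + 1 leaves the factor `Lc m`.
part-eq : ∀ {n} m k -> k N.≤ m -> suc m N.+ k ≡ n -> ∀ {N} (β : Vec ℕ N) -> Zn (rotP m) * part n m k β ≡ Level.Dn n * val (Lc m ⊛ ψc k) β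
part-eq m k le refl β = cancel (Level.Dn-pos k) (begin
  Dn k * (zr * ∑ R (\ κ -> w n (rp n (m ∷ κ)) * Θ χβ (rp n (m ∷ κ))))
    ≡⟨ cong (Dn k *_) (cong (zr *_) (∑-cong-∈ R (\ {κ} i -> conj κ i))) ⟩
  Dn k * (zr * ∑ R (\ κ -> w n (σ κ) * Θ χβ (σ κ)))
    ≡⟨ trans (sym (Z.*-assoc (Dn k) zr (∑ R (\ κ -> w n (σ κ) * Θ χβ (σ κ))))) (sym (∑-* R (Dn k * zr) (\ κ -> w n (σ κ) * Θ χβ (σ κ)))) ⟩
  ∑ R (\ κ -> Dn k * zr * (w n (σ κ) * Θ χβ (σ κ)))
    ≡⟨ ∑-cong R (\ κ -> trans (sym (Z.*-assoc (Dn k * zr) (w n (σ κ)) (Θ χβ (σ κ)))) (trans (cong₂ _*_ (wt κ) (Centraliser.Θ-⊕ m k le (rp k κ) χβ (\ {s} {t} -> Class⇒Resp {Φ = χβ} (ch-class β) {s} {t}))) (Z.*-assoc (Dn n) (w k (rp k κ)) (J κ)))) ⟩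
  ∑ R (\ κ -> Dn n * (w k (rp k κ) * J κ))
    ≡⟨ ∑-* R (Dn n) (\ κ -> w k (rp k κ) * J κ) ⟩
  Dn n * ∑ R (\ κ -> w k (rp k κ) * J κ)
    ≡⟨ cong (Dn n *_) (begin
      ∑ R (\ κ -> w k (rp k κ) * J κ)
        ≡⟨ ∑-cong R (\ κ -> sym (∑-* G (w k (rp k κ)) (\ g -> cm c g * Θ (Ψ g) (rp k κ)))) ⟩
      ∑ R (\ κ -> ∑ G (\ g -> w k (rp k κ) * (cm c g * Θ (Ψ g) (rp k κ))))
        ≡⟨ ∑-swap R G (\ κ g -> w k (rp k κ) * (cm c g * Θ (Ψ g) (rp k κ))) ⟩
      ∑ G (\ g -> ∑ R (\ κ -> w k (rp k κ) * (cm c g * Θ (Ψ g) (rp k κ))))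
        ≡⟨ ∑-cong G (\ g -> trans (∑-cong R (\ κ -> r₁ (w k (rp k κ)) (cm c g) (Θ (Ψ g) (rp k κ)))) (trans (∑-* R (cm c g) (\ κ -> w k (rp k κ) * Θ (Ψ g) (rp k κ)))
             (cong (cm c g *_) (sym (Level.class-average k (Ψ g) (Ψ-class g)))))) ⟩
      ∑ G (\ g -> cm c g * (Dn k * ∑ R (\ κ -> Ψ g (rp k κ))))
        ≡⟨ trans (∑-cong G (\ g -> r₁ (cm c g) (Dn k) (∑ R (\ κ -> Ψ g (rp k κ))))) (∑-* G (Dn k) (\ g -> cm c g * ∑ R (\ κ -> Ψ g (rp k κ)))) ⟩
      Dn k * ∑ G (\ g -> cm c g * ∑ R (\ κ -> Ψ g (rp k κ)))
        ≡⟨ cong (Dn k *_) (sym vl) ⟩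
      Dn k * val (Lc m ⊛ ψc k) β ∎) ⟩
  Dn n * (Dn k * val (Lc m ⊛ ψc k) β) ≡⟨ r₁ (Dn n) (Dn k) (val (Lc m ⊛ ψc k) β) ⟩
  Dn k * (Dn n * val (Lc m ⊛ ψc k) β) ∎)
  where
  open Level using (Dn; w)
  n = suc m N.+ k
  R = reps k
  c = rotP m
  zr = Zn c
  G = allP (suc m)
  χβ : Sym n -> ℤ
  χβ ρ = ch ρ β
  Ψ : Sym (suc m) -> Sym k -> ℤ
  Ψ g ρ = ch (g ⊕ ρ) β
  σ : List ℕ -> Sym n
  σ κ = rotP m ⊕ rp k κ
  J : List ℕ -> ℤ
  J κ = ∑ G (\ g -> cm c g * Θ (Ψ g) (rp k κ))
  r₁ : ∀ a b c -> a * (b * c) ≡ b * (a * c)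
  r₁ = solve-∀
  cancel : ∃[ f ] Dn k ≡ pos (suc f) -> ∀ {x y} -> Dn k * x ≡ Dn k * y -> x ≡ y
  cancel (f , e) {x} {y} q = *-cancelˡ f (subst (\ d -> d * x ≡ d * y) e q)
  Ψ-class : ∀ g -> Class (Ψ g)
  Ψ-class g r τ h e = alt-↭ {typ (g ⊕ r)} {typ (g ⊕ τ)} (↭-trans (typ-⊕ g r) (↭-trans (↭ₚ.++⁺ˡ (typ g) (conj-types r τ h e)) (↭-sym (typ-⊕ g τ)))) β
  conj : ∀ κ -> κ ∈ R -> w n (rp n (m ∷ κ)) * Θ χβ (rp n (m ∷ κ)) ≡ w n (σ κ) * Θ χβ (σ κ)
  conj κ i = go (types-conj (rp n (m ∷ κ)) (σ κ) tt')
    where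
    tt' : typ (rp n (m ∷ κ)) ↭ typ (σ κ)
    tt' = ↭-trans (typ-rp {n} {m ∷ κ} (cong (suc m N.+_) (reps-sum k i))) (↭-sym (↭-trans (typ-⊕ (rotP m) (rp k κ)) (↭ₚ.++⁺ (typ-rotP m) (typ-rp {k} {κ} (reps-sum k i)))))
    go : ∃[ h ] Conj (rp n (m ∷ κ)) (σ κ) h -> w n (rp n (m ∷ κ)) * Θ χβ (rp n (m ∷ κ)) ≡ w n (σ κ) * Θ χβ (σ κ)
    go (h , q) = cong₂ _*_ (Level.w-class n (rp n (m ∷ κ)) (σ κ) h q) (Θ-class {Φ = χβ} (ch-class β) (rp n (m ∷ κ)) (σ κ) h q)
  wt : ∀ κ -> Dn k * zr * w n (σ κ) ≡ Dn n * w k (rp k κ)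
  wt κ = trans (cong (\ d -> d * zr * w n (σ κ)) (sym (Level.w-Zn k (rp k κ)))) (trans (r₂ (w k (rp k κ)) (Zn (rp k κ)) zr (w n (σ κ)))
           (cong (_* w k (rp k κ)) (trans (cong (w n (σ κ) *_) (sym (Centraliser.Zn-⊕ m k le (rp k κ)))) (Level.w-Zn n (σ κ)))))
    where r₂ : ∀ a z y x -> a * z * y * x ≡ x * (y * z) * a
          r₂ = solve-∀
  vl : val (Lc m ⊛ ψc k) β ≡ ∑ G (\ g -> cm c g * ∑ R (\ κ -> Ψ g (rp k κ)))
  vl = trans (concat-∑ (\ cκ -> map (\ dμ -> fst cκ * fst dμ , snd cκ ++ snd dμ) (ψc k)) (Lc m) (term β)) (trans (∑-map (\ g -> cm c g , typ g) G (\ cκ -> ∑ (map (\ dμ -> fst cκ * fst dμ , snd cκ ++ snd dμ) (ψc k)) (term β))) (∑-cong G (\ g ->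
         trans (∑-map (\ dμ -> cm c g * fst dμ , typ g ++ snd dμ) (ψc k) (term β)) (trans (∑-map (1ℤ ,_) R (\ dμ -> (cm c g * fst dμ) * alt (sucs (typ g ++ snd dμ)) β)) (trans (∑-cong-∈ R (\ {κ} i ->
           (cong₂ _*_ (Z.*-identityʳ (cm c g)) (alt-↭ {typ g ++ κ} {typ (g ⊕ rp k κ)} (↭-trans (↭ₚ.++⁺ˡ (typ g) (↭-sym (typ-rp (reps-sum k i)))) (↭-sym (typ-⊕ g (rp k κ)))) β))))
           (∑-* R (cm c g) (\ κ -> Ψ g (rp k κ))))))))

cons∈partitions : ∀ {n k λ'} -> suc (k N.+ k) N.≤ n -> λ' ∈ partitions k -> (n N.∸ k ∷ λ') ∈ partitions n
cons∈partitions {n} {k} {λ'} l q = Par⇒∈partitions (subst (\ t -> Par t n (n N.∸ k ∷ λ')) (N.m∸n+n≡m k≤n)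
    (cons (N.m+n≤o⇒m≤o∸n 1 (N.≤-trans (s≤s (N.m≤m+n k k)) l)) (N.m∸n≤m n k) (Par-mono (N.m+n≤o⇒m≤o∸n k (N.<⇒≤ l)) (∈⇒Par k q))))
  where k≤n = N.≤-trans (N.m≤m+n k k) (N.<⇒≤ l)

-- Only the classes whose largest part is n ∸ k with 2k < n are kept.
ψ-bound : ∀ n K -> (∀ k -> k N.< K -> suc (k N.+ k) N.≤ n) -> ∀ {N} (β : Vec ℕ N) -> Str 0 β ->
  ∑ (upTo K) (\ k -> part n (N.pred (n N.∸ k)) k β) Z.≤ Level.Dn n * val (ψc n) β
ψ-bound n K hk {N} β s = Z.≤-trans (Z.≤-reflexive (sym lhs)) (Z.≤-trans (∑-⊆ (blocks partitions n K) (partitions n) f uq sub (\ {λ'} _ -> 0≤-* (Level.0≤w n (rp n (preds λ'))) (Θ-pos {n} β s (rp n (preds λ'))))) (Z.≤-reflexive (sym rhs)))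
  where
  open Level n
  f : List ℕ -> ℤ
  f λ' = w (rp n (preds λ')) * Θ (\ ρ -> ch ρ β) (rp n (preds λ'))
  lhs : ∑ (blocks partitions n K) f ≡ ∑ (upTo K) (\ k -> part n (N.pred (n N.∸ k)) k β)
  lhs = trans (∑-blocks partitions n K f) (∑-cong (upTo K) (\ k -> sym (∑-map preds (partitions k) (\ κ -> w (rp n (N.pred (n N.∸ k) ∷ κ)) * Θ (\ ρ -> ch ρ β) (rp n (N.pred (n N.∸ k) ∷ κ))))))
  rhs : Dn * val (ψc n) β ≡ ∑ (partitions n) f
  rhs = trans (cong (Dn *_) (trans (val-ψc n β) (∑-cong-∈ (reps n) (\ m -> sym (ch-rp n m β))))) (trans (class-average (\ ρ -> ch ρ β) (ch-class β)) (∑-map preds (partitions n) (\ κ -> w (rp n κ) * Θ (\ ρ -> ch ρ β) (rp n κ))))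
  uq : Unique (blocks partitions n K)
  uq = blocks-unique partitions n K (\ k -> partsF-unique k k k) (bd K hk)
    where bd : ∀ K -> (∀ k -> k N.< K -> suc (k N.+ k) N.≤ n) -> K N.≤ suc n
          bd zero h = z≤n
          bd (suc K) h = s≤s (N.≤-trans (N.m≤m+n K K) (N.<⇒≤ (h K N.≤-refl)))
  sub : ∀ {y} -> y ∈ blocks partitions n K -> y ∈ partitions n
  sub m = let (k , λ'' , l , q , e) = blocks-∈ partitions m in subst (_∈ partitions n) (sym e) (cons∈partitions {n} {k} {λ''} (hk k l) q)

-- Hooks and the dihedral group

open Data.Vec using ([]; _∷_)

-- The beads of the hook (x − lo, 1ʳ): lo, …, lo + r − 1 and x.
hk : ℕ -> ∀ r -> ℕ -> Vec ℕ (suc r)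
hk lo zero x = x ∷ []
hk lo (suc r) x = lo ∷ hk (suc lo) r x

hk-suc : ∀ lo r x -> hk (suc lo) r (suc x) ≡ Vec.map suc (hk lo r x)
hk-suc lo zero x = refl
hk-suc lo (suc r) x = cong (suc lo ∷_) (hk-suc (suc lo) r x)

Str-hk : ∀ lo r x -> lo N.+ r N.≤ x -> Str lo (hk lo r x)
Str-hk lo zero x l = subst (N._≤ x) (N.+-identityʳ lo) l , tt
Str-hk lo (suc r) x l = N.≤-refl , Str-hk (suc lo) r x (subst (N._≤ x) (N.+-suc lo r) l)

_∈ᵥ_ : ∀ {N} -> ℕ -> Vec ℕ N -> Set
a ∈ᵥ [] = ⊥
a ∈ᵥ (b ∷ β) = a ≡ b ⊎ a ∈ᵥ β

Anti-rep : ∀ {N} {A : V (suc N)} -> Anti A -> ∀ a γ -> a ∈ᵥ γ -> A (a ∷ γ) ≡ 0ℤ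
Anti-rep h a (b ∷ γ) (inj₁ refl) = x≡-x⇒x≡0 _ (fst h a a γ)
Anti-rep {A = A} h a (b ∷ γ) (inj₂ m) = trans (fst h a b γ) (cong -_ (Anti-rep {A = \ β -> A (b ∷ β)} (snd h b) a γ m))

sh-at : ∀ k (g : ℕ -> ℤ) b -> sh k g (k N.+ b) ≡ g b
sh-at zero g b = refl
sh-at (suc k) g b = sh-at k g b

sh-small : ∀ k (g : ℕ -> ℤ) b -> b N.< k -> sh k g b ≡ 0ℤ
sh-small (suc k) g zero l = refl
sh-small (suc k) g (suc b) l = sh-small k g b (N.≤-pred l)

hk-∈ : ∀ lo r x -> x ∈ᵥ hk lo r x
hk-∈ lo zero x = inj₁ refl
hk-∈ lo (suc r) x = inj₂ (hk-∈ (suc lo) r x)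

hk-rep : ∀ {r} lo x -> lo N.≤ x -> x N.< lo N.+ r -> ∀ {A : V (suc r)} -> Anti A -> A (hk lo r x) ≡ 0ℤ
hk-rep {zero} lo x l u h = ⊥-elim (N.<⇒≱ (subst (x N.<_) (N.+-identityʳ lo) u) l)
hk-rep {suc r} lo x l u {A} h = go (N.m≤n⇒m<n∨m≡n l)
  where go : lo N.< x ⊎ lo ≡ x -> A (lo ∷ hk (suc lo) r x) ≡ 0ℤ
        go (inj₂ refl) = Anti-rep {A = A} h lo _ (hk-∈ (suc lo) r lo)
        go (inj₁ lt) = hk-rep {r} (suc lo) x lt (subst (x N.<_) (N.+-suc lo r) u) {λ β -> A (lo ∷ β)} (Anti-tail {A = A} h lo)

-- Subtracting k from a bead of an interval with the k beads below it occupied gives a repetition.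
P-hk : ∀ k r lo b x {B : V (suc r)} -> b ≡ k N.+ lo -> Anti B -> (∀ a γ -> lo N.≤ a -> a N.< k N.+ lo -> a ∈ᵥ γ -> B γ ≡ 0ℤ) ->
  1 N.≤ k -> P k B (hk b r (k N.+ x)) ≡ B (hk b r x)
P-hk k zero lo b x {B} e h z l = trans (+-identityʳ _) (sh-at k (\ y -> B (y ∷ [])) x)
P-hk k (suc r) lo b x {B} refl h z l = trans (cong₂ _+_ (trans (sh-at k _ lo) (z lo _ N.≤-refl (N.+-monoˡ-≤ lo l) (inj₁ refl)))
  (P-hk k r (suc lo) (suc (k N.+ lo)) x {λ β -> B (k N.+ lo ∷ β)} (sym (N.+-suc k lo)) (Anti-tail {A = B} h (k N.+ lo)) z' l)) (+-identityˡ _)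
  where
  z' : ∀ a γ -> suc lo N.≤ a -> a N.< k N.+ suc lo -> a ∈ᵥ γ -> B (k N.+ lo ∷ γ) ≡ 0ℤ
  z' a γ p q m = go (N.m≤n⇒m<n∨m≡n (N.≤-pred (subst (a N.<_) (N.+-suc k lo) q)))
    where go : a N.< k N.+ lo ⊎ a ≡ k N.+ lo -> B (k N.+ lo ∷ γ) ≡ 0ℤ
          go (inj₁ lt) = z a (k N.+ lo ∷ γ) (N.<⇒≤ p) lt (inj₂ m)
          go (inj₂ refl) = Anti-rep {A = B} h a γ m

alt-strip : ∀ κ r x -> alt (sucs κ) (0 ∷ hk 2 r (suc x)) ≡ alt (sucs κ) (hk 1 r x)
alt-strip κ r x = trans (cong (\ t -> alt (sucs κ) (0 ∷ t)) (hk-suc 1 r x)) (alt-stable κ (hk 1 r x))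

-- The box comes off the leg, after which a zero part is stripped, or off the arm.
P1-hk : ∀ κ r x -> alt (sucs (0 ∷ κ)) (hk 1 (suc r) (suc x)) ≡ alt (sucs κ) (hk 1 r x) + alt (sucs κ) (hk 1 (suc r) x)
P1-hk κ r x = cong₂ _+_ (alt-strip κ r x) (P-hk 1 r 1 2 x {λ β -> alt (sucs κ) (1 ∷ β)} refl (Anti-tail {A = alt (sucs κ)} (Anti-alt (sucs κ)) 1)
    (\ a γ l u m -> z a γ (N.≤-antisym (N.≤-pred u) l) m) (s≤s z≤n))
  where z : ∀ a γ -> a ≡ 1 -> a ∈ᵥ γ -> alt (sucs κ) (1 ∷ γ) ≡ 0ℤ
        z a γ refl m = Anti-rep {A = alt (sucs κ)} (Anti-alt (sucs κ)) 1 γ m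

-- A domino comes off the arm, or off the leg with sign -1: bead 2 then moves to 0 past bead 1.
-- Every other bead would land on an occupied place.
P2-hk : ∀ κ r x -> alt (sucs (1 ∷ κ)) (hk 1 (suc (suc r)) (suc (suc x))) ≡ alt (sucs κ) (hk 1 (suc (suc r)) x) - alt (sucs κ) (hk 1 r x)
P2-hk κ r x = trans (+-identityˡ _) (trans (cong₂ _+_ first (P-hk 2 r 1 3 x {λ β -> A (1 ∷ 2 ∷ β)} refl (Anti-tail {A = \ β -> A (1 ∷ β)} (Anti-tail {A = A} (Anti-alt (sucs κ)) 1) 2) z (s≤s z≤n))) (+-comm (- alt (sucs κ) (hk 1 r x)) _))
  where
  A = alt (sucs κ) {suc (suc (suc r))}
  first : A (1 ∷ 0 ∷ hk 3 r (suc (suc x))) ≡ - alt (sucs κ) (hk 1 r x)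
  first = trans (fst (Anti-alt (sucs κ)) 1 0 _) (cong -_ (trans (cong (\ t -> A (0 ∷ 1 ∷ t)) (hk-suc 2 r (suc x))) (trans (alt-stable κ (0 ∷ hk 2 r (suc x))) (alt-strip κ r x))))
  z : ∀ a γ -> 1 N.≤ a -> a N.< 3 -> a ∈ᵥ γ -> A (1 ∷ 2 ∷ γ) ≡ 0ℤ
  z 1 γ _ _ m = Anti-rep {A = A} (Anti-alt (sucs κ)) 1 (2 ∷ γ) (inj₂ m)
  z 2 γ _ _ m = Anti-rep {A = \ β -> A (1 ∷ β)} (snd (Anti-alt (sucs κ)) 1) 2 γ m
  z (suc (suc (suc a))) γ _ (s≤s (s≤s (s≤s ()))) m

dbl : ℕ -> ℕ
dbl zero = zero
dbl (suc q) = suc (suc (dbl q))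

sg : ℕ -> ℤ
sg zero = 1ℤ
sg (suc r) = - sg r

sg-dbl : ∀ q -> sg (dbl q) ≡ 1ℤ
sg-dbl zero = refl
sg-dbl (suc q) = trans (Z.neg-involutive (sg (dbl q))) (sg-dbl q)

sg-sq : ∀ r -> sg r * sg r ≡ 1ℤ
sg-sq zero = refl
sg-sq (suc r) = trans (n (sg r)) (sg-sq r)
  where n : ∀ x -> (- x) * (- x) ≡ x * x
        n = solve-∀

-- Binomial coefficients.
cb : ℕ -> ℕ -> ℕ
cb a zero = 1
cb zero (suc q) = 0
cb (suc a) (suc q) = cb a (suc q) N.+ cb a q

cb-pos : ∀ a q -> q N.≤ a -> ∃[ c ] cb a q ≡ suc c
cb-pos a zero l = 0 , refl
cb-pos (suc a) (suc q) (s≤s l) = let (c , e) = cb-pos a q l in cb a (suc q) N.+ c , trans (cong (cb a (suc q) N.+_) e) (N.+-suc _ c)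

-- What is left of the type of a reflection of a polygon after setting 2-cycles aside: one fixed
-- point, two fixed points, or, in the absence of fixed points, one retained 2-cycle.
data Base : List ℕ -> ℕ -> Set where
  b1 : Base (0 ∷ []) 1
  b2 : Base (1 ∷ []) 2
  b11 : Base (0 ∷ 0 ∷ []) 2

-- `P2-hk` is Pascal's rule up to sign. With no further 2-cycle each base has value 1 at leg 0, and
-- hooks with a longer even leg do not fit. At leg 1 the values would differ between the bases,
-- hence the restriction to legs `dbl q`.
hk-value : ∀ a q {κ₀ x₀} -> Base κ₀ x₀ -> alt (sucs (replicate a 1 ++ κ₀)) (hk 1 (dbl q) (dbl a N.+ x₀)) ≡ sg q * pos (cb a q)
hk-value zero zero b1 = refl
hk-value zero zero b2 = refl
hk-value zero zero b11 = refl
hk-value zero (suc q) {κ₀} b = trans (go b) (sym (*-zeroʳ (sg (suc q))))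
  where go : ∀ {κ₀ x₀} -> Base κ₀ x₀ -> alt (sucs κ₀) (hk 1 (dbl (suc q)) x₀) ≡ 0ℤ
        go {κ₀} b1 = hk-rep {dbl (suc q)} 1 1 (s≤s z≤n) (s≤s (s≤s z≤n)) {alt (sucs κ₀)} (Anti-alt (sucs κ₀))
        go {κ₀} b2 = hk-rep {dbl (suc q)} 1 2 (s≤s z≤n) (s≤s (s≤s (s≤s z≤n))) {alt (sucs κ₀)} (Anti-alt (sucs κ₀))
        go {κ₀} b11 = hk-rep {dbl (suc q)} 1 2 (s≤s z≤n) (s≤s (s≤s (s≤s z≤n))) {alt (sucs κ₀)} (Anti-alt (sucs κ₀))
hk-value (suc a) zero b = trans (+-identityʳ _) (hk-value a zero b)
hk-value (suc a) (suc q) {κ₀} {x₀} b = trans (P2-hk (replicate a 1 ++ κ₀) (dbl q) (dbl a N.+ x₀)) (trans (cong₂ _-_ (hk-value a (suc q) b) (hk-value a q b))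
  (trans (r (sg q) (pos (cb a (suc q))) (pos (cb a q))) (cong (- sg q *_) (sym (Z.pos-+ (cb a (suc q)) (cb a q))))))
  where r : ∀ s x y -> (- s) * x - s * y ≡ (- s) * (x + y)
        r = solve-∀

Anti-suc : ∀ {N} {A : V N} -> Anti A -> Anti (\ γ -> A (Vec.map suc γ))
Anti-suc {zero} h = tt
Anti-suc {suc zero} h = tt
Anti-suc {suc (suc N)} {A} (z , t) = (\ a b β -> z (suc a) (suc b) _) , (\ a -> Anti-suc {A = \ β -> A (suc a ∷ β)} (t (suc a)))

-- Each monomial of the Vandermonde product is free of one variable, since 0 is an entry of δ.
van-suc : ∀ {N} (γ : Vec ℕ (suc N)) -> van (Vec.map suc γ) ≡ 0ℤ
van-suc {N} = Anti-zero {A = \ γ -> van (Vec.map suc γ)} (Anti-suc {A = van} Anti-van) z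
  where z : ∀ (β : Vec ℕ (suc N)) -> Str 0 β -> van (Vec.map suc β) ≡ 0ℤ
        z (b ∷ β) s = van-strict _ (Str-mono {β = Vec.map suc (b ∷ β)} z≤n (Str-suc 0 (b ∷ β) s)) (\ ())

data Insd : ∀ {r} -> ℕ -> ℕ -> Vec ℕ r -> Vec ℕ (suc r) -> Set where
  here : ∀ {r n} {γ : Vec ℕ r} -> Insd 0 n γ (n ∷ γ)
  there : ∀ {r n i a} {γ : Vec ℕ r} {β} -> Insd i n γ β -> Insd (suc i) n (a ∷ γ) (a ∷ β)

Insd-Str : ∀ {r n i lo} {γ : Vec ℕ r} {β} -> Insd i n γ β -> Str lo β -> Str lo γ
Insd-Str {γ = γ} here (p , s) = Str-mono {β = γ} (N.≤-trans p (N.n≤1+n _)) s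
Insd-Str (there i) (p , s) = p , Insd-Str i s

Insd-δ : ∀ {r n i lo} {β} -> Insd i n (δ lo r) β -> Str lo β -> i ≡ r × β ≡ hk lo r n × lo N.+ r N.≤ n
Insd-δ {zero} {lo = lo} here (p , s) = refl , refl , subst (N._≤ _) (sym (N.+-identityʳ lo)) p
Insd-δ {suc r} here (p , (q , s)) = ⊥-elim (N.<⇒≱ q p)
Insd-δ {suc r} {n} {lo = lo} (there i) (p , s) = let (e , e' , l) = Insd-δ i s in cong suc e , cong (lo ∷_) e' , subst (N._≤ n) (sym (N.+-suc lo r)) l

P-above : ∀ n {N} (B : V N) -> (∀ γ -> B (Vec.map suc γ) ≡ 0ℤ) -> ∀ β lo -> n N.< lo -> Str lo β -> P (suc n) B (Vec.map suc β) ≡ 0ℤ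
P-above n B z [] lo l s = refl
P-above n B z (b ∷ β) lo l (p , s) = cong₂ _+_ (go b (N.<-≤-trans l p)) (P-above n (\ γ -> B (suc b ∷ γ)) (\ γ -> z (b ∷ γ)) β (suc b) (N.<-≤-trans l (N.≤-trans p (N.n≤1+n b))) s)
  where
  go : ∀ b -> n N.< b -> sh (suc n) (\ x -> B (x ∷ Vec.map suc β)) (suc b) ≡ 0ℤ
  go b lt = trans (cong (sh n (\ x -> B (x ∷ Vec.map suc β))) (trans (sym (N.m+[n∸m]≡n lt)) (sym (N.+-suc n _)))) (trans (sh-at n _ (suc (b N.∸ suc n))) (z (b N.∸ suc n ∷ β)))

-- B vanishes at vectors without entry 0, and subtracting n + 1 produces a 0 only from an entry n +
-- 1. Bringing that 0 from place i to the front costs (-1)^i.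
P-insert : ∀ n {r} (B : V (suc r)) -> Anti B -> (∀ γ -> B (Vec.map suc γ) ≡ 0ℤ) -> ∀ β lo -> Str lo β ->
  P (suc n) B (Vec.map suc β) ≡ 0ℤ ⊎ ∃[ i ] ∃[ γ ] (Insd i n γ β × P (suc n) B (Vec.map suc β) ≡ sg i * B (0 ∷ Vec.map suc γ))
P-insert n {r} B h z (b ∷ β) lo (p , s) = go (N.<-cmp b n)
  where
  go : Tri (b N.< n) (b ≡ n) (n N.< b) -> P (suc n) B (suc b ∷ Vec.map suc β) ≡ 0ℤ ⊎ ∃[ i ] ∃[ γ ] (Insd i n γ (b ∷ β) × P (suc n) B (suc b ∷ Vec.map suc β) ≡ sg i * B (0 ∷ Vec.map suc γ))
  go (tri> _ _ g) = inj₁ (P-above n B z (b ∷ β) b g (N.≤-refl , s))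
  go (tri≈ _ refl _) = inj₂ (0 , β , here , trans (cong₂ _+_ (trans (cong (sh n (\ x -> B (x ∷ Vec.map suc β))) (sym (N.+-identityʳ n))) (sh-at n _ 0)) (P-above n (\ γ -> B (suc b ∷ γ)) (\ γ -> z (b ∷ γ)) β (suc n) N.≤-refl s))
                       (trans (+-identityʳ _) (sym (Z.*-identityˡ _))))
  go (tri< g _ _) = rest r β s B h z (sh-small n _ b g)
    where
    rest : ∀ r (β : Vec ℕ r) -> Str (suc b) β -> (B : V (suc r)) -> Anti B -> (∀ γ -> B (Vec.map suc γ) ≡ 0ℤ) -> sh (suc n) (\ x -> B (x ∷ Vec.map suc β)) (suc b) ≡ 0ℤ ->
      P (suc n) B (suc b ∷ Vec.map suc β) ≡ 0ℤ ⊎ ∃[ i ] ∃[ γ ] (Insd i n γ (b ∷ β) × P (suc n) B (suc b ∷ Vec.map suc β) ≡ sg i * B (0 ∷ Vec.map suc γ))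
    rest zero [] s B h z e = inj₁ (trans (+-identityʳ _) e)
    rest (suc r) β s B h z e = fin (P-insert n {r} (\ γ -> B (suc b ∷ γ)) (snd h (suc b)) (\ γ -> z (b ∷ γ)) β (suc b) s)
      where
      neg : ∀ a x -> a * (- x) ≡ (- a) * x
      neg = solve-∀
      fin : P (suc n) (\ γ -> B (suc b ∷ γ)) (Vec.map suc β) ≡ 0ℤ ⊎ ∃[ i ] ∃[ γ ] (Insd i n γ β × P (suc n) (\ γ -> B (suc b ∷ γ)) (Vec.map suc β) ≡ sg i * B (suc b ∷ 0 ∷ Vec.map suc γ)) -> _
      fin (inj₁ q) = inj₁ (cong₂ _+_ e q)
      fin (inj₂ (i , γ , d , q)) = inj₂ (suc i , b ∷ γ , there d , trans (cong₂ _+_ e q) (trans (+-identityˡ _) (trans (cong (sg i *_) (fst h (suc b) 0 (Vec.map suc γ))) (neg (sg i) (B (0 ∷ suc b ∷ Vec.map suc γ))))))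

data Hook (n : ℕ) {N} (β : Vec ℕ N) : Set where
  none : alt (suc n ∷ []) β ≡ 0ℤ -> Hook n β
  hook : ∀ r -> r N.≤ n -> alt (suc n ∷ []) β ≡ sg r -> (∀ κ -> alt (sucs κ) β ≡ alt (sucs κ) (hk 1 r (suc n))) -> Hook n β

-- Murnaghan-Nakayama for a single full cycle. Zero parts are stripped first; then removing the one
-- bead found by `P-insert` must leave δ, and this makes the shape a hook whose leg gives the sign.
classify : ∀ n {N} (β : Vec ℕ N) -> Str 0 β -> Hook n β
classify n {zero} [] s = none refl
classify n {suc N} (zero ∷ β) (_ , s) = strip (unsuc 0 β s)
  where
  strip : ∃[ β' ] (β ≡ Vec.map suc β' × Str 0 β') -> Hook n (0 ∷ β)
  strip (β' , refl , s') = go (classify n β' s')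
    where go : Hook n β' -> Hook n (0 ∷ Vec.map suc β')
          go (none e) = none (trans (alt-stable (n ∷ []) β') e)
          go (hook r l e f) = hook r l (trans (alt-stable (n ∷ []) β') e) (\ κ -> trans (alt-stable κ β') (f κ))
classify n {suc N} (suc b ∷ β) (_ , s) = go (unsuc 0 (suc b ∷ β) (s≤s z≤n , s))
  where
  go : ∃[ β' ] (suc b ∷ β ≡ Vec.map suc β' × Str 0 β') -> Hook n (suc b ∷ β)
  go (β' , e , s') = subst (Hook n) (sym e) (fin (P-insert n van Anti-van van-suc β' 0 s'))
    where
    fin : alt (suc n ∷ []) (Vec.map suc β') ≡ 0ℤ ⊎ ∃[ i ] ∃[ γ ] (Insd i n γ β' × alt (suc n ∷ []) (Vec.map suc β') ≡ sg i * van (0 ∷ Vec.map suc γ)) -> Hook n (Vec.map suc β')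
    fin (inj₁ q) = none q
    fin (inj₂ (i , γ , d , q)) = dec (Vecₚ.≡-dec N._≟_ γ (δ 0 N))
      where
      q' : alt (suc n ∷ []) (Vec.map suc β') ≡ sg i * van γ
      q' = trans q (cong (sg i *_) (Π-δ (e₀ van) γ))
      dec : Dec (γ ≡ δ 0 N) -> Hook n (Vec.map suc β')
      dec (no ne) = none (trans q' (trans (cong (sg i *_) (van-strict γ (Insd-Str d s') ne)) (*-zeroʳ (sg i))))
      dec (yes refl) = let (e₁ , e₂ , l) = Insd-δ d s' in
        hook N l (trans q' (trans (cong (sg i *_) (van-δ N)) (trans (Z.*-identityʳ (sg i)) (cong sg e₁)))) (\ κ -> cong (alt (sucs κ)) (trans (cong (Vec.map suc) e₂) (sym (hk-suc 0 N n))))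

it-+ : ∀ {A : Set} (f : A -> A) s t x -> it f (s N.+ t) x ≡ it f t (it f s x)
it-+ f zero t x = refl
it-+ f (suc s) t x = it-+ f s t (f x)

it-inj : ∀ {A : Set} {f : A -> A} -> (∀ {x y} -> f x ≡ f y -> x ≡ y) -> ∀ t {x y} -> it f t x ≡ it f t y -> x ≡ y
it-inj i zero e = e
it-inj i (suc t) e = i (it-inj i t e)

path-∈ : ∀ {n} {ρ : Fin n -> Fin n} x u y -> Path ρ x u y -> ∀ {z} -> z ∈ u -> ∃[ t ] (t N.< length u × it ρ (suc t) x ≡ z)
path-∈ x (w ∷ u) y (e , p) (here refl) = 0 , s≤s z≤n , e
path-∈ {ρ = ρ} x (w ∷ u) y (e , p) (there m) = let (t , l , q) = path-∈ w u y p m in suc t , s≤s l , trans (cong (it ρ (suc t)) e) q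

path-reverse : ∀ {n} (ρ : Sym n) x u y -> Path (ρ ▸_) x u y -> Path (ρ ◂_) y (reverse u) x
path-reverse ρ x [] y p = trans (cong (ρ ◂_) (sym p)) (inverseˡ ρ)
path-reverse ρ x (z ∷ u) y (e , p) = subst (\ t -> Path (ρ ◂_) y t x) (sym (Lₚ.unfold-reverse z u))
  (path-++⁺ (ρ ◂_) y (reverse u) z [] x (path-reverse ρ z u y p) (trans (cong (ρ ◂_) (sym e)) (inverseˡ ρ)))

lsumℕ-↭ : ∀ {κ κ'} -> κ ↭ κ' -> lsumℕ (sucs κ) ≡ lsumℕ (sucs κ')
lsumℕ-↭ ↭.refl = refl
lsumℕ-↭ (↭.prep x p) = cong (suc x N.+_) (lsumℕ-↭ p)
lsumℕ-↭ (↭.swap {ys = κ} x y p) = trans (cong (\ t -> suc x N.+ (suc y N.+ t)) (lsumℕ-↭ p)) (trans (sym (N.+-assoc (suc x) (suc y) k)) (trans (cong (N._+ k) (N.+-comm (suc x) (suc y))) (N.+-assoc (suc y) (suc x) k)))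
  where k = lsumℕ (sucs κ)
lsumℕ-↭ (↭.trans p q) = trans (lsumℕ-↭ p) (lsumℕ-↭ q)

hf : ℕ -> ℕ
hf zero = 0
hf (suc zero) = 0
hf (suc (suc m)) = suc (hf m)

hf-dbl : ∀ a -> hf (dbl a) ≡ a
hf-dbl zero = refl
hf-dbl (suc a) = cong suc (hf-dbl a)

hf-dbl₁ : ∀ a -> hf (suc (dbl a)) ≡ a
hf-dbl₁ zero = refl
hf-dbl₁ (suc a) = cong suc (hf-dbl₁ a)

dbl-≤ : ∀ q m -> dbl q N.≤ m -> q N.≤ hf m
dbl-≤ zero m l = z≤n
dbl-≤ (suc q) (suc (suc m)) (s≤s (s≤s l)) = s≤s (dbl-≤ q m l)

centraliser-double : ∀ {n} (Φ : Sym n -> ℤ) -> Class Φ -> ∀ c -> ∑ (allP n) (\ g -> cm c g * ∑ (allP n) (\ g' -> cm c g' * Φ (g ⨾ flip g'))) ≡ Zn c * Θ Φ c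
centraliser-double {n} Φ k c = trans (sym (trans (∑-map (\ g -> cm c g , g) G (\ cσ -> fst cσ * ev (map (\ g -> cm c g , g) G) (\ τ -> Φ (snd cσ ⨾ flip τ)))) (∑-cong G (\ g -> cong (cm c g *_) (∑-map (\ g -> cm c g , g) G (\ cσ -> fst cσ * Φ (g ⨾ flip (snd cσ)))))))) (quad-centraliser {Φ = Φ} k c)
  where G = allP n

module Dihedral (m : ℕ) where
  private
    n = suc m
    c = rotP m
    C = c ▸_

    C-inj : ∀ {x y} -> C x ≡ C y -> x ≡ y
    C-inj e = trans (sym (inverseˡ c)) (trans (cong (c ◂_) e) (inverseˡ c))

  Reflection : Sym n -> Set
  Reflection y = ∀ x -> C (y ▸ C x) ≡ y ▸ x

  -- A cycle and its inverse have the same type, and a permutation that conjugates one to the other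
  -- is a reflection.
  some-reflection : ∃[ h ] Reflection h
  some-reflection = let (u , p , s , l) = rot-focus m Fin.zero
                        d : CycD (c ◂_) ((Fin.zero , reverse u) ∷ [])
                        d = (path-reverse c Fin.zero u Fin.zero p ∷ []) , ↭-trans (↭-reflexive (Lₚ.++-identityʳ (Fin.zero ∷ reverse u))) (↭-trans (↭.prep Fin.zero (↭ₚ.↭-reverse u)) s)
                        (h , e) = types-conj c (flip c) (↭-trans (typ-rotP m) (↭-trans (↭-reflexive (cong (_∷ []) (sym (trans (Lₚ.length-reverse u) l)))) (↭-sym (typ-cyc (flip c) d))))
                    in h , \ x -> trans (cong C (e x)) (inverseʳ c)

  module _ (y : Sym n) (ry : Reflection y) where
    private
      Y = y ▸_

    reflect-it : ∀ t x -> it C t (Y (it C t x)) ≡ Y x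
    reflect-it zero x = refl
    reflect-it (suc t) x = trans (cong (\ z -> it C t (C (Y z))) (it-suc C t x)) (trans (cong (it C t) (ry (it C t x))) (reflect-it t x))

    reach : ∀ x z -> ∃[ t ] (t N.≤ m × it C t x ≡ z)
    reach x z = let (u , p , s , l) = rot-focus m x in go u p l (↭ₚ.∈-resp-↭ (↭-sym s) (∈-allFin z))
      where go : ∀ u -> Path C x u x -> length u ≡ m -> z ∈ x ∷ u -> ∃[ t ] (t N.≤ m × it C t x ≡ z)
            go u p l (here e) = 0 , z≤n , sym e
            go u p l (there i) = let (t , q , e) = path-∈ x u x p i in suc t , subst (suc t N.≤_) l q , e

    -- Let Y x = C^t x. Then C^t (Y (Y x)) = C^t (Y (C^t x)) = Y x = C^t x, and C^t is injective.
    involution : ∀ x -> Y (Y x) ≡ x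
    involution x = let (t , _ , e) = reach x (Y x) in it-inj C-inj t (trans (cong (\ z -> it C t (Y z)) (sym e)) (trans (reflect-it t x) (sym e)))

    half-turn : ∀ x t -> t N.≤ m -> it C t x ≢ x -> it C (t N.+ t) x ≡ x -> t N.+ t ≡ n
    half-turn x zero l ne e = ⊥-elim (ne refl)
    half-turn x (suc t) l ne e = go (N.<-cmp (suc t N.+ suc t) n)
      where
      full : it C n x ≡ x
      full = let (u , p , s , q) = rot-focus m x in subst (\ k -> it C (suc k) x ≡ x) q (path-end x u x p)
      go : Tri (suc t N.+ suc t N.< n) (suc t N.+ suc t ≡ n) (n N.< suc t N.+ suc t) -> suc t N.+ suc t ≡ n
      go (tri≈ _ q _) = q
      go (tri< q _ _) = ⊥-elim (rot-free m x (t N.+ suc t) (N.≤-pred q) e)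
      go (tri> _ _ q) = ⊥-elim (over ((suc t N.+ suc t) N.∸ suc n) (trans (cong suc (N.+-comm _ n)) (N.m+[n∸m]≡n q)))
        where
        over : ∀ s -> suc (s N.+ n) ≡ suc t N.+ suc t -> ⊥
        over s q = rot-free m x s (N.+-cancelʳ-< n s m (subst (N._≤ m N.+ n) (sym q) (N.+-mono-≤ l (N.≤-trans l (N.n≤1+n m)))))
          (trans (cong (it C (suc s)) (sym full)) (trans (sym (it-+ C n (suc s) x)) (trans (cong (\ k -> it C k x) (trans (N.+-comm n (suc s)) q)) e)))

    -- If x and C^t x are both fixed, then C^(2t) x = x, which forces 2t = n. So only the point
    -- opposite to x can be fixed besides x.
    fixed-unique : ∀ x z z' -> Y x ≡ x -> Y z ≡ z -> Y z' ≡ z' -> x ≢ z -> x ≢ z' -> z ≡ z'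
    fixed-unique x z z' fx fz fz' nz nz' = let (t , l , e) = turn z fz nz ; (t' , l' , e') = turn z' fz' nz' in
        trans (sym e) (trans (cong (\ k -> it C k x) (same t t' (trans l (sym l')))) e')
      where
      turn : ∀ z -> Y z ≡ z -> x ≢ z -> ∃[ t ] (t N.+ t ≡ n × it C t x ≡ z)
      turn z fz nz = let (t , l , e) = reach x z in t , half-turn x t l (\ q -> nz (trans (sym q) e))
        (trans (it-+ C t t x) (trans (cong (it C t) (trans e (sym (trans (cong Y e) fz)))) (trans (reflect-it t x) fx))) , e
      same : ∀ t t' -> t N.+ t ≡ t' N.+ t' -> t ≡ t'
      same t t' e = N.*-cancelˡ-≡ t t' 2 (trans (cong (t N.+_) (N.+-identityʳ t)) (trans e (sym (cong (t' N.+_) (N.+-identityʳ t')))))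

    cycle-shape : ∀ cs -> All (IsCy Y) cs -> Unique (supp cs) ->
      ∃[ a ] ∃[ fs ] ((lens cs ↭ replicate a 1 ++ map (\ _ -> 0) fs) × All (\ x -> Y x ≡ x) fs × Unique fs × (∀ {x} -> x ∈ fs -> x ∈ supp cs))
    cycle-shape [] [] u = 0 , [] , ↭-refl , [] , [] , \ ()
    cycle-shape ((x , []) ∷ cs) (p ∷ ps) (q ∷ u) = let (a , fs , s , f , uf , i) = cycle-shape cs ps u in
      a , x ∷ fs , ↭-trans (↭.prep 0 s) (↭-sym (↭ₚ.shift 0 (replicate a 1) (map (\ _ -> 0) fs))) , p ∷ f , All.tabulate (\ m -> All.lookup q (i m)) ∷ uf , \ { (here e) -> here e ; (there m) -> there (i m) }
    cycle-shape ((x , z ∷ []) ∷ cs) (p ∷ ps) (_ ∷ _ ∷ u) = let (a , fs , s , f , uf , i) = cycle-shape cs ps u in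
      suc a , fs , ↭.prep 1 s , f , uf , \ m -> there (there (i m))
    cycle-shape ((x , z ∷ w ∷ u) ∷ cs) ((p , q , _) ∷ ps) ((_ ∷ x≢w ∷ _) ∷ _) = ⊥-elim (x≢w (trans (sym (involution x)) (trans (cong Y p) q)))

    -- All reflections have the same value on hooks of even leg: in each of the three possible types
    -- the number of 2-cycles outside the base is `hf m`.
    reflection-value : ∀ q -> ch y (hk 1 (dbl q) n) ≡ sg q * pos (cb (hf m) q)
    reflection-value q = go (cycle-shape (fst (cycles y)) (fst (snd (cycles y))) (Unique-↭ (↭-sym (snd (snd (cycles y)))) (allFin⁺ n)))
      where
      fin : ∀ a {κ₀ x₀} -> Base κ₀ x₀ -> typ y ↭ replicate a 1 ++ κ₀ -> hf (dbl a N.+ N.pred x₀) ≡ a -> dbl a N.+ x₀ ≡ suc (dbl a N.+ N.pred x₀) -> ch y (hk 1 (dbl q) n) ≡ sg q * pos (cb (hf m) q)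
      fin a {κ₀} {x₀} b s e e' = trans (alt-↭ {typ y} {replicate a 1 ++ κ₀} s (hk 1 (dbl q) n)) (trans (cong (\ k -> alt (sucs (replicate a 1 ++ κ₀)) (hk 1 (dbl q) k)) (sym size))
          (trans (hk-value a q b) (cong (\ k -> sg q * pos (cb k q)) (sym (trans (cong hf (N.suc-injective (trans (sym size) e'))) e)))))
        where
        tot : ∀ a -> Base κ₀ x₀ -> lsumℕ (sucs (replicate a 1 ++ κ₀)) ≡ dbl a N.+ x₀
        tot (suc a) b = cong (\ k -> suc (suc k)) (tot a b)
        tot zero b1 = refl
        tot zero b2 = refl
        tot zero b11 = refl
        size : dbl a N.+ x₀ ≡ n
        size = trans (sym (tot a b)) (trans (sym (lsumℕ-↭ s)) (lsumℕ-CycD (snd (cycles y))))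
      one' : ∀ a -> hf (dbl a N.+ 1) ≡ a
      one' a = trans (cong hf (N.+-comm (dbl a) 1)) (hf-dbl₁ a)
      nil' : ∀ a -> hf (dbl a N.+ 0) ≡ a
      nil' a = trans (cong hf (N.+-identityʳ (dbl a))) (hf-dbl a)
      go : ∃[ a ] ∃[ fs ] ((typ y ↭ replicate a 1 ++ map (\ _ -> 0) fs) × All (\ x -> Y x ≡ x) fs × Unique fs × (∀ {x} -> x ∈ fs -> x ∈ supp (fst (cycles y)))) -> ch y (hk 1 (dbl q) n) ≡ sg q * pos (cb (hf m) q)
      go (zero , [] , s , _) = ⊥-elim (0≢n (trans (sym (lsumℕ-↭ s)) (lsumℕ-CycD (snd (cycles y)))))
        where 0≢n : 0 ≡ n -> ⊥
              0≢n ()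
      -- Without fixed points, one of the 2-cycles is moved to the end to serve as the base.
      go (suc a , [] , s , _) = fin a b2 (↭-trans s (↭-trans (↭-reflexive (Lₚ.++-identityʳ (1 ∷ replicate a 1))) (↭-sym (↭-trans (↭ₚ.shift 1 (replicate a 1) []) (↭-reflexive (cong (1 ∷_) (Lₚ.++-identityʳ (replicate a 1)))))))) (one' a) (N.+-suc (dbl a) 1)
      go (a , x ∷ [] , s , _) = fin a b1 s (nil' a) (N.+-suc (dbl a) 0)
      go (a , x ∷ z ∷ [] , s , _) = fin a b11 s (one' a) (N.+-suc (dbl a) 1)
      go (a , x ∷ z ∷ z' ∷ fs , s , (fx ∷ fz ∷ fz' ∷ _) , ((x≢z ∷ x≢z' ∷ _) ∷ (z≢z' ∷ _) ∷ _) , _) = ⊥-elim (z≢z' (fixed-unique x z z' fx fz fz' x≢z x≢z'))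

  module _ (h : Sym n) (rh : Reflection h) where
    private
      G = allP n

      flip-C : ∀ g -> Commute c g -> Commute c (flip g)
      flip-C g q x = sym (trans (cong (\ t -> g ◂ (c ▸ t)) (sym (inverseʳ g))) (trans (cong (g ◂_) (q (g ◂ x))) (inverseˡ g)))

      flip-R : Reflection (flip h)
      flip-R x = trans (sym (inverseˡ h)) (cong (h ◂_) (C-inj (trans (rh (h ◂ C x)) (inverseʳ h))))

      cross₁ : ∀ g g' -> Commute c g -> Commute c g' -> Reflection ((g ⨾ h) ⨾ flip g')
      cross₁ g g' q q' x = trans (flip-C g' q' (h ▸ (g ▸ C x))) (cong (g' ◂_) (trans (cong (\ t -> C (h ▸ t)) (sym (q x))) (rh (g ▸ x))))

      cross₂ : ∀ g g' -> Commute c g -> Commute c g' -> Reflection (g ⨾ flip (g' ⨾ h))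
      cross₂ g g' q q' x = trans (flip-C g' q' (h ◂ (g ▸ C x))) (cong (g' ◂_) (trans (cong (\ t -> C (h ◂ t)) (sym (q x))) (flip-R (g ▸ x))))

      SS : (Sym n -> Sym n -> ℤ) -> ℤ
      SS f = ∑ G (\ g -> cm c g * ∑ G (\ g' -> cm c g' * f g g'))

      SS-const : ∀ f e -> (∀ g g' -> Commute c g -> Commute c g' -> f g g' ≡ e) -> SS f ≡ Zn c * (Zn c * e)
      SS-const f e k = trans (∑-cong G (\ g -> outer g ((g ⨾ c) ≈? (c ⨾ g)))) (trans (∑-cong G (\ g -> Z.*-comm (cm c g) (Zn c * e))) (trans (∑-* G (Zn c * e) (cm c)) (Z.*-comm (Zn c * e) (Zn c))))
        where
        inner : ∀ g g' -> Commute c g -> (d : Dec (Commute c g')) -> 𝟙 d * f g g' ≡ e * 𝟙 d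
        inner g g' q (yes q') = trans (Z.*-identityˡ _) (trans (k g g' q q') (sym (Z.*-identityʳ e)))
        inner g g' q (no _) = sym (*-zeroʳ e)
        outer : ∀ g (d : Dec (Commute c g)) -> 𝟙 d * ∑ G (\ g' -> cm c g' * f g g') ≡ 𝟙 d * (Zn c * e)
        outer g (no _) = refl
        outer g (yes q) = cong (1ℤ *_) (trans (∑-cong G (\ g' -> inner g g' q ((g' ⨾ c) ≈? (c ⨾ g')))) (trans (∑-* G e (cm c)) (Z.*-comm e (Zn c))))

      X : ℤ -> LX n
      X ε = map (\ g -> cm c g , g) G ++ map (\ g -> ε * cm c g , g ⨾ h) G

      ev-X : ∀ ε f -> ev (X ε) f ≡ ∑ G (\ g -> cm c g * f g) + ε * ∑ G (\ g -> cm c g * f (g ⨾ h))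
      ev-X ε f = trans (∑-++ (map (\ g -> cm c g , g) G) (map (\ g -> ε * cm c g , g ⨾ h) G) (\ cσ -> fst cσ * f (snd cσ)))
        (cong₂ _+_ (∑-map (\ g -> cm c g , g) G (\ cσ -> fst cσ * f (snd cσ))) (trans (∑-map (\ g -> ε * cm c g , g ⨾ h) G (\ cσ -> fst cσ * f (snd cσ)))
          (trans (∑-cong G (\ g -> Z.*-assoc ε (cm c g) (f (g ⨾ h)))) (∑-* G ε (\ g -> cm c g * f (g ⨾ h))))))

      lin : ∀ ε (a b : Sym n -> ℤ) -> ∑ G (\ g -> cm c g * (a g + ε * b g)) ≡ ∑ G (\ g -> cm c g * a g) + ε * ∑ G (\ g -> cm c g * b g)
      lin ε a b = trans (∑-cong G (\ g -> r (cm c g) (a g) ε (b g))) (trans (∑-+ G (\ g -> cm c g * a g) (\ g -> ε * (cm c g * b g))) (cong (∑ G (\ g -> cm c g * a g) +_) (∑-* G ε (\ g -> cm c g * b g))))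
        where r : ∀ x a e b -> x * (a + e * b) ≡ x * a + e * (x * b)
              r = solve-∀

      quad-X : ∀ ε Φ -> quad (X ε) Φ ≡ (SS (\ g g' -> Φ (g ⨾ flip g')) + ε * SS (\ g g' -> Φ (g ⨾ flip (g' ⨾ h))))
                                     + ε * (SS (\ g g' -> Φ ((g ⨾ h) ⨾ flip g')) + ε * SS (\ g g' -> Φ ((g ⨾ h) ⨾ flip (g' ⨾ h))))
      quad-X ε Φ = trans (ev-X ε (\ σ -> ev (X ε) (\ τ -> Φ (σ ⨾ flip τ)))) (cong₂ _+_ (half (\ g -> g)) (cong (ε *_) (half (_⨾ h))))
        where half : ∀ (k : Sym n -> Sym n) -> ∑ G (\ g -> cm c g * ev (X ε) (\ τ -> Φ (k g ⨾ flip τ))) ≡ SS (\ g g' -> Φ (k g ⨾ flip g')) + ε * SS (\ g g' -> Φ (k g ⨾ flip (g' ⨾ h)))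
              half k = trans (∑-cong G (\ g -> cong (cm c g *_) (ev-X ε (\ τ -> Φ (k g ⨾ flip τ))))) (lin ε (\ g -> ∑ G (\ g' -> cm c g' * Φ (k g ⨾ flip g'))) (\ g -> ∑ G (\ g' -> cm c g' * Φ (k g ⨾ flip (g' ⨾ h)))))

    private
      -- With s² = 1 the quadratic form equals 2z(t - zb). Dividing by the positive factor 2z leaves
      -- t ≥ zb, and b ≥ 1.
      bound : ∀ z t s b c' b' Q -> s * s ≡ 1ℤ -> z ≡ pos (suc c') -> b ≡ pos (suc b') -> Q ≡ (z * t + (- s) * (z * (z * (s * b)))) + (- s) * (z * (z * (s * b)) + (- s) * (z * t)) -> 0≤ Q -> z Z.≤ t
      bound z t s b c' b' Q ss refl refl e p = Z.≤-trans low (Z.0≤i-j⇒j≤i {t} {z * b} (0≤-÷ c' (0≤-÷ 1 (subst 0≤_ eq p))))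
        where
        r : ∀ z t s b -> (z * t + (- s) * (z * (z * (s * b)))) + (- s) * (z * (z * (s * b)) + (- s) * (z * t)) ≡ (1ℤ + s * s) * (z * t) - pos 2 * (s * s) * (z * (z * b))
        r = solve-∀
        r' : ∀ z t b -> pos 2 * (z * t) - pos 2 * 1ℤ * (z * (z * b)) ≡ pos 2 * (z * (t - z * b))
        r' = solve-∀
        eq : Q ≡ pos 2 * (z * (t - z * b))
        eq = trans e (trans (r z t s b) (trans (cong (\ s -> (1ℤ + s) * (z * t) - pos 2 * s * (z * (z * b))) ss) (r' z t b)))
        low : z Z.≤ z * b
        low = subst (pos (suc c') Z.≤_) (Z.pos-* (suc c') (suc b')) (Z.+≤+ (N.m≤m*n (suc c') (suc b')))

    -- Extending the average over the rotations to the dihedral group by either sign of the reflections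
    -- bounds it below by the absolute value of the character at a reflection.
    even-hook′ : ∀ q -> dbl q N.≤ m -> Zn c Z.≤ Θ (\ ρ -> ch ρ (hk 1 (dbl q) n)) c
    even-hook′ q l = bound z t (sg q) (pos (cb (hf m) q)) (fst zs) (fst bs) (quad (X ε) φ) (sg-sq q) (snd zs) (cong pos (snd bs)) total (quad-pos (X ε) (gram-ch′ n β str))
      where
      β = hk 1 (dbl q) n
      φ : Sym n -> ℤ
      φ ρ = ch ρ β
      E = sg q * pos (cb (hf m) q)
      ε = - sg q
      z = Zn c
      zs = Zn-suc c
      bs = cb-pos (hf m) q (dbl-≤ q m l)
      t = Θ φ c
      sum₁ : SS (\ g g' -> φ (g ⨾ flip g')) ≡ z * t
      sum₁ = centraliser-double φ (ch-class β) c
      sum₄ : SS (\ g g' -> φ ((g ⨾ h) ⨾ flip (g' ⨾ h))) ≡ z * t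
      sum₄ = trans (∑-cong G (\ g -> cong (cm c g *_) (∑-cong G (\ g' -> cong (cm c g' *_) (ch-≈ {ρ = (g ⨾ h) ⨾ flip (g' ⨾ h)} {g ⨾ flip g'} (\ x -> cong (g' ◂_) (inverseˡ h)) β))))) sum₁
      sum₂ : SS (\ g g' -> φ (g ⨾ flip (g' ⨾ h))) ≡ z * (z * E)
      sum₂ = SS-const (\ g g' -> φ (g ⨾ flip (g' ⨾ h))) E (\ g g' p p' -> reflection-value (g ⨾ flip (g' ⨾ h)) (cross₂ g g' p p') q)
      sum₃ : SS (\ g g' -> φ ((g ⨾ h) ⨾ flip g')) ≡ z * (z * E)
      sum₃ = SS-const (\ g g' -> φ ((g ⨾ h) ⨾ flip g')) E (\ g g' p p' -> reflection-value ((g ⨾ h) ⨾ flip g') (cross₁ g g' p p') q)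
      total : quad (X ε) φ ≡ (z * t + ε * (z * (z * E))) + ε * (z * (z * E) + ε * (z * t))
      total = trans (quad-X ε φ) (cong₂ _+_ (cong₂ _+_ sum₁ (cong (ε *_) sum₂)) (cong (ε *_) (cong₂ _+_ sum₃ (cong (ε *_) sum₄))))
      str : Str 0 β
      str = Str-mono {β = β} z≤n (Str-hk 1 (dbl q) n (s≤s l))

  even-hook : ∀ q -> dbl q N.≤ m -> Zn (rotP m) Z.≤ Θ (\ ρ -> ch ρ (hk 1 (dbl q) (suc m))) (rotP m)
  even-hook = even-hook′ (fst some-reflection) (snd some-reflection)

data Parity : ℕ -> Set where
  even : ∀ q -> Parity (dbl q)
  odd : ∀ q -> Parity (suc (dbl q))

parity : ∀ r -> Parity r
parity zero = even 0
parity (suc r) = go (parity r)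
  where go : ∀ {r} -> Parity r -> Parity (suc r)
        go (even q) = odd q
        go (odd q) = even (suc q)

0≤Zn : ∀ {n} (τ : Sym n) -> 0≤ Zn τ
0≤Zn τ = let (c , e) = Zn-suc τ in subst 0≤_ (sym e) (Z.+≤+ z≤n)

Θ-cong : ∀ {n} {Φ Ψ : Sym n -> ℤ} τ -> (∀ ρ -> Φ ρ ≡ Ψ ρ) -> Θ Φ τ ≡ Θ Ψ τ
Θ-cong {n} τ e = ∑-cong (allP n) (\ g -> cong (cm τ g *_) (e g))

-- Σ_{g ∈ C} p_{type g} − |C| p_{m+1}
cyc-excess : ℕ -> Comb
cyc-excess m = Lc m ++ (- Zn (rotP m) , m ∷ []) ∷ []

val-++ : ∀ x y {N} (β : Vec ℕ N) -> val (x ++ y) β ≡ val x β + val y β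
val-++ x y β = ∑-++ x y (term β)

-- p_{m+1} has coefficient 0 at non-hooks and -1 at hooks with odd leg, where nonnegativity of Θ
-- suffices. At hooks with even leg the coefficient is 1, and `even-hook` supplies the missing |C|.
spos-cyc : ∀ m {N} -> SPos N (cyc-excess m)
spos-cyc m β s = subst 0≤_ (sym (trans (val-++ (Lc m) ((- Zn (rotP m) , m ∷ []) ∷ []) β) (cong (_+ (- Zn (rotP m) * alt (suc m ∷ []) β + 0ℤ)) (val-Lc m β)))) (go (classify m β s))
  where
  z = Zn (rotP m)
  t = Θ (\ ρ -> ch ρ β) (rotP m)
  r₀ : ∀ z t -> t ≡ t + (- z * 0ℤ + 0ℤ)
  r₀ = solve-∀
  r₁ : ∀ z t -> t - z ≡ t + (- z * 1ℤ + 0ℤ)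
  r₁ = solve-∀
  r₂ : ∀ z t -> t + z ≡ t + (- z * (- 1ℤ) + 0ℤ)
  r₂ = solve-∀
  go : Hook m β -> 0≤ (t + (- z * alt (suc m ∷ []) β + 0ℤ))
  go (none e) = subst (\ a -> 0≤ (t + (- z * a + 0ℤ))) (sym e) (subst 0≤_ (r₀ z t) (Θ-pos β s (rotP m)))
  go (hook r l e f) = par (parity r) l e f
    where
    par : ∀ {r} -> Parity r -> r N.≤ m -> alt (suc m ∷ []) β ≡ sg r -> (∀ κ -> alt (sucs κ) β ≡ alt (sucs κ) (hk 1 r (suc m))) -> 0≤ (t + (- z * alt (suc m ∷ []) β + 0ℤ))
    par (even q) l e f = subst (\ a -> 0≤ (t + (- z * a + 0ℤ))) (sym (trans e (sg-dbl q))) (subst 0≤_ (r₁ z t)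
      (Z.i≤j⇒0≤j-i (subst (z Z.≤_) (Θ-cong (rotP m) (\ ρ -> sym (f (typ ρ)))) (Dihedral.even-hook m q l))))
    par (odd q) l e f = subst (\ a -> 0≤ (t + (- z * a + 0ℤ))) (sym (trans e (cong -_ (sg-dbl q)))) (subst 0≤_ (r₂ z t) (0≤-+ (Θ-pos β s (rotP m)) (0≤Zn (rotP m))))

p₁ : Comb
p₁ = (1ℤ , 0 ∷ []) ∷ []

spos-p₁ : ∀ {N} -> SPos N p₁
spos-p₁ β s = subst 0≤_ (r (alt (1 ∷ []) β)) (go (classify 0 β s))
  where
  r : ∀ a -> a ≡ 1ℤ * a + 0ℤ
  r = solve-∀
  go : Hook 0 β -> 0≤ alt (1 ∷ []) β
  go (none e) = subst 0≤_ (sym e) (Z.+≤+ z≤n)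
  go (hook zero l e f) = subst 0≤_ (sym e) (Z.+≤+ z≤n)

deg-Lc : ∀ m -> Deg (suc m) (Lc m)
deg-Lc m = Allₚ.map⁺ (All.universal (\ g -> lsumℕ-CycD (snd (cycles g))) (allP (suc m)))

spos-Lc : ∀ m {N} -> SPos N (Lc m)
spos-Lc m β s = subst 0≤_ (sym (val-Lc m β)) (Θ-pos β s (rotP m))

val-p₁⊛ : ∀ x {N} (β : Vec ℕ N) -> val (p₁ ⊛ x) β ≡ ∑ x (\ cκ -> fst cκ * alt (sucs (0 ∷ snd cκ)) β)
val-p₁⊛ x β = trans (cong (\ l -> val l β) (Lₚ.++-identityʳ (map (\ dμ -> 1ℤ * fst dμ , 0 ∷ snd dμ) x))) (trans (∑-map (\ dμ -> 1ℤ * fst dμ , 0 ∷ snd dμ) x (term β))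
  (∑-cong x (\ dμ -> cong (_* alt (sucs (0 ∷ snd dμ)) β) (Z.*-identityˡ (fst dμ)))))

-- |C| p_{m+2} + p₁ Σ_{g ∈ C} p_{type g}
cyc-defect : ℕ -> Comb
cyc-defect m = (Zn (rotP m) , suc m ∷ []) ∷ (p₁ ⊛ Lc m)

-- Only hooks with odd leg are endangered. By `P1-hk` the product with p₁ sees there the hook with
-- one leg box less, whose leg is even, and `even-hook` gives |C|. The other branch, one arm box
-- less, is nonnegative, or 0 when there is no such box.
spos-defect : ∀ m {N} -> suc (suc m) N.≤ N -> SPos N (cyc-defect m)
spos-defect m {N} le β s = go (classify (suc m) β s)
  where
  z = Zn (rotP m)
  T' = val (p₁ ⊛ Lc m) β
  pT : 0≤ T'
  pT = spos-⊛ {N} {1} {suc m} p₁ (Lc m) (refl ∷ []) (deg-Lc m) (subst (N._≤ N) (N.+-comm 1 (suc m)) le) spos-p₁ (spos-Lc m) β s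
  go : Hook (suc m) β -> 0≤ (z * alt (suc (suc m) ∷ []) β + T')
  go (none e) = subst (\ a -> 0≤ (z * a + T')) (sym e) (subst (\ a -> 0≤ (a + T')) (sym (*-zeroʳ z)) (0≤-+ {0ℤ} (Z.+≤+ z≤n) pT))
  go (hook r l e f) = par (parity r) l e f
    where
    neg : ∀ z t -> t - z ≡ z * (- 1ℤ) + t
    neg = solve-∀
    par : ∀ {r} -> Parity r -> r N.≤ suc m -> alt (suc (suc m) ∷ []) β ≡ sg r -> (∀ κ -> alt (sucs κ) β ≡ alt (sucs κ) (hk 1 r (suc (suc m)))) -> 0≤ (z * alt (suc (suc m) ∷ []) β + T')
    par (even q) l e f = 0≤-+ (0≤-* (0≤Zn (rotP m)) (subst 0≤_ (sym (trans e (sg-dbl q))) (Z.+≤+ z≤n))) pT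
    par (odd q) (s≤s l) e f = subst (\ a -> 0≤ (z * a + T')) (sym (trans e (cong -_ (sg-dbl q)))) (subst 0≤_ (neg z T') (Z.i≤j⇒0≤j-i
        (subst (z Z.≤_) (sym split) (Z.≤-trans (Dihedral.even-hook m q l) (Z.≤-trans (Z.≤-reflexive (sym (+-identityʳ _))) (Z.+-monoʳ-≤ (Θ (\ ρ -> ch ρ a) (rotP m)) (sec (N.m≤n⇒m<n∨m≡n l))))))))
      where
      a = hk 1 (dbl q) (suc m)
      b = hk 1 (suc (dbl q)) (suc m)
      split : T' ≡ Θ (\ ρ -> ch ρ a) (rotP m) + Θ (\ ρ -> ch ρ b) (rotP m)
      split = trans (val-p₁⊛ (Lc m) β) (trans (∑-map (\ g -> cm (rotP m) g , typ g) (allP (suc m)) (\ cκ -> fst cκ * alt (sucs (0 ∷ snd cκ)) β))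
        (trans (∑-cong (allP (suc m)) (\ g -> trans (cong (cm (rotP m) g *_) (trans (f (0 ∷ typ g)) (P1-hk (typ g) (dbl q) (suc m)))) (*-distribˡ-+ (cm (rotP m) g) (ch g a) (ch g b))))
          (∑-+ (allP (suc m)) (\ g -> cm (rotP m) g * ch g a) (\ g -> cm (rotP m) g * ch g b))))
      sec : dbl q N.< m ⊎ dbl q ≡ m -> 0≤ Θ (\ ρ -> ch ρ b) (rotP m)
      sec (inj₁ lt) = Θ-pos b (Str-mono {β = b} z≤n (Str-hk 1 (suc (dbl q)) (suc m) (s≤s lt))) (rotP m)
      sec (inj₂ eq) = Z.≤-reflexive (sym (trans (∑-cong (allP (suc m)) (\ g -> trans (cong (cm (rotP m) g *_) (hk-rep {suc (dbl q)} 1 (suc m) (s≤s z≤n) (s≤s (s≤s (N.≤-reflexive (sym eq)))) {alt (sucs (typ g))} (Anti-alt (sucs (typ g))))) (*-zeroʳ (cm (rotP m) g)))) (∑-0 (allP (suc m)))))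

spos-ψc : ∀ n {N} -> SPos N (ψc n)
spos-ψc n β s = 0≤-÷′ (Level.Dn-pos n) (ψ-bound n 0 (\ _ ()) β s)

deg-ψc : ∀ n -> Deg n (ψc n)
deg-ψc n = Allₚ.map⁺ (All.tabulate (reps-sum n))

deg-⊛ : ∀ {m k} x y -> Deg m x -> Deg k y -> Deg (m N.+ k) (x ⊛ y)
deg-⊛ [] y dx dy = []
deg-⊛ {m} {k} (cκ ∷ x) y (e ∷ dx) dy = Allₚ.++⁺ (Allₚ.map⁺ (All.map (\ {dμ} e' -> trans (ls (snd cκ) (snd dμ)) (cong₂ N._+_ e e')) dy)) (deg-⊛ x y dx dy)
  where ls : ∀ κ κ' -> lsumℕ (sucs (κ ++ κ')) ≡ lsumℕ (sucs κ) N.+ lsumℕ (sucs κ')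
        ls [] κ' = refl
        ls (a ∷ κ) κ' = trans (cong (suc a N.+_) (ls κ κ')) (sym (N.+-assoc (suc a) _ _))

infixr 7 _⊙_
_⊙_ : ℤ -> Comb -> Comb
c ⊙ x = map (\ dκ -> c * fst dκ , snd dκ) x

val-⊙ : ∀ c x {N} (β : Vec ℕ N) -> val (c ⊙ x) β ≡ c * val x β
val-⊙ c x β = trans (∑-map (\ dκ -> c * fst dκ , snd dκ) x (term β)) (trans (∑-cong x (\ dκ -> Z.*-assoc c (fst dκ) (alt (sucs (snd dκ)) β))) (∑-* x c (term β)))

deg-⊙ : ∀ {d} c x -> Deg d x -> Deg d (c ⊙ x)
deg-⊙ c x dx = Allₚ.map⁺ dx

mul : Comb -> ∀ {N} -> V N -> V N
mul x A ν = ∑ x (\ cκ -> fst cκ * pmul (snd cκ) A ν)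

Lin-mul : ∀ x {N} -> Lin (mul x {N})
Lin-mul x = record
  { l-cong = \ e ν -> ∑-cong x (\ cκ -> cong (fst cκ *_) (l-cong (Lin-pmul (snd cκ)) e ν))
  ; l-+ = \ A B ν -> trans (∑-cong x (\ cκ -> trans (cong (fst cκ *_) (l-+ (Lin-pmul (snd cκ)) A B ν)) (*-distribˡ-+ (fst cκ) (pmul (snd cκ) A ν) (pmul (snd cκ) B ν)))) (∑-+ x (\ cκ -> fst cκ * pmul (snd cκ) A ν) (\ cκ -> fst cκ * pmul (snd cκ) B ν))
  ; l-* = \ c A ν -> trans (∑-cong x (\ cκ -> trans (cong (fst cκ *_) (l-* (Lin-pmul (snd cκ)) c A ν)) (r (fst cκ) c (pmul (snd cκ) A ν)))) (∑-* x c (\ cκ -> fst cκ * pmul (snd cκ) A ν)) }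
  where r : ∀ a b c -> a * (b * c) ≡ b * (a * c)
        r = solve-∀

mul-++ : ∀ x y {N} (A : V N) ν -> mul (x ++ y) A ν ≡ mul x A ν + mul y A ν
mul-++ x y A ν = ∑-++ x y (\ cκ -> fst cκ * pmul (snd cκ) A ν)

mul-p₁ : ∀ x y {N} (ν : Vec ℕ N) -> val ((p₁ ⊛ x) ⊛ y) ν ≡ mul x (val (p₁ ⊛ y)) ν
mul-p₁ x y {N} ν = trans (val-⊛ (p₁ ⊛ x) y ν) (trans (cong (\ l -> mul l (val y) ν) (Lₚ.++-identityʳ (map (\ dμ -> 1ℤ * fst dμ , 0 ∷ snd dμ) x)))
   (trans (∑-map (\ dμ -> 1ℤ * fst dμ , 0 ∷ snd dμ) x (\ cκ -> fst cκ * pmul (snd cκ) (val y) ν)) (∑-cong x (\ dμ -> cong₂ _*_ (Z.*-identityˡ (fst dμ))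
     (trans (comm (snd dμ) (val y) ν) (l-cong (Lin-pmul (snd dμ)) (\ β -> sym (trans (val-⊛ p₁ y β) (trans (+-identityʳ _) (Z.*-identityˡ _)))) ν))))))
  where
  comm : ∀ κ (A : V N) ν -> P 1 (pmul κ A) ν ≡ pmul κ (P 1 A) ν
  comm [] A ν = refl
  comm (a ∷ κ) A ν = trans (P-comm 1 (suc a) (pmul κ A) ν) (P-cong (suc a) (comm κ A) ν)

-- Partitions close to (n)

∑-filter : ∀ {A : Set} (p : A -> Bool) xs (f : A -> ℤ) -> ∑ (filterᵇ p xs) f ≡ ∑ xs (\ x -> if p x then f x else 0ℤ)
∑-filter p [] f = refl
∑-filter p (x ∷ xs) f with p x
... | true = cong (f x +_) (∑-filter p xs f)
... | false = trans (∑-filter p xs f) (sym (+-identityˡ _))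

∑-split : ∀ {A : Set} (p : A -> Bool) xs (f : A -> ℤ) -> ∑ xs f ≡ ∑ (filterᵇ p xs) f + ∑ (filterᵇ (not ∘ p) xs) f
∑-split p xs f = sym (trans (cong₂ _+_ (∑-filter p xs f) (∑-filter (not ∘ p) xs f)) (trans (sym (∑-+ xs _ _)) (∑-cong xs (\ x -> go (p x) (f x)))))
  where go : ∀ b y -> (if b then y else 0ℤ) + (if not b then y else 0ℤ) ≡ y
        go true y = +-identityʳ y
        go false y = +-identityˡ y

∑-upTo : ∀ K (f : ℕ -> ℤ) -> ∑ (upTo (suc K)) f ≡ ∑ (upTo K) f + f K
∑-upTo K f = trans (cong (\ l -> ∑ l f) (sym (Lₚ.upTo-∷ʳ K))) (trans (∑-++ (upTo K) (K ∷ []) f) (cong (∑ (upTo K) f +_) (+-identityʳ (f K))))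

∑-≤-∈ : ∀ {A : Set} (xs : List A) {f g : A -> ℤ} -> (∀ {x} -> x ∈ xs -> f x Z.≤ g x) -> ∑ xs f Z.≤ ∑ xs g
∑-≤-∈ [] h = Z.≤-refl
∑-≤-∈ (x ∷ xs) h = Z.+-mono-≤ (h (here refl)) (∑-≤-∈ xs (h ∘ there))

¬T⇒false : ∀ {b} -> ¬ T b -> b ≡ false
¬T⇒false {true} h = ⊥-elim (h tt)
¬T⇒false {false} h = refl

T⇒true : ∀ {b} -> T b -> b ≡ true
T⇒true {true} _ = refl

leB-< : ∀ {x m xs κ} -> m N.< x -> leB (x ∷ xs) (m ∷ κ) ≡ false
leB-< {x} {m} {xs} {κ} l = cong₂ (\ a b -> a ∨ (b ∧ leB xs κ)) (¬T⇒false (\ t -> N.<-asym l (N.<ᵇ⇒< x m t))) (¬T⇒false (\ t -> N.<⇒≢ l (sym (N.≡ᵇ⇒≡ x m t))))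

leB-> : ∀ {x m xs κ} -> x N.< m -> leB (x ∷ xs) (m ∷ κ) ≡ true
leB-> {x} {m} {xs} {κ} l = cong (\ a -> a ∨ ((x N.≡ᵇ m) ∧ leB xs κ)) (T⇒true (N.<⇒<ᵇ l))

leB-≡ : ∀ m {xs κ} -> leB (m ∷ xs) (m ∷ κ) ≡ leB xs κ
leB-≡ m {xs} {κ} = cong₂ (\ a b -> a ∨ (b ∧ leB xs κ)) (¬T⇒false (\ t -> N.<-irrefl {m} refl (N.<ᵇ⇒< m m t))) (T⇒true (N.≡⇒≡ᵇ m m refl))

Par-tight : ∀ {n m λ'} -> Par n m λ' -> Par n n λ'
Par-tight nil = nil
Par-tight (cons {n} {k = k} p q r) = cons p (N.m≤m+n k n) r

-- Multiplied by z, the difference a - Dp becomes D(L - zp); this removes the order z of the cyclic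
-- centraliser from `part-eq`.
scaled-≤ : ∀ z D L p a -> ∃[ c ] z ≡ pos (suc c) -> 0≤ D -> z * a ≡ D * L -> 0≤ (L + (- z * p + 0ℤ)) -> D * p Z.≤ a
scaled-≤ z D L p a zc d e h = Z.0≤i-j⇒j≤i (0≤-÷′ {z} {a - D * p} zc (subst 0≤_ (sym (trans (r₁ z a D p) (trans (cong (_- D * (z * p)) e) (r₂ D L z p)))) (0≤-* d h)))
  where
  r₁ : ∀ z a D p -> z * (a - D * p) ≡ z * a - D * (z * p)
  r₁ = solve-∀
  r₂ : ∀ D L z p -> D * L - D * (z * p) ≡ D * (L + (- z * p + 0ℤ))
  r₂ = solve-∀

-- Here μ = (n - K, κ). A partition exceeds μ if its first part is n - k with k < K, or if its first
-- part is n - K and its remainder exceeds κ. With s = S + 1, s times the sum of these remainders is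
-- gp - gm. By `sK` and `sK'`, sψ_K dominates gp and sψ_{K+1} dominates p₁ gm. The bound `big` says
-- 2(K + 1) < n, so that block K + 1 is still part of the class equation estimate.
module TopCase (n K : ℕ) (big : suc (suc (suc (K N.+ K))) N.≤ n) (κ : List ℕ) (S : ℕ) (gp gm : Comb) (dp : Deg K gp) (dm : Deg K gm)
  (gEq : ∀ {N} (β : Vec ℕ N) -> pos (suc S) * ∑ (filterᵇ (\ λ' -> not (leB λ' κ)) (partitions K)) (\ λ' -> alt (sucs (preds λ')) β) ≡ val gp β - val gm β)
  (sp : SPos n gp) (sm : SPos n gm) (sK : SPos n (pos (suc S) ⊙ ψc K ++ (- 1ℤ) ⊙ gp)) (sK' : SPos n (pos (suc S) ⊙ ψc (suc K) ++ (- 1ℤ) ⊙ (p₁ ⊛ gm)))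
  (β : Vec ℕ n) (sβ : Str 0 β) where
  private
    μ = n N.∸ K ∷ κ
    s = pos (suc S)
    open Level n using (Dn; Dn-pos)
    alt' : List ℕ -> V n
    alt' λ' = alt (sucs (preds λ'))
    W : ℕ -> ℤ
    W k = part n (N.pred (n N.∸ k)) k β

    small : ∀ k -> k N.≤ suc K -> suc (k N.+ k) N.≤ n
    small k l = N.≤-trans (s≤s (N.+-mono-≤ l l)) (subst (N._≤ n) (cong (\ t -> suc (suc t)) (sym (N.+-suc K K))) big)
    k<n : ∀ k -> k N.≤ suc K -> k N.< n
    k<n k l = N.≤-trans (s≤s (N.m≤m+n k k)) (small k l)
    sucpred : ∀ k -> k N.≤ suc K -> suc (N.pred (n N.∸ k)) ≡ n N.∸ k
    sucpred k l = go (n N.∸ k) (N.m<n⇒0<n∸m (k<n k l))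
      where go : ∀ x -> 0 N.< x -> suc (N.pred x) ≡ x
            go (suc x) _ = refl
    index : ∀ k -> k N.≤ suc K -> suc (N.pred (n N.∸ k)) N.+ k ≡ n
    index k l = trans (cong (N._+ k) (sucpred k l)) (N.m∸n+n≡m (N.<⇒≤ (k<n k l)))
    le : ∀ k -> k N.≤ suc K -> k N.≤ N.pred (n N.∸ k)
    le k l = N.≤-pred (N.≤-trans (N.m+n≤o⇒m≤o∸n (suc k) (small k l)) (N.≤-reflexive (sym (sucpred k l))))
    le' : ∀ k -> k N.≤ suc K -> k N.+ suc (N.pred (n N.∸ k)) N.≤ n
    le' k l = N.≤-reflexive (trans (N.+-comm k _) (index k l))

    D≥0 : 0≤ Dn
    D≥0 = Z.+≤+ z≤n

    q : ℕ -> ℕ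
    q k = N.pred (n N.∸ k)
    deg-excess : ∀ m -> Deg (suc m) (cyc-excess m)
    deg-excess m = Allₚ.++⁺ (deg-Lc m) (N.+-identityʳ (suc m) ∷ [])

    mul-excess : ∀ m (A : V n) -> mul (cyc-excess m) A β ≡ mul (Lc m) A β + (- Zn (rotP m) * P (suc m) A β + 0ℤ)
    mul-excess m A = mul-++ (Lc m) ((- Zn (rotP m) , m ∷ []) ∷ []) A β

    low : ∀ k -> k N.≤ suc K -> Dn * P (suc (q k)) (val (ψc k)) β Z.≤ W k
    low k l = scaled-≤ (Zn (rotP (q k))) Dn (mul (Lc (q k)) (val (ψc k)) β) (P (suc (q k)) (val (ψc k)) β) (W k) (Zn-suc (rotP (q k))) D≥0
      (trans (part-eq (q k) k (le k l) (index k l) β) (cong (Dn *_) (val-⊛ (Lc (q k)) (ψc k) β)))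
      (subst 0≤_ (trans (val-⊛ (cyc-excess (q k)) (ψc k) β) (mul-excess (q k) (val (ψc k))))
        (spos-⊛ {n} {suc (q k)} {k} (cyc-excess (q k)) (ψc k) (deg-excess (q k)) (deg-ψc k) (le' k l) (spos-cyc (q k)) (spos-ψc k) β sβ))

    rest : ∀ k (y : Comb) {N} (γ : Vec ℕ N) -> val (s ⊙ ψc k ++ (- 1ℤ) ⊙ y) γ ≡ s * val (ψc k) γ + (- 1ℤ) * val y γ
    rest k y γ = trans (val-++ (s ⊙ ψc k) ((- 1ℤ) ⊙ y) γ) (cong₂ _+_ (val-⊙ s (ψc k) γ) (val-⊙ (- 1ℤ) y γ))

    mul-rest : ∀ x k y -> mul x (val (s ⊙ ψc k ++ (- 1ℤ) ⊙ y)) β ≡ s * mul x (val (ψc k)) β + (- 1ℤ) * mul x (val y) β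
    mul-rest x k y = trans (l-cong (Lin-mul x) (rest k y) β) (trans (l-+ (Lin-mul x) (\ γ -> s * val (ψc k) γ) (\ γ -> (- 1ℤ) * val y γ) β)
      (cong₂ _+_ (l-* (Lin-mul x) s (val (ψc k)) β) (l-* (Lin-mul x) (- 1ℤ) (val y) β)))

    deg-rest : ∀ k y -> Deg k y -> Deg k (s ⊙ ψc k ++ (- 1ℤ) ⊙ y)
    deg-rest k y d = Allₚ.++⁺ (deg-⊙ s (ψc k) (deg-ψc k)) (deg-⊙ (- 1ℤ) y d)

    scale-eq : ∀ z w D L -> z * w ≡ D * L -> z * (s * w) ≡ D * (s * L)
    scale-eq z w D L e = trans (r₁ z s w) (trans (cong (s *_) e) (r₁ s D L))
      where r₁ : ∀ a b c -> a * (b * c) ≡ b * (a * c)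
            r₁ = solve-∀

    K≤ : K N.≤ suc K
    K≤ = N.n≤1+n K
    Pg : Comb -> ℤ
    Pg g = P (suc (q K)) (val g) β

    -- p_{n-K} gp is dominated by L_{n-K} gp through `spos-cyc`, and this by s L_{n-K} ψ_K through
    -- `sK`.
    mid : Dn * Pg gp Z.≤ s * W K
    mid = scaled-≤ z Dn (s * L) (Pg gp) (s * W K) (Zn-suc (rotP (q K))) D≥0
      (scale-eq z (W K) Dn L (trans (part-eq (q K) K (le K K≤) (index K K≤) β) (cong (Dn *_) (val-⊛ (Lc (q K)) (ψc K) β))))
      (subst 0≤_ (r L s (mul (Lc (q K)) (val gp) β) (- z * Pg gp + 0ℤ)) (0≤-+
        (subst 0≤_ (trans (val-⊛ (cyc-excess (q K)) gp β) (mul-excess (q K) (val gp))) (spos-⊛ {n} {suc (q K)} {K} (cyc-excess (q K)) gp (deg-excess (q K)) dp (le' K K≤) (spos-cyc (q K)) sp β sβ))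
        (subst 0≤_ (trans (val-⊛ (Lc (q K)) (s ⊙ ψc K ++ (- 1ℤ) ⊙ gp) β) (mul-rest (Lc (q K)) K gp)) (spos-⊛ {n} {suc (q K)} {K} (Lc (q K)) (s ⊙ ψc K ++ (- 1ℤ) ⊙ gp) (deg-Lc (q K)) (deg-rest K gp dp) (le' K K≤) (spos-Lc (q K)) sK β sβ))))
      where
      z = Zn (rotP (q K))
      L = mul (Lc (q K)) (val (ψc K)) β
      r : ∀ L s M e -> (M + e) + (s * L + (- 1ℤ) * M) ≡ s * L + e
      r = solve-∀

    q' = q (suc K)
    q'≡ : suc q' ≡ q K
    q'≡ = trans (sucpred (suc K) N.≤-refl) (sym (N.pred[m∸n]≡m∸[1+n] n K))

    -- This is how the negative part of block K is charged to block K + 1: -p_{n-K} is dominated by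
    -- p₁ L_{n-K-1} (`spos-defect`), and p₁ gm by sψ_{K+1} (`sK'`).
    high : Dn * (- Pg gm) Z.≤ s * W (suc K)
    high = scaled-≤ z Dn (s * L) (- Pg gm) (s * W (suc K)) (Zn-suc (rotP q')) D≥0
      (scale-eq z (W (suc K)) Dn L (trans (part-eq q' (suc K) (le (suc K) N.≤-refl) (index (suc K) N.≤-refl) β) (cong (Dn *_) (val-⊛ (Lc q') (ψc (suc K)) β))))
      (subst 0≤_ (r L s M z (Pg gm)) (0≤-+
        (subst 0≤_ (trans (val-⊛ (cyc-defect q') gm β) (cong₂ _+_ (cong (\ t -> z * P (suc t) (val gm) β) q'≡) (trans (sym (val-⊛ (p₁ ⊛ Lc q') gm β)) (mul-p₁ (Lc q') gm β))))
          (spos-⊛ {n} {suc (suc q')} {K} (cyc-defect q') gm (cong suc (N.+-identityʳ (suc q')) ∷ deg-⊛ p₁ (Lc q') (refl ∷ []) (deg-Lc q')) dm (subst (\ t -> K N.+ suc t N.≤ n) (sym q'≡) (le' K K≤))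
             (spos-defect q' (subst (\ t -> suc t N.≤ n) (sym q'≡) (N.≤-trans (N.≤-reflexive (sucpred K K≤)) (N.m∸n≤m n K)))) sm β sβ))
        (subst 0≤_ (trans (val-⊛ (Lc q') X' β) (mul-rest (Lc q') (suc K) (p₁ ⊛ gm))) (spos-⊛ {n} {suc q'} {suc K} (Lc q') X' (deg-Lc q') (deg-rest (suc K) (p₁ ⊛ gm) (deg-⊛ p₁ gm (refl ∷ []) dm)) (le' (suc K) N.≤-refl) (spos-Lc q') sK' β sβ))))
      where
      z = Zn (rotP q')
      X' = s ⊙ ψc (suc K) ++ (- 1ℤ) ⊙ (p₁ ⊛ gm)
      L = mul (Lc q') (val (ψc (suc K))) β
      M = mul (Lc q') (val (p₁ ⊛ gm)) β
      r : ∀ L s M z g -> (z * g + M) + (s * L + (- 1ℤ) * M) ≡ s * L + (- z * (- g) + 0ℤ)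
      r = solve-∀

    Sf : ℕ -> List (List ℕ)
    Sf k = filterᵇ (\ λ' -> not (leB (n N.∸ k ∷ λ') μ)) (partitions k)

    filtered : filterᵇ (\ λ' -> not (leB λ' μ)) (partitions n) ↭ blocks Sf n (suc K)
    filtered = ↭-from-⊆ _ _ (Uₚ.filter⁺ (T? ∘ (\ λ' -> not (leB λ' μ))) (partsF-unique n n n))
      (blocks-unique Sf n (suc K) (\ k -> Uₚ.filter⁺ (T? ∘ (\ λ' -> not (leB (n N.∸ k ∷ λ') μ))) (partsF-unique k k k)) (N.≤-trans (s≤s (N.n≤1+n K)) (s≤s (N.<⇒≤ (k<n (suc K) N.≤-refl)))))
      (\ m -> let (i , t) = ∈-filter⁻ (T? ∘ (\ λ' -> not (leB λ' μ))) {xs = partitions n} m in fwd (∈⇒Par n i) refl t) bwd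
      where
      fwd : ∀ {n₁ m₁ λ'} -> Par n₁ m₁ λ' -> n₁ ≡ n -> T (not (leB λ' μ)) -> λ' ∈ blocks Sf n (suc K)
      fwd nil e ()
      fwd (cons {n'} {m₁} {x} {xs} a b r) e t = subst (\ y -> (y ∷ xs) ∈ blocks Sf n (suc K)) x≡ (∈-blocks Sf {n} {suc K} {n'} (s≤s k≤K) (∈-filter⁺ (T? ∘ (\ λ' -> not (leB (n N.∸ n' ∷ λ') μ))) (Par⇒∈partitions (Par-tight r)) (subst (\ y -> T (not (leB (y ∷ xs) μ))) (sym x≡) t)))
        where
        x≡ : n N.∸ n' ≡ x
        x≡ = trans (cong (N._∸ n') (sym e)) (N.m+n∸n≡m x n')
        m≤x : n N.∸ K N.≤ x
        m≤x = N.≮⇒≥ (\ lt -> subst (\ b -> T (not b)) (leB-> {x} {n N.∸ K} {xs} {κ} lt) t)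
        k≤K : n' N.≤ K
        k≤K = N.+-cancelˡ-≤ x n' K (N.≤-trans (N.≤-reflexive e) (N.≤-trans (N.≤-reflexive (sym (N.m∸n+n≡m (N.<⇒≤ (k<n K K≤))))) (N.+-monoˡ-≤ K m≤x)))
      bwd : ∀ {λ'} -> λ' ∈ blocks Sf n (suc K) -> λ' ∈ filterᵇ (\ λ' -> not (leB λ' μ)) (partitions n)
      bwd m = let (k , λ'' , l , i , e) = blocks-∈ Sf m ; (i' , t) = ∈-filter⁻ (T? ∘ (\ λ' -> not (leB (n N.∸ k ∷ λ') μ))) {xs = partitions k} i in
        subst (_∈ filterᵇ (\ λ' -> not (leB λ' μ)) (partitions n)) (sym e) (∈-filter⁺ (T? ∘ (\ λ' -> not (leB λ' μ))) (cons∈partitions {n} {k} {λ''} (small k (N.≤-trans (N.≤-pred l) K≤)) i') t)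

    head-sum : ∀ k (xs : List (List ℕ)) -> ∑ xs (\ λ' -> alt' (n N.∸ k ∷ λ') β) ≡ P (suc (q k)) (\ γ -> ∑ xs (\ λ' -> alt' λ' γ)) β
    head-sum k xs = sym (l-∑ (Lin-P (suc (q k))) xs alt' β)

    ψ-∑ : ∀ k (γ : Vec ℕ n) -> val (ψc k) γ ≡ ∑ (partitions k) (\ λ' -> alt' λ' γ)
    ψ-∑ k γ = trans (val-ψc k γ) (∑-map preds (partitions k) (\ κ -> alt (sucs κ) γ))

    block-low : ∀ {k} -> k ∈ upTo K -> ∑ (Sf k) (\ λ' -> alt' (n N.∸ k ∷ λ') β) ≡ P (suc (q k)) (val (ψc k)) β
    block-low {k} m = trans (∑-filter (\ λ' -> not (leB (n N.∸ k ∷ λ') μ)) (partitions k) (\ λ' -> alt' (n N.∸ k ∷ λ') β)) (trans (∑-cong (partitions k) (\ λ' -> cong (\ b -> if not b then alt' (n N.∸ k ∷ λ') β else 0ℤ) (leB-< {n N.∸ k} {n N.∸ K} {λ'} {κ} (N.∸-monoʳ-< (∈-upTo⁻ m) (N.<⇒≤ (k<n K K≤))))))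
      (trans (head-sum k (partitions k)) (P-cong (suc (q k)) (\ γ -> sym (ψ-∑ k γ)) β)))

    Gs = filterᵇ (\ λ' -> not (leB λ' κ)) (partitions K)
    block-K : s * ∑ (Sf K) (\ λ' -> alt' (n N.∸ K ∷ λ') β) ≡ Pg gp - Pg gm
    block-K = trans (cong (s *_) (trans (∑-filter (\ λ' -> not (leB (n N.∸ K ∷ λ') μ)) (partitions K) f) (trans (∑-cong (partitions K) (\ λ' -> cong (\ b -> if not b then f λ' else 0ℤ) (leB-≡ (n N.∸ K) {λ'} {κ})))
        (trans (sym (∑-filter (\ λ' -> not (leB λ' κ)) (partitions K) f)) (head-sum K Gs)))))
      (trans (sym (l-* LP s (\ γ -> ∑ Gs (\ λ' -> alt' λ' γ)) β)) (trans (l-cong LP (\ γ -> gEq γ) β) (l-- LP (val gp) (val gm) β)))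
      where
      LP = Lin-P (suc (q K)) {n}
      f : List ℕ -> ℤ
      f λ' = alt' (n N.∸ K ∷ λ') β

  top-case : 0≤ ∑ (filterᵇ (\ λ' -> leB λ' μ) (partitions n)) (\ λ' -> alt (sucs (preds λ')) β)
  top-case = 0≤-÷′ {Dn} {Y} Dn-pos (0≤-÷ S {Dn * Y} (subst 0≤_ (sym fin) (Z.i≤j⇒0≤j-i bound)))
    where
    Y = ∑ (filterᵇ (\ λ' -> leB λ' μ) (partitions n)) (\ λ' -> alt' λ' β)
    Lw = ∑ (upTo K) (\ k -> P (suc (q k)) (val (ψc k)) β)
    Bk = ∑ (Sf K) (\ λ' -> alt' (n N.∸ K ∷ λ') β)
    ψn = val (ψc n) β
    total : ψn ≡ Y + (Lw + Bk)
    total = trans (ψ-∑ n β) (trans (∑-split (\ λ' -> leB λ' μ) (partitions n) (\ λ' -> alt' λ' β)) (cong (Y +_) (trans (∑-↭ filtered (\ λ' -> alt' λ' β)) (trans (∑-blocks Sf n (suc K) (\ λ' -> alt' λ' β)) (trans (∑-upTo K (\ k -> ∑ (Sf k) (\ λ' -> alt' (n N.∸ k ∷ λ') β))) (cong (_+ Bk) (∑-cong-∈ (upTo K) block-low)))))))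
    fin : s * (Dn * Y) ≡ s * (Dn * ψn) - (s * (Dn * Lw) + (Dn * Pg gp + Dn * (- Pg gm)))
    fin = trans (r₁ s Dn Y Lw Bk) (cong₂ _-_ (cong (\ t -> s * (Dn * t)) (sym total)) (cong (s * (Dn * Lw) +_) (trans (cong (Dn *_) block-K) (r₂ Dn (Pg gp) (Pg gm)))))
      where
      r₁ : ∀ s D Y L B -> s * (D * Y) ≡ s * (D * (Y + (L + B))) - (s * (D * L) + D * (s * B))
      r₁ = solve-∀
      r₂ : ∀ D a b -> D * (a - b) ≡ D * a + D * (- b)
      r₂ = solve-∀
    sumW : s * ∑ (upTo (suc (suc K))) W ≡ s * ∑ (upTo K) W + (s * W K + s * W (suc K))
    sumW = trans (cong (s *_) (trans (∑-upTo (suc K) W) (cong (_+ W (suc K)) (∑-upTo K W)))) (r s (∑ (upTo K) W) (W K) (W (suc K)))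
      where r : ∀ s a b c -> s * ((a + b) + c) ≡ s * a + (s * b + s * c)
            r = solve-∀
    bound : s * (Dn * Lw) + (Dn * Pg gp + Dn * (- Pg gm)) Z.≤ s * (Dn * ψn)
    bound = Z.≤-trans (Z.+-mono-≤ (Z.*-monoˡ-≤-nonNeg s (Z.≤-trans (Z.≤-reflexive (sym (∑-* (upTo K) Dn (\ k -> P (suc (q k)) (val (ψc k)) β)))) (∑-≤-∈ (upTo K) (\ {k} m -> low k (N.≤-trans (N.<⇒≤ (∈-upTo⁻ m)) K≤))))) (Z.+-mono-≤ mid high))
      (Z.≤-trans (Z.≤-reflexive (sym sumW)) (Z.*-monoˡ-≤-nonNeg s (ψ-bound n (suc (suc K)) (\ k l -> small k (N.≤-pred l)) β sβ)))

-- Finite computations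

-- Evaluates an antisymmetric function at a vector with one entry out of order: sorted insertion
-- with sign, and 0 on a collision. Thus computations only ever touch strict vectors.
insK : ∀ {N} -> ℕ -> Vec ℕ N -> V (suc N) -> ℤ
insK a [] f = f (a ∷ [])
insK a (b ∷ β) f = if a N.<ᵇ b then f (a ∷ b ∷ β) else (if a N.≡ᵇ b then 0ℤ else - insK a β (\ γ -> f (b ∷ γ)))

-- The Murnaghan–Nakayama rule on strictly increasing bead vectors.
mnP : ∀ k {N} -> V N -> V N
mnP k F [] = 0ℤ
mnP k F (b ∷ β) = (if k N.≤ᵇ b then insK (b N.∸ k) β F else 0ℤ) + mnP k (\ γ -> insK b γ F) β

isδ : ∀ {N} -> ℕ -> Vec ℕ N -> ℤ
isδ lo [] = 1ℤ
isδ lo (b ∷ β) = if b N.≡ᵇ lo then isδ (suc lo) β else 0ℤ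

mn : List ℕ -> ∀ {N} -> V N
mn [] = isδ 0
mn (k ∷ κ) = mnP k (mn κ)

insK-Anti : ∀ {N} lo a (β : Vec ℕ N) {F A : V (suc N)} -> lo N.≤ a -> Str lo β -> Anti A -> (∀ γ -> Str lo γ -> F γ ≡ A γ) -> insK a β F ≡ A (a ∷ β)
insK-Anti lo a [] l s h e = e (a ∷ []) (l , tt)
insK-Anti lo a (b ∷ β) {F} {A} l (p , s) h e = go (N.<-cmp a b)
  where
  X = insK a β (\ γ -> F (b ∷ γ))
  go : Tri (a N.< b) (a ≡ b) (b N.< a) -> (if a N.<ᵇ b then F (a ∷ b ∷ β) else (if a N.≡ᵇ b then 0ℤ else - X)) ≡ A (a ∷ b ∷ β)
  go (tri< q _ _) = trans (cong (\ t -> if t then F (a ∷ b ∷ β) else (if a N.≡ᵇ b then 0ℤ else - X)) (T⇒true (N.<⇒<ᵇ q))) (e (a ∷ b ∷ β) (l , q , s))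
  go (tri≈ nq q _) = trans (cong₂ (\ t u -> if t then F (a ∷ b ∷ β) else (if u then 0ℤ else - X)) (¬T⇒false (\ t -> nq (N.<ᵇ⇒< a b t))) (T⇒true (N.≡⇒≡ᵇ a b q))) (sym (Anti-rep {A = A} h a (b ∷ β) (inj₁ q)))
  go (tri> nq nq' q) = trans (cong₂ (\ t u -> if t then F (a ∷ b ∷ β) else (if u then 0ℤ else - X)) (¬T⇒false (\ t -> nq (N.<ᵇ⇒< a b t))) (¬T⇒false (\ t -> nq' (N.≡ᵇ⇒≡ a b t))))
    (trans (cong -_ (insK-Anti (suc b) a β {λ γ -> F (b ∷ γ)} {λ γ -> A (b ∷ γ)} q s (snd h b) (\ γ s' -> e (b ∷ γ) (p , s')))) (sym (fst h a b β)))

mnP-P : ∀ k {N} (β : Vec ℕ N) {F A : V N} -> Str 0 β -> Anti A -> (∀ γ -> Str 0 γ -> F γ ≡ A γ) -> mnP k F β ≡ P k A β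
mnP-P k [] s h e = refl
mnP-P k (b ∷ β) {F} {A} (p , s) h e = cong₂ _+_ (go (k N.≤? b)) (mnP-P k β {λ γ -> insK b γ F} {λ γ -> A (b ∷ γ)} s₀ (Anti-tail {A = A} h b) (\ γ sγ -> insK-Anti 0 b γ {F} {A} z≤n sγ h e))
  where
  s₀ = Str-mono {β = β} z≤n s
  go : Dec (k N.≤ b) -> (if k N.≤ᵇ b then insK (b N.∸ k) β F else 0ℤ) ≡ sh k (\ x -> A (x ∷ β)) b
  go (yes l) = trans (cong (\ t -> if t then insK (b N.∸ k) β F else 0ℤ) (T⇒true (N.≤⇒≤ᵇ l))) (trans (insK-Anti 0 (b N.∸ k) β {F} {A} z≤n s₀ h e)
    (sym (trans (cong (sh k (\ x -> A (x ∷ β))) (sym (N.m+[n∸m]≡n l))) (sh-at k _ (b N.∸ k)))))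
  go (no nl) = trans (cong (\ t -> if t then insK (b N.∸ k) β F else 0ℤ) (¬T⇒false (\ t -> nl (N.≤ᵇ⇒≤ k b t)))) (sym (sh-small k (\ x -> A (x ∷ β)) b (N.≰⇒> nl)))

isδ-van : ∀ {N} (β : Vec ℕ N) -> Str 0 β -> isδ 0 β ≡ van β
isδ-van {N} β s = go (Vecₚ.≡-dec N._≟_ β (δ 0 N))
  where
  import Data.Vec.Properties as Vecₚ
  on : ∀ lo N -> isδ lo (δ lo N) ≡ 1ℤ
  on lo zero = refl
  on lo (suc N) = trans (cong (\ t -> if t then isδ (suc lo) (δ (suc lo) N) else 0ℤ) (T⇒true (N.≡⇒≡ᵇ lo lo refl))) (on (suc lo) N)
  off : ∀ {N} lo (β : Vec ℕ N) -> β ≢ δ lo N -> isδ lo β ≡ 0ℤ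
  off lo [] ne = ⊥-elim (ne refl)
  off lo (b ∷ β) ne = d (b N.≟ lo)
    where d : Dec (b ≡ lo) -> (if b N.≡ᵇ lo then isδ (suc lo) β else 0ℤ) ≡ 0ℤ
          d (yes refl) = trans (cong (\ t -> if t then isδ (suc lo) β else 0ℤ) (T⇒true (N.≡⇒≡ᵇ b b refl))) (off (suc lo) β (\ q -> ne (cong (lo ∷_) q)))
          d (no nb) = cong (\ t -> if t then isδ (suc lo) β else 0ℤ) (¬T⇒false (\ t -> nb (N.≡ᵇ⇒≡ b lo t)))
  go : Dec (β ≡ δ 0 N) -> isδ 0 β ≡ van β
  go (yes refl) = trans (on 0 N) (sym (van-δ N))
  go (no ne) = trans (off 0 β ne) (sym (van-strict β s ne))

mn-alt : ∀ λ' {N} (β : Vec ℕ N) -> Str 0 β -> mn λ' β ≡ alt λ' β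
mn-alt [] β s = isδ-van β s
mn-alt (k ∷ λ') β s = mnP-P k β {mn λ'} {alt λ'} s (Anti-alt λ') (mn-alt λ')

-- The strictly increasing vectors with entries ≥ lo whose sum exceeds the least possible one by e.
exs : ∀ N -> ℕ -> ℕ -> List (Vec ℕ N)
exs zero lo zero = [] ∷ []
exs zero lo (suc e) = []
exs (suc N) lo e = concatMap (\ d -> map (lo N.+ d ∷_) (exs N (suc (lo N.+ d)) (e N.∸ d N.* suc N))) (filterᵇ (\ d -> d N.* suc N N.≤ᵇ e) (upTo (suc e)))

δ-shift : ∀ d lo N -> sumV (δ (lo N.+ d) N) ≡ d N.* N N.+ sumV (δ lo N)
δ-shift zero lo N = cong (\ t -> sumV (δ t N)) (N.+-identityʳ lo)
δ-shift (suc d) lo N = trans (cong (\ t -> sumV (δ t N)) (N.+-suc lo d)) (trans (δsum (lo N.+ d) N) (trans (cong (N N.+_) (δ-shift d lo N)) (sym (N.+-assoc N (d N.* N) _))))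

∈-exs : ∀ {N} lo e (β : Vec ℕ N) -> Str lo β -> sumV β ≡ e N.+ sumV (δ lo N) -> β ∈ exs N lo e
∈-exs lo zero [] s q = here refl
∈-exs lo (suc e) [] s ()
∈-exs {suc N} lo e (b ∷ β) (p , s) q = subst (\ b -> (b ∷ β) ∈ exs (suc N) lo e) b≡ (∈-concatMap⁺ (\ d -> map (lo N.+ d ∷_) (exs N (suc (lo N.+ d)) (e N.∸ d N.* suc N)))
    (lose (∈-filter⁺ (T? ∘ (\ d -> d N.* suc N N.≤ᵇ e)) (∈-upTo⁺ (s≤s (N.≤-trans (N.m≤m*n d (suc N)) dN≤))) (N.≤⇒≤ᵇ dN≤))
      (∈-map⁺ (lo N.+ d ∷_) (∈-exs (suc (lo N.+ d)) (e N.∸ d N.* suc N) β (subst (\ t -> Str (suc t) β) (sym b≡) s) rest))))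
  where
  d = b N.∸ lo
  b≡ : lo N.+ d ≡ b
  b≡ = N.m+[n∸m]≡n p
  σ = sumV (δ (suc lo) N)
  shift : sumV (δ (suc (lo N.+ d)) N) ≡ d N.* N N.+ σ
  shift = δ-shift d (suc lo) N
  q' : d N.+ sumV β ≡ e N.+ σ
  q' = N.+-cancelˡ-≡ lo _ _ (trans (sym (N.+-assoc lo d (sumV β))) (trans (cong (N._+ sumV β) b≡) (trans q (sw e lo σ))))
    where sw : ∀ x y z -> x N.+ (y N.+ z) ≡ y N.+ (x N.+ z)
          sw x y z = trans (sym (N.+-assoc x y z)) (trans (cong (N._+ z) (N.+-comm x y)) (N.+-assoc y x z))
  dd : d N.* suc N ≡ d N.+ d N.* N
  dd = N.*-suc d N
  dN≤ : d N.* suc N N.≤ e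
  dN≤ = N.+-cancelʳ-≤ σ (d N.* suc N) e (N.≤-trans (N.≤-reflexive (trans (cong (N._+ σ) dd) (trans (N.+-assoc d (d N.* N) σ) (cong (d N.+_) (sym shift)))))
    (N.≤-trans (N.+-monoʳ-≤ d (Str-sum (suc (lo N.+ d)) β (subst (\ t -> Str (suc t) β) (sym b≡) s))) (N.≤-reflexive q')))
  rest : sumV β ≡ (e N.∸ d N.* suc N) N.+ sumV (δ (suc (lo N.+ d)) N)
  rest = N.+-cancelˡ-≡ d _ _ (trans q' (trans (cong (N._+ σ) (sym (N.m∸n+n≡m dN≤))) (trans (N.+-assoc (e N.∸ d N.* suc N) (d N.* suc N) σ)
    (trans (cong (e N.∸ d N.* suc N N.+_) (trans (cong (N._+ σ) dd) (trans (N.+-assoc d (d N.* N) σ) (cong (d N.+_) (sym shift))))) (sw (e N.∸ d N.* suc N) d _)))))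
    where sw : ∀ x y z -> x N.+ (y N.+ z) ≡ y N.+ (x N.+ z)
          sw x y z = trans (sym (N.+-assoc x y z)) (trans (cong (N._+ z) (N.+-comm x y)) (N.+-assoc y x z))

allᵇ : ∀ {A : Set} -> (A -> Bool) -> List A -> Bool
allᵇ p [] = true
allᵇ p (x ∷ xs) = p x ∧ allᵇ p xs

allᵇ-∈ : ∀ {A : Set} {p : A -> Bool} xs -> T (allᵇ p xs) -> ∀ {x} -> x ∈ xs -> T (p x)
allᵇ-∈ {p = p} (y ∷ xs) t m = go (p y) refl t m
  where go : ∀ b -> p y ≡ b -> T (b ∧ allᵇ p xs) -> ∀ {x} -> x ∈ y ∷ xs -> T (p x)
        go true e t (here refl) = subst T (sym e) tt
        go true e t (there m) = allᵇ-∈ xs t m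

nonneg : ℤ -> Bool
nonneg (pos _) = true
nonneg -[1+ _ ] = false

nonneg⇒ : ∀ {x} -> T (nonneg x) -> 0≤ x
nonneg⇒ {pos x} t = Z.+≤+ z≤n

mnval : Comb -> ∀ {N} -> V N
mnval x β = ∑ x (\ cκ -> fst cκ * mn (sucs (snd cκ)) β)

check : ℕ -> Comb -> Bool
check d x = allᵇ (\ β -> nonneg (mnval x β)) (exs d 0 d)

val-pad : ∀ x j {N} (β : Vec ℕ N) -> val x (pad j β) ≡ val x β
val-pad x j β = ∑-cong x (\ cκ -> cong (fst cκ *_) (alt-pad (snd cκ) j β))

-- In degree d, d variables decide: fewer variables are padded with zero parts, and with more
-- variables the smallest part is 0 and can be stripped.
spos-check : ∀ d x -> Deg d x -> T (check d x) -> ∀ {N} -> SPos N x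
spos-check d x dx t {N} β s = go N β s (d N.<? N)
  where
  at-d : ∀ {N} -> N ≡ d -> (β : Vec ℕ N) -> Str 0 β -> Dec (sumV β ≡ d N.+ tri N) -> 0≤ val x β
  at-d refl β s (no ne) = Z.≤-reflexive (sym (Hom-val d x dx β s ne))
  at-d refl β s (yes e) = subst 0≤_ (∑-cong x (\ cκ -> cong (fst cκ *_) (mn-alt (sucs (snd cκ)) β s))) (nonneg⇒ (allᵇ-∈ (exs d 0 d) t (∈-exs 0 d β s e)))
  go : ∀ N (β : Vec ℕ N) -> Str 0 β -> Dec (d N.< N) -> 0≤ val x β
  strip : ∀ N (β : Vec ℕ (suc N)) -> Str 0 β -> d N.< suc N -> Dec (sumV β ≡ d N.+ tri (suc N)) -> 0≤ val x β
  go N β s (no nl) = subst 0≤_ (val-pad x (d N.∸ N) β) (at-d (N.m∸n+n≡m (N.≮⇒≥ nl)) (pad (d N.∸ N) β) (Str-pad (d N.∸ N) s) (_ N.≟ _))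
  go (suc N) β s (yes l) = strip N β s l (_ N.≟ _)
  strip N β s l (no ne) = Z.≤-reflexive (sym (Hom-val d x dx β s ne))
  strip N β s l (yes e) = fin (headZero β s (N.≤-trans (s≤s (N.≤-reflexive e)) (N.+-monoˡ-≤ (tri (suc N)) l)))
    where fin : ∃[ β' ] (β ≡ 0 ∷ Vec.map suc β' × Str 0 β') -> 0≤ val x β
          fin (β' , refl , s') = subst 0≤_ (sym (val-pad x 1 β')) (go N β' s' (d N.<? N))

-- ψ_μ is nonnegative on all Schur functions (in n variables).
Good : ℕ -> List ℕ -> Set
Good n μ = ∀ (β : Vec ℕ n) -> Str 0 β -> 0≤ ∑ (filterᵇ (\ λ' -> leB λ' μ) (partitions n)) (\ λ' -> alt λ' β)

prefix-ok : List (List ℕ × ℤ) -> List (List ℕ) -> Bool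
prefix-ok vs μs = allᵇ (\ μ -> nonneg (∑ vs (\ lv -> if leB (fst lv) μ then snd lv else 0ℤ))) μs

-- The character values at β are listed once and then tested against every μ ≥ `lo`.
check-from : ℕ -> List ℕ -> Bool
check-from n lo = allᵇ (\ β -> prefix-ok (map (\ λ' -> λ' , mn λ' β) (partitions n)) (filterᵇ (leB lo) (partitions n))) (exs n 0 n)

∑-pos0 : ∀ {A : Set} (xs : List A) {f : A -> ℤ} -> (∀ {x} -> x ∈ xs -> f x ≡ 0ℤ) -> ∑ xs f ≡ 0ℤ
∑-pos0 xs h = trans (∑-cong-∈ xs h) (∑-0 xs)

alt-hom : ∀ {n λ'} -> λ' ∈ partitions n -> ∀ {N} (β : Vec ℕ N) -> sumV β ≢ n N.+ tri N -> alt λ' β ≡ 0ℤ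
alt-hom {n} {λ'} m {N} β ne = Hom-alt λ' β (\ e -> ne (trans e (cong (N._+ tri N) (Par-sum (∈⇒Par n m)))))

check-from-good : ∀ n lo -> T (check-from n lo) -> ∀ μ -> μ ∈ partitions n -> T (leB lo μ) -> Good n μ
check-from-good n lo t μ m l β s = go (sumV β N.≟ (n N.+ tri n))
  where
  go : Dec (sumV β ≡ n N.+ tri n) -> 0≤ ∑ (filterᵇ (\ λ' -> leB λ' μ) (partitions n)) (\ λ' -> alt λ' β)
  go (no ne) = Z.≤-reflexive (sym (∑-pos0 (filterᵇ (\ λ' -> leB λ' μ) (partitions n)) (\ i -> alt-hom (fst (∈-filter⁻ (T? ∘ (\ λ' -> leB λ' μ)) {xs = partitions n} i)) β ne)))
  go (yes e) = subst 0≤_ (trans (∑-map (\ λ' -> λ' , mn λ' β) (partitions n) (\ lv -> if leB (fst lv) μ then snd lv else 0ℤ))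
      (trans (∑-cong (partitions n) (\ λ' -> cong (\ v -> if leB λ' μ then v else 0ℤ) (mn-alt λ' β s))) (sym (∑-filter (\ λ' -> leB λ' μ) (partitions n) (\ λ' -> alt λ' β)))))
    (nonneg⇒ (allᵇ-∈ (filterᵇ (leB lo) (partitions n)) (allᵇ-∈ (exs n 0 n) t (∈-exs 0 n β s e)) (∈-filter⁺ (T? ∘ leB lo) m l)))

-- For κ ⊢ K and g = Σ_{κ' > κ} p_κ', a multiplier s and s times the negative part of the Schur expansion of g.
negative-part : List ℕ -> ℕ × Comb
negative-part (1 ∷ 1 ∷ []) = 1 , (1ℤ , 0 ∷ 0 ∷ []) ∷ (- 1ℤ , 1 ∷ []) ∷ []
negative-part (2 ∷ 1 ∷ []) = 2 , (1ℤ , 0 ∷ 0 ∷ 0 ∷ []) ∷ (- 1ℤ , 2 ∷ []) ∷ []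
negative-part (1 ∷ 1 ∷ 1 ∷ []) = 2 , (1ℤ , 0 ∷ 0 ∷ 0 ∷ []) ∷ (- 1ℤ , 2 ∷ []) ∷ []
negative-part (3 ∷ 1 ∷ []) = 5 , (1ℤ , 0 ∷ 0 ∷ 0 ∷ 0 ∷ []) ∷ (pos 2 , 2 ∷ 0 ∷ []) ∷ (- pos 3 , 3 ∷ []) ∷ []
negative-part (2 ∷ 2 ∷ []) = 23 , (pos 5 , 0 ∷ 0 ∷ 0 ∷ 0 ∷ []) ∷ (pos 6 , 1 ∷ 0 ∷ 0 ∷ []) ∷ (pos 3 , 1 ∷ 1 ∷ []) ∷ (- pos 8 , 2 ∷ 0 ∷ []) ∷ (- pos 6 , 3 ∷ []) ∷ []
negative-part (2 ∷ 1 ∷ 1 ∷ []) = 3 , (1ℤ , 0 ∷ 0 ∷ 0 ∷ 0 ∷ []) ∷ (pos 2 , 1 ∷ 0 ∷ 0 ∷ []) ∷ (- 1ℤ , 1 ∷ 1 ∷ []) ∷ (- pos 2 , 3 ∷ []) ∷ []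
negative-part (1 ∷ 1 ∷ 1 ∷ 1 ∷ []) = 3 , (1ℤ , 0 ∷ 0 ∷ 0 ∷ 0 ∷ []) ∷ (- 1ℤ , 1 ∷ 1 ∷ []) ∷ []
negative-part _ = 0 , []

module _ (K : ℕ) (κ : List ℕ) where
  above : List (List ℕ)
  above = filterᵇ (\ λ' -> not (leB λ' κ)) (partitions K)

  scl : ℤ
  scl = pos (suc (fst (negative-part κ)))

  neg-comb pos-comb gap gap' : Comb
  neg-comb = snd (negative-part κ)
  pos-comb = scl ⊙ map (\ λ' -> 1ℤ , preds λ') above ++ neg-comb
  gap = scl ⊙ ψc K ++ (- 1ℤ) ⊙ pos-comb
  gap' = scl ⊙ ψc (suc K) ++ (- 1ℤ) ⊙ (p₁ ⊛ neg-comb)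

  degᵇ : ℕ -> Comb -> Bool
  degᵇ d x = allᵇ (\ cκ -> lsumℕ (sucs (snd cκ)) N.≡ᵇ d) x

  -- Decides the degree of `neg-comb` and the hypotheses `sp`, `sm`, `sK` and `sK'` of `TopCase`.
  split-ok : Bool
  split-ok = degᵇ K neg-comb ∧ (check K pos-comb ∧ (check K neg-comb ∧ (check K gap ∧ check (suc K) gap')))

split-table : ∀ {K} -> K ∈ upTo 5 -> ∀ {κ} -> κ ∈ partitions K -> T (split-ok K κ)
split-table {K} m i = allᵇ-∈ (partitions K) (allᵇ-∈ {p = \ K -> allᵇ (split-ok K) (partitions K)} (upTo 5) tt m) i

preds-sum : ∀ {n λ'} -> λ' ∈ partitions n -> lsumℕ (sucs (preds λ')) ≡ n
preds-sum {n} m = let r = ∈⇒Par n m in trans (cong lsumℕ (sucs-preds r)) (Par-sum r)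

∧-T : ∀ {a b} -> T (a ∧ b) -> T a × T b
∧-T {true} t = tt , t

top-good : ∀ n K -> K ∈ upTo 5 -> suc (suc (suc (K N.+ K))) N.≤ n -> ∀ {κ} -> κ ∈ partitions K -> Good n (n N.∸ K ∷ κ)
top-good n K m big {κ} i β s = subst 0≤_ (∑-cong-∈ (filterᵇ (\ λ' -> leB λ' (n N.∸ K ∷ κ)) (partitions n)) (\ {λ'} j -> cong (\ l -> alt l β) (sucs-preds (∈⇒Par n (fst (∈-filter⁻ (T? ∘ (\ λ' -> leB λ' (n N.∸ K ∷ κ))) {xs = partitions n} j))))))
    (TopCase.top-case n K big κ (fst (negative-part κ)) gp gm dp dm gEq (spos-check K gp dp tp) (spos-check K gm dm tm)
      (spos-check K (gap K κ) (Allₚ.++⁺ (deg-⊙ sc (ψc K) (deg-ψc K)) (deg-⊙ (- 1ℤ) gp dp)) tg)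
      (spos-check (suc K) (gap' K κ) (Allₚ.++⁺ (deg-⊙ sc (ψc (suc K)) (deg-ψc (suc K))) (deg-⊙ (- 1ℤ) (p₁ ⊛ gm) (deg-⊛ p₁ gm (refl ∷ []) dm))) tg') β s)
  where
  gm = neg-comb K κ
  gp = pos-comb K κ
  sc = scl K κ
  ab = above K κ
  ok = split-table m i
  td = fst (∧-T {degᵇ K κ K gm} ok)
  ok₁ = snd (∧-T {degᵇ K κ K gm} ok)
  tp = fst (∧-T {check K gp} ok₁)
  ok₂ = snd (∧-T {check K gp} ok₁)
  tm = fst (∧-T {check K gm} ok₂)
  ok₃ = snd (∧-T {check K gm} ok₂)
  tg = fst (∧-T {check K (gap K κ)} ok₃)
  tg' = snd (∧-T {check K (gap K κ)} ok₃)
  dm : Deg K gm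
  dm = All.tabulate (\ {cκ} j -> N.≡ᵇ⇒≡ (lsumℕ (sucs (snd cκ))) K (allᵇ-∈ gm td j))
  dp : Deg K gp
  dp = Allₚ.++⁺ (deg-⊙ sc (map (\ λ' -> 1ℤ , preds λ') ab) (Allₚ.map⁺ (All.tabulate (\ j -> preds-sum (fst (∈-filter⁻ (T? ∘ (\ λ' -> not (leB λ' κ))) {xs = partitions K} j)))))) dm
  gEq : ∀ {N} (β : Vec ℕ N) -> sc * ∑ ab (\ λ' -> alt (sucs (preds λ')) β) ≡ val gp β - val gm β
  gEq β = sym (trans (cong (_- val gm β) (trans (val-++ (sc ⊙ map (\ λ' -> 1ℤ , preds λ') ab) gm β) (cong (_+ val gm β) (trans (val-⊙ sc (map (\ λ' -> 1ℤ , preds λ') ab) β)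
      (cong (sc *_) (trans (∑-map (\ λ' -> 1ℤ , preds λ') ab (term β)) (∑-cong ab (\ λ' -> Z.*-identityˡ (alt (sucs (preds λ')) β)))))))))
    (r (sc * ∑ ab (\ λ' -> alt (sucs (preds λ')) β)) (val gm β)))
    where r : ∀ a b -> (a + b) - b ≡ a
          r = solve-∀

small-good : ∀ n -> check-from n (n N.∸ 4 ∷ replicate 4 1) ≡ true -> ∀ μ -> μ ∈ partitions n -> T (leB (n N.∸ 4 ∷ replicate 4 1) μ) -> Good n μ
small-good n t = check-from-good n (n N.∸ 4 ∷ replicate 4 1) (subst T (sym t) tt)

-- A partition above (n - 4, 1⁴) has first part at least n - 4, so K ≤ 4, and 11 = 2·4 + 3 is the
-- bound `big` for K = 4.
case-ii-big : ∀ n -> 11 N.≤ n -> ∀ μ -> μ ∈ partitions n -> T (leB (n N.∸ 4 ∷ replicate 4 1) μ) -> Good n μ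
case-ii-big n l μ m t = go (∈⇒Par n {n} {n} m) refl t
  where
  go : ∀ {n₁ m₁ μ} -> Par n₁ m₁ μ -> n₁ ≡ n -> T (leB (n N.∸ 4 ∷ replicate 4 1) μ) -> Good n μ
  go nil refl t = ⊥-elim (N.<⇒≱ l z≤n)
  go (cons {K} {m₁} {x} {κ} a b r) e t = subst (\ y -> Good n (y ∷ κ)) x≡ (top-good n K (∈-upTo⁺ (s≤s K≤4)) (N.≤-trans (s≤s (s≤s (s≤s (N.+-mono-≤ K≤4 K≤4)))) l) (Par⇒∈partitions (Par-tight r)))
    where
    x≡ : n N.∸ K ≡ x
    x≡ = trans (cong (N._∸ K) (sym e)) (N.m+n∸n≡m x K)
    m≤x : n N.∸ 4 N.≤ x
    m≤x = N.≮⇒≥ (\ lt -> subst T (leB-< {n N.∸ 4} {x} {replicate 4 1} {κ} lt) t)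
    K≤4 : K N.≤ 4
    K≤4 = N.+-cancelˡ-≤ x K 4 (N.≤-trans (N.≤-reflexive e) (N.≤-trans (N.≤-reflexive (sym (N.m∸n+n≡m (N.≤-trans (N.m≤m+n 4 7) l)))) (N.+-monoˡ-≤ 4 m≤x)))

check5 : check-from 5 (5 N.∸ 4 ∷ replicate 4 1) ≡ true
check5 = refl

check6 : check-from 6 (6 N.∸ 4 ∷ replicate 4 1) ≡ true
check6 = refl

check7 : check-from 7 (7 N.∸ 4 ∷ replicate 4 1) ≡ true
check7 = refl

check8 : check-from 8 (8 N.∸ 4 ∷ replicate 4 1) ≡ true
check8 = refl

check9 : check-from 9 (9 N.∸ 4 ∷ replicate 4 1) ≡ true
check9 = refl

check10 : check-from 10 (10 N.∸ 4 ∷ replicate 4 1) ≡ true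
check10 = refl

case-ii : ∀ n -> 5 N.≤ n -> ∀ μ -> μ ∈ partitions n -> T (leB (n N.∸ 4 ∷ replicate 4 1) μ) -> Good n μ
case-ii 5 l = small-good 5 check5
case-ii 6 l = small-good 6 check6
case-ii 7 l = small-good 7 check7
case-ii 8 l = small-good 8 check8
case-ii 9 l = small-good 9 check9
case-ii 10 l = small-good 10 check10
case-ii n@(suc (suc (suc (suc (suc (suc (suc (suc (suc (suc (suc n'))))))))))) l = case-ii-big n (N.m≤m+n 11 n')
case-ii 0 ()
case-ii 1 (s≤s ())
case-ii 2 (s≤s (s≤s ()))
case-ii 3 (s≤s (s≤s (s≤s ())))
case-ii 4 (s≤s (s≤s (s≤s (s≤s ()))))

-- Partitions close to (1ⁿ)

mul-⊛ : ∀ x y {N} (A : V N) ν -> mul (x ⊛ y) A ν ≡ mul x (mul y A) ν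
mul-⊛ x y A ν = trans (concat-∑ (\ cκ -> map (\ dμ -> fst cκ * fst dμ , snd cκ ++ snd dμ) y) x (\ cκ -> fst cκ * pmul (snd cκ) A ν)) (∑-cong x (\ cκ ->
    trans (∑-map (\ dμ -> fst cκ * fst dμ , snd cκ ++ snd dμ) y (\ cκ -> fst cκ * pmul (snd cκ) A ν)) (trans (∑-cong y (\ dμ -> trans (Z.*-assoc (fst cκ) (fst dμ) _) (cong (\ t -> fst cκ * (fst dμ * t)) (app (snd cκ) (snd dμ) ν))))
      (trans (∑-* y (fst cκ) (\ dμ -> fst dμ * pmul (snd cκ) (pmul (snd dμ) A) ν)) (cong (fst cκ *_) (sym (trans (l-∑ (Lin-pmul (snd cκ)) y (\ dμ β -> fst dμ * pmul (snd dμ) A β) ν) (∑-cong y (\ dμ -> l-* (Lin-pmul (snd cκ)) (fst dμ) (pmul (snd dμ) A) ν)))))))))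
  where
  app : ∀ κ κ' ν -> pmul (κ ++ κ') A ν ≡ pmul κ (pmul κ' A) ν
  app [] κ' ν = refl
  app (m ∷ κ) κ' ν = P-cong (suc m) (app κ κ') ν

mul-⊙ : ∀ c x {N} (A : V N) ν -> mul (c ⊙ x) A ν ≡ c * mul x A ν
mul-⊙ c x A ν = trans (∑-map (\ dκ -> c * fst dκ , snd dκ) x (\ cκ -> fst cκ * pmul (snd cκ) A ν)) (trans (∑-cong x (\ dκ -> Z.*-assoc c (fst dκ) (pmul (snd dκ) A ν))) (∑-* x c (\ cκ -> fst cκ * pmul (snd cκ) A ν)))

val-p₁ : ∀ x {N} (β : Vec ℕ N) -> val (p₁ ⊛ x) β ≡ P 1 (val x) β
val-p₁ x β = trans (val-⊛ p₁ x β) (trans (+-identityʳ _) (Z.*-identityˡ _))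

-- Twice the Schur functions h₂ and e₂.
h₂² e₂² : Comb
h₂² = (1ℤ , 0 ∷ 0 ∷ []) ∷ (1ℤ , 1 ∷ []) ∷ []
e₂² = (1ℤ , 0 ∷ 0 ∷ []) ∷ (- 1ℤ , 1 ∷ []) ∷ []

unit : Comb
unit = (1ℤ , []) ∷ []

-- p₁^{2k}, p₂^k and Σ_{i<k} p₁^{2(k-1-i)} p₂^i
aC bC γC oC : ℕ -> Comb
aC zero = unit
aC (suc k) = p₁ ⊛ (p₁ ⊛ aC k)
bC k = (1ℤ , replicate k 1) ∷ []
γC zero = []
γC (suc k) = (p₁ ⊛ (p₁ ⊛ γC k)) ++ bC k
oC k = aC k ++ bC k

deg-aC : ∀ k -> Deg (dbl k) (aC k)
deg-aC zero = refl ∷ []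
deg-aC (suc k) = deg-⊛ p₁ (p₁ ⊛ aC k) (refl ∷ []) (deg-⊛ p₁ (aC k) (refl ∷ []) (deg-aC k))

deg-bC : ∀ k -> Deg (dbl k) (bC k)
deg-bC k = go k ∷ []
  where go : ∀ k -> lsumℕ (sucs (replicate k 1)) ≡ dbl k
        go zero = refl
        go (suc k) = cong (\ t -> suc (suc t)) (go k)

deg-γC : ∀ k -> Deg (dbl k) (γC (suc k))
deg-γC zero = refl ∷ []
deg-γC (suc k) = Allₚ.++⁺ (deg-⊛ p₁ (p₁ ⊛ γC (suc k)) (refl ∷ []) (deg-⊛ p₁ (γC (suc k)) (refl ∷ []) (deg-γC k))) (deg-bC (suc k))

deg-oC : ∀ k -> Deg (dbl k) (oC k)
deg-oC k = Allₚ.++⁺ (deg-aC k) (deg-bC k)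

module Quadratic {N : ℕ} where
  A B : V N -> V N
  A f = P 1 (P 1 f)
  B f = P 2 f

  LA : Lin A
  LA = record { l-cong = \ e -> P-cong 1 (P-cong 1 e) ; l-+ = \ f g ν -> trans (P-cong 1 (P-+ 1 f g) ν) (P-+ 1 (P 1 f) (P 1 g) ν) ; l-* = \ c f ν -> trans (P-cong 1 (P-* 1 c f) ν) (P-* 1 c (P 1 f) ν) }
  LB : Lin B
  LB = Lin-P 2

  AB : ∀ f ν -> A (B f) ν ≡ B (A f) ν
  AB f ν = trans (P-cong 1 (P-comm 1 2 f) ν) (P-comm 1 2 (P 1 f) ν)

  a b γ o : ℕ -> V N
  a k = val (aC k)
  b k = val (bC k)
  γ k = val (γC k)
  o k = val (oC k)

  a-suc : ∀ k ν -> a (suc k) ν ≡ A (a k) ν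
  a-suc k ν = trans (val-p₁ (p₁ ⊛ aC k) ν) (P-cong 1 (val-p₁ (aC k)) ν)

  b-suc : ∀ k ν -> b (suc k) ν ≡ B (b k) ν
  b-suc k ν = trans (r (alt (sucs (replicate (suc k) 1)) ν)) (P-cong 2 (\ β -> sym (r (alt (sucs (replicate k 1)) β))) ν)
    where r : ∀ x -> 1ℤ * x + 0ℤ ≡ x
          r = solve-∀

  γ-suc : ∀ k ν -> γ (suc k) ν ≡ A (γ k) ν + b k ν
  γ-suc k ν = trans (val-++ (p₁ ⊛ (p₁ ⊛ γC k)) (bC k) ν) (cong (_+ b k ν) (trans (val-p₁ (p₁ ⊛ γC k) ν) (P-cong 1 (val-p₁ (γC k)) ν)))

  o-eq : ∀ k ν -> o k ν ≡ a k ν + b k ν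
  o-eq k ν = val-++ (aC k) (bC k) ν

  -- The sum is symmetric in p₁² and p₂, so it also grows at its other end.
  γ-suc′ : ∀ k ν -> γ (suc k) ν ≡ B (γ k) ν + a k ν
  γ-suc′ zero ν = trans (γ-suc 0 ν) (cong₂ _+_ (trans (l-0 LA ν) (sym (l-0 LB ν))) refl)
  γ-suc′ (suc k) ν = begin
    γ (suc (suc k)) ν ≡⟨ γ-suc (suc k) ν ⟩
    A (γ (suc k)) ν + b (suc k) ν ≡⟨ cong₂ _+_ (trans (l-cong LA (γ-suc′ k) ν) (trans (l-+ LA (B (γ k)) (a k) ν) (cong₂ _+_ (AB (γ k) ν) (sym (a-suc k ν))))) (b-suc k ν) ⟩
    (B (A (γ k)) ν + a (suc k) ν) + B (b k) ν ≡⟨ r (B (A (γ k)) ν) (a (suc k) ν) (B (b k) ν) ⟩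
    (B (A (γ k)) ν + B (b k) ν) + a (suc k) ν ≡⟨ cong (_+ a (suc k) ν) (sym (trans (l-cong LB (γ-suc k) ν) (l-+ LB (A (γ k)) (b k) ν))) ⟩
    B (γ (suc k)) ν + a (suc k) ν ∎
    where r : ∀ x y z -> (x + y) + z ≡ (x + z) + y
          r = solve-∀

  H E : V N -> V N
  H = mul h₂²
  E = mul e₂²

  H-eq : ∀ f ν -> H f ν ≡ A f ν + B f ν
  H-eq f ν = r (A f ν) (B f ν)
    where r : ∀ x y -> 1ℤ * x + (1ℤ * y + 0ℤ) ≡ x + y
          r = solve-∀
  E-eq : ∀ f ν -> E f ν ≡ A f ν - B f ν
  E-eq f ν = r (A f ν) (B f ν)
    where r : ∀ x y -> 1ℤ * x + ((- 1ℤ) * y + 0ℤ) ≡ x - y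
          r = solve-∀

  -- The sum of the two recursions; their difference is `diff`, the factorisation of a^k - b^k by a
  -- - b.
  rel₁ : ∀ k ν -> pos 2 * γ (suc k) ν ≡ H (γ k) ν + o k ν
  rel₁ k ν = trans (two (γ (suc k) ν)) (trans (cong₂ _+_ (γ-suc k ν) (γ-suc′ k ν)) (trans (r (A (γ k) ν) (b k ν) (B (γ k) ν) (a k ν)) (sym (cong₂ _+_ (H-eq (γ k) ν) (o-eq k ν)))))
    where two : ∀ x -> pos 2 * x ≡ x + x
          two = solve-∀
          r : ∀ x y z w -> (x + y) + (z + w) ≡ (x + z) + (w + y)
          r = solve-∀

  diff : ∀ k ν -> a k ν - b k ν ≡ E (γ k) ν
  diff k ν = trans (r (A (γ k) ν) (b k ν) (B (γ k) ν) (a k ν) (trans (sym (γ-suc k ν)) (γ-suc′ k ν))) (sym (E-eq (γ k) ν))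
    where r : ∀ x y z w -> x + y ≡ z + w -> w - y ≡ x - z
          r x y z w e = trans (r₁ w y z) (trans (cong (\ t -> t - (y + z)) (trans (+-comm w z) (sym e))) (r₂ x y z))
            where r₁ : ∀ w y z -> w - y ≡ (w + z) - (y + z)
                  r₁ = solve-∀
                  r₂ : ∀ x y z -> (x + y) - (y + z) ≡ x - z
                  r₂ = solve-∀

  rel₃ : ∀ k ν -> pos 2 * a k ν ≡ o k ν + E (γ k) ν
  rel₃ k ν = trans (r (a k ν) (b k ν)) (cong₂ _+_ (sym (o-eq k ν)) (diff k ν))
    where r : ∀ x y -> pos 2 * x ≡ (x + y) + (x - y)
          r = solve-∀

  -- 2(a^(k+1) + b^(k+1)) = (a + b)(a^k + b^k) + (a - b)(a^k - b^k), where a = p₁², b = p₂; by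
  -- `diff` the last factor contains a - b once more.
  rel₂ : ∀ k ν -> pos 2 * o (suc k) ν ≡ H (o k) ν + E (E (γ k)) ν
  rel₂ k ν = sym (begin
    H (o k) ν + E (E (γ k)) ν
      ≡⟨ cong₂ _+_ (trans (H-eq (o k) ν) (cong₂ _+_ (trans (l-cong LA (o-eq k) ν) (l-+ LA (a k) (b k) ν)) (trans (l-cong LB (o-eq k) ν) (l-+ LB (a k) (b k) ν))))
         (trans (E-eq (E (γ k)) ν) (cong₂ _-_ (trans (l-cong LA (\ β -> sym (diff k β)) ν) (l-- LA (a k) (b k) ν)) (trans (l-cong LB (\ β -> sym (diff k β)) ν) (l-- LB (a k) (b k) ν)))) ⟩
    ((A (a k) ν + A (b k) ν) + (B (a k) ν + B (b k) ν)) + ((A (a k) ν - A (b k) ν) - (B (a k) ν - B (b k) ν)) ≡⟨ r (A (a k) ν) (A (b k) ν) (B (a k) ν) (B (b k) ν) ⟩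
    pos 2 * (A (a k) ν + B (b k) ν) ≡⟨ cong (pos 2 *_) (sym (trans (o-eq (suc k) ν) (cong₂ _+_ (a-suc k ν) (b-suc k ν)))) ⟩
    pos 2 * o (suc k) ν ∎)
    where r : ∀ x y z w -> ((x + y) + (z + w)) + ((x - y) - (z - w)) ≡ pos 2 * (x + w)
          r = solve-∀

  spos-h : SPos N h₂²
  spos-h = spos-check 2 h₂² (refl ∷ refl ∷ []) tt

  private
    comm≤ : ∀ i j {t} -> i N.+ j ≡ t -> t N.≤ N -> j N.+ i N.≤ N
    comm≤ i j e l = N.≤-trans (N.≤-reflexive (trans (N.+-comm j i) e)) l

  spos-aC : ∀ k -> dbl k N.≤ N -> SPos N (aC k)
  spos-aC zero l = spos-check 0 unit (refl ∷ []) tt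
  spos-aC (suc k) l = spos-⊛ {N} {1} {suc (dbl k)} p₁ (p₁ ⊛ aC k) (refl ∷ []) (deg-⊛ p₁ (aC k) (refl ∷ []) (deg-aC k)) (comm≤ 1 (suc (dbl k)) refl l) spos-p₁
    (spos-⊛ {N} {1} {dbl k} p₁ (aC k) (refl ∷ []) (deg-aC k) (comm≤ 1 (dbl k) refl (N.≤-trans (N.n≤1+n _) l)) spos-p₁ (spos-aC k (N.≤-trans (N.n≤1+n _) (N.≤-trans (N.n≤1+n _) l))))

  -- γC 0 = 0 has no degree, so the degree bound is asked for only when k > 0.
  mul-pos : ∀ {d e} x y -> Deg d x -> Deg e y -> d N.+ e N.≤ N -> SPos N x -> SPos N y -> ∀ ν -> Str 0 ν -> 0≤ mul x (val y) ν
  mul-pos {d} {e} x y dx dy l px py ν s = subst 0≤_ (val-⊛ x y ν) (spos-⊛ {N} {d} {e} x y dx dy (comm≤ d e refl l) px py ν s)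

  mulγ-pos : ∀ {d} x k -> Deg d x -> SPos N x -> (∀ j -> k ≡ suc j -> d N.+ dbl j N.≤ N × SPos N (γC k)) -> ∀ ν -> Str 0 ν -> 0≤ mul x (γ k) ν
  mulγ-pos x zero dx px h ν s = Z.≤-reflexive (sym (l-0 (Lin-mul x) ν))
  mulγ-pos x (suc j) dx px h ν s = let (l , p) = h j refl in mul-pos x (γC (suc j)) dx (deg-γC j) l px p ν s

  -- `rel₁` and `rel₂` express twice the next terms through products with 2h₂ and (2e₂)² only, so
  -- the sum and a^k + b^k become positive together.
  spos-γo : ∀ k -> dbl k N.≤ N -> SPos N (γC (suc k)) × SPos N (oC k)
  spos-γo zero l = spos-check 0 (γC 1) (refl ∷ []) tt , spos-check 0 (oC 0) (refl ∷ refl ∷ []) tt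
  spos-γo (suc k) l = (\ ν s -> 0≤-÷ 1 (subst 0≤_ (sym (rel₁ (suc k) ν)) (0≤-+ (mul-pos h₂² (γC (suc k)) (refl ∷ refl ∷ []) (deg-γC k) l spos-h pγ ν s) (po ν s)))) , po
    where
    ih = spos-γo k (N.≤-trans (N.n≤1+n _) (N.≤-trans (N.n≤1+n _) l))
    pγ = fst ih
    ee : ∀ k -> dbl (suc k) N.≤ N -> (∀ j -> k ≡ suc j -> SPos N (γC k)) -> ∀ ν -> Str 0 ν -> 0≤ E (E (γ k)) ν
    ee k l h ν s = subst 0≤_ (mul-⊛ e₂² e₂² (γ k) ν) (mulγ-pos (e₂² ⊛ e₂²) k (deg-⊛ e₂² e₂² (refl ∷ refl ∷ []) (refl ∷ refl ∷ [])) (spos-check 4 (e₂² ⊛ e₂²) (deg-⊛ e₂² e₂² (refl ∷ refl ∷ []) (refl ∷ refl ∷ [])) tt)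
      (\ { j refl -> l , h j refl }) ν s)
    po : SPos N (oC (suc k))
    po ν s = 0≤-÷ 1 (subst 0≤_ (sym (rel₂ k ν)) (0≤-+ (mul-pos h₂² (oC k) (refl ∷ refl ∷ []) (deg-oC k) l spos-h (snd ih) ν s)
      (ee k l (\ { j refl -> fst (spos-γo j (N.≤-trans (N.n≤1+n _) (N.≤-trans (N.n≤1+n _) (N.≤-trans (N.n≤1+n _) (N.≤-trans (N.n≤1+n _) l))))) }) ν s)))

  p₃₁ w₁₂ f₁ f₂ f₃ : Comb
  p₃₁ = (1ℤ , 2 ∷ 0 ∷ []) ∷ []
  -- 12 s₂₂
  w₁₂ = (1ℤ , 0 ∷ 0 ∷ 0 ∷ 0 ∷ []) ∷ (pos 3 , 1 ∷ 1 ∷ []) ∷ (- pos 4 , 2 ∷ 0 ∷ []) ∷ []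
  -- p₃p₁ = s₄ - s₂₂ + s₁₁₁₁, so f₁ is 12(s₄ + s₁₁₁₁). The other two say that s₂₂ fits into h₂², and
  -- that s₂₂e₂ fits into h₂³ + e₂²h₂; the factors 12 and 24 clear denominators.
  f₁ = pos 12 ⊙ p₃₁ ++ w₁₂
  f₂ = pos 3 ⊙ (h₂² ⊛ h₂²) ++ (- 1ℤ) ⊙ w₁₂
  f₃ = pos 3 ⊙ (h₂² ⊛ (h₂² ⊛ h₂²)) ++ (pos 3 ⊙ ((e₂² ⊛ e₂²) ⊛ h₂²) ++ (- 1ℤ) ⊙ (w₁₂ ⊛ e₂²))

  -- For n = 2m + 4 this is ψ at (3, 1^(n-3)): all p₂^i p₁^(n-2i), and p₃p₁ times p₁^(2m).
  tC : ℕ -> Comb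
  tC m = γC (suc (suc (suc m))) ++ (p₃₁ ⊛ aC m)

  deg-tC : ∀ m -> Deg (dbl (suc (suc m))) (tC m)
  deg-tC m = Allₚ.++⁺ (deg-γC (suc (suc m))) (deg-⊛ p₃₁ (aC m) (refl ∷ []) (deg-aC m))

  lin2 : ∀ {L : V N -> V N} -> Lin L -> ∀ {f g h : V N} -> (∀ β -> pos 2 * f β ≡ g β + h β) -> ∀ ν -> pos 2 * L f ν ≡ L g ν + L h ν
  lin2 {L} l {f} {g} {h} e ν = trans (sym (l-* l (pos 2) f ν)) (trans (l-cong l e ν) (l-+ l g h ν))

  LH : Lin H
  LH = Lin-mul h₂²
  LE : Lin E
  LE = Lin-mul e₂²
  LHH : Lin (\ f -> H (H f))
  LHH = record { l-cong = \ e -> l-cong LH (l-cong LH e) ; l-+ = \ f g ν -> trans (l-cong LH (l-+ LH f g) ν) (l-+ LH (H f) (H g) ν) ; l-* = \ c f ν -> trans (l-cong LH (l-* LH c f) ν) (l-* LH c (H f) ν) }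
  LEE : Lin (\ f -> E (E f))
  LEE = record { l-cong = \ e -> l-cong LE (l-cong LE e) ; l-+ = \ f g ν -> trans (l-cong LE (l-+ LE f g) ν) (l-+ LE (E f) (E g) ν) ; l-* = \ c f ν -> trans (l-cong LE (l-* LE c f) ν) (l-* LE c (E f) ν) }

  private
    dh = deg-⊛ h₂² h₂² (refl ∷ refl ∷ []) (refl ∷ refl ∷ [])
    de = deg-⊛ e₂² e₂² (refl ∷ refl ∷ []) (refl ∷ refl ∷ [])
    dw : Deg 4 w₁₂
    dw = refl ∷ refl ∷ refl ∷ []
    df₁ : Deg 4 f₁
    df₁ = refl ∷ dw
    df₂ : Deg 4 f₂
    df₂ = Allₚ.++⁺ (deg-⊙ (pos 3) (h₂² ⊛ h₂²) dh) (deg-⊙ (- 1ℤ) w₁₂ dw)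
    df₃ : Deg 6 f₃
    df₃ = Allₚ.++⁺ (deg-⊙ (pos 3) (h₂² ⊛ (h₂² ⊛ h₂²)) (deg-⊛ h₂² (h₂² ⊛ h₂²) (refl ∷ refl ∷ []) dh))
      (Allₚ.++⁺ (deg-⊙ (pos 3) ((e₂² ⊛ e₂²) ⊛ h₂²) (deg-⊛ (e₂² ⊛ e₂²) h₂² de (refl ∷ refl ∷ []))) (deg-⊙ (- 1ℤ) (w₁₂ ⊛ e₂²) (deg-⊛ w₁₂ e₂² dw (refl ∷ refl ∷ []))))
    dhee = deg-⊛ h₂² (e₂² ⊛ e₂²) (refl ∷ refl ∷ []) de

  -- Three uses of the recurrences write 8γ_{m+3} in γ_m and o_m: it is H³γ + 3H²o + 3HE²γ + E²o,
  -- with H and E multiplication by 2h₂ and 2e₂. The negative part -12 s₂₂ a_m is by `rel₃` half on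
  -- o_m and half on Eγ_m; f₂ absorbs the first half in 3H²o, f₃ the second in 3H³γ + 3E²Hγ. What
  -- remains has nonnegative coefficients.
  spos-tC : ∀ m -> dbl (suc (suc m)) N.≤ N -> SPos N (tC m)
  spos-tC m l ν s = 0≤-÷ 23 (subst 0≤_ (sym total) (0≤-+ (0≤-+ (0≤-+ (0≤-+ (0≤-+ (0≤-* {pos 2} (Z.+≤+ z≤n) pF₁) pF₂) pF₃) (0≤-* {pos 6} (Z.+≤+ z≤n) pHEE)) (0≤-* {pos 6} (Z.+≤+ z≤n) pHH)) (0≤-* {pos 3} (Z.+≤+ z≤n) pEE)))
    where
    g = γ m
    u = γ (suc (suc (suc m))) ν
    y = mul p₃₁ (a m) ν
    oo = o m
    m≤ : dbl m N.≤ N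
    m≤ = N.≤-trans (N.m≤n+m (dbl m) 4) l
    γ-pos : ∀ j -> m ≡ suc j -> 6 N.+ dbl j N.≤ N × SPos N (γC m)
    γ-pos j refl = l , fst (spos-γo j (N.≤-trans (N.n≤1+n _) (N.≤-trans (N.n≤1+n _) m≤)))
    eight : pos 8 * u ≡ (H (H (H g)) ν + H (H oo) ν) + pos 2 * (H (H oo) ν + H (E (E g)) ν) + (E (E (H g)) ν + E (E oo) ν)
    eight = trans (r₁ u) (trans (cong (pos 4 *_) (rel₁ (suc (suc m)) ν)) (trans (r₂ (H (γ (suc (suc m))) ν) (o (suc (suc m)) ν))
        (trans (cong₂ (\ p q -> pos 2 * (p + q)) (lin2 LH (rel₁ (suc m)) ν) (rel₂ (suc m) ν)) (trans (r₃ (H (H (γ (suc m))) ν) (H (o (suc m)) ν) (E (E (γ (suc m))) ν))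
          (cong₂ _+_ (cong₂ _+_ (lin2 LHH (rel₁ m) ν) (cong (pos 2 *_) (lin2 LH (rel₂ m) ν))) (lin2 LEE (rel₁ m) ν))))))
      where
      r₁ : ∀ u -> pos 8 * u ≡ pos 4 * (pos 2 * u)
      r₁ = solve-∀
      r₂ : ∀ p q -> pos 4 * (p + q) ≡ pos 2 * (pos 2 * p + pos 2 * q)
      r₂ = solve-∀
      r₃ : ∀ p q t -> pos 2 * ((p + q) + (q + t)) ≡ (pos 2 * p + pos 2 * (pos 2 * q)) + pos 2 * t
      r₃ = solve-∀
    Wo = mul w₁₂ oo ν
    We = mul w₁₂ (E g) ν
    Wa = mul w₁₂ (a m) ν
    F₁ = mul f₁ (a m) ν
    F₂ = mul f₂ oo ν
    F₃ = mul f₃ g ν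
    eF₁ : F₁ ≡ pos 12 * y + Wa
    eF₁ = trans (mul-++ (pos 12 ⊙ p₃₁) w₁₂ (a m) ν) (cong (_+ Wa) (mul-⊙ (pos 12) p₃₁ (a m) ν))
    eWa : pos 2 * Wa ≡ Wo + We
    eWa = lin2 (Lin-mul w₁₂) (rel₃ m) ν
    eF₂ : F₂ ≡ pos 3 * H (H oo) ν + (- 1ℤ) * Wo
    eF₂ = trans (mul-++ (pos 3 ⊙ (h₂² ⊛ h₂²)) ((- 1ℤ) ⊙ w₁₂) oo ν) (cong₂ _+_ (trans (mul-⊙ (pos 3) (h₂² ⊛ h₂²) oo ν) (cong (pos 3 *_) (mul-⊛ h₂² h₂² oo ν))) (mul-⊙ (- 1ℤ) w₁₂ oo ν))
    eF₃ : F₃ ≡ pos 3 * H (H (H g)) ν + (pos 3 * E (E (H g)) ν + (- 1ℤ) * We)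
    eF₃ = trans (mul-++ (pos 3 ⊙ (h₂² ⊛ (h₂² ⊛ h₂²))) (pos 3 ⊙ ((e₂² ⊛ e₂²) ⊛ h₂²) ++ (- 1ℤ) ⊙ (w₁₂ ⊛ e₂²)) g ν) (cong₂ _+_
      (trans (mul-⊙ (pos 3) (h₂² ⊛ (h₂² ⊛ h₂²)) g ν) (cong (pos 3 *_) (trans (mul-⊛ h₂² (h₂² ⊛ h₂²) g ν) (l-cong LH (mul-⊛ h₂² h₂² g) ν))))
      (trans (mul-++ (pos 3 ⊙ ((e₂² ⊛ e₂²) ⊛ h₂²)) ((- 1ℤ) ⊙ (w₁₂ ⊛ e₂²)) g ν) (cong₂ _+_
        (trans (mul-⊙ (pos 3) ((e₂² ⊛ e₂²) ⊛ h₂²) g ν) (cong (pos 3 *_) (trans (mul-⊛ (e₂² ⊛ e₂²) h₂² g ν) (mul-⊛ e₂² e₂² (H g) ν))))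
        (trans (mul-⊙ (- 1ℤ) (w₁₂ ⊛ e₂²) g ν) (cong (- 1ℤ *_) (mul-⊛ w₁₂ e₂² g ν))))))
    pF₁ : 0≤ F₁
    pF₁ = mul-pos f₁ (aC m) df₁ (deg-aC m) l (spos-check 4 f₁ df₁ tt) (spos-aC m m≤) ν s
    pF₂ : 0≤ F₂
    pF₂ = mul-pos f₂ (oC m) df₂ (deg-oC m) l (spos-check 4 f₂ df₂ tt) (snd (spos-γo m m≤)) ν s
    pF₃ : 0≤ F₃
    pF₃ = mulγ-pos f₃ m df₃ (spos-check 6 f₃ df₃ tt) γ-pos ν s
    pHEE : 0≤ H (E (E g)) ν
    pHEE = subst 0≤_ (trans (mul-⊛ h₂² (e₂² ⊛ e₂²) g ν) (l-cong LH (mul-⊛ e₂² e₂² g) ν)) (mulγ-pos (h₂² ⊛ (e₂² ⊛ e₂²)) m dhee (spos-check 6 (h₂² ⊛ (e₂² ⊛ e₂²)) dhee tt) γ-pos ν s)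
    pHH : 0≤ H (H oo) ν
    pHH = subst 0≤_ (mul-⊛ h₂² h₂² oo ν) (mul-pos (h₂² ⊛ h₂²) (oC m) dh (deg-oC m) l (spos-check 4 (h₂² ⊛ h₂²) dh tt) (snd (spos-γo m m≤)) ν s)
    pEE : 0≤ E (E oo) ν
    pEE = subst 0≤_ (mul-⊛ e₂² e₂² oo ν) (mul-pos (e₂² ⊛ e₂²) (oC m) de (deg-oC m) l (spos-check 4 (e₂² ⊛ e₂²) de tt) (snd (spos-γo m m≤)) ν s)
    total : pos 24 * val (tC m) ν ≡ ((((pos 2 * F₁ + F₂) + F₃) + pos 6 * H (E (E g)) ν) + pos 6 * H (H oo) ν) + pos 3 * E (E oo) ν
    total = trans (cong (pos 24 *_) (trans (val-++ (γC (suc (suc (suc m)))) (p₃₁ ⊛ aC m) ν) (cong (u +_) (val-⊛ p₃₁ (aC m) ν)))) (trans (r₁ u y) (trans (cong (\ t -> pos 3 * t + pos 24 * y) eight)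
       (trans (r₂ (H (H (H g)) ν) (H (H oo) ν) (H (E (E g)) ν) (E (E (H g)) ν) (E (E oo) ν) y Wo We) (sym (trans (cong (\ t -> (((t + F₂) + F₃) + pos 6 * H (E (E g)) ν) + pos 6 * H (H oo) ν + pos 3 * E (E oo) ν) (trans (cong (pos 2 *_) eF₁) (trans (r₃ y Wa) (cong (pos 24 * y +_) eWa))))
         (cong₂ (\ p q -> (((pos 24 * y + (Wo + We) + p) + q) + pos 6 * H (E (E g)) ν) + pos 6 * H (H oo) ν + pos 3 * E (E oo) ν) eF₂ eF₃))))))
      where
      r₁ : ∀ u y -> pos 24 * (u + y) ≡ pos 3 * (pos 8 * u) + pos 24 * y
      r₁ = solve-∀
      r₂ : ∀ hhh hh hee eeh ee y wo we -> pos 3 * ((hhh + hh) + pos 2 * (hh + hee) + (eeh + ee)) + pos 24 * y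
             ≡ (((pos 24 * y + (wo + we) + (pos 3 * hh + (- 1ℤ) * wo)) + (pos 3 * hhh + (pos 3 * eeh + (- 1ℤ) * we))) + pos 6 * hee) + pos 6 * hh + pos 3 * ee
      r₂ = solve-∀
      r₃ : ∀ y w -> pos 2 * (pos 12 * y + w) ≡ pos 24 * y + pos 2 * w
      r₃ = solve-∀

open Quadratic using (spos-γo; spos-tC; tC; deg-tC; p₃₁)

-- Partitions with parts at most 2, and (3, 1^(n-3)).

Pw : ℕ -> ∀ {N} -> V N -> V N
Pw zero A = A
Pw (suc r) A = P 1 (Pw r A)

Pw-cong : ∀ r {N} {A B : V N} -> A ≗ᵥ B -> Pw r A ≗ᵥ Pw r B
Pw-cong zero e = e
Pw-cong (suc r) e = P-cong 1 (Pw-cong r e)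

Pw-+ : ∀ r {N} (A B : V N) ν -> Pw r (\ β -> A β + B β) ν ≡ Pw r A ν + Pw r B ν
Pw-+ zero A B ν = refl
Pw-+ (suc r) A B ν = trans (P-cong 1 (Pw-+ r A B) ν) (P-+ 1 (Pw r A) (Pw r B) ν)

Pw-P : ∀ r k {N} (A : V N) ν -> Pw r (P k A) ν ≡ P k (Pw r A) ν
Pw-P zero k A ν = refl
Pw-P (suc r) k A ν = trans (P-cong 1 (Pw-P r k A) ν) (P-comm 1 k (Pw r A) ν)

pw : ℕ -> Comb -> Comb
pw zero x = x
pw (suc r) x = p₁ ⊛ pw r x

val-pw : ∀ r x {N} (ν : Vec ℕ N) -> val (pw r x) ν ≡ Pw r (val x) ν
val-pw zero x ν = refl
val-pw (suc r) x ν = trans (val-p₁ (pw r x) ν) (P-cong 1 (val-pw r x) ν)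

spos-pw : ∀ r {d N} x -> Deg d x -> r N.+ d N.≤ N -> SPos N x -> SPos N (pw r x) × Deg (r N.+ d) (pw r x)
spos-pw zero x dx l px = px , dx
spos-pw (suc r) {d} {N} x dx l px = let (p , q) = spos-pw r x dx (N.≤-trans (N.n≤1+n _) l) px in
  spos-⊛ {N} {1} {r N.+ d} p₁ (pw r x) (refl ∷ []) q (N.≤-trans (N.≤-reflexive (N.+-comm (r N.+ d) 1)) l) spos-p₁ p , deg-⊛ p₁ (pw r x) (refl ∷ []) q

alt-ones : ∀ r {N} (ν : Vec ℕ N) -> alt (replicate r 1) ν ≡ Pw r van ν
alt-ones zero ν = refl
alt-ones (suc r) ν = P-cong 1 (alt-ones r) ν

alt-twos : ∀ i r {N} (ν : Vec ℕ N) -> alt (replicate i 2 ++ replicate r 1) ν ≡ Pw r (val (bC i)) ν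
alt-twos zero r ν = trans (alt-ones r ν) (Pw-cong r (\ β -> sym (one′ (van β))) ν)
  where one′ : ∀ x -> 1ℤ * x + 0ℤ ≡ x
        one′ = solve-∀
alt-twos (suc i) r ν = trans (P-cong 2 (alt-twos i r) ν) (trans (sym (Pw-P r 2 (val (bC i)) ν)) (Pw-cong r (\ β -> sym (Quadratic.b-suc i β)) ν))

tw : ℕ -> ℕ -> List ℕ
tw n i = replicate i 2 ++ replicate (n N.∸ dbl i) 1

twos-sum : ∀ n k -> dbl k N.≤ n -> ∀ {N} (ν : Vec ℕ N) -> Pw (n N.∸ dbl k) (val (γC (suc k))) ν ≡ ∑ (upTo (suc k)) (\ i -> alt (tw n i) ν)
twos-sum n zero l ν = trans (sym (alt-twos 0 n ν)) (sym (+-identityʳ _))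
twos-sum n (suc k) l ν = begin
  Pw r (val (γC (suc (suc k)))) ν ≡⟨ Pw-cong r (Quadratic.γ-suc (suc k)) ν ⟩
  Pw r (\ β -> P 1 (P 1 (val (γC (suc k)))) β + val (bC (suc k)) β) ν ≡⟨ Pw-+ r (P 1 (P 1 (val (γC (suc k))))) (val (bC (suc k))) ν ⟩
  Pw r (P 1 (P 1 (val (γC (suc k))))) ν + Pw r (val (bC (suc k))) ν
    ≡⟨ cong₂ _+_ (trans (Pw-P r 1 (P 1 (val (γC (suc k)))) ν) (trans (P-cong 1 (Pw-P r 1 (val (γC (suc k)))) ν) (trans (cong (\ t -> Pw t (val (γC (suc k))) ν) r≡) (twos-sum n k (N.≤-trans (N.m≤n+m (dbl k) 2) l) ν)))) (sym (alt-twos (suc k) r ν)) ⟩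
  ∑ (upTo (suc k)) (\ i -> alt (tw n i) ν) + alt (tw n (suc k)) ν ≡⟨ sym (∑-upTo (suc k) (\ i -> alt (tw n i) ν)) ⟩
  ∑ (upTo (suc (suc k))) (\ i -> alt (tw n i) ν) ∎
  where
  r = n N.∸ dbl (suc k)
  r≡ : suc (suc r) ≡ n N.∸ dbl k
  r≡ = trans (sym (N.+-∸-assoc 2 l)) refl

Par-1 : ∀ {n λ'} -> Par n 1 λ' -> λ' ≡ replicate n 1
Par-1 nil = refl
Par-1 (cons {k = suc zero} p q r) = cong (1 ∷_) (Par-1 r)
Par-1 (cons {k = suc (suc k)} p (s≤s ()) r)

Par-2 : ∀ {n λ'} -> Par n 2 λ' -> ∃[ i ] (dbl i N.≤ n × λ' ≡ tw n i)
Par-2 nil = 0 , z≤n , refl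
Par-2 (cons {k = suc zero} p q r) = 0 , z≤n , cong (1 ∷_) (Par-1 r)
Par-2 (cons {k = suc (suc zero)} p q r) = let (i , l , e) = Par-2 r in suc i , s≤s (s≤s l) , cong (2 ∷_) e
Par-2 (cons {k = suc (suc (suc k))} p (s≤s (s≤s ())) r)

Par-ones : ∀ n -> Par n 1 (replicate n 1)
Par-ones zero = nil
Par-ones (suc n) = cons (s≤s z≤n) (s≤s z≤n) (Par-ones n)

Par-tw : ∀ n i -> dbl i N.≤ n -> Par n 2 (tw n i)
Par-tw n zero l = Par-mono (s≤s z≤n) (Par-ones n)
Par-tw (suc (suc n)) (suc i) (s≤s (s≤s l)) = cons (s≤s z≤n) (s≤s (s≤s z≤n)) (Par-tw n i l)

leB-refl : ∀ xs -> leB xs xs ≡ true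
leB-refl [] = refl
leB-refl (x ∷ xs) = trans (leB-≡ x {xs} {xs}) (leB-refl xs)

leB-tw : ∀ n i j -> dbl i N.≤ n -> dbl j N.≤ n -> T (leB (tw n i) (tw n j)) -> i N.≤ j
leB-tw n zero j l l' t = z≤n
leB-tw (suc (suc n)) (suc i) zero l l' ()
leB-tw (suc (suc n)) (suc i) (suc j) (s≤s (s≤s l)) (s≤s (s≤s l')) t = s≤s (leB-tw n i j l l' (subst T (leB-≡ 2 {tw n i} {tw n j}) t))

tw-leB : ∀ n i j -> dbl i N.≤ n -> dbl j N.≤ n -> i N.≤ j -> T (leB (tw n i) (tw n j))
tw-leB n zero zero l l' p = subst T (sym (leB-refl (replicate n 1))) tt
tw-leB (suc (suc n)) zero (suc j) l l' p = tt
tw-leB (suc zero) zero (suc j) l (s≤s ()) p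
tw-leB (suc (suc n)) (suc i) (suc j) (s≤s (s≤s l)) (s≤s (s≤s l')) (s≤s p) = subst T (sym (leB-≡ 2 {tw n i} {tw n j})) (tw-leB n i j l l' p)

tw-inj : ∀ n {i j} -> tw n i ≡ tw n j -> i ≡ j
tw-inj n {i} {j} = go i j
  where go : ∀ i j {a b} -> replicate i 2 ++ replicate a 1 ≡ replicate j 2 ++ replicate b 1 -> i ≡ j
        go zero zero e = refl
        go zero (suc j) {zero} ()
        go zero (suc j) {suc a} ()
        go (suc i) zero {a} {zero} ()
        go (suc i) zero {a} {suc b} ()
        go (suc i) (suc j) e = cong suc (go i j (Lₚ.∷-injectiveʳ e))

dbl-mono : ∀ {i j} -> i N.≤ j -> dbl i N.≤ dbl j
dbl-mono z≤n = z≤n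
dbl-mono (s≤s l) = s≤s (s≤s (dbl-mono l))

dbl-hf : ∀ n -> dbl (hf n) N.≤ n
dbl-hf zero = z≤n
dbl-hf (suc zero) = z≤n
dbl-hf (suc (suc n)) = s≤s (s≤s (dbl-hf n))

-- The partitions up to (2^j, 1^(n-2j)) are those with i ≤ j parts 2 and all others 1, so ψ is
-- p₁^(n-2j) times γ_{j+1}.
good-twos : ∀ n j -> dbl j N.≤ n -> Good n (tw n j)
good-twos n j l β s = subst 0≤_ (trans (val-pw (n N.∸ dbl j) (γC (suc j)) β) (trans (twos-sum n j l β) (trans (sym (∑-map (tw n) (upTo (suc j)) (\ λ' -> alt λ' β))) (sym (∑-↭ perm (\ λ' -> alt λ' β))))))
    (fst (spos-pw (n N.∸ dbl j) {dbl j} {n} (γC (suc j)) (deg-γC j) (N.≤-reflexive (N.m∸n+n≡m l)) (fst (spos-γo j l))) β s)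
  where
  perm : filterᵇ (\ λ' -> leB λ' (tw n j)) (partitions n) ↭ map (tw n) (upTo (suc j))
  perm = ↭-from-⊆ _ _ (Uₚ.filter⁺ (T? ∘ (\ λ' -> leB λ' (tw n j))) (partsF-unique n n n)) (Uₚ.map⁺ (tw-inj n) (Uₚ.upTo⁺ (suc j))) fwd bwd
    where
    to2 : ∀ {n₁ m₁ λ'} -> Par n₁ m₁ λ' -> T (leB λ' (tw n j)) -> Par n₁ 2 λ'
    to2 nil t = nil
    to2 (cons {k = k} {xs} p q r) t = cons p (hd (tw n j) (Par-tw n j l) t) r
      where hd : ∀ {n₂} ys -> Par n₂ 2 ys -> T (leB (k ∷ xs) ys) -> k N.≤ 2
            hd (y ∷ ys) (cons _ y≤2 _) t = N.≮⇒≥ (\ lt -> subst T (leB-< {k} {y} {xs} {ys} (N.≤-<-trans y≤2 lt)) t)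
    fwd : ∀ {λ'} -> λ' ∈ filterᵇ (\ λ' -> leB λ' (tw n j)) (partitions n) -> λ' ∈ map (tw n) (upTo (suc j))
    fwd {λ'} m = let (i , t) = ∈-filter⁻ (T? ∘ (\ λ' -> leB λ' (tw n j))) {xs = partitions n} m
                     (k , lk , e) = Par-2 (to2 (∈⇒Par n i) t)
                 in subst (_∈ map (tw n) (upTo (suc j))) (sym e) (∈-map⁺ (tw n) (∈-upTo⁺ (s≤s (leB-tw n k j lk l (subst (\ x -> T (leB x (tw n j))) e t)))))
    bwd : ∀ {λ'} -> λ' ∈ map (tw n) (upTo (suc j)) -> λ' ∈ filterᵇ (\ λ' -> leB λ' (tw n j)) (partitions n)
    bwd m = let (i , q , e) = ∈-map⁻ (tw n) m ; i≤j = N.≤-pred (∈-upTo⁻ q) ; li = N.≤-trans (dbl-mono i≤j) l in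
      subst (_∈ filterᵇ (\ λ' -> leB λ' (tw n j)) (partitions n)) (sym e) (∈-filter⁺ (T? ∘ (\ λ' -> leB λ' (tw n j))) (Par⇒∈partitions (Par-tight (Par-tw n i li))) (tw-leB n i j li l i≤j))

Par-ones-≤ : ∀ {n₁ m₁ xs} -> Par n₁ m₁ xs -> ∀ k -> T (leB xs (replicate k 1)) -> xs ≡ replicate n₁ 1
Par-ones-≤ nil k t = refl
Par-ones-≤ (cons {k = suc zero} p q r) k t = cong (1 ∷_) (Par-1 r)
Par-ones-≤ (cons {k = suc (suc _)} p q r) zero ()
Par-ones-≤ (cons {k = suc (suc _)} p q r) (suc k) ()

three : ℕ -> List ℕ
three n = 3 ∷ replicate (n N.∸ 3) 1

three-sum : ∀ n -> 3 N.≤ n -> (β : Vec ℕ n) -> ∑ (filterᵇ (\ λ' -> leB λ' (three n)) (partitions n)) (\ λ' -> alt λ' β) ≡ alt (three n) β + Pw (n N.∸ dbl (hf n)) (val (γC (suc (hf n)))) β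
three-sum n l β = trans (∑-↭ perm (\ λ' -> alt λ' β)) (cong (alt (three n) β +_) (trans (∑-map (tw n) (upTo (suc (hf n))) (\ λ' -> alt λ' β)) (sym (twos-sum n (hf n) (dbl-hf n) β))))
  where
  three≢ : ∀ i -> three n ≢ tw n i
  three≢ zero e = go (n N.∸ 0) e
    where go : ∀ k -> three n ≢ replicate k 1
          go zero ()
          go (suc k) ()
  three≢ (suc i) ()
  head-< : ∀ i -> T (leB (tw n i) (three n))
  head-< zero = go n l
    where go : ∀ k -> 3 N.≤ k -> T (leB (replicate k 1) (three n))
          go (suc k) _ = tt
  head-< (suc i) = tt
  perm : filterᵇ (\ λ' -> leB λ' (three n)) (partitions n) ↭ three n ∷ map (tw n) (upTo (suc (hf n)))
  perm = ↭-from-⊆ _ _ (Uₚ.filter⁺ (T? ∘ (\ λ' -> leB λ' (three n))) (partsF-unique n n n)) (Allₚ.map⁺ (All.universal three≢ (upTo (suc (hf n)))) ∷ Uₚ.map⁺ (tw-inj n) (Uₚ.upTo⁺ (suc (hf n)))) fwd bwd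
    where
    low : ∀ {n₁ λ'} -> Par n₁ 2 λ' -> n₁ ≡ n -> λ' ∈ three n ∷ map (tw n) (upTo (suc (hf n)))
    low p refl = let (i , li , e) = Par-2 p in there (subst (_∈ map (tw n) (upTo (suc (hf n)))) (sym e) (∈-map⁺ (tw n) (∈-upTo⁺ (s≤s (dbl-≤ i n li)))))
    go : ∀ {n₁ m₁ λ'} -> Par n₁ m₁ λ' -> n₁ ≡ n -> T (leB λ' (three n)) -> λ' ∈ three n ∷ map (tw n) (upTo (suc (hf n)))
    go nil e t = low nil e
    go (cons {k = suc zero} p q r) e t = low (cons p (s≤s z≤n) r) e
    go (cons {k = suc (suc zero)} p q r) e t = low (cons p (s≤s (s≤s z≤n)) r) e
    go (cons {n'} {k = suc (suc (suc zero))} p q r) e t = here (cong (3 ∷_) (trans (Par-ones-≤ r (n N.∸ 3) t) (cong (\ k -> replicate k 1) (cong (N._∸ 3) e))))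
    go (cons {k = suc (suc (suc (suc _)))} p q r) e ()
    fwd : ∀ {λ'} -> λ' ∈ filterᵇ (\ λ' -> leB λ' (three n)) (partitions n) -> λ' ∈ three n ∷ map (tw n) (upTo (suc (hf n)))
    fwd {λ'} m = let (i , t) = ∈-filter⁻ (T? ∘ (\ λ' -> leB λ' (three n))) {xs = partitions n} m in go (∈⇒Par n i) refl t
    bwd : ∀ {λ'} -> λ' ∈ three n ∷ map (tw n) (upTo (suc (hf n))) -> λ' ∈ filterᵇ (\ λ' -> leB λ' (three n)) (partitions n)
    bwd (here refl) = ∈-filter⁺ (T? ∘ (\ λ' -> leB λ' (three n))) (Par⇒∈partitions (subst (\ t -> Par t n (three n)) (N.m+[n∸m]≡n l) (cons (s≤s z≤n) l (Par-mono (s≤s z≤n) (Par-ones (n N.∸ 3)))))) (subst T (sym (leB-refl (three n))) tt)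
    bwd (there m) = let (i , q , e) = ∈-map⁻ (tw n) m in subst (_∈ filterᵇ (\ λ' -> leB λ' (three n)) (partitions n)) (sym e)
      (∈-filter⁺ (T? ∘ (\ λ' -> leB λ' (three n))) (Par⇒∈partitions (Par-tight (Par-tw n i (N.≤-trans (dbl-mono (N.≤-pred (∈-upTo⁻ q))) (dbl-hf n))))) (head-< i))

Pw-add : ∀ r s {N} (A : V N) ν -> Pw r (Pw s A) ν ≡ Pw (r N.+ s) A ν
Pw-add zero s A ν = refl
Pw-add (suc r) s A ν = P-cong 1 (Pw-add r s A) ν

-- For n ≥ 4, ψ is `tC m` with m = `hf n` - 2, multiplied once more by p₁ if n is odd. For n = 3
-- there is no such m, and the values are computed.
good-three : ∀ n -> 3 N.≤ n -> Good n (three n)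
good-three 3 l = check-from-good 3 [] tt (3 ∷ []) (there (there (here refl))) tt
good-three n@(suc (suc (suc (suc n')))) l β s = subst 0≤_ (trans eq (sym (three-sum n l β))) (fst (spos-pw r {dbl (suc (suc m))} {n} (tC {n} m) (deg-tC {n} m) (N.≤-reflexive (N.m∸n+n≡m (dbl-hf n))) (spos-tC m (dbl-hf n))) β s)
  where
  m = hf n'
  r = n N.∸ dbl (hf n)
  a-Pw : ∀ k ν -> val (aC k) {n} ν ≡ Pw (dbl k) van ν
  a-Pw zero ν = one′ (van ν)
    where one′ : ∀ x -> 1ℤ * x + 0ℤ ≡ x
          one′ = solve-∀
  a-Pw (suc k) ν = trans (Quadratic.a-suc k ν) (P-cong 1 (P-cong 1 (a-Pw k)) ν)
  tail : ∀ ν -> val ((p₃₁ {n}) ⊛ aC m) ν ≡ P 3 (Pw (suc (dbl m)) van) ν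
  tail ν = trans (val-⊛ (p₃₁ {n}) (aC m) ν) (trans (one′ (P 3 (P 1 (val (aC m))) ν)) (P-cong 3 (P-cong 1 (a-Pw m)) ν))
    where one′ : ∀ x -> 1ℤ * x + 0ℤ ≡ x
          one′ = solve-∀
  size : r N.+ suc (dbl m) ≡ n N.∸ 3
  size = N.+-cancelˡ-≡ 3 _ _ (trans (sw r (dbl m)) (N.m∸n+n≡m (dbl-hf n)))
    where sw : ∀ r d -> 3 N.+ (r N.+ suc d) ≡ r N.+ (4 N.+ d)
          sw r d = trans (cong (3 N.+_) (N.+-suc r d)) (sym (trans (N.+-suc r _) (cong suc (trans (N.+-suc r _) (cong suc (trans (N.+-suc r _) (cong suc (N.+-suc r d))))))))
  eq : val (pw r (tC {n} m)) β ≡ alt (three n) β + Pw r (val (γC (suc (hf n)))) β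
  eq = begin
    val (pw r (tC {n} m)) β ≡⟨ val-pw r (tC {n} m) β ⟩
    Pw r (val (tC {n} m)) β ≡⟨ trans (Pw-cong r (val-++ (γC (suc (hf n))) ((p₃₁ {n}) ⊛ aC m)) β) (Pw-+ r (val (γC (suc (hf n)))) (val ((p₃₁ {n}) ⊛ aC m)) β) ⟩
    Pw r (val (γC (suc (hf n)))) β + Pw r (val ((p₃₁ {n}) ⊛ aC m)) β ≡⟨ +-comm (Pw r (val (γC (suc (hf n)))) β) _ ⟩
    Pw r (val ((p₃₁ {n}) ⊛ aC m)) β + Pw r (val (γC (suc (hf n)))) β
      ≡⟨ cong (_+ Pw r (val (γC (suc (hf n)))) β) (trans (Pw-cong r tail β) (trans (Pw-P r 3 (Pw (suc (dbl m)) van) β) (P-cong 3 (\ ν -> trans (Pw-add r (suc (dbl m)) van ν) (trans (cong (\ k -> Pw k van ν) size) (sym (alt-ones (n N.∸ 3) ν)))) β))) ⟩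
    alt (three n) β + Pw r (val (γC (suc (hf n)))) β ∎
good-three 0 ()
good-three 1 (s≤s ())
good-three 2 (s≤s (s≤s ()))

case-i : ∀ n -> 3 N.≤ n -> ∀ μ -> μ ∈ partitions n -> T (leB μ (three n)) -> Good n μ
case-i n l μ m t = fin (∈⇒Par n m) refl t
  where
  twos : ∀ {n₁ λ'} -> Par n₁ 2 λ' -> n₁ ≡ n -> Good n λ'
  twos p refl = let (i , li , e) = Par-2 p in subst (Good n) (sym e) (good-twos n i li)
  fin : ∀ {n₁ m₁ λ'} -> Par n₁ m₁ λ' -> n₁ ≡ n -> T (leB λ' (three n)) -> Good n λ'
  fin nil e t = twos nil e
  fin (cons {k = suc zero} p q r) e t = twos (cons p (s≤s z≤n) r) e
  fin (cons {k = suc (suc zero)} p q r) e t = twos (cons p (s≤s (s≤s z≤n)) r) e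
  fin (cons {n'} {k = suc (suc (suc zero))} p q r) e t = subst (Good n) (cong (3 ∷_) (sym (trans (Par-ones-≤ r (n N.∸ 3) t) (cong (\ k -> replicate k 1) (cong (N._∸ 3) e))))) (good-three n l)
  fin (cons {k = suc (suc (suc (suc _)))} p q r) e ()

-- Tableaux and interlacing beads

pos-sum : ∀ {A : Set} (xs : List A) (f : A -> ℕ) -> pos (sum (map f xs)) ≡ ∑ xs (pos ∘ f)
pos-sum [] f = refl
pos-sum (x ∷ xs) f = trans (Z.pos-+ (f x) (sum (map f xs))) (cong (pos (f x) +_) (pos-sum xs f))

∑-product : ∀ (R : List ℕ) (L : List (List ℕ)) f -> ∑ (concatMap (\ z -> map (z ∷_) L) R) f ≡ ∑ R (\ z -> ∑ L (\ w -> f (z ∷ w)))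
∑-product R L f = trans (concat-∑ (\ z -> map (z ∷_) L) R f) (∑-cong R (\ z -> ∑-map (z ∷_) L f))

dz-idem : ∀ w -> dropZeros (dropZeros w) ≡ dropZeros w
dz-idem [] = refl
dz-idem (zero ∷ w) = dz-idem w
dz-idem (suc z ∷ w) = cong (suc z ∷_) (dz-idem w)

dz-cons : ∀ z w -> dropZeros (z ∷ dropZeros w) ≡ dropZeros (z ∷ w)
dz-cons zero w = dz-idem w
dz-cons (suc z) w = cong (suc z ∷_) (dz-idem w)

dz-snoc : ∀ w -> dropZeros (w ++ 0 ∷ []) ≡ dropZeros w
dz-snoc [] = refl
dz-snoc (zero ∷ w) = dz-snoc w
dz-snoc (suc z ∷ w) = cong (suc z ∷_) (dz-snoc w)

dz-sum : ∀ w -> sum (dropZeros w) ≡ sum w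
dz-sum [] = refl
dz-sum (zero ∷ w) = dz-sum w
dz-sum (suc z ∷ w) = cong (suc z N.+_) (dz-sum w)

dz-All : ∀ w -> All (1 N.≤_) (dropZeros w)
dz-All [] = []
dz-All (zero ∷ w) = dz-All w
dz-All (suc z ∷ w) = s≤s z≤n ∷ dz-All w

dz-id : ∀ {w} -> All (1 N.≤_) w -> dropZeros w ≡ w
dz-id [] = refl
dz-id {suc z ∷ w} (_ ∷ a) = cong (suc z ∷_) (dz-id a)

Desc : List ℕ -> Set
Desc [] = ⊤
Desc (x ∷ []) = ⊤
Desc (x ∷ y ∷ r) = y N.≤ x × Desc (y ∷ r)

zeros-dz : ∀ r -> Desc (0 ∷ r) -> dropZeros r ≡ []
zeros-dz [] d = refl
zeros-dz (zero ∷ r) d = zeros-dz r (snd d)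
zeros-dz (suc y ∷ r) (() , _)

-- Next to a zero part every later interlacing entry is 0, so a function that ignores zeros has the
-- same sum over the trimmed shape.
interlace-dz : ∀ ζ -> Desc ζ -> (f : List ℕ -> ℤ) -> (∀ w -> f w ≡ f (dropZeros w)) -> ∑ (interlace ζ) f ≡ ∑ (interlace (dropZeros ζ)) f
interlace-dz [] d f hf = refl
interlace-dz (zero ∷ []) d f hf = cong (_+ 0ℤ) (hf (0 ∷ []))
interlace-dz (suc x ∷ []) d f hf = refl
interlace-dz (x ∷ zero ∷ r) d f hf = trans (∑-product (range 0 x) (interlace (0 ∷ r)) f) (trans (∑-cong (range 0 x) (\ z -> trans (interlace-dz (0 ∷ r) (snd d) (\ w -> f (z ∷ w)) (hf′ z)) (trans (cong (\ l -> ∑ (interlace l) (\ w -> f (z ∷ w))) (zeros-dz r (snd d))) (+-identityʳ (f (z ∷ []))))))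
    (fin x))
  where
  hf′ : ∀ z w -> f (z ∷ w) ≡ f (z ∷ dropZeros w)
  hf′ z w = trans (hf (z ∷ w)) (trans (cong f (sym (dz-cons z w))) (sym (hf (z ∷ dropZeros w))))
  fin : ∀ x -> ∑ (range 0 x) (\ z -> f (z ∷ [])) ≡ ∑ (interlace (dropZeros (x ∷ 0 ∷ r))) f
  fin zero = trans (cong (_+ 0ℤ) (hf (0 ∷ []))) (cong (\ l -> ∑ (interlace l) f) (sym (zeros-dz r (snd d))))
  fin (suc x) = trans (sym (∑-map (\ z -> z ∷ []) (range 0 (suc x)) f)) (cong (\ l -> ∑ (interlace (suc x ∷ l)) f) (sym (zeros-dz r (snd d))))
interlace-dz (suc x ∷ suc y ∷ r) d f hf = trans (∑-product (range (suc y) (suc x)) (interlace (suc y ∷ r)) f) (trans (∑-cong (range (suc y) (suc x)) (\ z -> interlace-dz (suc y ∷ r) (snd d) (\ w -> f (z ∷ w)) (hf′ z)))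
    (sym (∑-product (range (suc y) (suc x)) (interlace (suc y ∷ dropZeros r)) f)))
  where
  hf′ : ∀ z w -> f (z ∷ w) ≡ f (z ∷ dropZeros w)
  hf′ z w = trans (hf (z ∷ w)) (trans (cong f (sym (dz-cons z w))) (sym (hf (z ∷ dropZeros w))))
interlace-dz (zero ∷ suc y ∷ r) (() , _) f hf

-- The choices in `interlace` for all entries except the last, which alone is bounded below by 0
-- instead of by a part.
tops : List ℕ -> List (List ℕ)
tops (x ∷ y ∷ r) = concatMap (\ z -> map (z ∷_) (tops (y ∷ r))) (range y x)
tops _ = [] ∷ []

interlace-snoc : ∀ ys y f -> ∑ (interlace (ys ++ y ∷ [])) f ≡ ∑ (tops (ys ++ y ∷ [])) (\ w -> ∑ (range 0 y) (\ z -> f (w ++ z ∷ [])))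
interlace-snoc [] y f = trans (∑-map (\ z -> z ∷ []) (range 0 y) f) (sym (+-identityʳ _))
interlace-snoc (x ∷ []) y f = trans (∑-product (range y x) (interlace (y ∷ [])) f) (trans (∑-cong (range y x) (\ z -> interlace-snoc [] y (\ w -> f (z ∷ w)))) (sym (∑-product (range y x) ([] ∷ []) (\ w -> ∑ (range 0 y) (\ z -> f (w ++ z ∷ []))))))
interlace-snoc (x ∷ u ∷ ys) y f = trans (∑-product (range u x) (interlace (u ∷ ys ++ y ∷ [])) f) (trans (∑-cong (range u x) (\ z -> interlace-snoc (u ∷ ys) y (\ w -> f (z ∷ w)))) (sym (∑-product (range u x) (tops (u ∷ ys ++ y ∷ [])) (\ w -> ∑ (range 0 y) (\ z -> f (w ++ z ∷ []))))))

tops-snoc : ∀ ys x y f -> ∑ (tops (ys ++ x ∷ y ∷ [])) f ≡ ∑ (tops (ys ++ x ∷ [])) (\ w -> ∑ (range y x) (\ z -> f (w ++ z ∷ [])))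
tops-snoc [] x y f = trans (∑-product (range y x) ([] ∷ []) f) (trans (∑-cong (range y x) (\ z -> +-identityʳ (f (z ∷ [])))) (sym (+-identityʳ _)))
tops-snoc (v ∷ []) x y f = trans (∑-product (range x v) (tops (x ∷ y ∷ [])) f) (trans (∑-cong (range x v) (\ z -> tops-snoc [] x y (\ w -> f (z ∷ w)))) (sym (∑-product (range x v) ([] ∷ []) (\ w -> ∑ (range y x) (\ z -> f (w ++ z ∷ []))))))
tops-snoc (v ∷ u ∷ ys) x y f = trans (∑-product (range u v) (tops (u ∷ ys ++ x ∷ y ∷ [])) f) (trans (∑-cong (range u v) (\ z -> tops-snoc (u ∷ ys) x y (\ w -> f (z ∷ w)))) (sym (∑-product (range u v) (tops (u ∷ ys ++ x ∷ [])) (\ w -> ∑ (range y x) (\ z -> f (w ++ z ∷ []))))))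

-- The sum over `tops` with the smallest part read first, the order in which beads are listed.
Jsum : List ℕ -> (List ℕ -> ℤ) -> ℤ
Jsum [] h = h []
Jsum (r ∷ []) h = h []
Jsum (r ∷ r₁ ∷ ρ) h = ∑ (range r r₁) (\ x -> Jsum (r₁ ∷ ρ) (\ w -> h (w ++ x ∷ [])))

tops-rev : ∀ r ρ h -> ∑ (tops (reverse (r ∷ ρ))) h ≡ Jsum (r ∷ ρ) h
tops-rev r [] h = +-identityʳ (h [])
tops-rev r (r₁ ∷ ρ) h = trans (cong (\ l -> ∑ (tops l) h) (trans (Lₚ.unfold-reverse r (r₁ ∷ ρ)) (trans (cong (_++ r ∷ []) (Lₚ.unfold-reverse r₁ ρ)) (Lₚ.++-assoc (reverse ρ) (r₁ ∷ []) (r ∷ [])))))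
  (trans (tops-snoc (reverse ρ) r₁ r h) (trans (cong (\ l -> ∑ (tops l) (\ w -> ∑ (range r r₁) (\ z -> h (w ++ z ∷ [])))) (sym (Lₚ.unfold-reverse r₁ ρ)))
    (trans (∑-swap (tops (reverse (r₁ ∷ ρ))) (range r r₁) (\ w z -> h (w ++ z ∷ []))) (∑-cong (range r r₁) (\ z -> tops-rev r₁ ρ (\ w -> h (w ++ z ∷ [])))))))

range-∈ : ∀ {a b z} -> z ∈ range a b -> a N.≤ z
range-∈ {a} {b} m = let (i , _ , e) = ∈-map⁻ (a N.+_) m in subst (a N.≤_) (sym e) (N.m≤m+n a i)

interlace-length : ∀ ν -> All (1 N.≤_) ν -> ∀ {z} -> z ∈ interlace ν -> length ν N.≤ suc (length (dropZeros z))
interlace-length [] a m = z≤n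
interlace-length (x ∷ []) a m = s≤s z≤n
interlace-length (x ∷ y ∷ r) (_ ∷ py ∷ a) m = let (z , q , m') = find (∈-concatMap⁻ (\ z -> map (z ∷_) (interlace (y ∷ r))) {xs = range y x} m) ; (w , mw , e) = ∈-map⁻ (z ∷_) m' in
    subst (\ z -> suc (suc (length r)) N.≤ suc (length (dropZeros z))) (sym e) (s≤s (go z w (N.≤-trans py (range-∈ {y} {x} q)) (interlace-length (y ∷ r) (py ∷ a) mw)))
  where go : ∀ z w -> 1 N.≤ z -> suc (length r) N.≤ suc (length (dropZeros w)) -> suc (length r) N.≤ length (dropZeros (z ∷ w))
        go (suc z) w _ l = l

kostka-step : ∀ ν a as -> pos (kostkaRev ν (a ∷ as)) ≡ ∑ (interlace ν) (\ z -> if (sum ν N.∸ sum (dropZeros z)) N.≡ᵇ a then pos (kostkaRev (dropZeros z) as) else 0ℤ)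
kostka-step ν a as = trans (pos-sum (filterᵇ (\ ν' -> (sum ν N.∸ sum ν') N.≡ᵇ a) (hstrips ν)) (\ ν' -> kostkaRev ν' as))
  (trans (∑-filter (\ ν' -> (sum ν N.∸ sum ν') N.≡ᵇ a) (hstrips ν) (\ ν' -> pos (kostkaRev ν' as))) (∑-map dropZeros (interlace ν) (\ ν' -> if (sum ν N.∸ sum ν') N.≡ᵇ a then pos (kostkaRev ν' as) else 0ℤ)))

-- A horizontal strip shortens the first column by at most one, so there must be at least as many
-- letters as rows.
kostka-long : ∀ as ν -> All (1 N.≤_) ν -> length as N.< length ν -> pos (kostkaRev ν as) ≡ 0ℤ
kostka-long [] (suc x ∷ ν) (p ∷ a) l = refl
kostka-long (a ∷ as) ν pν l = trans (kostka-step ν a as) (trans (∑-cong-∈ (interlace ν) (\ {z} m -> go z ((sum ν N.∸ sum (dropZeros z)) N.≡ᵇ a) (N.≤-pred (N.≤-trans l (interlace-length ν pν m))))) (∑-0 (interlace ν)))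
  where go : ∀ z b -> length as N.< length (dropZeros z) -> (if b then pos (kostkaRev (dropZeros z) as) else 0ℤ) ≡ 0ℤ
        go z true l = kostka-long as (dropZeros z) (dz-All z) l
        go z false l = refl

-- The partition with beads β = ν + δ, smallest part first and with zeros.
pl : ℕ -> ∀ {N} -> Vec ℕ N -> List ℕ
pl lo [] = []
pl lo (b ∷ β) = b N.∸ lo ∷ pl (suc lo) β

part-of : ∀ {N} -> Vec ℕ N -> List ℕ
part-of β = dropZeros (reverse (pl 0 β))

-- The horizontal strip condition in terms of beads: the staircase with N + 1 steps against the one
-- with N steps turns every second weak inequality into a strict one.
IL : ∀ {N} -> Vec ℕ (suc N) -> Vec ℕ N -> Set
IL {zero} (b ∷ []) [] = ⊤
IL {suc N} (b ∷ b₁ ∷ bs) (x ∷ β) = b N.≤ x × x N.< b₁ × IL (b₁ ∷ bs) β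

DI : ∀ {N} -> Vec ℕ (suc N) -> List (Vec ℕ N)
DI {zero} (b ∷ []) = [] ∷ []
DI {suc N} (b ∷ b₁ ∷ bs) = concatMap (\ i -> map (b N.+ i ∷_) (DI (b₁ ∷ bs))) (upTo (b₁ N.∸ b))

DI⇒IL : ∀ {N} (b : Vec ℕ (suc N)) {β} -> β ∈ DI b -> IL b β
DI⇒IL {zero} (b ∷ []) {[]} m = tt
DI⇒IL {suc N} (b ∷ b₁ ∷ bs) {x ∷ β} m = let (i , q , m') = find (∈-concatMap⁻ (\ i -> map (b N.+ i ∷_) (DI (b₁ ∷ bs))) {xs = upTo (b₁ N.∸ b)} m) ; (β' , r , e) = ∈-map⁻ (b N.+ i ∷_) m' in
  subst (IL (b ∷ b₁ ∷ bs)) (sym e) (N.m≤m+n b i , lt b₁ b i (∈-upTo⁻ q) , DI⇒IL (b₁ ∷ bs) r)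
  where lt : ∀ c b i -> i N.< c N.∸ b -> b N.+ i N.< c
        lt c b i l = N.≤-trans (N.+-monoʳ-< b l) (N.≤-reflexive (N.m+[n∸m]≡n {b} {c} (N.<⇒≤ (N.m∸n≢0⇒n<m (\ z -> N.<⇒≱ l (subst (N._≤ i) (sym z) z≤n))))))

IL⇒DI : ∀ {N} (b : Vec ℕ (suc N)) {β} -> IL b β -> β ∈ DI b
IL⇒DI {zero} (b ∷ []) {[]} _ = here refl
IL⇒DI {suc N} (b ∷ b₁ ∷ bs) {x ∷ β} (p , q , r) = ∈-concatMap⁺ (\ i -> map (b N.+ i ∷_) (DI (b₁ ∷ bs))) (lose (∈-upTo⁺ (N.∸-monoˡ-< q p)) (subst (\ t -> (t ∷ β) ∈ map (b N.+ (x N.∸ b) ∷_) (DI (b₁ ∷ bs))) (N.m+[n∸m]≡n p) (∈-map⁺ (b N.+ (x N.∸ b) ∷_) (IL⇒DI (b₁ ∷ bs) r))))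

Jsum-DI : ∀ {N} j (b : Vec ℕ (suc N)) -> Str j b -> ∀ h -> Jsum (pl j b) h ≡ ∑ (DI b) (\ β -> h (reverse (pl j β)))
Jsum-DI {zero} j (b ∷ []) s h = sym (+-identityʳ (h []))
Jsum-DI {suc N} j (b ∷ b₁ ∷ bs) (p , (q , s)) h = begin
  ∑ (range (b N.∸ j) (b₁ N.∸ suc j)) (\ x -> Jsum (pl (suc j) (b₁ ∷ bs)) (\ w -> h (w ++ x ∷ [])))
    ≡⟨ ∑-map (b N.∸ j N.+_) (upTo (suc (b₁ N.∸ suc j N.∸ (b N.∸ j)))) (\ x -> Jsum (pl (suc j) (b₁ ∷ bs)) (\ w -> h (w ++ x ∷ []))) ⟩
  ∑ (upTo (suc (b₁ N.∸ suc j N.∸ (b N.∸ j)))) (\ i -> Jsum (pl (suc j) (b₁ ∷ bs)) (\ w -> h (w ++ (b N.∸ j N.+ i) ∷ [])))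
    ≡⟨ cong (\ k -> ∑ (upTo k) (\ i -> Jsum (pl (suc j) (b₁ ∷ bs)) (\ w -> h (w ++ (b N.∸ j N.+ i) ∷ [])))) size ⟩
  ∑ (upTo (b₁ N.∸ b)) (\ i -> Jsum (pl (suc j) (b₁ ∷ bs)) (\ w -> h (w ++ (b N.∸ j N.+ i) ∷ [])))
    ≡⟨ ∑-cong (upTo (b₁ N.∸ b)) (\ i -> trans (Jsum-DI (suc j) (b₁ ∷ bs) (N.≤-trans (s≤s p) q , s) (\ w -> h (w ++ (b N.∸ j N.+ i) ∷ []))) (trans (∑-cong (DI (b₁ ∷ bs)) (\ β -> cong h (trans (sym (Lₚ.unfold-reverse (b N.∸ j N.+ i) (pl (suc j) β))) (cong (\ t -> reverse (t ∷ pl (suc j) β)) (sym (N.+-∸-comm i p))))))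
         (sym (∑-map (b N.+ i ∷_) (DI (b₁ ∷ bs)) (\ β -> h (reverse (pl j β))))))) ⟩
  ∑ (upTo (b₁ N.∸ b)) (\ i -> ∑ (map (b N.+ i ∷_) (DI (b₁ ∷ bs))) (\ β -> h (reverse (pl j β))))
    ≡⟨ sym (concat-∑ (\ i -> map (b N.+ i ∷_) (DI (b₁ ∷ bs))) (upTo (b₁ N.∸ b)) (\ β -> h (reverse (pl j β)))) ⟩
  ∑ (DI (b ∷ b₁ ∷ bs)) (\ β -> h (reverse (pl j β))) ∎
  where
  size : suc (b₁ N.∸ suc j N.∸ (b N.∸ j)) ≡ b₁ N.∸ b
  size = trans (cong (\ t -> suc (t N.∸ (b N.∸ j))) refl) (trans (cong suc (trans (N.∸-+-assoc b₁ (suc j) (b N.∸ j)) (cong (\ t -> b₁ N.∸ suc t) (N.m+[n∸m]≡n p)))) (sym (N.+-∸-assoc 1 q)))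

pl-Desc : ∀ {N} j (b : Vec ℕ N) -> Str j b -> Desc (reverse (pl j b))
pl-Desc j b s = snoc (pl j b) (asc j b s)
  where
  Asc : List ℕ -> Set
  Asc [] = ⊤
  Asc (x ∷ []) = ⊤
  Asc (x ∷ y ∷ r) = x N.≤ y × Asc (y ∷ r)
  asc : ∀ {N} j (b : Vec ℕ N) -> Str j b -> Asc (pl j b)
  asc j [] s = tt
  asc j (b ∷ []) s = tt
  asc j (b ∷ b₁ ∷ bs) (p , (q , s)) = N.∸-monoˡ-≤ (suc j) q , asc (suc j) (b₁ ∷ bs) (N.≤-trans (s≤s p) q , s)
  app : ∀ ys x y -> Desc (ys ++ y ∷ []) -> x N.≤ y -> Desc (ys ++ y ∷ x ∷ [])
  app [] x y d l = l , tt
  app (u ∷ []) x y d l = fst d , l , tt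
  app (u ∷ v ∷ ys) x y d l = fst d , app (v ∷ ys) x y (snd d) l
  snoc : ∀ ρ -> Asc ρ -> Desc (reverse ρ)
  snoc [] a = tt
  snoc (x ∷ []) a = tt
  snoc (x ∷ y ∷ r) (l , a) = subst Desc (sym (trans (Lₚ.unfold-reverse x (y ∷ r)) (trans (cong (_++ x ∷ []) (Lₚ.unfold-reverse y r)) (Lₚ.++-assoc (reverse r) (y ∷ []) (x ∷ []))))) (app (reverse r) x y (subst Desc (Lₚ.unfold-reverse y r) (snoc (y ∷ r) a)) l)

sum-reverse : ∀ xs -> sum (reverse xs) ≡ sum xs
sum-reverse [] = refl
sum-reverse (x ∷ xs) = trans (cong sum (Lₚ.unfold-reverse x xs)) (trans (LAₚ.sum-++ (reverse xs) (x ∷ [])) (trans (cong₂ N._+_ (sum-reverse xs) (N.+-identityʳ x)) (N.+-comm (sum xs) x)))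

pl-sum : ∀ {N} j (b : Vec ℕ N) -> Str j b -> sum (pl j b) N.+ sumV (δ j N) ≡ sumV b
pl-sum j [] s = refl
pl-sum {suc N} j (b ∷ β) (p , s) = trans (sw (b N.∸ j) (sum (pl (suc j) β)) j (sumV (δ (suc j) N))) (cong₂ N._+_ (N.m∸n+n≡m p) (pl-sum (suc j) β (Str-mono {β = β} (s≤s p) s)))
  where sw : ∀ a b c d -> (a N.+ b) N.+ (c N.+ d) ≡ (a N.+ c) N.+ (b N.+ d)
        sw a b c d = trans (N.+-assoc a b (c N.+ d)) (trans (cong (a N.+_) (trans (sym (N.+-assoc b c d)) (trans (cong (N._+ d) (N.+-comm b c)) (N.+-assoc c b d)))) (sym (N.+-assoc a c (b N.+ d))))

pl-≥ : ∀ {N} j lo (β : Vec ℕ N) -> Str (lo N.+ j) β -> All (lo N.≤_) (pl j β)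
pl-≥ j lo [] s = []
pl-≥ j lo (b ∷ β) (p , s) = N.m+n≤o⇒m≤o∸n lo p ∷ pl-≥ (suc j) lo β (subst (\ t -> Str t β) (sym (N.+-suc lo j)) (Str-mono {β = β} (s≤s p) s))

pl-length : ∀ {N} j (β : Vec ℕ N) -> length (pl j β) ≡ N
pl-length j [] = refl
pl-length j (b ∷ β) = cong suc (pl-length (suc j) β)

IL-Strˡ : ∀ {N} (b : Vec ℕ (suc N)) β -> IL b β -> Str 0 b
IL-Strˡ (b ∷ bs) β il = z≤n , go b bs β il
  where go : ∀ {N} b (bs : Vec ℕ N) β -> IL (b ∷ bs) β -> Str (suc b) bs
        go b [] [] il = tt
        go b (b₁ ∷ bs) (x ∷ β) (p , q , r) = N.≤-trans (s≤s p) q , go b₁ bs β r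

IL-Strʳ : ∀ {N} b (bs : Vec ℕ N) β -> IL (b ∷ bs) β -> Str b β
IL-Strʳ b [] [] il = tt
IL-Strʳ b (b₁ ∷ bs) (x ∷ β) (p , q , r) = p , Str-mono {β = β} q (IL-Strʳ b₁ bs β r)

IL-sum : ∀ {N} b (bs : Vec ℕ N) β -> IL (b ∷ bs) β -> sumV β N.+ N N.≤ sumV bs
IL-sum b [] [] il = z≤n
IL-sum {suc N} b (b₁ ∷ bs) (x ∷ β) (p , q , r) = N.≤-trans (N.≤-reflexive (trans (N.+-suc (x N.+ sumV β) N) (cong suc (N.+-assoc x (sumV β) N)))) (N.+-mono-≤ q (IL-sum b₁ bs β r))

-- A shape with N + 1 beads has N + 1 interlacing entries, while only N beads may remain. The last
-- entry is forced to be 0, for otherwise N + 1 rows would be left for N letters (`kostka-long`).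
-- The summand N is the difference of the two staircases.
kostka-beads : ∀ {N} (b : Vec ℕ (suc N)) -> Str 0 b -> ∀ a as -> length as ≡ N ->
  pos (kostkaRev (part-of b) (a ∷ as)) ≡ ∑ (DI b) (\ β -> if sumV b N.≡ᵇ (a N.+ (sumV β N.+ N)) then pos (kostkaRev (part-of β) as) else 0ℤ)
kostka-beads {N} (b ∷ bs) s a as len = begin
  pos (kostkaRev ν (a ∷ as)) ≡⟨ kostka-step ν a as ⟩
  ∑ (interlace ν) F ≡⟨ sym (interlace-dz (reverse ρ) (pl-Desc 0 (b ∷ bs) s) F (\ w -> cong (\ t -> if (sum ν N.∸ sum t) N.≡ᵇ a then pos (kostkaRev t as) else 0ℤ) (sym (dz-idem w)))) ⟩
  ∑ (interlace (reverse ρ)) F ≡⟨ cong (\ l -> ∑ (interlace l) F) (Lₚ.unfold-reverse b (pl 1 bs)) ⟩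
  ∑ (interlace (reverse (pl 1 bs) ++ b ∷ [])) F ≡⟨ interlace-snoc (reverse (pl 1 bs)) b F ⟩
  ∑ (tops (reverse (pl 1 bs) ++ b ∷ [])) F' ≡⟨ cong (\ l -> ∑ (tops l) F') (sym (Lₚ.unfold-reverse b (pl 1 bs))) ⟩
  ∑ (tops (reverse ρ)) F' ≡⟨ tops-rev b (pl 1 bs) F' ⟩
  Jsum ρ F' ≡⟨ Jsum-DI 0 (b ∷ bs) s F' ⟩
  ∑ (DI (b ∷ bs)) (\ β -> F' (reverse (pl 0 β))) ≡⟨ ∑-cong-∈ (DI (b ∷ bs)) (\ {β} m -> trans (last β (DI⇒IL (b ∷ bs) m)) (cong (\ c -> if c then pos (kostkaRev (part-of β) as) else 0ℤ) (size β (DI⇒IL (b ∷ bs) m)))) ⟩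
  ∑ (DI (b ∷ bs)) (\ β -> if sumV (b ∷ bs) N.≡ᵇ (a N.+ (sumV β N.+ N)) then pos (kostkaRev (part-of β) as) else 0ℤ) ∎
  where
  ρ = pl 0 (b ∷ bs)
  ν = part-of (b ∷ bs)
  F : List ℕ -> ℤ
  F z = if (sum ν N.∸ sum (dropZeros z)) N.≡ᵇ a then pos (kostkaRev (dropZeros z) as) else 0ℤ
  F' : List ℕ -> ℤ
  F' w = ∑ (range 0 b) (\ z -> F (w ++ z ∷ []))
  last : ∀ β -> IL (b ∷ bs) β -> F' (reverse (pl 0 β)) ≡ F (reverse (pl 0 β))
  last β il = trans (∑-map (0 N.+_) (upTo (suc b)) (\ z -> F (reverse (pl 0 β) ++ z ∷ []))) (trans (∑-single (upTo (suc b)) 0 (\ z -> F (reverse (pl 0 β) ++ z ∷ [])) (Uₚ.upTo⁺ (suc b)) (here refl) (\ {z} m nz -> vanish-z z nz (N.≤-pred (∈-upTo⁻ m))))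
      (cong (\ t -> if (sum ν N.∸ sum t) N.≡ᵇ a then pos (kostkaRev t as) else 0ℤ) (dz-snoc (reverse (pl 0 β)))))
    where
    vanish-z : ∀ z -> z ≢ 0 -> z N.≤ b -> F (reverse (pl 0 β) ++ z ∷ []) ≡ 0ℤ
    vanish-z zero nz l = ⊥-elim (nz refl)
    vanish-z (suc z) nz l = go ((sum ν N.∸ sum (dropZeros u)) N.≡ᵇ a)
      where
      u = reverse (pl 0 β) ++ suc z ∷ []
      pu : All (1 N.≤_) u
      pu = Allₚ.++⁺ (↭ₚ.All-resp-↭ (↭-sym (↭ₚ.↭-reverse (pl 0 β))) (All.map (N.≤-trans (N.≤-trans (s≤s z≤n) l)) (pl-≥ 0 b β (subst (\ t -> Str t β) (sym (N.+-identityʳ b)) (IL-Strʳ b bs β il))))) (s≤s z≤n ∷ [])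
      lu : length u ≡ suc N
      lu = trans (Lₚ.length-++ (reverse (pl 0 β))) (trans (cong (N._+ 1) (trans (Lₚ.length-reverse (pl 0 β)) (pl-length 0 β))) (N.+-comm N 1))
      go : ∀ c -> (if c then pos (kostkaRev (dropZeros u) as) else 0ℤ) ≡ 0ℤ
      go false = refl
      go true = trans (cong (\ t -> pos (kostkaRev t as)) (dz-id pu)) (kostka-long as u pu (N.≤-reflexive (trans (cong suc len) (sym lu))))
  Σν : ∀ {M} (β : Vec ℕ M) -> Str 0 β -> sum (part-of β) N.+ tri M ≡ sumV β
  Σν {M} β s = trans (cong (N._+ tri M) (trans (dz-sum (reverse (pl 0 β))) (sum-reverse (pl 0 β)))) (pl-sum 0 β s)
  size : ∀ β -> IL (b ∷ bs) β -> ((sum ν N.∸ sum (part-of β)) N.≡ᵇ a) ≡ (sumV (b ∷ bs) N.≡ᵇ (a N.+ (sumV β N.+ N)))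
  size β il = bool _ _ (\ t -> N.≡⇒≡ᵇ _ _ (to (N.≡ᵇ⇒≡ _ _ t))) (\ t -> N.≡⇒≡ᵇ _ _ (fro (N.≡ᵇ⇒≡ _ _ t)))
    where
    bool : ∀ x y -> (T x -> T y) -> (T y -> T x) -> x ≡ y
    bool true true f g = refl
    bool true false f g = ⊥-elim (f tt)
    bool false true f g = ⊥-elim (g tt)
    bool false false f g = refl
    sβ = Str-mono {β = β} z≤n (IL-Strʳ b bs β il)
    t = tri N
    e₁ : sum ν N.+ (t N.+ N) ≡ sumV (b ∷ bs)
    e₁ = trans (cong (sum ν N.+_) (trans (N.+-comm t N) (sym (δsum 0 N)))) (Σν (b ∷ bs) s)
    e₂ : sum (part-of β) N.+ t ≡ sumV β
    e₂ = Σν β sβ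
    le : sum (part-of β) N.≤ sum ν
    le = N.+-cancelʳ-≤ (t N.+ N) _ _ (N.≤-trans (N.≤-reflexive (trans (sym (N.+-assoc (sum (part-of β)) t N)) (cong (N._+ N) e₂))) (N.≤-trans (N.≤-trans (IL-sum b bs β il) (N.m≤n+m _ b)) (N.≤-reflexive (sym e₁))))
    to : sum ν N.∸ sum (part-of β) ≡ a -> sumV (b ∷ bs) ≡ a N.+ (sumV β N.+ N)
    to q = trans (sym e₁) (trans (cong (N._+ (t N.+ N)) (trans (sym (N.m∸n+n≡m le)) (cong (N._+ sum (part-of β)) q))) (trans (N.+-assoc a _ _) (cong (a N.+_) (trans (sym (N.+-assoc (sum (part-of β)) t N)) (cong (N._+ N) e₂)))))
    fro : sumV (b ∷ bs) ≡ a N.+ (sumV β N.+ N) -> sum ν N.∸ sum (part-of β) ≡ a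
    fro q = trans (cong (N._∸ sum (part-of β)) (N.+-cancelʳ-≡ (t N.+ N) (sum ν) (a N.+ sum (part-of β)) (trans e₁ (trans q (sym (trans (N.+-assoc a _ _) (cong (a N.+_) (trans (sym (N.+-assoc (sum (part-of β)) t N)) (cong (N._+ N) e₂)))))))))
      (N.m+n∸n≡m a (sum (part-of β)))

-- Dividing an alternant by the product of the xⱼ - x₀: interlacing.

sh-suc : ∀ i (g : ℕ -> ℤ) b -> sh i g (suc b) ≡ sh i (\ x -> g (suc x)) b + (if i N.≡ᵇ suc b then g 0 else 0ℤ)
sh-suc zero g b = sym (+-identityʳ _)
sh-suc (suc zero) g zero = sym (+-identityˡ _)
sh-suc (suc (suc i)) g zero = refl
sh-suc (suc i) g (suc b) = sh-suc i g b

-- Gessel–Viennot cancellation: in the antidiagonal sum only the terms whose first argument is below d survive.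
ad-cancel : ∀ (F : ℕ -> ℕ -> ℤ) -> (∀ u v -> F u v ≡ - F v u) -> ∀ d b -> ad F b d ≡ ∑ (upTo d) (\ i -> sh i (\ x -> F i (d N.+ x)) b)
ad-cancel F h zero b = ad-anti F h b
ad-cancel F h (suc d) b = begin
  ad F b (suc d) ≡⟨ r₁ (F (suc b) d) (ad F b (suc d)) ⟩
  ad F (suc b) d - F (suc b) d ≡⟨ cong (_- F (suc b) d) (trans (ad-cancel F h d (suc b)) (trans (∑-cong (upTo d) (\ i -> trans (sh-suc i (\ x -> F i (d N.+ x)) b) (cong₂ _+_ (sh-cong i (\ x -> cong (F i) (N.+-suc d x)) b) (cong (\ t -> if i N.≡ᵇ suc b then F i t else 0ℤ) (N.+-identityʳ d)))))
      (∑-+ (upTo d) (\ i -> sh i (\ x -> F i (suc d N.+ x)) b) (\ i -> if i N.≡ᵇ suc b then F i d else 0ℤ)))) ⟩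
  (S + Q) - F (suc b) d ≡⟨ r₂ S Q (F (suc b) d) ⟩
  S + (Q - F (suc b) d) ≡⟨ cong (S +_) (cmp (N.<-cmp (suc b) d)) ⟩
  S + sh d (\ x -> F d (suc d N.+ x)) b ≡⟨ sym (∑-upTo d (\ i -> sh i (\ x -> F i (suc d N.+ x)) b)) ⟩
  ∑ (upTo (suc d)) (\ i -> sh i (\ x -> F i (suc d N.+ x)) b) ∎
  where
  S = ∑ (upTo d) (\ i -> sh i (\ x -> F i (suc d N.+ x)) b)
  Q = ∑ (upTo d) (\ i -> if i N.≡ᵇ suc b then F i d else 0ℤ)
  r₁ : ∀ a x -> x ≡ (a + x) - a
  r₁ = solve-∀
  r₂ : ∀ s q f -> (s + q) - f ≡ s + (q - f)
  r₂ = solve-∀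
  off : ∀ {i} -> i ≢ suc b -> (if i N.≡ᵇ suc b then F i d else 0ℤ) ≡ 0ℤ
  off {i} ne = cong (\ t -> if t then F i d else 0ℤ) (¬T⇒false (\ t -> ne (N.≡ᵇ⇒≡ i (suc b) t)))
  Q0 : d N.≤ suc b -> Q ≡ 0ℤ
  Q0 l = ∑-pos0 (upTo d) (\ {i} m -> off (\ e -> N.<⇒≱ (∈-upTo⁻ m) (subst (d N.≤_) (sym e) l)))
  cmp : Tri (suc b N.< d) (suc b ≡ d) (d N.< suc b) -> Q - F (suc b) d ≡ sh d (\ x -> F d (suc d N.+ x)) b
  cmp (tri< l _ _) = trans (cong (_- F (suc b) d) (trans (∑-single (upTo d) (suc b) (\ i -> if i N.≡ᵇ suc b then F i d else 0ℤ) (Uₚ.upTo⁺ d) (∈-upTo⁺ l) (\ _ -> off)) (cong (\ t -> if t then F (suc b) d else 0ℤ) (T⇒true (N.≡⇒≡ᵇ b b refl)))))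
    (trans (Z.+-inverseʳ (F (suc b) d)) (sym (sh-small d (\ x -> F d (suc d N.+ x)) b (N.<-trans N.≤-refl l))))
  cmp (tri≈ _ refl _) = trans (cong₂ _-_ (Q0 N.≤-refl) (x≡-x⇒x≡0 _ (h d d))) (sym (sh-small d (\ x -> F d (suc d N.+ x)) b N.≤-refl))
  cmp (tri> _ _ l) = trans (cong₂ _-_ (Q0 (N.<⇒≤ l)) (h (suc b) d)) (trans (r₃ (F d (suc b))) (sym (trans (cong (sh d (\ x -> F d (suc d N.+ x))) (sym (N.m+[n∸m]≡n (N.≤-pred l)))) (trans (sh-at d (\ x -> F d (suc d N.+ x)) (b N.∸ d)) (cong (\ t -> F d (suc t)) (N.m+[n∸m]≡n (N.≤-pred l)))))))
    where r₃ : ∀ x -> 0ℤ - (- x) ≡ x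
          r₃ = solve-∀

ad-off : ∀ F b lo c -> ad F b (lo N.+ c) ≡ ad (\ u v -> F u (lo N.+ v)) b c
ad-off F b zero c = refl
ad-off F b (suc lo) c = trans (ad-shiftʳ F b (lo N.+ c)) (ad-off (\ u v -> F u (suc v)) b lo c)

shA : ∀ {N} -> ℕ -> V (suc N) -> V (suc N)
shA i B (y ∷ γ) = sh i (\ t -> B (t ∷ γ)) y

𝒢-sh : ∀ i {N} (B : V (suc N)) c β -> 𝒢 (shA i B) (c ∷ β) ≡ sh i (\ t -> 𝒢 B (t ∷ β)) c
𝒢-sh i B c [] = refl
𝒢-sh i B c (x ∷ β) = trans (l-cong Lin-𝒢 {A = G₁ (shA i B) x} {B = shA i (G₁ B x)} (\ { (y ∷ γ) -> ad-shˡ i (\ u v -> B (u ∷ v ∷ γ)) y (suc x) }) (c ∷ β)) (𝒢-sh i (G₁ B x) c β)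

offA : ∀ {N} -> ℕ -> V (suc N) -> V (suc N)
offA lo A (y ∷ γ) = A (lo N.+ y ∷ γ)

-- The vectors that interlace β from above with first entry at least `lo`; c is the excess of the
-- sum over its least possible value, still to be distributed.
UI : ∀ {N} -> ℕ -> ℕ -> Vec ℕ N -> List (Vec ℕ (suc N))
UI lo c [] = (lo N.+ c ∷ []) ∷ []
UI lo c (x ∷ β) = concatMap (\ i -> map (lo N.+ i ∷_) (UI (suc x) (c N.∸ i) β)) (filterᵇ (\ i -> i N.≤ᵇ c) (upTo (suc x N.∸ lo)))

sh-if : ∀ i (f : ℕ -> ℤ) c -> sh i f c ≡ (if i N.≤ᵇ c then f (c N.∸ i) else 0ℤ)
sh-if i f c = go (i N.≤? c)
  where go : Dec (i N.≤ c) -> sh i f c ≡ (if i N.≤ᵇ c then f (c N.∸ i) else 0ℤ)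
        go (yes l) = trans (cong (sh i f) (sym (N.m+[n∸m]≡n l))) (trans (sh-at i f (c N.∸ i)) (sym (cong (\ t -> if t then f (c N.∸ i) else 0ℤ) (T⇒true (N.≤⇒≤ᵇ l)))))
        go (no nl) = trans (sh-small i f c (N.≰⇒> nl)) (sym (cong (\ t -> if t then f (c N.∸ i) else 0ℤ) (¬T⇒false (\ t -> nl (N.≤ᵇ⇒≤ i c t)))))

-- The exponent c of x₀ is passed along the beads. At each division `ad-cancel` gives the current
-- bead the value lo + i, takes i from c and goes on with lower bound `suc x`; the last bead
-- receives what is left.
𝒢-UI : ∀ {N} lo (A : V (suc N)) -> Anti A -> ∀ c β -> Str lo β -> 𝒢 (offA lo A) (c ∷ β) ≡ ∑ (UI lo c β) A
𝒢-UI lo A h c [] s = sym (+-identityʳ _)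
𝒢-UI {suc N} lo A h c (x ∷ β) (p , s) = begin
  𝒢 (G₁ (offA lo A) x) (c ∷ β) ≡⟨ l-cong Lin-𝒢 {A = G₁ (offA lo A) x} {B = \ γ -> ∑ (upTo d) (\ i -> shA i (offA (suc x) (A′ i)) γ)} step (c ∷ β) ⟩
  𝒢 (\ γ -> ∑ (upTo d) (\ i -> shA i (offA (suc x) (A′ i)) γ)) (c ∷ β) ≡⟨ l-∑ Lin-𝒢 (upTo d) (\ i -> shA i (offA (suc x) (A′ i))) (c ∷ β) ⟩
  ∑ (upTo d) (\ i -> 𝒢 (shA i (offA (suc x) (A′ i))) (c ∷ β))
    ≡⟨ ∑-cong (upTo d) (\ i -> trans (𝒢-sh i (offA (suc x) (A′ i)) c β) (trans (sh-cong i (\ t -> 𝒢-UI (suc x) (A′ i) (Anti-tail {A = A} h (lo N.+ i)) t β s) c) (sh-if i (\ t -> ∑ (UI (suc x) t β) (A′ i)) c))) ⟩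
  ∑ (upTo d) (\ i -> if i N.≤ᵇ c then ∑ (UI (suc x) (c N.∸ i) β) (A′ i) else 0ℤ) ≡⟨ sym (∑-filter (\ i -> i N.≤ᵇ c) (upTo d) (\ i -> ∑ (UI (suc x) (c N.∸ i) β) (A′ i))) ⟩
  ∑ (filterᵇ (\ i -> i N.≤ᵇ c) (upTo d)) (\ i -> ∑ (UI (suc x) (c N.∸ i) β) (A′ i))
    ≡⟨ sym (trans (concat-∑ (\ i -> map (lo N.+ i ∷_) (UI (suc x) (c N.∸ i) β)) (filterᵇ (\ i -> i N.≤ᵇ c) (upTo d)) A) (∑-cong (filterᵇ (\ i -> i N.≤ᵇ c) (upTo d)) (\ i -> ∑-map (lo N.+ i ∷_) (UI (suc x) (c N.∸ i) β) A))) ⟩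
  ∑ (UI lo c (x ∷ β)) A ∎
  where
  d = suc x N.∸ lo
  lod : lo N.+ d ≡ suc x
  lod = N.m+[n∸m]≡n (N.≤-trans p (N.n≤1+n x))
  A′ : ℕ -> V (suc N)
  A′ i γ = A (lo N.+ i ∷ γ)
  step : ∀ γ -> G₁ (offA lo A) x γ ≡ ∑ (upTo d) (\ i -> shA i (offA (suc x) (A′ i)) γ)
  step (y ∷ γ) = trans (cong (ad (\ u v -> A (lo N.+ u ∷ v ∷ γ)) y) (sym lod)) (trans (ad-off (\ u v -> A (lo N.+ u ∷ v ∷ γ)) y lo d)
    (trans (ad-cancel (\ u v -> A (lo N.+ u ∷ lo N.+ v ∷ γ)) (\ u v -> fst h (lo N.+ u) (lo N.+ v) γ) d y) (∑-cong (upTo d) (\ i -> sh-cong i (\ t -> cong (\ k -> A (lo N.+ i ∷ k ∷ γ)) (trans (sym (N.+-assoc lo d t)) (cong (N._+ t) lod))) y))))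

headV : ∀ {N} -> Vec ℕ (suc N) -> ℕ
headV (b ∷ _) = b

private
  sw₃ : ∀ x y z -> x N.+ (y N.+ z) ≡ y N.+ (x N.+ z)
  sw₃ x y z = trans (sym (N.+-assoc x y z)) (trans (cong (N._+ z) (N.+-comm x y)) (N.+-assoc y x z))

UI⇒IL : ∀ {N} lo c (β : Vec ℕ N) -> Str lo β -> ∀ {b} -> b ∈ UI lo c β -> lo N.≤ headV b × IL b β × sumV b ≡ lo N.+ (c N.+ (sumV β N.+ N))
UI⇒IL lo c [] s (here refl) = N.m≤m+n lo c , tt , trans (N.+-identityʳ _) (cong (lo N.+_) (sym (N.+-identityʳ c)))
UI⇒IL {suc N} lo c (x ∷ β) (p , s) m = let (i , q , m') = find (∈-concatMap⁻ (\ i -> map (lo N.+ i ∷_) (UI (suc x) (c N.∸ i) β)) {xs = filterᵇ (\ i -> i N.≤ᵇ c) (upTo (suc x N.∸ lo))} m)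
                                           (b' , r , e) = ∈-map⁻ (lo N.+ i ∷_) m'
                                           (q₁ , q₂) = ∈-filter⁻ (T? ∘ (\ i -> i N.≤ᵇ c)) {xs = upTo (suc x N.∸ lo)} q
                                       in subst (\ b -> lo N.≤ headV b × IL b (x ∷ β) × sumV b ≡ lo N.+ (c N.+ (sumV (x ∷ β) N.+ suc N))) (sym e) (fin i b' (∈-upTo⁻ q₁) (N.≤ᵇ⇒≤ i c q₂) (UI⇒IL (suc x) (c N.∸ i) β s r))
  where
  fin : ∀ i b' -> i N.< suc x N.∸ lo -> i N.≤ c -> suc x N.≤ headV b' × IL b' β × sumV b' ≡ suc x N.+ (c N.∸ i N.+ (sumV β N.+ N)) -> lo N.≤ lo N.+ i × IL (lo N.+ i ∷ b') (x ∷ β) × lo N.+ i N.+ sumV b' ≡ lo N.+ (c N.+ (x N.+ sumV β N.+ suc N))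
  fin i (b₁ ∷ bs) l l' (h , il , e) = N.m≤m+n lo i , (N.≤-pred (N.≤-trans (N.+-monoʳ-< lo l) (N.≤-reflexive (N.m+[n∸m]≡n {lo} {suc x} (N.≤-trans p (N.n≤1+n x))))) , h , il) ,
    trans (N.+-assoc lo i _) (cong (lo N.+_) (trans (cong (i N.+_) (trans e (sw₃ (suc x) (c N.∸ i) (sumV β N.+ N)))) (trans (sym (N.+-assoc i (c N.∸ i) _)) (cong₂ N._+_ (N.m+[n∸m]≡n l') (sym (trans (N.+-suc (x N.+ sumV β) N) (cong suc (N.+-assoc x (sumV β) N))))))))

IL⇒UI : ∀ {N} lo c (β : Vec ℕ N) {b} -> lo N.≤ headV b -> IL b β -> sumV b ≡ lo N.+ (c N.+ (sumV β N.+ N)) -> b ∈ UI lo c β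
IL⇒UI lo c [] {b ∷ []} l il e = here (cong (_∷ []) (trans (sym (N.+-identityʳ b)) (trans e (cong (lo N.+_) (N.+-identityʳ c)))))
IL⇒UI {suc N} lo c (x ∷ β) {b ∷ b₁ ∷ bs} l (p , q , il) e = ∈-concatMap⁺ (\ i -> map (lo N.+ i ∷_) (UI (suc x) (c N.∸ i) β))
    (lose (∈-filter⁺ (T? ∘ (\ i -> i N.≤ᵇ c)) (∈-upTo⁺ (N.∸-monoˡ-< (s≤s p) l)) (N.≤⇒≤ᵇ i≤c)) (subst (\ t -> (t ∷ b₁ ∷ bs) ∈ map (lo N.+ i ∷_) (UI (suc x) (c N.∸ i) β)) b≡ (∈-map⁺ (lo N.+ i ∷_) (IL⇒UI (suc x) (c N.∸ i) β q il rest))))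
  where
  i = b N.∸ lo
  b≡ : lo N.+ i ≡ b
  b≡ = N.m+[n∸m]≡n l
  R = sumV β N.+ N
  e' : i N.+ sumV (b₁ ∷ bs) ≡ c N.+ (suc x N.+ R)
  e' = N.+-cancelˡ-≡ lo _ _ (trans (sym (N.+-assoc lo i _)) (trans (cong (N._+ sumV (b₁ ∷ bs)) b≡) (trans e (cong (\ t -> lo N.+ (c N.+ t)) (trans (N.+-suc (x N.+ sumV β) N) (cong suc (N.+-assoc x (sumV β) N)))))))
  low : suc x N.+ R N.≤ sumV (b₁ ∷ bs)
  low = N.+-mono-≤ q (IL-sum b₁ bs β il)
  i≤c : i N.≤ c
  i≤c = N.+-cancelʳ-≤ (suc x N.+ R) i c (N.≤-trans (N.+-monoʳ-≤ i low) (N.≤-reflexive e'))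
  rest : sumV (b₁ ∷ bs) ≡ suc x N.+ (c N.∸ i N.+ R)
  rest = N.+-cancelˡ-≡ i _ _ (trans e' (trans (cong (N._+ (suc x N.+ R)) (sym (N.m+[n∸m]≡n i≤c))) (trans (N.+-assoc i (c N.∸ i) _) (cong (i N.+_) (sw₃ (c N.∸ i) (suc x) R)))))

Unique-product : ∀ {A B C : Set} (h : A -> B -> C) -> (∀ {x x' y y'} -> h x y ≡ h x' y' -> x ≡ x' × y ≡ y') -> (L : A -> List B) -> (∀ x -> Unique (L x)) -> ∀ xs -> Unique xs -> Unique (concatMap (\ x -> map (h x) (L x)) xs)
Unique-product h inj L uL [] [] = []
Unique-product h inj L uL (x ∷ xs) (a ∷ u) = Uₚ.++⁺ (Uₚ.map⁺ (\ e -> snd (inj e)) (uL x)) (Unique-product h inj L uL xs u)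
  (\ { (p , q) -> let (y , _ , e) = ∈-map⁻ (h x) p ; (x' , m , q') = find (∈-concatMap⁻ (\ x -> map (h x) (L x)) {xs = xs} q) ; (y' , _ , e') = ∈-map⁻ (h x') q' in All.lookup a m (fst (inj (trans (sym e) e'))) })

∷-inj : ∀ {N} lo {i i' : ℕ} {v v' : Vec ℕ N} -> lo N.+ i ∷ v ≡ lo N.+ i' ∷ v' -> i ≡ i' × v ≡ v'
∷-inj lo e = N.+-cancelˡ-≡ lo _ _ (Vecₚ.∷-injectiveˡ e) , Vecₚ.∷-injectiveʳ e

exs-unique : ∀ N lo e -> Unique (exs N lo e)
exs-unique zero lo zero = [] ∷ []
exs-unique zero lo (suc e) = []
exs-unique (suc N) lo e = Unique-product (\ d v -> lo N.+ d ∷ v) (∷-inj lo) (\ d -> exs N (suc (lo N.+ d)) (e N.∸ d N.* suc N)) (\ d -> exs-unique N (suc (lo N.+ d)) (e N.∸ d N.* suc N)) _ (Uₚ.filter⁺ (T? ∘ (\ d -> d N.* suc N N.≤ᵇ e)) (Uₚ.upTo⁺ (suc e)))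

UI-unique : ∀ {N} lo c (β : Vec ℕ N) -> Unique (UI lo c β)
UI-unique lo c [] = [] ∷ []
UI-unique lo c (x ∷ β) = Unique-product (\ i v -> lo N.+ i ∷ v) (∷-inj lo) (\ i -> UI (suc x) (c N.∸ i) β) (\ i -> UI-unique (suc x) (c N.∸ i) β) _ (Uₚ.filter⁺ (T? ∘ (\ i -> i N.≤ᵇ c)) (Uₚ.upTo⁺ (suc x N.∸ lo)))

DI-unique : ∀ {N} (b : Vec ℕ (suc N)) -> Unique (DI b)
DI-unique {zero} (b ∷ []) = [] ∷ []
DI-unique {suc N} (b ∷ b₁ ∷ bs) = Unique-product (\ i v -> b N.+ i ∷ v) (∷-inj b) (\ _ -> DI (b₁ ∷ bs)) (\ _ -> DI-unique (b₁ ∷ bs)) _ (Uₚ.upTo⁺ (b₁ N.∸ b))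

exs-∈ : ∀ {N} lo e {β : Vec ℕ N} -> β ∈ exs N lo e -> Str lo β × sumV β ≡ e N.+ sumV (δ lo N)
exs-∈ {zero} lo zero (here refl) = tt , refl
exs-∈ {zero} lo (suc e) ()
exs-∈ {suc N} lo e m = let (d , q , m') = find (∈-concatMap⁻ (\ d -> map (lo N.+ d ∷_) (exs N (suc (lo N.+ d)) (e N.∸ d N.* suc N))) {xs = filterᵇ (\ d -> d N.* suc N N.≤ᵇ e) (upTo (suc e))} m)
                           (v , r , eq) = ∈-map⁻ (lo N.+ d ∷_) m'
                           (_ , q₂) = ∈-filter⁻ (T? ∘ (\ d -> d N.* suc N N.≤ᵇ e)) {xs = upTo (suc e)} q
                           (s , t) = exs-∈ {N} (suc (lo N.+ d)) (e N.∸ d N.* suc N) r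
                       in subst (\ β -> Str lo β × sumV β ≡ e N.+ (lo N.+ sumV (δ (suc lo) N))) (sym eq) ((N.m≤m+n lo d , s) , fin d (sumV v) (N.≤ᵇ⇒≤ (d N.* suc N) e q₂) t)
  where
  σ = sumV (δ (suc lo) N)
  fin : ∀ d S -> d N.* suc N N.≤ e -> S ≡ e N.∸ d N.* suc N N.+ sumV (δ (suc (lo N.+ d)) N) -> lo N.+ d N.+ S ≡ e N.+ (lo N.+ σ)
  fin d S l q = trans (N.+-assoc lo d S) (trans (cong (lo N.+_) (trans (cong (d N.+_) (trans q (cong (e N.∸ d N.* suc N N.+_) (δ-shift d (suc lo) N)))) (trans (sw₃ d (e N.∸ d N.* suc N) (d N.* N N.+ σ))
    (trans (cong (e N.∸ d N.* suc N N.+_) (trans (sym (N.+-assoc d (d N.* N) σ)) (cong (N._+ σ) (sym (N.*-suc d N))))) (trans (sym (N.+-assoc (e N.∸ d N.* suc N) (d N.* suc N) σ)) (cong (N._+ σ) (N.m∸n+n≡m l))))))) (sw₃ lo e σ))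

module _ {N : ℕ} (a e e' : ℕ) (ae : a N.+ e' ≡ e) where
  private
    tri-suc : tri (suc N) ≡ N N.+ tri N
    tri-suc = δsum 0 N

    to : ∀ s -> s ≡ e' N.+ tri N -> a N.+ (s N.+ N) ≡ e N.+ tri (suc N)
    to s q = trans (cong (\ t -> a N.+ (t N.+ N)) q) (trans (cong (a N.+_) (N.+-assoc e' (tri N) N)) (trans (sym (N.+-assoc a e' _)) (cong₂ N._+_ ae (trans (N.+-comm (tri N) N) (sym tri-suc)))))

    fro : ∀ s -> a N.+ (s N.+ N) ≡ e N.+ tri (suc N) -> s ≡ e' N.+ tri N
    fro s q = N.+-cancelʳ-≡ N s _ (N.+-cancelˡ-≡ a _ _ (trans q (sym (to (e' N.+ tri N) refl))))

    in? : Vec ℕ (suc N) -> Vec ℕ N -> Bool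
    in? b β = sumV b N.≡ᵇ (a N.+ (sumV β N.+ N))

    pairs₁ pairs₂ : List (Vec ℕ (suc N) × Vec ℕ N)
    pairs₁ = concatMap (\ β -> map (\ b -> b , β) (UI 0 a β)) (exs N 0 e')
    pairs₂ = concatMap (\ b -> map (\ β -> b , β) (filterᵇ (in? b) (DI b))) (exs (suc N) 0 e)

    pairs-↭ : pairs₁ ↭ pairs₂
    pairs-↭ = ↭-from-⊆ pairs₁ pairs₂ (Unique-product (\ β b -> b , β) (\ { refl -> refl , refl }) (UI 0 a) (UI-unique 0 a) (exs N 0 e') (exs-unique N 0 e'))
      (Unique-product _,_ (\ { refl -> refl , refl }) (\ b -> filterᵇ (in? b) (DI b)) (\ b -> Uₚ.filter⁺ (T? ∘ in? b) (DI-unique b)) (exs (suc N) 0 e) (exs-unique (suc N) 0 e)) fwd bwd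
      where
      fwd : ∀ {x} -> x ∈ pairs₁ -> x ∈ pairs₂
      fwd m = let (β , q , m') = find (∈-concatMap⁻ (\ β -> map (\ b -> b , β) (UI 0 a β)) {xs = exs N 0 e'} m) ; (b , r , eq) = ∈-map⁻ (\ b -> b , β) m'
                  (s , t) = exs-∈ 0 e' q ; (_ , il , t') = UI⇒IL 0 a β s r in
        subst (_∈ pairs₂) (sym eq) (∈-concatMap⁺ (\ b -> map (\ β -> b , β) (filterᵇ (in? b) (DI b))) (lose (∈-exs 0 e b (IL-Strˡ b β il) (trans t' (to (sumV β) t))) (∈-map⁺ (\ β -> b , β) (∈-filter⁺ (T? ∘ in? b) (IL⇒DI b il) (N.≡⇒≡ᵇ _ _ t')))))
      bwd : ∀ {x} -> x ∈ pairs₂ -> x ∈ pairs₁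
      bwd m = let (b , q , m') = find (∈-concatMap⁻ (\ b -> map (\ β -> b , β) (filterᵇ (in? b) (DI b))) {xs = exs (suc N) 0 e} m) ; (β , r , eq) = ∈-map⁻ (\ β -> b , β) m'
                  (d , t) = ∈-filter⁻ (T? ∘ in? b) {xs = DI b} r ; il = DI⇒IL b d ; t' = N.≡ᵇ⇒≡ (sumV b) _ t in
        subst (_∈ pairs₁) (sym eq) (∈-concatMap⁺ (\ β -> map (\ b -> b , β) (UI 0 a β)) (lose (∈-exs 0 e' β (strʳ b β il) (fro (sumV β) (trans (sym t') (snd (exs-∈ 0 e q))))) (∈-map⁺ (\ b -> b , β) (IL⇒UI 0 a β z≤n il t'))))
        where strʳ : ∀ (b : Vec ℕ (suc N)) β -> IL b β -> Str 0 β
              strʳ (b ∷ bs) β il = Str-mono {β = β} z≤n (IL-Strʳ b bs β il)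

  -- Both sides run over interlacing pairs (b, β) whose degrees differ by a: `UI` lists the b above
  -- a given β, `DI` the β below a given b.
  exchange : ∀ (A : V (suc N)) (k : V N) -> ∑ (exs N 0 e') (\ β -> ∑ (UI 0 a β) A * k β) ≡ ∑ (exs (suc N) 0 e) (\ b -> A b * ∑ (DI b) (\ β -> if in? b β then k β else 0ℤ))
  exchange A k = begin
    ∑ (exs N 0 e') (\ β -> ∑ (UI 0 a β) A * k β)
      ≡⟨ ∑-cong (exs N 0 e') (\ β -> trans (Z.*-comm (∑ (UI 0 a β) A) (k β)) (trans (sym (∑-* (UI 0 a β) (k β) A)) (trans (∑-cong (UI 0 a β) (\ b -> Z.*-comm (k β) (A b))) (sym (∑-map (\ b -> b , β) (UI 0 a β) g))))) ⟩
    ∑ (exs N 0 e') (\ β -> ∑ (map (\ b -> b , β) (UI 0 a β)) g) ≡⟨ sym (concat-∑ (\ β -> map (\ b -> b , β) (UI 0 a β)) (exs N 0 e') g) ⟩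
    ∑ pairs₁ g ≡⟨ ∑-↭ pairs-↭ g ⟩
    ∑ pairs₂ g ≡⟨ concat-∑ (\ b -> map (\ β -> b , β) (filterᵇ (in? b) (DI b))) (exs (suc N) 0 e) g ⟩
    ∑ (exs (suc N) 0 e) (\ b -> ∑ (map (\ β -> b , β) (filterᵇ (in? b) (DI b))) g)
      ≡⟨ ∑-cong (exs (suc N) 0 e) (\ b -> trans (∑-map (\ β -> b , β) (filterᵇ (in? b) (DI b)) g) (trans (∑-* (filterᵇ (in? b) (DI b)) (A b) k) (cong (A b *_) (∑-filter (in? b) (DI b) k)))) ⟩
    ∑ (exs (suc N) 0 e) (\ b -> A b * ∑ (DI b) (\ β -> if in? b β then k β else 0ℤ)) ∎
    where g : Vec ℕ (suc N) × Vec ℕ N -> ℤ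
          g bβ = A (fst bβ) * k (snd bβ)

  hom-quot : ∀ (A : V (suc N)) -> HomV e A -> ∀ β -> Str 0 β -> sumV β ≢ e' N.+ tri N -> ∑ (UI 0 a β) A ≡ 0ℤ
  hom-quot A hA β s ne = ∑-pos0 (UI 0 a β) (\ {b} m -> let (_ , il , t) = UI⇒IL 0 a β s m in hA b (IL-Strˡ b β il) (\ q -> ne (fro (sumV β) (trans (sym t) q))))

𝒢-interlace : ∀ {N} (A : V (suc N)) -> Anti A -> ∀ a β -> Str 0 β -> 𝒢 A (a ∷ β) ≡ ∑ (UI 0 a β) A
𝒢-interlace A h a β s = trans (l-cong Lin-𝒢 {A = A} {B = offA 0 A} (\ { (y ∷ γ) -> refl }) (a ∷ β)) (𝒢-UI 0 A h a β s)

-- The coefficients of A / van are those of Σ_ν A(ν + δ) s_ν.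
Ev-kostka : ∀ {N} e (A : V N) -> Anti A -> HomV e A -> ∀ α -> Ev A α ≡ ∑ (exs N 0 e) (\ b -> A b * pos (kostkaRev (part-of b) (toList α)))
Ev-kostka {zero} zero A h hA [] = sym (trans (+-identityʳ _) (Z.*-identityʳ (A [])))
Ev-kostka {zero} (suc e) A h hA [] = hA [] tt (\ ())
Ev-kostka {suc N} e A h hA (a ∷ α) = go (a N.≤? e)
  where
  B : V N
  B β = 𝒢 A (a ∷ β)
  hB : Anti B
  hB = 𝒢-Anti {A = A} (Anti-tail {A = A} h) a
  k : V N
  k β = pos (kostkaRev (part-of β) (toList α))
  beads : ∀ {b} -> b ∈ exs (suc N) 0 e -> pos (kostkaRev (part-of b) (a ∷ toList α)) ≡ ∑ (DI b) (\ β -> if sumV b N.≡ᵇ (a N.+ (sumV β N.+ N)) then k β else 0ℤ)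
  beads {b} m = kostka-beads b (fst (exs-∈ 0 e m)) a (toList α) (Vecₚ.length-toList α)
  go : Dec (a N.≤ e) -> Ev B α ≡ ∑ (exs (suc N) 0 e) (\ b -> A b * pos (kostkaRev (part-of b) (a ∷ toList α)))
  go (yes l) = begin
    Ev B α ≡⟨ Ev-kostka e' B hB (\ β s ne -> trans (𝒢-interlace A h a β s) (hom-quot a e e' ae A hA β s ne)) α ⟩
    ∑ (exs N 0 e') (\ β -> B β * k β) ≡⟨ ∑-cong-∈ (exs N 0 e') (\ {β} m -> cong (_* k β) (𝒢-interlace A h a β (fst (exs-∈ 0 e' m)))) ⟩
    ∑ (exs N 0 e') (\ β -> ∑ (UI 0 a β) A * k β) ≡⟨ exchange a e e' ae A k ⟩
    ∑ (exs (suc N) 0 e) (\ b -> A b * ∑ (DI b) (\ β -> if sumV b N.≡ᵇ (a N.+ (sumV β N.+ N)) then k β else 0ℤ)) ≡⟨ ∑-cong-∈ (exs (suc N) 0 e) (\ {b} m -> cong (A b *_) (sym (beads m))) ⟩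
    ∑ (exs (suc N) 0 e) (\ b -> A b * pos (kostkaRev (part-of b) (a ∷ toList α))) ∎
    where e' = e N.∸ a
          ae = N.m+[n∸m]≡n l
  -- A strip of a boxes does not fit into a shape with fewer than a boxes, so both sides are 0.
  go (no nl) = trans (trans (l-cong Lin-Ev {A = B} {B = \ _ -> 0ℤ} (Anti-zero {A = B} hB zeroB) α) (l-0 Lin-Ev α)) (sym (∑-pos0 (exs (suc N) 0 e) (\ {b} m -> trans (cong (A b *_) (trans (beads m) (∑-pos0 (DI b) (\ {β} d -> offb b β (DI⇒IL b d) (snd (exs-∈ 0 e m)))))) (*-zeroʳ (A b)))))
    where
    big : ∀ β -> Str 0 β -> e N.+ tri (suc N) N.< a N.+ (sumV β N.+ N)
    big β s = N.+-mono-<-≤ (N.≰⇒> nl) (N.≤-trans (N.≤-reflexive (trans (δsum 0 N) (N.+-comm N (tri N)))) (N.+-monoˡ-≤ N (Str-sum 0 β s)))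
    zeroB : ∀ β -> Str 0 β -> B β ≡ 0ℤ
    zeroB β s = trans (𝒢-interlace A h a β s) (∑-pos0 (UI 0 a β) (\ {b} m -> let (_ , il , t) = UI⇒IL 0 a β s m in hA b (IL-Strˡ b β il) (\ q -> N.<-irrefl (trans (sym q) t) (big β s))))
    strʳ : ∀ (b : Vec ℕ (suc N)) β -> IL b β -> Str 0 β
    strʳ (b ∷ bs) β il = Str-mono {β = β} z≤n (IL-Strʳ b bs β il)
    offb : ∀ b β -> IL b β -> sumV b ≡ e N.+ tri (suc N) -> (if sumV b N.≡ᵇ (a N.+ (sumV β N.+ N)) then k β else 0ℤ) ≡ 0ℤ
    offb b β il q = cong (\ t -> if t then k β else 0ℤ) (¬T⇒false (\ t -> N.<-irrefl (trans (sym q) (N.≡ᵇ⇒≡ (sumV b) _ t)) (big β (strʳ b β il))))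

-- Coefficients of p_λ and the passage to `SchurPositive`.

subtract : ℕ -> (List ℕ -> ℤ) -> List ℕ -> ℤ
subtract k f α = ∑ (subtractOne k α) f

subtract-∷ : ∀ k f a as -> subtract k f (a ∷ as) ≡ (if k N.≤ᵇ a then f (a N.∸ k ∷ as) else 0ℤ) + subtract k (\ w -> f (a ∷ w)) as
subtract-∷ k f a as = trans (∑-++ (if k N.≤ᵇ a then (a N.∸ k ∷ as) ∷ [] else []) (map (a ∷_) (subtractOne k as)) f) (cong₂ _+_ (go (k N.≤ᵇ a)) (∑-map (a ∷_) (subtractOne k as) f))
  where go : ∀ b -> ∑ (if b then (a N.∸ k ∷ as) ∷ [] else []) f ≡ (if b then f (a N.∸ k ∷ as) else 0ℤ)
        go true = +-identityʳ _
        go false = refl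

subtract-cong : ∀ k {f g : List ℕ -> ℤ} -> (∀ w -> f w ≡ g w) -> ∀ as -> subtract k f as ≡ subtract k g as
subtract-cong k e as = ∑-cong (subtractOne k as) e

subtract-↭ : ∀ k {f : List ℕ -> ℤ} -> (∀ {v w} -> v ↭ w -> f v ≡ f w) -> ∀ {as bs} -> as ↭ bs -> subtract k f as ≡ subtract k f bs
subtract-↭ k h ↭.refl = refl
subtract-↭ k {f} h (↭.prep {as} {bs} x p) = trans (subtract-∷ k f x as) (trans (cong₂ _+_ (cong (\ t -> if k N.≤ᵇ x then t else 0ℤ) (h (↭.prep (x N.∸ k) p))) (subtract-↭ k {λ w -> f (x ∷ w)} (\ q -> h (↭.prep x q)) p)) (sym (subtract-∷ k f x bs)))
subtract-↭ k {f} h (↭.swap {as} {bs} x y p) = begin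
  subtract k f (x ∷ y ∷ as) ≡⟨ trans (subtract-∷ k f x (y ∷ as)) (cong (c x (f (x N.∸ k ∷ y ∷ as)) +_) (subtract-∷ k (\ w -> f (x ∷ w)) y as)) ⟩
  c x (f (x N.∸ k ∷ y ∷ as)) + (c y (f (x ∷ y N.∸ k ∷ as)) + subtract k (\ w -> f (x ∷ y ∷ w)) as)
    ≡⟨ cong₂ _+_ (cong (c x) (h (↭.swap (x N.∸ k) y p))) (cong₂ _+_ (cong (c y) (h (↭.swap x (y N.∸ k) p))) (trans (subtract-cong k (\ w -> h (↭.swap x y ↭.refl)) as) (subtract-↭ k {λ w -> f (y ∷ x ∷ w)} (\ q -> h (↭.prep y (↭.prep x q))) p))) ⟩
  c x (f (y ∷ x N.∸ k ∷ bs)) + (c y (f (y N.∸ k ∷ x ∷ bs)) + subtract k (\ w -> f (y ∷ x ∷ w)) bs) ≡⟨ r (c x (f (y ∷ x N.∸ k ∷ bs))) (c y (f (y N.∸ k ∷ x ∷ bs))) (subtract k (\ w -> f (y ∷ x ∷ w)) bs) ⟩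
  c y (f (y N.∸ k ∷ x ∷ bs)) + (c x (f (y ∷ x N.∸ k ∷ bs)) + subtract k (\ w -> f (y ∷ x ∷ w)) bs) ≡⟨ sym (trans (subtract-∷ k f y (x ∷ bs)) (cong (c y (f (y N.∸ k ∷ x ∷ bs)) +_) (subtract-∷ k (\ w -> f (y ∷ w)) x bs))) ⟩
  subtract k f (y ∷ x ∷ bs) ∎
  where
  c : ℕ -> ℤ -> ℤ
  c z t = if k N.≤ᵇ z then t else 0ℤ
  r : ∀ a b d -> a + (b + d) ≡ b + (a + d)
  r = solve-∀
subtract-↭ k h (↭.trans p q) = trans (subtract-↭ k h p) (subtract-↭ k h q)

pC : List ℕ -> List ℕ -> ℤ
pC λ' α = pos (pCoeff λ' α)

pC-∷ : ∀ k λ' α -> pC (k ∷ λ') α ≡ subtract k (pC λ') α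
pC-∷ k λ' α = pos-sum (subtractOne k α) (pCoeff λ')

-- Symmetry of p_λ, by which the exponent vector may be reversed to match the order in which
-- `kostka` reads its content.
pC-↭ : ∀ λ' {α α'} -> α ↭ α' -> pC λ' α ≡ pC λ' α'
pC-↭ [] p = cong (\ b -> pos (if b then 1 else 0)) (az p)
  where
  swap∧ : ∀ x y z -> x ∧ (y ∧ z) ≡ y ∧ (x ∧ z)
  swap∧ true y z = refl
  swap∧ false true z = refl
  swap∧ false false z = refl
  az : ∀ {α α'} -> α ↭ α' -> allZero α ≡ allZero α'
  az ↭.refl = refl
  az (↭.prep x p) = cong ((x N.≡ᵇ 0) ∧_) (az p)
  az (↭.swap {as} {bs} x y p) = trans (cong (\ t -> (x N.≡ᵇ 0) ∧ ((y N.≡ᵇ 0) ∧ t)) (az p)) (swap∧ (x N.≡ᵇ 0) (y N.≡ᵇ 0) (allZero bs))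
  az (↭.trans p q) = trans (az p) (az q)
pC-↭ (k ∷ λ') {α} {α'} p = trans (pC-∷ k λ' α) (trans (subtract-↭ k {pC λ'} (pC-↭ λ') p) (sym (pC-∷ k λ' α')))

subtract-P : ∀ k {N} (f : List ℕ -> ℤ) (α : Vec ℕ N) -> subtract k f (toList α) ≡ P k (\ β -> f (toList β)) α
subtract-P k f [] = refl
subtract-P k f (a ∷ α) = trans (subtract-∷ k f a (toList α)) (cong₂ _+_ (sym (sh-if k (\ x -> f (x ∷ toList α)) a)) (subtract-P k (\ w -> f (a ∷ w)) α))

pC-pow : ∀ λ' {N} (α : Vec ℕ N) -> pC λ' (toList α) ≡ pow λ' α
pC-pow [] [] = refl
pC-pow [] (zero ∷ α) = pC-pow [] α
pC-pow [] (suc a ∷ α) = refl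
pC-pow (k ∷ λ') α = trans (pC-∷ k λ' (toList α)) (trans (subtract-P k (pC λ') α) (P-cong k (pC-pow λ') α))

dz-Desc : ∀ ζ -> Desc ζ -> Desc (dropZeros ζ)
dz-Desc [] d = tt
dz-Desc (zero ∷ ζ) d = subst Desc (sym (zeros-dz ζ d)) tt
dz-Desc (suc x ∷ []) d = tt
dz-Desc (suc x ∷ zero ∷ r) d = subst (\ l -> Desc (suc x ∷ l)) (sym (zeros-dz r (snd d))) tt
dz-Desc (suc x ∷ suc y ∷ r) d = fst d , dz-Desc (suc y ∷ r) (snd d)

Desc-Par : ∀ ν -> Desc ν -> All (1 N.≤_) ν -> Par (sum ν) (sum ν) ν
Desc-Par [] d a = nil
Desc-Par (x ∷ []) d (p ∷ a) = cons p (N.m≤m+n x 0) nil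
Desc-Par (x ∷ y ∷ r) d (p ∷ a) = cons p (N.m≤m+n x _) (bound (Desc-Par (y ∷ r) (snd d) a) (fst d))
  where bound : ∀ {n m y r x} -> Par n m (y ∷ r) -> y N.≤ x -> Par n x (y ∷ r)
        bound (cons p _ q) l = cons p l q

part-of-∈ : ∀ n {b} -> b ∈ exs n 0 n -> part-of b ∈ partitions n
part-of-∈ n {b} m = let (s , t) = exs-∈ 0 n m
                        σ = N.+-cancelʳ-≡ (tri n) (sum (part-of b)) n (trans (cong (N._+ tri n) (trans (dz-sum (reverse (pl 0 b))) (sum-reverse (pl 0 b)))) (trans (pl-sum 0 b s) t))
                    in Par⇒∈partitions (subst (\ k -> Par k k (part-of b)) σ (Desc-Par (part-of b) (dz-Desc (reverse (pl 0 b)) (pl-Desc 0 b s)) (dz-All (reverse (pl 0 b)))))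

0≤⇒pos : ∀ {x} -> 0≤ x -> pos Z.∣ x ∣ ≡ x
0≤⇒pos {pos x} _ = refl

-- The coefficient of s_ν is the value of the summed alternants at the beads of ν, which `Good`
-- makes nonnegative; the indicator sum `coeff` finds these beads from ν. `Ev` strips x₀ first,
-- against the largest entry of the tableau, so the expansion is taken at the reverse of α.
good⇒SchurPositive : ∀ n μ -> Good n μ -> SchurPositive n (ψ n μ)
good⇒SchurPositive n μ good = c , \ α -> Z.+-injective (trans (lhs α) (sym (rhs α)))
  where
  Λ = filterᵇ (\ λ' -> leB λ' μ) (partitions n)
  E = exs n 0 n
  _≟_ = Lₚ.≡-dec N._≟_
  S : V n
  S b = ∑ Λ (\ λ' -> alt λ' b)
  S-pos : ∀ {b} -> b ∈ E -> 0≤ S b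
  S-pos {b} m = good b (fst (exs-∈ 0 n m))
  coeff : List ℕ -> ℤ
  coeff ν = ∑ E (\ b -> 𝟙 (part-of b ≟ ν) * S b)
  𝟙-pos : ∀ {P : Set} (d : Dec P) -> 0≤ 𝟙 d
  𝟙-pos (yes _) = Z.+≤+ z≤n
  𝟙-pos (no _) = Z.+≤+ z≤n
  c : List ℕ -> ℕ
  c ν = Z.∣ coeff ν ∣
  c-coeff : ∀ ν -> pos (c ν) ≡ coeff ν
  c-coeff ν = 0≤⇒pos (0≤-∑ E (\ {b} m -> 0≤-* (𝟙-pos (part-of b ≟ ν)) (S-pos m)))
  K : Vec ℕ n -> List ℕ -> ℤ
  K α ν = pos (kostkaRev ν (reverse (toList α)))
  rev : ∀ (α : Vec ℕ n) -> toList (Vec.reverse α) ≡ reverse (toList α)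
  rev = Vecₚ.toList-reverse
  one-λ : ∀ α {λ'} -> λ' ∈ Λ -> pC λ' (toList α) ≡ ∑ E (\ b -> alt λ' b * K α (part-of b))
  one-λ α {λ'} m = begin
    pC λ' (toList α) ≡⟨ pC-↭ λ' (↭-trans (↭-sym (↭ₚ.↭-reverse (toList α))) (↭-reflexive (sym (rev α)))) ⟩
    pC λ' (toList (Vec.reverse α)) ≡⟨ pC-pow λ' (Vec.reverse α) ⟩
    pow λ' (Vec.reverse α) ≡⟨ sym (Ev-alt λ' (Vec.reverse α)) ⟩
    Ev (alt λ') (Vec.reverse α) ≡⟨ Ev-kostka n (alt λ') (Anti-alt λ') (\ b s ne -> alt-hom (fst (∈-filter⁻ (T? ∘ (\ λ' -> leB λ' μ)) {xs = partitions n} m)) b ne) (Vec.reverse α) ⟩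
    ∑ E (\ b -> alt λ' b * pos (kostkaRev (part-of b) (toList (Vec.reverse α)))) ≡⟨ ∑-cong E (\ b -> cong (\ l -> alt λ' b * pos (kostkaRev (part-of b) l)) (rev α)) ⟩
    ∑ E (\ b -> alt λ' b * K α (part-of b)) ∎
  middle : Vec ℕ n -> ℤ
  middle α = ∑ E (\ b -> K α (part-of b) * S b)
  lhs : ∀ α -> pos (ψ n μ α) ≡ middle α
  lhs α = begin
    pos (ψ n μ α) ≡⟨ pos-sum Λ (\ λ' -> pCoeff λ' (toList α)) ⟩
    ∑ Λ (\ λ' -> pC λ' (toList α)) ≡⟨ ∑-cong-∈ Λ (one-λ α) ⟩
    ∑ Λ (\ λ' -> ∑ E (\ b -> alt λ' b * K α (part-of b))) ≡⟨ ∑-swap Λ E (\ λ' b -> alt λ' b * K α (part-of b)) ⟩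
    ∑ E (\ b -> ∑ Λ (\ λ' -> alt λ' b * K α (part-of b))) ≡⟨ ∑-cong E (\ b -> trans (∑-cong Λ (\ λ' -> Z.*-comm (alt λ' b) (K α (part-of b)))) (∑-* Λ (K α (part-of b)) (\ λ' -> alt λ' b))) ⟩
    middle α ∎
  rhs : ∀ α -> pos (sum (map (\ ν -> c ν N.* kostka ν (toList α)) (partitions n))) ≡ middle α
  rhs α = begin
    pos (sum (map (\ ν -> c ν N.* kostka ν (toList α)) (partitions n))) ≡⟨ pos-sum (partitions n) (\ ν -> c ν N.* kostka ν (toList α)) ⟩
    ∑ (partitions n) (\ ν -> pos (c ν N.* kostka ν (toList α)))
      ≡⟨ ∑-cong (partitions n) (\ ν -> trans (Z.pos-* (c ν) (kostka ν (toList α))) (trans (cong (_* K α ν) (c-coeff ν)) (trans (Z.*-comm (coeff ν) (K α ν)) (sym (∑-* E (K α ν) (\ b -> 𝟙 (part-of b ≟ ν) * S b)))))) ⟩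
    ∑ (partitions n) (\ ν -> ∑ E (\ b -> K α ν * (𝟙 (part-of b ≟ ν) * S b))) ≡⟨ ∑-swap (partitions n) E (\ ν b -> K α ν * (𝟙 (part-of b ≟ ν) * S b)) ⟩
    ∑ E (\ b -> ∑ (partitions n) (\ ν -> K α ν * (𝟙 (part-of b ≟ ν) * S b)))
      ≡⟨ ∑-cong-∈ E (\ {b} m -> trans (∑-single (partitions n) (part-of b) (\ ν -> K α ν * (𝟙 (part-of b ≟ ν) * S b)) (partsF-unique n n n) (part-of-∈ n m)
            (\ {ν} _ ne -> trans (cong (\ t -> K α ν * (t * S b)) (𝟙-no (part-of b ≟ ν) (\ e -> ne (sym e)))) (*-zeroʳ (K α ν))))
          (cong (K α (part-of b) *_) (trans (cong (_* S b) (𝟙-yes (part-of b ≟ part-of b) refl)) (Z.*-identityˡ (S b))))) ⟩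
    middle α ∎

IsPartition⇒∈ : ∀ {n μ} -> IsPartition n μ -> μ ∈ partitions n
IsPartition⇒∈ {n} {μ} (l , a , e) = Par⇒∈partitions (subst (\ k -> Par k k μ) e (Desc-Par μ (desc l) a))
  where desc : ∀ {μ} -> Linked (\ a b -> b N.≤ a) μ -> Desc μ
        desc Linked.[] = tt
        desc Linked.[-] = tt
        desc (p Linked.∷ l) = p , desc l

theorem1p3 : (n : ℕ) → 1 ≤ n → (μ : List ℕ) → IsPartition n μ →
    ((3 ≤ n × μ ≤ʳ (3 ∷ replicate (n ∸ 3) 1)) ⊎ (5 ≤ n × (n ∸ 4 ∷ replicate 4 1) ≤ʳ μ)) →
    SchurPositive n (ψ n μ)
theorem1p3 n _ μ p (inj₁ (l , t)) = good⇒SchurPositive n μ (case-i n l μ (IsPartition⇒∈ p) t)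
theorem1p3 n _ μ p (inj₂ (l , t)) = good⇒SchurPositive n μ (case-ii n l μ (IsPartition⇒∈ p) t)
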